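{- Fix integers $1\le d<k$ with $d\ge k/2$, and a constant $\gamma>0$. Let $G$ be an $n$-vertex $k$-uniform hypergraph with $k\mid n$ and $\delta_d(G)\ge(\alpha_d(k)+\gamma)\binom{n-d}{k-d}$, and let $p=\delta_d(G)/\binom{n-d}{k-d}$. Then the number $\Phi(G)$ of perfect matchings of $G$ satisfies \[ \Phi(G)\ge \Phi(K_n^{(k)})\cdot(p+o(1))^{n/k}, \] where $\Phi(K_n^{(k)})=n!/((n/k)!\,(k!)^{n/k})$ is the number of perfect matchings of the complete $k$-uniform hypergraph on $n$ vertices, and asymptotics are as $n\to\infty$ along integers divisible by $k$, uniformly over all such $G$. That is: for every $\varepsilon>0$ there is $n_0$ such that for all $n\ge n_0$ with $k\mid n$ and all such $G$, $\Phi(G)\ge \Phi(K_n^{(k)})(p-\varepsilon)^{n/k}$.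
   Context: A $k$-uniform hypergraph ($k$-graph) $G$ has a vertex set $V(G)$ and an edge set $E(G)$ of $k$-element subsets of $V(G)$. For a set $S$ of vertices, $\deg_G(S)$ is the number of edges containing $S$; the minimum $d$-degree $\delta_d(G)$ is the minimum of $\deg_G(S)$ over all $d$-element $S\subseteq V(G)$. A perfect matching is a set of pairwise disjoint edges covering all vertices. For $n$ divisible by $k$, $m_d(k,n)$ is the minimum $d$-degree that ensures that every $n$-vertex $k$-graph with at least that minimum $d$-degree has a perfect matching, and $\alpha_d(k)=\lim_{n\to\infty}m_d(k,n)/\binom{n-d}{k-d}$ (the limit over $n$ divisible by $k$ is known to exist).
   Formalization: The bound is stated for 0 < ε < γ (γ, ε rational) instead of every ε > 0: for large ε the literal claim fails (complete hypergraph, p = 1, ε = 3, n/k even); cases with γ ≤ ε ≤ p follow by monotonicity. -}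

module Defs where

open import Data.Bool using (Bool; true; false; _∧_; _∨_; not; if_then_else_)
import Data.Nat
import Data.Rational
open import Data.Nat using (ℕ; zero; suc; _+_; _*_; _∸_; _≤ᵇ_; _≡ᵇ_; _⊓_; _!; _^_)
open import Data.Nat.Combinatorics using (_C_)
open import Data.List using (List; []; _∷_; map; _++_; length; filterᵇ; upTo; foldr)
open import Data.Bool.ListAction using (all; any)
open import Data.Vec using (Vec; []; _∷_)
open import Data.Fin.Subset using (Subset; ∣_∣; _∪_; ⊥)
open import Data.Integer using (+_)
open import Data.Rational using (ℚ; _/_; 0ℚ; 1ℚ) renaming (_*_ to _*ℚ_)
open import Data.Product using (Σ; _×_)
open import Relation.Binary.PropositionalEquality using (_≡_)

subsetᵇ : ∀ {n} → Subset n → Subset n → Bool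
subsetᵇ [] [] = true
subsetᵇ (a ∷ s) (b ∷ t) = (not a ∨ b) ∧ subsetᵇ s t

disjointᵇ : ∀ {n} → Subset n → Subset n → Bool
disjointᵇ [] [] = true
disjointᵇ (a ∷ s) (b ∷ t) = not (a ∧ b) ∧ disjointᵇ s t

eqᵇ : ∀ {n} → Subset n → Subset n → Bool
eqᵇ S T = subsetᵇ S T ∧ subsetᵇ T S

fullᵇ : ∀ {n} → Subset n → Bool
fullᵇ [] = true
fullᵇ (a ∷ s) = a ∧ fullᵇ s

allSubsets : (n : ℕ) → List (Subset n)
allSubsets zero = [] ∷ []
allSubsets (suc n) = map (true ∷_) (allSubsets n) ++ map (false ∷_) (allSubsets n)

subsetsOfSize : (j n : ℕ) → List (Subset n)
subsetsOfSize j n = filterᵇ (λ S → ∣ S ∣ ≡ᵇ j) (allSubsets n)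

sublists : ∀ {a} {A : Set a} → List A → List (List A)
sublists [] = [] ∷ []
sublists (x ∷ xs) = map (x ∷_) (sublists xs) ++ sublists xs

-- minimum of a list (0 for the empty list; only used on nonempty lists)
minList : List ℕ → ℕ
minList [] = 0
minList (x ∷ []) = x
minList (x ∷ y ∷ ys) = x ⊓ minList (y ∷ ys)

KGraph : (k n : ℕ) → Set
KGraph k n = Σ (Subset n → Bool) (λ E → ∀ S → E S ≡ true → ∣ S ∣ ≡ k)

deg : ∀ {n} → (Subset n → Bool) → Subset n → ℕ
deg {n} E S = length (filterᵇ (λ T → E T ∧ subsetᵇ S T) (allSubsets n))

minDeg : ∀ {n} → (d : ℕ) → (Subset n → Bool) → ℕ
minDeg {n} d E = minList (map (deg E) (subsetsOfSize d n))

edgeList : ∀ {n} → (Subset n → Bool) → List (Subset n)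
edgeList {n} E = filterᵇ E (allSubsets n)

pairwiseDisjointᵇ : ∀ {n} → List (Subset n) → Bool
pairwiseDisjointᵇ [] = true
pairwiseDisjointᵇ (S ∷ Ss) = all (disjointᵇ S) Ss ∧ pairwiseDisjointᵇ Ss

isPerfectMatchingᵇ : ∀ {n} → List (Subset n) → Bool
isPerfectMatchingᵇ M = pairwiseDisjointᵇ M ∧ fullᵇ (foldr _∪_ ⊥ M)

-- Φ(G): number of perfect matchings (sets of edges = sublists of the
-- duplicate-free edge list)
numPM : ∀ {n} → (Subset n → Bool) → ℕ
numPM E = length (filterᵇ isPerfectMatchingᵇ (sublists (edgeList E)))

hasPMᵇ : ∀ {n} → (Subset n → Bool) → Bool
hasPMᵇ E = not (numPM E ≡ᵇ 0)

allKGraphs : (k n : ℕ) → List (Subset n → Bool)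
allKGraphs k n = map (λ L T → any (eqᵇ T) L) (sublists (subsetsOfSize k n))

forcesPMᵇ : (d k n t : ℕ) → Bool
forcesPMᵇ d k n t = all (λ E → not (t ≤ᵇ minDeg d E) ∨ hasPMᵇ E) (allKGraphs k n)

-- the property is upward closed in t and holds for t = C(n-d,k-d)+1
-- (no graph has larger minimum d-degree when d ≤ n), so m_d(k,n) is the
-- least t in [0, C(n-d,k-d)+1] with the property.
m : (d k n : ℕ) → ℕ
m d k n = minList (filterᵇ (forcesPMᵇ d k n) (upTo (suc (suc ((n ∸ d) C (k ∸ d))))))

ratio : ℕ → ℕ → ℚ
ratio a zero = 0ℚ
ratio a (suc b) = (+ a) / suc b

infixr 8 _^ℚ_
_^ℚ_ : ℚ → ℕ → ℚ
x ^ℚ zero = 1ℚ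
x ^ℚ suc j = x *ℚ (x ^ℚ j)

normDeg : ∀ {n} → (d k : ℕ) → (Subset n → Bool) → ℚ
normDeg {n} d k E = ratio (minDeg d E) ((n ∸ d) C (k ∸ d))

completePM : (k q : ℕ) → ℚ
completePM k q = ratio ((q * k) !) ((q !) * ((k !) ^ q))

-- α_d(k) = lim_{n→∞, k∣n} m_d(k,n)/C(n-d,k-d), encoded by its lower cut:
-- BelowAlpha d k q  ⇔  q < α_d(k).  (Since the limit exists, q < α iff
-- some rational r > q is eventually ≤ m_d(k,n)/C(n-d,k-d) along k∣n.)
BelowAlpha : (d k : ℕ) → ℚ → Set
BelowAlpha d k q =
  Σ ℚ (λ r → (q Data.Rational.< r) ×
    Σ ℕ (λ N → ∀ j → N Data.Nat.≤ j * k →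
      r Data.Rational.≤ ratio (m d k (j * k)) (((j * k) ∸ d) C (k ∸ d))))

{-# OPTIONS --safe #-}

-- Only the bound α_d(k) ≥ 1/2 is needed: it follows from graphs with a parity
-- obstruction, and the degree hypothesis then gives p > 1/2 + ε.
--
-- Cut a uniformly random ordering of the vertices into q sets of size d and q
-- sets of size k - d, and join a set of the first kind to one of the second kind
-- when their union is an edge.  Because k - d ≤ d, both sides of this bipartite
-- graph have minimum degree about p q with probability at least 1/2, and
-- averaging over the orderings reduces the theorem to the following: a q × q
-- bipartite graph with all degrees at least r q, r > 1/2, has at least
-- q! (r - o(1))^q perfect matchings.
--
-- For a set U of rows and a larger set W of columns let N(U,W) be the number of
-- matchings that saturate U, and put a_u = N(U-u,W) / N(U,W) and
-- b_w = N(U,W-w) / N(U,W).  The exchange inequality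
--   N(U-u,W) N(U,W-w) ≤ N(U,W) N(U-u,W-w)
-- yields a_u Σ_{w ~ u} b_w ≤ 1 and b_w Σ_{u ~ w} a_u ≤ 1.  As in the entropy
-- estimate of Cuckler and Kahn for Dirac graphs, the product of the geometric
-- means of a and b is then at most 1 / (r |U|), since r ≥ 1/2.  As N is
-- log-submodular in the rows and in the columns, N(U,W)^2 is bounded below by
-- (r |U|)^s N(U-g,W) N(U,W-g') for suitable groups g of s rows and g' of s columns.
-- Iterating this is a random walk on the numbers (i , j) of remaining groups.  It
-- starts at (K - h , K); on the diagonal only a crude switching bound is available,
-- but the diagonal is rarely hit, as (j - i - h)^2 + i + j is harmonic.  A constant
-- number K of groups suffices, so the degree conditions survive all deletions.
module Submission where

-- Write T(i) for the product of (i' t)^s over i' ≤ i, where s is the group size and t / s the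
-- density. The group step says that log (N / T) at (i , j) is at least the mean of its values at (i
-- - 1 , j) and (i , j - 1). So it is superharmonic for the walk, and bounds on the boundary
-- propagate inwards with a harmonic error. Starting h groups off the diagonal means leaving out h
-- groups of rows. They are restored by switching, at a constant factor per row, which is harmless
-- because they are a small fraction of all rows. The obstacle is that geometric means, logarithms
-- and probabilities are real quantities. They are replaced by natural numbers: means by powers with
-- a common exponent, logarithmic errors by powers of 2 in an inequality raised to a power Λ,
-- expectations by sums over draws without replacement. Densities are integers τ relative to a scale
-- M, and every approximation is charged in units of 1 / M: one for dependent draws, one for
-- concentration, two for the losses of the matching count, one for rounding. The scale is taken so
-- large that all these units together stay below ε.

-- Powers and the inequality of arithmetic and geometric means.

module Arithmetic where

  open import Data.Nat
  open import Data.Nat.Properties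
  open import Data.Nat.Tactic.RingSolver using (solve-∀)
  open import Data.Nat.ListAction using (sum; product)
  open import Data.List using ([]; _∷_; length)
  open import Relation.Binary.PropositionalEquality as ≡ using (_≡_; cong)
  open import Relation.Nullary using (yes; no)
  open import Data.Empty using (⊥-elim)

  ^-distrib-* : ∀ x y n → (x * y) ^ n ≡ x ^ n * y ^ n
  ^-distrib-* x y zero = ≡.refl
  ^-distrib-* x y (suc n) = ≡.trans (cong (x * y *_) (^-distrib-* x y n)) (lem x y (x ^ n) (y ^ n))
    where
      lem : ∀ a b c d → a * b * (c * d) ≡ a * c * (b * d)
      lem = solve-∀

  ^-cancel-≤ : ∀ n x y → 0 < n → x ^ n ≤ y ^ n → x ≤ y
  ^-cancel-≤ (suc n) x y _ p with x ≤? y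
  ... | yes q = q
  ... | no q = ⊥-elim (<⇒≱ (^-monoˡ-< (suc n) (≰⇒> q)) p)

  *-cancelˡ-pos : ∀ x {y z} → 0 < x → x * y ≤ x * z → y ≤ z
  *-cancelˡ-pos (suc x) _ p = *-cancelˡ-≤ (suc x) p

  *-cancelʳ-pos : ∀ x {y z} → 0 < x → y * x ≤ z * x → y ≤ z
  *-cancelʳ-pos (suc x) {y} {z} _ p = *-cancelʳ-≤ y z (suc x) p

  ^-pos : ∀ x n → 0 < x → 0 < x ^ n
  ^-pos (suc x) n _ = m^n>0 (suc x) n

  *-pos : ∀ {x y} → 0 < x → 0 < y → 0 < x * y
  *-pos {suc x} {suc y} _ _ = z<s

  -- The graph of a power lies above its tangent at `z`. Adding `n * (y * z ^ suc n)` to both sides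
  -- of the inductive step leaves a single use of 2yz ≤ y² + z².
  power-tangent : ∀ n y z → suc n * (y * z ^ n) ≤ y ^ suc n + n * z ^ suc n
  power-tangent zero y z = ≤-reflexive (≡.trans (+-identityʳ _) (≡.sym (+-identityʳ _)))
  power-tangent (suc n) y z = +-cancelʳ-≤ (n * (y * (z * z ^ n))) _ _ (begin
    suc (suc n) * (y * (z * z ^ n)) + n * (y * (z * z ^ n)) ≡⟨ lem1 n y z (z ^ n) ⟩
    suc n * (z ^ n) * (2 * (y * z)) ≤⟨ *-monoʳ-≤ (suc n * (z ^ n)) (am-gm₂ y z) ⟩
    suc n * (z ^ n) * (y * y + z * z) ≡⟨ lem2 n y z (z ^ n) ⟩
    y * (suc n * (y * z ^ n)) + suc n * (z * (z * z ^ n)) ≤⟨ +-monoˡ-≤ (suc n * (z * (z * z ^ n))) (*-monoʳ-≤ y (power-tangent n y z)) ⟩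
    y * (y ^ suc n + n * (z * z ^ n)) + suc n * (z * (z * z ^ n)) ≡⟨ lem3 n y z (z ^ n) (y ^ suc n) ⟩
    y * y ^ suc n + suc n * (z * (z * z ^ n)) + n * (y * (z * z ^ n)) ∎)
    where
      open ≤-Reasoning
      am-gm₂ : ∀ a b → 2 * (a * b) ≤ a * a + b * b
      am-gm₂ zero b = z≤n
      am-gm₂ (suc a) zero = ≤-trans (≤-reflexive (≡.trans (cong (2 *_) (*-zeroʳ (suc a))) ≡.refl)) z≤n
      am-gm₂ (suc a) (suc b) = ≤-trans (≤-reflexive (l1 a b)) (≤-trans (+-monoˡ-≤ (2 + 2 * a + 2 * b) (am-gm₂ a b)) (≤-reflexive (l2 a b)))
        where
          l1 : ∀ a b → 2 * (suc a * suc b) ≡ 2 * (a * b) + (2 + 2 * a + 2 * b)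
          l1 = solve-∀
          l2 : ∀ a b → a * a + b * b + (2 + 2 * a + 2 * b) ≡ suc a * suc a + suc b * suc b
          l2 = solve-∀
      lem1 : ∀ n y z w → suc (suc n) * (y * (z * w)) + n * (y * (z * w)) ≡ suc n * w * (2 * (y * z))
      lem1 = solve-∀
      lem2 : ∀ n y z w → suc n * w * (y * y + z * z) ≡ y * (suc n * (y * w)) + suc n * (z * (z * w))
      lem2 = solve-∀
      lem3 : ∀ n y z w v → y * (v + n * (z * w)) + suc n * (z * (z * w)) ≡ y * v + suc n * (z * (z * w)) + n * (y * (z * w))
      lem3 = solve-∀

  -- The inductive step of AM-GM with denominators cleared, `S` being the sum of n numbers:
  -- `power-tangent` at the point `suc n * S`, evaluated at `n * (S + x)`.
  am-gm-step : ∀ n S x → suc n ^ suc n * (S ^ n * x) ≤ n ^ n * (S + x) ^ suc n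
  am-gm-step zero S x = ≤-trans (m≤m+n _ S) (≤-reflexive (lem S x))
    where
      lem : ∀ S x → 1 * 1 * (1 * x) + S ≡ 1 * ((S + x) * 1)
      lem = solve-∀
  am-gm-step n@(suc n') zero x = ≤-trans (≤-reflexive (*-zeroʳ (suc n ^ suc n))) z≤n
  am-gm-step n@(suc n') S@(suc _) x = *-cancelˡ-pos n z<s (+-cancelʳ-≤ (n * Z ^ suc n) _ _ (begin
    n * (suc n ^ suc n * (S ^ n * x)) + n * Z ^ suc n
      ≡⟨ cong (λ v → n * (suc n ^ suc n * (S ^ n * x)) + n * (Z * v)) (^-distrib-* (suc n) S n) ⟩
    n * (suc n * suc n ^ n * (S ^ n * x)) + n * (suc n * S * (suc n ^ n * S ^ n))
      ≡⟨ lem n S x (suc n ^ n) (S ^ n) ⟩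
    suc n * (n * (S + x) * (suc n ^ n * S ^ n)) ≡⟨ cong (λ v → suc n * (n * (S + x) * v)) (^-distrib-* (suc n) S n) ⟨
    suc n * (n * (S + x) * Z ^ n) ≤⟨ power-tangent n (n * (S + x)) Z ⟩
    (n * (S + x)) ^ suc n + n * Z ^ suc n ≡⟨ cong (_+ n * Z ^ suc n) (^-distrib-* n (S + x) (suc n)) ⟩
    n * n ^ n * (S + x) ^ suc n + n * Z ^ suc n ≡⟨ cong (_+ n * Z ^ suc n) (*-assoc n (n ^ n) _) ⟩
    n * (n ^ n * (S + x) ^ suc n) + n * Z ^ suc n ∎))
    where
      open ≤-Reasoning
      Z = suc n * S
      lem : ∀ n S x p q → n * (suc n * p * (q * x)) + n * (suc n * S * (p * q)) ≡ suc n * (n * (S + x) * (p * q))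
      lem = solve-∀

  am-gm : ∀ xs → product xs * length xs ^ length xs ≤ sum xs ^ length xs
  am-gm [] = ≤-refl
  am-gm (x ∷ xs) = *-cancelˡ-pos (n ^ n) (n^n-pos n) (begin
    n ^ n * (x * product xs * suc n ^ suc n) ≡⟨ lem (n ^ n) x (product xs) (suc n ^ suc n) ⟩
    product xs * n ^ n * (suc n ^ suc n * x) ≤⟨ *-monoˡ-≤ (suc n ^ suc n * x) (am-gm xs) ⟩
    S ^ n * (suc n ^ suc n * x) ≡⟨ lem2 (S ^ n) (suc n ^ suc n) x ⟩
    suc n ^ suc n * (S ^ n * x) ≤⟨ am-gm-step n S x ⟩
    n ^ n * (S + x) ^ suc n ≡⟨ cong (λ v → n ^ n * v ^ suc n) (+-comm S x) ⟩
    n ^ n * (x + S) ^ suc n ∎)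
    where
      open ≤-Reasoning
      n = length xs
      S = sum xs
      n^n-pos : ∀ n → 0 < n ^ n
      n^n-pos zero = z<s
      n^n-pos (suc n) = m^n>0 (suc n) (suc n)
      lem : ∀ a x p q → a * (x * p * q) ≡ p * a * (q * x)
      lem = solve-∀
      lem2 : ∀ a b c → a * (b * c) ≡ b * (a * c)
      lem2 = solve-∀

-- Sums over draws without replacement, and their exchangeability.

module Pickers where

  open import Data.Nat
  open import Data.Nat.Properties
  open import Data.Nat.Tactic.RingSolver using (solve-∀)
  open import Data.List using (List; []; _∷_; _++_; length; concatMap)
  open import Data.List.Properties using (length-++; ++-assoc)
  open import Data.List.Relation.Unary.All using (All; []; _∷_)
  open import Data.List.Relation.Binary.Permutation.Propositional using (_↭_; refl; prep; swap; trans)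
  open import Data.List.Relation.Binary.Permutation.Propositional.Properties using (↭-length; ++⁺ˡ)
  open import Data.Product using (_×_; _,_)
  open import Data.Unit using (⊤; tt)
  open import Relation.Binary.PropositionalEquality as ≡ using (_≡_; cong; cong₂; subst)

  private variable
    A B X Y : Set

  -- The falling factorial, which counts sequences of `j` distinct entries; truncated subtraction
  -- makes it 0 as soon as `j` exceeds `n`.
  fall : ℕ → ℕ → ℕ
  fall n zero = 1
  fall n (suc j) = n * fall (n ∸ 1) j

  fall-+ : ∀ n a b → fall n (a + b) ≡ fall n a * fall (n ∸ a) b
  fall-+ n zero b = ≡.sym (+-identityʳ _)
  fall-+ n (suc a) b = begin
    n * fall (n ∸ 1) (a + b) ≡⟨ cong (n *_) (fall-+ (n ∸ 1) a b) ⟩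
    n * (fall (n ∸ 1) a * fall (n ∸ 1 ∸ a) b) ≡⟨ *-assoc n _ _ ⟨
    n * fall (n ∸ 1) a * fall (n ∸ 1 ∸ a) b ≡⟨ cong (λ z → n * fall (n ∸ 1) a * fall z b) (∸-+-assoc n 1 a) ⟩
    n * fall (n ∸ 1) a * fall (n ∸ suc a) b ∎
    where open ≡.≡-Reasoning

  -- Sums over draws without replacement: h is given the entry drawn and the list of the remaining entries.
  pick : (A → List A → ℕ) → List A → ℕ
  pick h [] = 0
  pick h (x ∷ xs) = h x xs + pick (λ y ys → h y (x ∷ ys)) xs

  pick-mono : {h h' : A → List A → ℕ} → ∀ xs → (∀ x r → xs ↭ x ∷ r → h x r ≤ h' x r) → pick h xs ≤ pick h' xs
  pick-mono [] p = z≤n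
  pick-mono (x ∷ xs) p = +-mono-≤ (p x xs refl) (pick-mono xs (λ y r q → p y (x ∷ r) (trans (prep x q) (swap x y refl))))

  pick-ext : {h h' : A → List A → ℕ} → ∀ xs → (∀ x r → xs ↭ x ∷ r → h x r ≡ h' x r) → pick h xs ≡ pick h' xs
  pick-ext xs p = ≤-antisym (pick-mono xs (λ x r q → ≤-reflexive (p x r q))) (pick-mono xs (λ x r q → ≤-reflexive (≡.sym (p x r q))))

  interchange : ∀ a b c d → (a + b) + (c + d) ≡ (a + c) + (b + d)
  interchange = solve-∀

  pick-add : (h h' : A → List A → ℕ) → ∀ xs → pick (λ x r → h x r + h' x r) xs ≡ pick h xs + pick h' xs
  pick-add h h' [] = ≡.refl
  pick-add h h' (x ∷ xs) = ≡.trans (cong ((h x xs + h' x xs) +_) (pick-add _ _ xs)) (interchange (h x xs) (h' x xs) _ _)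

  pick-scale : ∀ c (h : A → List A → ℕ) xs → pick (λ x r → c * h x r) xs ≡ c * pick h xs
  pick-scale c h [] = ≡.sym (*-zeroʳ c)
  pick-scale c h (x ∷ xs) = ≡.trans (cong (c * h x xs +_) (pick-scale c _ xs)) (≡.sym (*-distribˡ-+ c _ _))

  Resp : (X → List A → ℕ) → Set
  Resp {X} {A} h = ∀ x {r r' : List A} → r ↭ r' → h x r ≡ h x r'

  pick-resp : {h : A → List A → ℕ} → Resp h → ∀ {xs ys} → xs ↭ ys → pick h xs ≡ pick h ys
  pick-resp H refl = ≡.refl
  pick-resp H (prep x p) = cong₂ _+_ (H x p) (pick-resp (λ y q → H y (prep x q)) p)
  pick-resp {h = h} H (swap {xs} {ys} x y p) = begin
    h x (y ∷ xs) + (h y (x ∷ xs) + pick (λ z zs → h z (x ∷ y ∷ zs)) xs) ≡⟨ cong₂ _+_ (H x (prep y p)) (cong₂ _+_ (H y (prep x p)) (pick-resp (λ z q → H z (prep x (prep y q))) p)) ⟩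
    h x (y ∷ ys) + (h y (x ∷ ys) + pick (λ z zs → h z (x ∷ y ∷ zs)) ys) ≡⟨ cong (λ w → h x (y ∷ ys) + (h y (x ∷ ys) + w)) (pick-ext ys (λ z r _ → H z (swap x y refl))) ⟩
    h x (y ∷ ys) + (h y (x ∷ ys) + pick (λ z zs → h z (y ∷ x ∷ zs)) ys) ≡⟨ lem (h x (y ∷ ys)) (h y (x ∷ ys)) _ ⟩
    h y (x ∷ ys) + (h x (y ∷ ys) + pick (λ z zs → h z (y ∷ x ∷ zs)) ys) ∎
    where
      open ≡.≡-Reasoning
      lem : ∀ a b c → a + (b + c) ≡ b + (a + c)
      lem = solve-∀
  pick-resp H (trans p q) = ≡.trans (pick-resp H p) (pick-resp H q)

  pick-++ : (h : A → List A → ℕ) → ∀ xs ys → pick h (xs ++ ys) ≡ pick (λ x r → h x (r ++ ys)) xs + pick (λ y r → h y (xs ++ r)) ys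
  pick-++ h [] ys = ≡.refl
  pick-++ h (x ∷ xs) ys = ≡.trans (cong (h x (xs ++ ys) +_) (pick-++ (λ y r → h y (x ∷ r)) xs ys)) (≡.sym (+-assoc (h x (xs ++ ys)) _ _))

  pick-zero : (xs : List A) → pick (λ _ _ → 0) xs ≡ 0
  pick-zero [] = ≡.refl
  pick-zero (x ∷ xs) = pick-zero xs

  pick-const : ∀ c (xs : List A) → pick (λ _ _ → c) xs ≡ length xs * c
  pick-const c [] = ≡.refl
  pick-const c (x ∷ xs) = cong (c +_) (pick-const c xs)

  pick-total : ∀ (g : ℕ → ℕ) (xs : List A) → pick (λ _ r → g (length r)) xs ≡ fall (length xs) 1 * g (length xs ∸ 1)
  pick-total g xs = ≡.trans (pick-ext xs (λ x r q → cong (λ n → g (n ∸ 1)) (≡.sym (↭-length q)))) (≡.trans (pick-const (g (length xs ∸ 1)) xs) (cong (_* g (length xs ∸ 1)) (≡.sym (*-identityʳ (length xs)))))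

  -- Exchangeability of two successive draws. Interchanges of longer draws from one list are built
  -- from this case.
  pick-pick : (h : A → A → List A → ℕ) → ∀ xs → pick (λ x r → pick (λ y r' → h x y r') r) xs ≡ pick (λ y r → pick (λ x r' → h x y r') r) xs
  pick-pick h [] = ≡.refl
  pick-pick h (z ∷ zs) = begin
    pick (λ y r' → h z y r') zs + pick (λ x r → h x z r + pick (λ y r' → h x y (z ∷ r')) r) zs
      ≡⟨ cong (pick (λ y r' → h z y r') zs +_) (pick-add _ _ zs) ⟩
    pick (λ y r' → h z y r') zs + (pick (λ x r → h x z r) zs + pick (λ x r → pick (λ y r' → h x y (z ∷ r')) r) zs)
      ≡⟨ cong (λ w → pick (λ y r' → h z y r') zs + (pick (λ x r → h x z r) zs + w)) (pick-pick (λ x y r → h x y (z ∷ r)) zs) ⟩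
    pick (λ y r' → h z y r') zs + (pick (λ x r → h x z r) zs + pick (λ y r → pick (λ x r' → h x y (z ∷ r')) r) zs)
      ≡⟨ lem (pick (λ y r' → h z y r') zs) (pick (λ x r → h x z r) zs) _ ⟩
    pick (λ x r → h x z r) zs + (pick (λ y r' → h z y r') zs + pick (λ y r → pick (λ x r' → h x y (z ∷ r')) r) zs)
      ≡⟨ cong (pick (λ x r → h x z r) zs +_) (pick-add _ _ zs) ⟨
    pick (λ x r → h x z r) zs + pick (λ y r → h z y r + pick (λ x r' → h x y (z ∷ r')) r) zs ∎
    where
      open ≡.≡-Reasoning
      lem : ∀ a b c → a + (b + c) ≡ b + (a + c)
      lem = solve-∀

  pick-swap : (h : A → List A → B → List B → ℕ) → ∀ xs ys → pick (λ x r → pick (λ y s → h x r y s) ys) xs ≡ pick (λ y s → pick (λ x r → h x r y s) xs) ys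
  pick-swap h [] ys = ≡.sym (pick-zero ys)
  pick-swap h (x ∷ xs) ys = ≡.trans (cong (pick (h x xs) ys +_) (pick-swap (λ z r → h z (x ∷ r)) xs ys)) (≡.sym (pick-add _ _ ys))

  -- A random experiment that removes entries from a list, with `run` as its unnormalised
  -- expectation. The outcome `x` uses up the entries `flat x`, and `Ok` describes the possible
  -- outcomes; by `total` their number depends only on the length of the list.
  record Picker (A X : Set) : Set₁ where
    field
      run : (X → List A → ℕ) → List A → ℕ
      flat : X → List A
      Ok : X → Set
      size : ℕ
      ok-size : ∀ {x} → Ok x → length (flat x) ≡ size
      mono : ∀ {h h'} xs → (∀ x r → Ok x → xs ↭ flat x ++ r → h x r ≤ h' x r) → run h xs ≤ run h' xs
      add : ∀ h h' xs → run (λ x r → h x r + h' x r) xs ≡ run h xs + run h' xs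
      scale : ∀ c h xs → run (λ x r → c * h x r) xs ≡ c * run h xs
      resp : ∀ {h} → Resp h → ∀ {xs ys} → xs ↭ ys → run h xs ≡ run h ys
      total : ∀ (g : ℕ → ℕ) xs → run (λ _ r → g (length r)) xs ≡ fall (length xs) size * g (length xs ∸ size)
    ext : ∀ {h h'} xs → (∀ x r → Ok x → xs ↭ flat x ++ r → h x r ≡ h' x r) → run h xs ≡ run h' xs
    ext xs p = ≤-antisym (mono xs (λ x r o q → ≤-reflexive (p x r o q))) (mono xs (λ x r o q → ≤-reflexive (≡.sym (p x r o q))))
    ext′ : ∀ {h h'} xs → (∀ x r → h x r ≡ h' x r) → run h xs ≡ run h' xs
    ext′ xs p = ext xs (λ x r _ _ → p x r)
    scaleʳ : ∀ c h xs → run (λ x r → h x r * c) xs ≡ run h xs * c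
    scaleʳ c h xs = ≡.trans (ext′ xs (λ x r → *-comm (h x r) c)) (≡.trans (scale c h xs) (*-comm c _))
    const : ∀ c xs → run (λ _ _ → c) xs ≡ fall (length xs) size * c
    const c xs = total (λ _ → c) xs

  open Picker public

  picker : Picker A A
  picker .run = pick
  picker .flat x = x ∷ []
  picker .Ok x = ⊤
  picker .size = 1
  picker .ok-size _ = ≡.refl
  picker .mono xs p = pick-mono xs (λ x r q → p x r tt q)
  picker .add = pick-add
  picker .scale = pick-scale
  picker .resp = pick-resp
  picker .total = pick-total

  repRun : Picker A X → ℕ → (List X → List A → ℕ) → List A → ℕ
  repRun P zero h xs = h [] xs
  repRun P (suc c) h xs = P .run (λ x r → repRun P c (λ ys r' → h (x ∷ ys) r') r) xs

  module _ (P : Picker A X) where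

    repMono : ∀ c {h h'} xs → (∀ ys r → (length ys ≡ c × All (P .Ok) ys) → xs ↭ concatMap (P .flat) ys ++ r → h ys r ≤ h' ys r) → repRun P c h xs ≤ repRun P c h' xs
    repMono zero xs p = p [] xs (≡.refl , []) refl
    repMono (suc c) xs p = P .mono xs (λ x r o q → repMono c r (λ ys r' (l , os) q' → p (x ∷ ys) r' (cong suc l , o ∷ os)
      (trans q (subst (P .flat x ++ r ↭_) (≡.sym (++-assoc (P .flat x) _ r')) (++⁺ˡ (P .flat x) q')))))

    repOkSize : ∀ c {ys} → (length ys ≡ c × All (P .Ok) ys) → length (concatMap (P .flat) ys) ≡ c * P .size
    repOkSize zero {[]} (l , os) = ≡.refl
    repOkSize (suc c) {y ∷ ys} (l , o ∷ os) = ≡.trans (length-++ (P .flat y)) (cong₂ _+_ (P .ok-size o) (repOkSize c (suc-injective l , os)))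

    repAdd : ∀ c h h' xs → repRun P c (λ x r → h x r + h' x r) xs ≡ repRun P c h xs + repRun P c h' xs
    repAdd zero h h' xs = ≡.refl
    repAdd (suc c) h h' xs = ≡.trans (ext′ P xs (λ x r → repAdd c _ _ r)) (P .add _ _ xs)

    repScale : ∀ c k h xs → repRun P c (λ x r → k * h x r) xs ≡ k * repRun P c h xs
    repScale zero k h xs = ≡.refl
    repScale (suc c) k h xs = ≡.trans (ext′ P xs (λ x r → repScale c k _ r)) (P .scale k _ xs)

    repResp : ∀ c {h} → Resp h → ∀ {xs ys} → xs ↭ ys → repRun P c h xs ≡ repRun P c h ys
    repResp zero H p = H [] p
    repResp (suc c) H p = P .resp (λ x q → repResp c (λ ys q' → H (x ∷ ys) q') q) p

    repTotal : ∀ c (g : ℕ → ℕ) xs → repRun P c (λ _ r → g (length r)) xs ≡ fall (length xs) (c * P .size) * g (length xs ∸ c * P .size)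
    repTotal zero g xs = ≡.sym (+-identityʳ _)
    repTotal (suc c) g xs = begin
      P .run (λ x r → repRun P c (λ _ r' → g (length r')) r) xs ≡⟨ ext′ P xs (λ x r → repTotal c g r) ⟩
      P .run (λ x r → fall (length r) cs * g (length r ∸ cs)) xs ≡⟨ P .total (λ n → fall n cs * g (n ∸ cs)) xs ⟩
      fall n s * (fall (n ∸ s) cs * g (n ∸ s ∸ cs)) ≡⟨ *-assoc (fall n s) _ _ ⟨
      fall n s * fall (n ∸ s) cs * g (n ∸ s ∸ cs) ≡⟨ cong₂ (λ u v → u * g v) (≡.sym (fall-+ n s cs)) (∸-+-assoc n s cs) ⟩
      fall n (s + cs) * g (n ∸ (s + cs)) ∎
      where
        open ≡.≡-Reasoning
        s = P .size
        cs = c * s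
        n = length xs

  rep : Picker A X → ℕ → Picker A (List X)
  rep P c .run = repRun P c
  rep P c .flat = concatMap (P .flat)
  rep P c .Ok ys = length ys ≡ c × All (P .Ok) ys
  rep P c .size = c * P .size
  rep P c .ok-size = repOkSize P c
  rep P c .mono = repMono P c
  rep P c .add = repAdd P c
  rep P c .scale = repScale P c
  rep P c .resp = repResp P c
  rep P c .total = repTotal P c

  Commute : Picker A X → Picker A Y → Set
  Commute {A} {X} {Y} P Q = ∀ (h : X → Y → List A → ℕ) xs →
    P .run (λ x r → Q .run (λ y r' → h x y r') r) xs ≡ Q .run (λ y r → P .run (λ x r' → h x y r') r) xs

  commute-sym : (P : Picker A X) (Q : Picker A Y) → Commute P Q → Commute Q P
  commute-sym P Q C h xs = ≡.sym (C (λ x y → h y x) xs)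

  commute-rep : (P : Picker A X) (Q : Picker A Y) → Commute P Q → ∀ c → Commute (rep P c) Q
  commute-rep P Q C zero h xs = ≡.refl
  commute-rep P Q C (suc c) h xs = begin
    P .run (λ x r → repRun P c (λ ys r' → Q .run (λ y r'' → h (x ∷ ys) y r'') r') r) xs
      ≡⟨ ext′ P xs (λ x r → commute-rep P Q C c (λ ys → h (x ∷ ys)) r) ⟩
    P .run (λ x r → Q .run (λ y r' → repRun P c (λ ys r'' → h (x ∷ ys) y r'') r') r) xs
      ≡⟨ C (λ x y r' → repRun P c (λ ys r'' → h (x ∷ ys) y r'') r') xs ⟩
    Q .run (λ y r → P .run (λ x r' → repRun P c (λ ys r'' → h (x ∷ ys) y r'') r') r) xs ∎
    where open ≡.≡-Reasoning

  commute-reps : (P : Picker A X) (Q : Picker A Y) → Commute P Q → ∀ c c' → Commute (rep P c) (rep Q c')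
  commute-reps P Q C c c' = commute-rep P (rep Q c') (commute-sym (rep Q c') P (commute-rep Q P (commute-sym P Q C) c')) c

  -- By exchangeability each of the `suc c` outcomes can be moved to the front, so choosing one of
  -- them amounts to `suc c` copies of the first draw.
  rep-pick : (P : Picker A X) → Commute P P → ∀ c (H : X → List X → List A → ℕ) xs →
    repRun P (suc c) (λ vs r → pick (λ v vs' → H v vs' r) vs) xs ≡ suc c * P .run (λ v r → repRun P c (λ vs r' → H v vs r') r) xs
  rep-pick P C zero H xs = ≡.trans (ext′ P xs (λ x r → +-identityʳ _)) (≡.sym (+-identityʳ _))
  rep-pick P C (suc c) H xs = begin
    P .run (λ x r → repRun P (suc c) (λ vs r' → H x vs r' + pick (λ v vs' → H v (x ∷ vs') r') vs) r) xs
      ≡⟨ ext′ P xs (λ x r → repAdd P (suc c) (H x) (λ vs r' → pick (λ v vs' → H v (x ∷ vs') r') vs) r) ⟩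
    P .run (λ x r → repRun P (suc c) (H x) r + repRun P (suc c) (λ vs r' → pick (λ v vs' → H v (x ∷ vs') r') vs) r) xs
      ≡⟨ P .add _ _ xs ⟩
    T + P .run (λ x r → repRun P (suc c) (λ vs r' → pick (λ v vs' → H v (x ∷ vs') r') vs) r) xs
      ≡⟨ cong (T +_) (ext′ P xs (λ x r → rep-pick P C c (λ v vs' → H v (x ∷ vs')) r)) ⟩
    T + P .run (λ x r → suc c * P .run (λ v r' → repRun P c (λ vs r'' → H v (x ∷ vs) r'') r') r) xs
      ≡⟨ cong (T +_) (P .scale (suc c) _ xs) ⟩
    T + suc c * P .run (λ x r → P .run (λ v r' → repRun P c (λ vs r'' → H v (x ∷ vs) r'') r') r) xs
      ≡⟨ cong (λ w → T + suc c * w) (C (λ x v r' → repRun P c (λ vs r'' → H v (x ∷ vs) r'') r') xs) ⟩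
    T + suc c * P .run (λ v r → P .run (λ x r' → repRun P c (λ vs r'' → H v (x ∷ vs) r'') r') r) xs ∎
    where
      open ≡.≡-Reasoning
      T = P .run (λ v r → repRun P (suc c) (λ vs r' → H v vs r') r) xs

  rep-+ : (P : Picker A X) → ∀ a b (h : List X → List A → ℕ) xs →
    repRun P (a + b) h xs ≡ repRun P a (λ us r → repRun P b (λ vs r' → h (us ++ vs) r') r) xs
  rep-+ P zero b h xs = ≡.refl
  rep-+ P (suc a) b h xs = ext′ P xs (λ x r → rep-+ P a b (λ ys → h (x ∷ ys)) r)

  -- Lets a whole group of columns be treated as one draw.
  rep-* : (P : Picker A X) → ∀ a b (h : List X → List A → ℕ) xs →
    repRun P (a * b) h xs ≡ repRun (rep P b) a (λ uss r → h (Data.List.concat uss) r) xs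
  rep-* P zero b h xs = ≡.refl
  rep-* P (suc a) b h xs = ≡.trans (rep-+ P b (a * b) h xs) (ext′ (rep P b) xs (λ us r → rep-* P a b (λ vs → h (us ++ vs)) r))

-- Matching counts and their exchange inequalities.

module MatchingCounts where

  open Pickers
  open import Data.Nat
  open import Data.Nat.Properties
  open import Data.Nat.Tactic.RingSolver using (solve-∀)
  open import Data.List using (List; []; _∷_; _++_; length)
  open import Data.List.Relation.Binary.Permutation.Propositional using (_↭_; refl; prep; swap; trans)
  open import Data.List.Relation.Binary.Permutation.Propositional.Properties using (↭-length; ++⁺ʳ; ++-comm)
  open import Relation.Binary.PropositionalEquality as ≡ using (_≡_; cong)

  module Matchings {R C : Set} (a : R → C → ℕ) where

    -- the number of matchings that saturate the rows us, each weighted by the product of its entries of a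
    N : List R → List C → ℕ
    N [] ws = 1
    N (u ∷ us) ws = pick (λ v r → a u v * N us r) ws

    N-cols : ∀ us {ws ws'} → ws ↭ ws' → N us ws ≡ N us ws'
    N-cols [] p = ≡.refl
    N-cols (u ∷ us) p = pick-resp (λ v q → cong (a u v *_) (N-cols us q)) p

    N-rows : ∀ {us us'} → us ↭ us' → ∀ ws → N us ws ≡ N us' ws
    N-rows refl ws = ≡.refl
    N-rows (prep u p) ws = pick-ext ws (λ v r _ → cong (a u v *_) (N-rows p r))
    N-rows (swap {us} {us'} u u' p) ws = begin
      pick (λ v r → a u v * pick (λ v' r' → a u' v' * N us r') r) ws ≡⟨ pick-ext ws (λ v r _ → pick-scale (a u v) _ r) ⟨
      pick (λ v r → pick (λ v' r' → a u v * (a u' v' * N us r')) r) ws ≡⟨ pick-pick (λ v v' r → a u v * (a u' v' * N us r)) ws ⟩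
      pick (λ v' r → pick (λ v r' → a u v * (a u' v' * N us r')) r) ws ≡⟨ pick-ext ws (λ v' r _ → pick-ext r (λ v r' _ → ≡.trans (lem (a u v) (a u' v') _) (cong (λ z → a u' v' * (a u v * z)) (N-rows p r')))) ⟩
      pick (λ v' r → pick (λ v r' → a u' v' * (a u v * N us' r')) r) ws ≡⟨ pick-ext ws (λ v' r _ → pick-scale (a u' v') _ r) ⟩
      pick (λ v' r → a u' v' * pick (λ v r' → a u v * N us' r') r) ws ∎
      where
        open ≡.≡-Reasoning
        lem : ∀ x y z → x * (y * z) ≡ y * (x * z)
        lem = solve-∀
    N-rows (trans p q) ws = ≡.trans (N-rows p ws) (N-rows q ws)

    -- A matching either leaves `w` uncovered or matches it to exactly one row.
    column-expansion : ∀ us w ws → N us (w ∷ ws) ≡ N us ws + pick (λ u us' → a u w * N us' ws) us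
    column-expansion [] w ws = ≡.refl
    column-expansion (u ∷ us) w ws = begin
      a u w * N us ws + pick (λ v r → a u v * N us (w ∷ r)) ws
        ≡⟨ cong (a u w * N us ws +_) (pick-ext ws (λ v r _ → ≡.trans (cong (a u v *_) (column-expansion us w r)) (*-distribˡ-+ (a u v) _ _))) ⟩
      a u w * N us ws + pick (λ v r → a u v * N us r + a u v * pick (λ u' us' → a u' w * N us' r) us) ws
        ≡⟨ cong (a u w * N us ws +_) (pick-add _ _ ws) ⟩
      a u w * N us ws + (N (u ∷ us) ws + pick (λ v r → a u v * pick (λ u' us' → a u' w * N us' r) us) ws)
        ≡⟨ cong (λ z → a u w * N us ws + (N (u ∷ us) ws + z)) step ⟩
      a u w * N us ws + (N (u ∷ us) ws + pick (λ u' us' → a u' w * N (u ∷ us') ws) us)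
        ≡⟨ lem (a u w * N us ws) (N (u ∷ us) ws) _ ⟩
      N (u ∷ us) ws + (a u w * N us ws + pick (λ u' us' → a u' w * N (u ∷ us') ws) us) ∎
      where
        open ≡.≡-Reasoning
        lem : ∀ x y z → x + (y + z) ≡ y + (x + z)
        lem = solve-∀
        lem2 : ∀ x y z → x * (y * z) ≡ y * (x * z)
        lem2 = solve-∀
        step : pick (λ v r → a u v * pick (λ u' us' → a u' w * N us' r) us) ws ≡ pick (λ u' us' → a u' w * N (u ∷ us') ws) us
        step = begin
          pick (λ v r → a u v * pick (λ u' us' → a u' w * N us' r) us) ws ≡⟨ pick-ext ws (λ v r _ → pick-scale (a u v) _ us) ⟨
          pick (λ v r → pick (λ u' us' → a u v * (a u' w * N us' r)) us) ws ≡⟨ pick-swap _ ws us ⟩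
          pick (λ u' us' → pick (λ v r → a u v * (a u' w * N us' r)) ws) us ≡⟨ pick-ext us (λ u' us' _ → ≡.trans (pick-ext ws (λ v r _ → lem2 (a u v) (a u' w) _)) (pick-scale (a u' w) _ ws)) ⟩
          pick (λ u' us' → a u' w * N (u ∷ us') ws) us ∎

    N-mono-cols : ∀ us Q R → N us Q ≤ N us (Q ++ R)
    N-mono-cols [] Q R = ≤-refl
    N-mono-cols (u ∷ us) Q R = ≤-trans (pick-mono Q (λ v r _ → *-monoʳ-≤ (a u v) (N-mono-cols us r R)))
      (≤-trans (m≤m+n _ _) (≤-reflexive (≡.sym (pick-++ _ Q R))))

    -- The relative gain from a column `w` shrinks when the columns `R` are present. The two
    -- exchange inequalities hold by a joint induction: expanding along the column `w` leads to
    -- `exchange-row-column` with one row fewer, and expanding along the row `u` leads back to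
    -- `exchange-columns` for the rows `us`.
    exchange-columns : ∀ m us → length us ≡ m → ∀ w Q R → N us (w ∷ Q ++ R) * N us Q ≤ N us (Q ++ R) * N us (w ∷ Q)
    exchange-row-column : ∀ m u us → length us ≡ m → ∀ Q R → N us (Q ++ R) * N (u ∷ us) Q ≤ N (u ∷ us) (Q ++ R) * N us Q

    exchange-row-column m u us l Q R = begin
      N us (Q ++ R) * pick (λ v r → a u v * N us r) Q ≡⟨ pick-scale (N us (Q ++ R)) _ Q ⟨
      pick (λ v r → N us (Q ++ R) * (a u v * N us r)) Q ≤⟨ pick-mono Q term ⟩
      pick (λ v r → N us Q * (a u v * N us (r ++ R))) Q ≡⟨ pick-scale (N us Q) _ Q ⟩
      -- The matchings that send `u` into `R` are discarded here.
      N us Q * pick (λ v r → a u v * N us (r ++ R)) Q ≤⟨ *-monoʳ-≤ (N us Q) (≤-trans (m≤m+n _ _) (≤-reflexive (≡.sym (pick-++ _ Q R)))) ⟩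
      N us Q * N (u ∷ us) (Q ++ R) ≡⟨ *-comm (N us Q) _ ⟩
      N (u ∷ us) (Q ++ R) * N us Q ∎
      where
        open ≤-Reasoning
        lem : ∀ x y z → x * (y * z) ≡ y * (x * z)
        lem = solve-∀
        term : ∀ v r → Q ↭ v ∷ r → N us (Q ++ R) * (a u v * N us r) ≤ N us Q * (a u v * N us (r ++ R))
        term v r p = begin
          N us (Q ++ R) * (a u v * N us r) ≡⟨ lem (N us (Q ++ R)) (a u v) _ ⟩
          a u v * (N us (Q ++ R) * N us r) ≡⟨ cong (λ z → a u v * (z * N us r)) (N-cols us (++⁺ʳ R p)) ⟩
          a u v * (N us (v ∷ r ++ R) * N us r) ≤⟨ *-monoʳ-≤ (a u v) (exchange-columns m us l v r R) ⟩
          a u v * (N us (r ++ R) * N us (v ∷ r)) ≡⟨ cong (λ z → a u v * (N us (r ++ R) * z)) (N-cols us p) ⟨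
          a u v * (N us (r ++ R) * N us Q) ≡⟨ lem2 (a u v) _ (N us Q) ⟩
          N us Q * (a u v * N us (r ++ R)) ∎
          where
            lem2 : ∀ x y z → x * (y * z) ≡ z * (x * y)
            lem2 = solve-∀

    exchange-columns zero [] l w Q R = ≤-refl
    exchange-columns (suc m) us l w Q R = begin
      N us (w ∷ Q ++ R) * N us Q ≡⟨ cong (_* N us Q) (column-expansion us w (Q ++ R)) ⟩
      (N us (Q ++ R) + pick (λ u us' → a u w * N us' (Q ++ R)) us) * N us Q ≡⟨ *-distribʳ-+ (N us Q) (N us (Q ++ R)) _ ⟩
      N us (Q ++ R) * N us Q + pick (λ u us' → a u w * N us' (Q ++ R)) us * N us Q ≤⟨ +-monoʳ-≤ _ step ⟩
      N us (Q ++ R) * N us Q + N us (Q ++ R) * pick (λ u us' → a u w * N us' Q) us ≡⟨ *-distribˡ-+ (N us (Q ++ R)) _ _ ⟨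
      N us (Q ++ R) * (N us Q + pick (λ u us' → a u w * N us' Q) us) ≡⟨ cong (N us (Q ++ R) *_) (column-expansion us w Q) ⟨
      N us (Q ++ R) * N us (w ∷ Q) ∎
      where
        open ≤-Reasoning
        lem : ∀ x y z → x * (y * z) ≡ y * (z * x)
        lem = solve-∀
        lem2 : ∀ x y z → x * (y * z) ≡ y * (x * z)
        lem2 = solve-∀
        term : ∀ u us' → us ↭ u ∷ us' → N us Q * (a u w * N us' (Q ++ R)) ≤ N us (Q ++ R) * (a u w * N us' Q)
        term u us' p = begin
          N us Q * (a u w * N us' (Q ++ R)) ≡⟨ lem (N us Q) (a u w) _ ⟩
          a u w * (N us' (Q ++ R) * N us Q) ≡⟨ cong (λ z → a u w * (N us' (Q ++ R) * z)) (N-rows p Q) ⟩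
          a u w * (N us' (Q ++ R) * N (u ∷ us') Q) ≤⟨ *-monoʳ-≤ (a u w) (exchange-row-column m u us' (suc-injective (≡.trans (≡.sym (↭-length p)) l)) Q R) ⟩
          a u w * (N (u ∷ us') (Q ++ R) * N us' Q) ≡⟨ cong (λ z → a u w * (z * N us' Q)) (N-rows p (Q ++ R)) ⟨
          a u w * (N us (Q ++ R) * N us' Q) ≡⟨ lem2 (a u w) (N us (Q ++ R)) _ ⟩
          N us (Q ++ R) * (a u w * N us' Q) ∎
        step : pick (λ u us' → a u w * N us' (Q ++ R)) us * N us Q ≤ N us (Q ++ R) * pick (λ u us' → a u w * N us' Q) us
        step = begin
          pick (λ u us' → a u w * N us' (Q ++ R)) us * N us Q ≡⟨ *-comm _ (N us Q) ⟩
          N us Q * pick (λ u us' → a u w * N us' (Q ++ R)) us ≡⟨ pick-scale (N us Q) _ us ⟨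
          pick (λ u us' → N us Q * (a u w * N us' (Q ++ R))) us ≤⟨ pick-mono us term ⟩
          pick (λ u us' → N us (Q ++ R) * (a u w * N us' Q)) us ≡⟨ pick-scale (N us (Q ++ R)) _ us ⟩
          N us (Q ++ R) * pick (λ u us' → a u w * N us' Q) us ∎

    cols-submodular : ∀ us w w' ws → N us (w ∷ w' ∷ ws) * N us ws ≤ N us (w ∷ ws) * N us (w' ∷ ws)
    cols-submodular us w w' ws = begin
      N us (w ∷ w' ∷ ws) * N us ws ≡⟨ cong (_* N us ws) (N-cols us (prep w (++-comm (w' ∷ []) ws))) ⟩
      N us (w ∷ ws ++ w' ∷ []) * N us ws ≤⟨ exchange-columns _ us ≡.refl w ws (w' ∷ []) ⟩
      N us (ws ++ w' ∷ []) * N us (w ∷ ws) ≡⟨ *-comm (N us (ws ++ w' ∷ [])) _ ⟩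
      N us (w ∷ ws) * N us (ws ++ w' ∷ []) ≡⟨ cong (N us (w ∷ ws) *_) (N-cols us (++-comm (w' ∷ []) ws)) ⟨
      N us (w ∷ ws) * N us (w' ∷ ws) ∎
      where open ≤-Reasoning

    row-column-modular : ∀ u us w ws → N us (w ∷ ws) * N (u ∷ us) ws ≤ N (u ∷ us) (w ∷ ws) * N us ws
    row-column-modular u us w ws = begin
      N us (w ∷ ws) * N (u ∷ us) ws ≡⟨ cong (_* N (u ∷ us) ws) (N-cols us (++-comm (w ∷ []) ws)) ⟩
      N us (ws ++ w ∷ []) * N (u ∷ us) ws ≤⟨ exchange-row-column _ u us ≡.refl ws (w ∷ []) ⟩
      N (u ∷ us) (ws ++ w ∷ []) * N us ws ≡⟨ cong (_* N us ws) (N-cols (u ∷ us) (++-comm (w ∷ []) ws)) ⟨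
      N (u ∷ us) (w ∷ ws) * N us ws ∎
      where open ≤-Reasoning

    rows-submodular : ∀ u u' us ws → N (u ∷ u' ∷ us) ws * N us ws ≤ N (u ∷ us) ws * N (u' ∷ us) ws
    rows-submodular u u' us ws = begin
      N (u ∷ u' ∷ us) ws * N us ws ≡⟨ *-comm _ (N us ws) ⟩
      N us ws * pick (λ v r → a u v * N (u' ∷ us) r) ws ≡⟨ pick-scale (N us ws) _ ws ⟨
      pick (λ v r → N us ws * (a u v * N (u' ∷ us) r)) ws ≤⟨ pick-mono ws term ⟩
      pick (λ v r → N (u' ∷ us) ws * (a u v * N us r)) ws ≡⟨ pick-scale (N (u' ∷ us) ws) _ ws ⟩
      N (u' ∷ us) ws * N (u ∷ us) ws ≡⟨ *-comm (N (u' ∷ us) ws) _ ⟩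
      N (u ∷ us) ws * N (u' ∷ us) ws ∎
      where
        open ≤-Reasoning
        lem2 : ∀ x y z → x * (y * z) ≡ y * (x * z)
        lem2 = solve-∀
        term : ∀ v r → ws ↭ v ∷ r → N us ws * (a u v * N (u' ∷ us) r) ≤ N (u' ∷ us) ws * (a u v * N us r)
        term v r p = begin
          N us ws * (a u v * N (u' ∷ us) r) ≡⟨ lem2 (N us ws) (a u v) _ ⟩
          a u v * (N us ws * N (u' ∷ us) r) ≡⟨ cong (λ z → a u v * (z * N (u' ∷ us) r)) (N-cols us p) ⟩
          a u v * (N us (v ∷ r) * N (u' ∷ us) r) ≤⟨ *-monoʳ-≤ (a u v) (row-column-modular u' us v r) ⟩
          a u v * (N (u' ∷ us) (v ∷ r) * N us r) ≡⟨ cong (λ z → a u v * (z * N us r)) (N-cols (u' ∷ us) p) ⟨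
          a u v * (N (u' ∷ us) ws * N us r) ≡⟨ lem2 (a u v) (N (u' ∷ us) ws) _ ⟩
          N (u' ∷ us) ws * (a u v * N us r) ∎

    N-pos-tail : ∀ u us ws → 0 < N (u ∷ us) ws → 0 < N us ws
    N-pos-tail u us ws p with N us ws in eq
    ... | suc _ = z<s
    ... | zero = ≤-trans p (≤-trans (pick-mono ws term) (≤-reflexive (pick-zero ws)))
      where
        term : ∀ v r → ws ↭ v ∷ r → a u v * N us r ≤ 0
        term v r q = ≤-reflexive (≡.trans (cong (a u v *_) (n≤0⇒n≡0 (≤-trans (N-mono-cols us r (v ∷ []))
          (≤-reflexive (≡.trans (≡.sym (N-cols us (trans q (++-comm (v ∷ []) r)))) eq))))) (*-zeroʳ (a u v)))

-- Products over deletions, and the entropy estimate in integers.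

module Deletions where

  open Arithmetic
  open Pickers
  open import Data.Nat
  open import Data.Nat.Properties
  open import Data.Nat.Tactic.RingSolver using (solve-∀)
  open import Data.Nat.ListAction using (sum; product)
  open import Data.Nat.ListAction.Properties using (product-++)
  open import Data.List using (List; []; _∷_; _++_; length; concat; map)
  open import Data.List.Properties using (++-identityʳ; ++-assoc; length-map)
  open import Data.List.Relation.Unary.All as All using (All; []; _∷_)
  open import Data.List.Relation.Binary.Permutation.Propositional using (_↭_; refl; prep; swap; trans)
  open import Data.List.Relation.Binary.Permutation.Propositional.Properties using (++⁺ʳ; shifts)
  open import Data.Product using (_×_; _,_; proj₁; proj₂; ∃; ∃₂)
  open import Data.Sum using (inj₁; inj₂)
  open import Relation.Nullary using (yes; no)
  open import Data.Empty using (⊥-elim)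
  open import Relation.Binary.PropositionalEquality as ≡ using (_≡_; cong; cong₂; subst)

  private variable X : Set

  -- In contrast to `pick` the values after the single deletions are kept apart, as their product
  -- and their extrema are needed.
  dels : (List X → ℕ) → List X → List ℕ
  dels F [] = []
  dels F (x ∷ xs) = F xs ∷ dels (λ ys → F (x ∷ ys)) xs

  dels-ext : {F G : List X → ℕ} → (∀ xs → F xs ≡ G xs) → ∀ xs → dels F xs ≡ dels G xs
  dels-ext e [] = ≡.refl
  dels-ext e (x ∷ xs) = cong₂ _∷_ (e xs) (dels-ext (λ ys → e (x ∷ ys)) xs)

  dels-++ : (F : List X → ℕ) → ∀ xs ys → dels F (xs ++ ys) ≡ dels (λ l → F (l ++ ys)) xs ++ dels (λ l → F (xs ++ l)) ys
  dels-++ F [] ys = ≡.refl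
  dels-++ F (x ∷ xs) ys = cong (F (xs ++ ys) ∷_) (dels-++ (λ l → F (x ∷ l)) xs ys)

  length-dels : (F : List X → ℕ) → ∀ xs → length (dels F xs) ≡ length xs
  length-dels F [] = ≡.refl
  length-dels F (x ∷ xs) = cong suc (length-dels _ xs)

  product-dels : {F G : List X → ℕ} {A B : ℕ} → ∀ xs → (∀ x r → xs ↭ x ∷ r → F r * A ≤ G r * B) →
    product (dels F xs) * A ^ length xs ≤ product (dels G xs) * B ^ length xs
  product-dels [] p = ≤-refl
  product-dels {F = F} {G} {A} {B} (x ∷ xs) p = begin
    F xs * product (dels (λ l → F (x ∷ l)) xs) * (A * A ^ length xs) ≡⟨ lem (F xs) _ A _ ⟩
    F xs * A * (product (dels (λ l → F (x ∷ l)) xs) * A ^ length xs)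
      ≤⟨ *-mono-≤ (p x xs refl) (product-dels xs (λ y r q → p y (x ∷ r) (trans (prep x q) (swap x y refl)))) ⟩
    G xs * B * (product (dels (λ l → G (x ∷ l)) xs) * B ^ length xs) ≡⟨ lem (G xs) _ B _ ⟨
    G xs * product (dels (λ l → G (x ∷ l)) xs) * (B * B ^ length xs) ∎
    where
      open ≤-Reasoning
      lem : ∀ a b c d → a * b * (c * d) ≡ a * c * (b * d)
      lem = solve-∀

  dels-max : (F : List X → ℕ) → ∀ xs → 0 < length xs → ∃₂ λ x r → xs ↭ x ∷ r × All (_≤ F r) (dels F xs)
  dels-max F (x ∷ []) _ = x , [] , refl , ≤-refl ∷ []
  dels-max F (x ∷ xs@(_ ∷ _)) _ with dels-max (λ l → F (x ∷ l)) xs z<s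
  ... | y , r , p , q with ≤-total (F xs) (F (x ∷ r))
  ... | inj₁ le = y , x ∷ r , trans (prep x p) (swap x y refl) , le ∷ q
  ... | inj₂ ge = x , xs , refl , ≤-refl ∷ All.map (λ z → ≤-trans z ge) q

  dels-min : (F : List X → ℕ) → ∀ xs → 0 < length xs → ∃₂ λ x r → xs ↭ x ∷ r × All (F r ≤_) (dels F xs)
  dels-min F (x ∷ []) _ = x , [] , refl , ≤-refl ∷ []
  dels-min F (x ∷ xs@(_ ∷ _)) _ with dels-min (λ l → F (x ∷ l)) xs z<s
  ... | y , r , p , q with ≤-total (F (x ∷ r)) (F xs)
  ... | inj₁ le = y , x ∷ r , trans (prep x p) (swap x y refl) , le ∷ q
  ... | inj₂ ge = x , xs , refl , ≤-refl ∷ All.map (λ z → ≤-trans ge z) q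

  product-bound : ∀ {b} xs → All (_≤ b) xs → product xs ≤ b ^ length xs
  product-bound [] _ = ≤-refl
  product-bound (x ∷ xs) (p ∷ ps) = *-mono-≤ p (product-bound xs ps)

  -- `F` is abstract because it will count matchings both as a function of the rows and as a
  -- function of the columns. The premise `positive` has two hypotheses since positivity is
  -- inherited in opposite directions: from more rows to fewer, but from fewer columns to more.
  module GroupDeletion (F : List X → ℕ)
    (F-↭ : ∀ {xs ys} → xs ↭ ys → F xs ≡ F ys)
    (submodular : ∀ x y zs → F (x ∷ y ∷ zs) * F zs ≤ F (x ∷ zs) * F (y ∷ zs))
    (positive : ∀ x ys zs → 0 < F zs → 0 < F (x ∷ ys ++ zs) → 0 < F (ys ++ zs)) where

    -- By submodularity the factor by which the deletion of an entry changes `F` only grows when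
    -- other entries are present. So the factors met while `g` is deleted entry by entry are bounded
    -- by those for the full list, and they telescope.
    group-deletion : ∀ zs g → 0 < F (g ++ zs) →
      F zs * F (g ++ zs) ^ length g ≤ F (g ++ zs) * product (dels (λ l → F (l ++ zs)) g)
    group-deletion zs [] p = ≤-refl
    group-deletion zs (u ∷ g) p with F zs in eq
    ... | zero = z≤n
    ... | suc f = *-cancelʳ-pos (M ^ m) (^-pos M m M>0) (begin
      suc f * (L * L ^ m) * M ^ m ≡⟨ lem (suc f) L (L ^ m) (M ^ m) ⟩
      suc f * M ^ m * (L * L ^ m) ≤⟨ *-monoˡ-≤ (L * L ^ m) (≤-trans (≤-reflexive (cong (_* M ^ m) (≡.sym eq))) (group-deletion zs g M>0)) ⟩
      M * P * (L * L ^ m) ≡⟨ lem2 M P L (L ^ m) ⟩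
      L * M * (P * L ^ m) ≤⟨ *-monoʳ-≤ (L * M) (product-dels {F = λ l → F (l ++ zs)} {G = λ l → F (u ∷ l ++ zs)} g term) ⟩
      L * M * (Q * M ^ m) ≡⟨ lem3 L M Q (M ^ m) ⟩
      L * (M * Q) * M ^ m ∎)
      where
        open ≤-Reasoning
        L = F (u ∷ g ++ zs)
        M = F (g ++ zs)
        m = length g
        P = product (dels (λ l → F (l ++ zs)) g)
        Q = product (dels (λ l → F (u ∷ l ++ zs)) g)
        M>0 : 0 < M
        M>0 = positive u g zs (subst (0 <_) (≡.sym eq) z<s) p
        term : ∀ x r → g ↭ x ∷ r → F (r ++ zs) * L ≤ F (u ∷ r ++ zs) * M
        term x r q = begin
          F (r ++ zs) * L ≡⟨ cong (F (r ++ zs) *_) (F-↭ (prep u (++⁺ʳ zs q))) ⟩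
          F (r ++ zs) * F (u ∷ x ∷ r ++ zs) ≡⟨ *-comm (F (r ++ zs)) _ ⟩
          F (u ∷ x ∷ r ++ zs) * F (r ++ zs) ≤⟨ submodular u x (r ++ zs) ⟩
          F (u ∷ r ++ zs) * F (x ∷ r ++ zs) ≡⟨ cong (F (u ∷ r ++ zs) *_) (F-↭ (++⁺ʳ zs q)) ⟨
          F (u ∷ r ++ zs) * M ∎
        lem : ∀ a b c d → a * (b * c) * d ≡ a * d * (b * c)
        lem = solve-∀
        lem2 : ∀ a b c d → a * b * (c * d) ≡ c * a * (b * d)
        lem2 = solve-∀
        lem3 : ∀ a b c d → a * b * (c * d) ≡ a * (b * c) * d
        lem3 = solve-∀

    -- `zs` holds the groups already dealt with. They stay present, so that every factor refers to
    -- the same full list. `L` will be the least value left by the deletion of a group.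
    groups-deletion : ∀ s L zs Xs → All (λ g → length g ≡ s) Xs → 0 < F (concat Xs ++ zs) →
      All (L ≤_) (dels (λ Zs → F (concat Zs ++ zs)) Xs) →
      L ^ length Xs * (F (concat Xs ++ zs) ^ s) ^ length Xs ≤ F (concat Xs ++ zs) ^ length Xs * product (dels (λ l → F (l ++ zs)) (concat Xs))
    groups-deletion s L zs [] _ p _ = ≤-refl
    groups-deletion s L zs (g ∷ Xs) (e ∷ es) p (q ∷ qs) = begin
      L * L ^ k * (W ^ s * (W ^ s) ^ k) ≡⟨ lem L (L ^ k) (W ^ s) _ ⟩
      L * W ^ s * (L ^ k * (W ^ s) ^ k) ≤⟨ *-mono-≤ first rest ⟩
      W * P₁ * (W ^ k * P₂) ≡⟨ lem W P₁ (W ^ k) P₂ ⟩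
      W * W ^ k * (P₁ * P₂) ≡⟨ cong (W * W ^ k *_) splitP ⟨
      W * W ^ k * product (dels (λ l → F (l ++ zs)) (g ++ concat Xs)) ∎
      where
        open ≤-Reasoning
        k = length Xs
        W = F ((g ++ concat Xs) ++ zs)
        W₁ = F (g ++ (concat Xs ++ zs))
        W₂ = F (concat Xs ++ (g ++ zs))
        W≡W₁ : W ≡ W₁
        W≡W₁ = cong F (++-assoc g (concat Xs) zs)
        mv : ∀ l → F ((g ++ l) ++ zs) ≡ F (l ++ g ++ zs)
        mv l = ≡.trans (cong F (++-assoc g l zs)) (F-↭ (shifts g l))
        W≡W₂ : W ≡ W₂
        W≡W₂ = mv (concat Xs)
        P₁ = product (dels (λ l → F (l ++ (concat Xs ++ zs))) g)
        P₂ = product (dels (λ l → F (l ++ (g ++ zs))) (concat Xs))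
        splitP : product (dels (λ l → F (l ++ zs)) (g ++ concat Xs)) ≡ P₁ * P₂
        splitP = ≡.trans (cong product (dels-++ (λ l → F (l ++ zs)) g (concat Xs))) (≡.trans (product-++ (dels (λ l → F ((l ++ concat Xs) ++ zs)) g) _)
          (cong₂ _*_ (cong product (dels-ext (λ l → cong F (++-assoc l (concat Xs) zs)) g)) (cong product (dels-ext mv (concat Xs)))))
        first : L * W ^ s ≤ W * P₁
        first = begin
          L * W ^ s ≤⟨ *-monoˡ-≤ (W ^ s) q ⟩
          F (concat Xs ++ zs) * W ^ s ≡⟨ cong₂ (λ v n → F (concat Xs ++ zs) * v ^ n) W≡W₁ (≡.sym e) ⟩
          F (concat Xs ++ zs) * W₁ ^ length g ≤⟨ group-deletion (concat Xs ++ zs) g (subst (0 <_) W≡W₁ p) ⟩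
          W₁ * P₁ ≡⟨ cong (_* P₁) W≡W₁ ⟨
          W * P₁ ∎
        rest : L ^ k * (W ^ s) ^ k ≤ W ^ k * P₂
        rest = subst (λ v → L ^ k * (v ^ s) ^ k ≤ v ^ k * P₂) (≡.sym W≡W₂)
          (groups-deletion s L (g ++ zs) Xs es (subst (0 <_) W≡W₂ p) (subst (All (L ≤_)) (dels-ext (λ Zs → mv (concat Zs)) Xs) qs))
        lem : ∀ a b c d → a * b * (c * d) ≡ a * c * (b * d)
        lem = solve-∀

    groups-deletion₀ : ∀ s L Xs → All (λ g → length g ≡ s) Xs → 0 < F (concat Xs) →
      All (L ≤_) (dels (λ Zs → F (concat Zs)) Xs) →
      L ^ length Xs * (F (concat Xs) ^ s) ^ length Xs ≤ F (concat Xs) ^ length Xs * product (dels F (concat Xs))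
    groups-deletion₀ s L Xs es p q = subst₃ (groups-deletion s L [] Xs es (subst (0 <_) (≡.sym (idʳ (concat Xs))) p)
        (subst (All (L ≤_)) (dels-ext (λ Zs → ≡.sym (idʳ (concat Zs))) Xs) q))
      where
        idʳ : ∀ l → F (l ++ []) ≡ F l
        idʳ l = cong F (++-identityʳ l)
        subst₃ : L ^ length Xs * (F (concat Xs ++ []) ^ s) ^ length Xs ≤ F (concat Xs ++ []) ^ length Xs * product (dels (λ l → F (l ++ [])) (concat Xs)) →
          L ^ length Xs * (F (concat Xs) ^ s) ^ length Xs ≤ F (concat Xs) ^ length Xs * product (dels F (concat Xs))
        subst₃ h rewrite idʳ (concat Xs) | dels-ext idʳ (concat Xs) = h

  -- The weights will be adjacencies to a fixed vertex, so that the deletions inside its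
  -- neighbourhood can be singled out.
  weighted-dels : (X → ℕ) → (List X → ℕ) → List X → List (ℕ × ℕ)
  weighted-dels c F [] = []
  weighted-dels c F (x ∷ xs) = (c x , F xs) ∷ weighted-dels c (λ l → F (x ∷ l)) xs

  module _ (c : X → ℕ) where
    wd-product : ∀ F xs → product (map proj₂ (weighted-dels c F xs)) ≡ product (dels F xs)
    wd-product F [] = ≡.refl
    wd-product F (x ∷ xs) = cong (F xs *_) (wd-product _ xs)

    wd-sum : ∀ F xs → sum (map (λ p → proj₁ p * proj₂ p) (weighted-dels c F xs)) ≡ pick (λ x r → c x * F r) xs
    wd-sum F [] = ≡.refl
    wd-sum F (x ∷ xs) = cong (c x * F xs +_) (wd-sum _ xs)

    wd-weight : ∀ F xs → sum (map proj₁ (weighted-dels c F xs)) ≡ sum (map c xs)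
    wd-weight F [] = ≡.refl
    wd-weight F (x ∷ xs) = cong (c x +_) (wd-weight _ xs)

    wd-length : ∀ F xs → length (weighted-dels c F xs) ≡ length xs
    wd-length F [] = ≡.refl
    wd-length F (x ∷ xs) = cong suc (wd-length _ xs)

    wd-bound : ∀ F b xs → (∀ x → c x ≤ 1) → All (_≤ b) (dels F xs) → All (λ p → proj₁ p ≤ 1 × proj₂ p ≤ b) (weighted-dels c F xs)
    wd-bound F b [] h [] = []
    wd-bound F b (x ∷ xs) h (p ∷ ps) = (h x , p) ∷ wd-bound _ b xs h ps

  sum-weights-bound : ∀ {b} ps → All (λ p → proj₁ p ≤ 1 × proj₂ p ≤ b) ps → sum (map proj₁ ps) ≤ length ps
  sum-weights-bound [] _ = z≤n
  sum-weights-bound (_ ∷ ps) (h ∷ hs) = +-mono-≤ (proj₁ h) (sum-weights-bound ps hs)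

  -- A vertex may have more than `δ` neighbours. Exactly `δ` of them are kept for AM-GM; the surplus
  -- is bounded by the maximum `b`, like the non-neighbours.
  select : ∀ b δ m ps → length ps ≡ δ + m → All (λ p → proj₁ p ≤ 1 × proj₂ p ≤ b) ps → δ ≤ sum (map proj₁ ps) →
    ∃ λ ys → length ys ≡ δ × sum ys ≤ sum (map (λ p → proj₁ p * proj₂ p) ps) × product (map proj₂ ps) ≤ product ys * b ^ m
  select b zero m ps e h _ = [] , ≡.refl , z≤n , ≤-trans (subst (λ l → product (map proj₂ ps) ≤ b ^ l) (≡.trans (length-map proj₂ ps) e) (product-bound (map proj₂ ps) (bd ps h))) (≤-reflexive (≡.sym (+-identityʳ _)))
    where
      bd : ∀ ps → All (λ p → proj₁ p ≤ 1 × proj₂ p ≤ b) ps → All (_≤ b) (map proj₂ ps)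
      bd [] [] = []
      bd (p ∷ ps) (h ∷ hs) = proj₂ h ∷ bd ps hs
  select b (suc δ) m ((0 , B) ∷ ps) e (h ∷ hs) d with m
  ... | zero = ⊥-elim (<⇒≱ d (≤-trans (sum-weights-bound ps hs) (≤-reflexive (≡.trans (suc-injective e) (+-identityʳ δ)))))
  ... | suc m' with select b (suc δ) m' ps (≡.trans (suc-injective e) (+-suc δ m')) hs d
  ... | ys , l , s , p = ys , l , s , ≤-trans (*-mono-≤ (proj₂ h) p) (≤-reflexive (lem b (product ys) (b ^ m')))
    where
      lem : ∀ a b c → a * (b * c) ≡ b * (a * c)
      lem = solve-∀
  select b (suc δ) m ((1 , B) ∷ ps) e (h ∷ hs) (s≤s d) with select b δ m ps (suc-injective e) hs d
  ... | ys , l , s , p = B ∷ ys , cong suc l , +-mono-≤ (≤-reflexive (≡.sym (+-identityʳ B))) s , ≤-trans (*-monoʳ-≤ B p) (≤-reflexive (≡.sym (*-assoc B (product ys) (b ^ m))))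
  select b (suc δ) m ((suc (suc _) , B) ∷ ps) e ((s≤s () , _) ∷ hs) d

  -- AM-GM on `δ` neighbours of an extremal vertex of the other side, whose own deletion leaves `α`:
  -- the mass inequality at that vertex controls the sum of their values, and the other values are
  -- at most `b`.
  half : ∀ α Q b δ m ps → length ps ≡ δ + m → All (λ p → proj₁ p ≤ 1 × proj₂ p ≤ b) ps → δ ≤ sum (map proj₁ ps) →
    α * sum (map (λ p → proj₁ p * proj₂ p) ps) ≤ Q → product (map proj₂ ps) * (α * δ) ^ δ ≤ Q ^ δ * b ^ m
  half α Q b δ m ps e h d q with select b δ m ps e h d
  ... | ys , ≡.refl , s , p = begin
    product (map proj₂ ps) * (α * δ) ^ δ ≤⟨ *-monoˡ-≤ ((α * δ) ^ δ) p ⟩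
    product ys * b ^ m * (α * δ) ^ δ ≡⟨ cong (product ys * b ^ m *_) (^-distrib-* α δ δ) ⟩
    product ys * b ^ m * (α ^ δ * δ ^ δ) ≡⟨ lem (product ys) (b ^ m) (α ^ δ) (δ ^ δ) ⟩
    α ^ δ * (product ys * δ ^ δ) * b ^ m ≤⟨ *-monoˡ-≤ (b ^ m) (*-monoʳ-≤ (α ^ δ) (am-gm ys)) ⟩
    α ^ δ * sum ys ^ δ * b ^ m ≡⟨ cong (_* b ^ m) (^-distrib-* α (sum ys) δ) ⟨
    (α * sum ys) ^ δ * b ^ m ≤⟨ *-monoˡ-≤ (b ^ m) (^-monoˡ-≤ δ (≤-trans (*-monoʳ-≤ α s) q)) ⟩
    Q ^ δ * b ^ m ∎
    where
      open ≤-Reasoning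
      lem : ∀ a b c d → a * b * (c * d) ≡ c * (a * d) * b
      lem = solve-∀

  -- The two cases of the entropy estimate: if A * B * δ ≤ Q bound every factor by the maximum; otherwise use AM-GM on a neighbourhood.
  combine : ∀ ΠA ΠB A B Q i j r z → i ≤ j → 0 < Q →
    let t = r + z ; s = r + t in
    ΠA ≤ A ^ (i * s) → ΠB ≤ B ^ (j * s) →
    ΠA * (B * (i * t)) ^ (i * t) ≤ Q ^ (i * t) * A ^ (i * r) →
    ΠB * (A * (j * t)) ^ (j * t) ≤ Q ^ (j * t) * B ^ (j * r) →
    ΠA ^ j * ΠB ^ i * ((i * t) ^ s) ^ (i * j) ≤ (Q ^ s) ^ (i * j)
  combine ΠA ΠB A B Q i j r z i≤j Q>0 a₁ b₁ a₂ b₂ with A * B * (i * (r + z)) ≤? Q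
  ... | yes p = begin
    ΠA ^ j * ΠB ^ i * (δ ^ s) ^ E ≤⟨ *-monoˡ-≤ ((δ ^ s) ^ E) (*-mono-≤ (^-monoˡ-≤ j a₁) (^-monoˡ-≤ i b₁)) ⟩
    (A ^ (i * s)) ^ j * (B ^ (j * s)) ^ i * (δ ^ s) ^ E ≡⟨ cong₂ (λ u v → u * v * (δ ^ s) ^ E) (≡.trans (^-*-assoc A (i * s) j) (≡.trans (cong (A ^_) (l1 i j s)) (≡.sym (^-*-assoc A s E)))) (≡.trans (^-*-assoc B (j * s) i) (≡.trans (cong (B ^_) (l2 i j s)) (≡.sym (^-*-assoc B s E)))) ⟩
    (A ^ s) ^ E * (B ^ s) ^ E * (δ ^ s) ^ E ≡⟨ cong (_* (δ ^ s) ^ E) (^-distrib-* (A ^ s) (B ^ s) E) ⟨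
    (A ^ s * B ^ s) ^ E * (δ ^ s) ^ E ≡⟨ ^-distrib-* (A ^ s * B ^ s) (δ ^ s) E ⟨
    (A ^ s * B ^ s * δ ^ s) ^ E ≡⟨ cong (λ v → (v * δ ^ s) ^ E) (^-distrib-* A B s) ⟨
    ((A * B) ^ s * δ ^ s) ^ E ≡⟨ cong (_^ E) (^-distrib-* (A * B) δ s) ⟨
    ((A * B * δ) ^ s) ^ E ≤⟨ ^-monoˡ-≤ E (^-monoˡ-≤ s p) ⟩
    (Q ^ s) ^ E ∎
    where
      open ≤-Reasoning
      t = r + z
      s = r + t
      E = i * j
      δ = i * t
      l1 : ∀ i j s → i * s * j ≡ s * (i * j)
      l1 = solve-∀
      l2 : ∀ i j s → j * s * i ≡ s * (i * j)
      l2 = solve-∀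
  -- Since 2t = s + z, the two AM-GM bounds multiply to (Q / δ)^(sE) (Q / (Pδ))^(zE) with
  -- `P = A * B`, and the second factor is at most 1 in this case. The existence of `z` is the
  -- condition s ≤ 2t, that is, density at least 1/2.
  ... | no ¬p = *-cancelʳ-pos (Q ^ (z * E)) (^-pos Q (z * E) Q>0) (*-cancelʳ-pos (P ^ (r * E)) (^-pos P (r * E) P>0) (begin
    Y * (δ ^ s) ^ E * Q ^ (z * E) * P ^ (r * E) ≤⟨ *-monoˡ-≤ (P ^ (r * E)) (*-monoʳ-≤ (Y * (δ ^ s) ^ E) (^-monoˡ-≤ (z * E) (<⇒≤ (≰⇒> ¬p)))) ⟩
    Y * (δ ^ s) ^ E * (P * δ) ^ (z * E) * P ^ (r * E) ≡⟨ cong₂ (λ u v → Y * u * v * P ^ (r * E)) (^-*-assoc δ s E) (^-distrib-* P δ (z * E)) ⟩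
    Y * δ ^ (s * E) * (P ^ (z * E) * δ ^ (z * E)) * P ^ (r * E) ≡⟨ l3 Y (δ ^ (s * E)) (P ^ (z * E)) (δ ^ (z * E)) (P ^ (r * E)) ⟩
    Y * ((P ^ (r * E) * P ^ (z * E)) * (δ ^ (s * E) * δ ^ (z * E))) ≡⟨ cong₂ (λ u v → Y * (u * v)) (≡.trans (≡.sym (^-distribˡ-+-* P (r * E) (z * E))) (cong (P ^_) (≡.sym (*-distribʳ-+ E r z)))) (≡.trans (≡.sym (^-distribˡ-+-* δ (s * E) (z * E))) (≡.trans (cong (δ ^_) (l4 r z E)) (^-distribˡ-+-* δ (t * E) (t * E)))) ⟩
    Y * (P ^ (t * E) * (δ ^ (t * E) * δ ^ (t * E))) ≤⟨ main ⟩
    Q ^ (t * E) * Q ^ (t * E) * P ^ (r * E) ≡⟨ cong (_* P ^ (r * E)) (≡.trans (≡.sym (^-distribˡ-+-* Q (t * E) (t * E))) (≡.trans (cong (Q ^_) (≡.sym (l4 r z E))) (^-distribˡ-+-* Q (s * E) (z * E)))) ⟩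
    Q ^ (s * E) * Q ^ (z * E) * P ^ (r * E) ≡⟨ cong (λ u → u * Q ^ (z * E) * P ^ (r * E)) (^-*-assoc Q s E) ⟨
    (Q ^ s) ^ E * Q ^ (z * E) * P ^ (r * E) ∎))
    where
      open ≤-Reasoning
      t = r + z
      s = r + t
      E = i * j
      δ = i * t
      P = A * B
      Y = ΠA ^ j * ΠB ^ i
      pos-fst : ∀ x y → 0 < x * y → 0 < x
      pos-fst (suc x) y _ = z<s
      P>0 : 0 < P
      P>0 = pos-fst P δ (≤-trans Q>0 (<⇒≤ (≰⇒> ¬p)))
      l3 : ∀ y a b c d → y * a * (b * c) * d ≡ y * ((d * b) * (a * c))
      l3 = solve-∀
      l4 : ∀ r z E → (r + (r + z)) * E + z * E ≡ (r + z) * E + (r + z) * E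
      l4 = solve-∀
      pw : ∀ x a b c → a * b ≡ c → (x ^ a) ^ b ≡ x ^ c
      pw x a b c e = ≡.trans (^-*-assoc x a b) (cong (x ^_) e)
      e1 : i * t * j ≡ t * E
      e1 = lem i t j
        where
          lem : ∀ i t j → i * t * j ≡ t * (i * j)
          lem = solve-∀
      e2 : j * t * i ≡ t * E
      e2 = lem i t j
        where
          lem : ∀ i t j → j * t * i ≡ t * (i * j)
          lem = solve-∀
      e3 : i * r * j ≡ r * E
      e3 = lem i r j
        where
          lem : ∀ i t j → i * t * j ≡ t * (i * j)
          lem = solve-∀
      e4 : j * r * i ≡ r * E
      e4 = lem i r j
        where
          lem : ∀ i t j → j * t * i ≡ t * (i * j)
          lem = solve-∀
      main : Y * (P ^ (t * E) * (δ ^ (t * E) * δ ^ (t * E))) ≤ Q ^ (t * E) * Q ^ (t * E) * P ^ (r * E)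
      main = begin
        -- The bound for the columns comes with `j * t`, which `i ≤ j` makes at least `δ`.
        Y * (P ^ (t * E) * (δ ^ (t * E) * δ ^ (t * E))) ≤⟨ *-monoʳ-≤ Y (*-monoʳ-≤ (P ^ (t * E)) (*-monoʳ-≤ (δ ^ (t * E)) (^-monoˡ-≤ (t * E) (*-monoˡ-≤ t i≤j)))) ⟩
        Y * (P ^ (t * E) * (δ ^ (t * E) * (j * t) ^ (t * E))) ≡⟨ cong (λ u → Y * (u * (δ ^ (t * E) * (j * t) ^ (t * E)))) (^-distrib-* A B (t * E)) ⟩
        Y * (A ^ (t * E) * B ^ (t * E) * (δ ^ (t * E) * (j * t) ^ (t * E))) ≡⟨ l5 (ΠA ^ j) (ΠB ^ i) (A ^ (t * E)) (B ^ (t * E)) (δ ^ (t * E)) ((j * t) ^ (t * E)) ⟩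
        ΠA ^ j * (B ^ (t * E) * δ ^ (t * E)) * (ΠB ^ i * (A ^ (t * E) * (j * t) ^ (t * E))) ≡⟨ cong₂ _*_ (left ΠA B (i * t) j e1) (left ΠB A (j * t) i e2) ⟩
        (ΠA * (B * (i * t)) ^ (i * t)) ^ j * (ΠB * (A * (j * t)) ^ (j * t)) ^ i ≤⟨ *-mono-≤ (^-monoˡ-≤ j a₂) (^-monoˡ-≤ i b₂) ⟩
        (Q ^ (i * t) * A ^ (i * r)) ^ j * (Q ^ (j * t) * B ^ (j * r)) ^ i ≡⟨ cong₂ _*_ (^-distrib-* (Q ^ (i * t)) (A ^ (i * r)) j) (^-distrib-* (Q ^ (j * t)) (B ^ (j * r)) i) ⟩
        (Q ^ (i * t)) ^ j * (A ^ (i * r)) ^ j * ((Q ^ (j * t)) ^ i * (B ^ (j * r)) ^ i) ≡⟨ cong₂ (λ u v → u * (A ^ (i * r)) ^ j * (v * (B ^ (j * r)) ^ i)) (pw Q (i * t) j _ e1) (pw Q (j * t) i _ e2) ⟩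
        Q ^ (t * E) * (A ^ (i * r)) ^ j * (Q ^ (t * E) * (B ^ (j * r)) ^ i) ≡⟨ cong₂ (λ u v → Q ^ (t * E) * u * (Q ^ (t * E) * v)) (pw A (i * r) j _ e3) (pw B (j * r) i _ e4) ⟩
        Q ^ (t * E) * A ^ (r * E) * (Q ^ (t * E) * B ^ (r * E)) ≡⟨ l6 (Q ^ (t * E)) (A ^ (r * E)) (Q ^ (t * E)) (B ^ (r * E)) ⟩
        Q ^ (t * E) * Q ^ (t * E) * (A ^ (r * E) * B ^ (r * E)) ≡⟨ cong (Q ^ (t * E) * Q ^ (t * E) *_) (^-distrib-* A B (r * E)) ⟨
        Q ^ (t * E) * Q ^ (t * E) * P ^ (r * E) ∎
        where
          l5 : ∀ a b c d e f → a * b * (c * d * (e * f)) ≡ a * (d * e) * (b * (c * f))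
          l5 = solve-∀
          l6 : ∀ a b c d → a * b * (c * d) ≡ a * c * (b * d)
          l6 = solve-∀
          left : ∀ Π B w j → w * j ≡ t * E → Π ^ j * (B ^ (t * E) * w ^ (t * E)) ≡ (Π * (B * w) ^ w) ^ j
          left Π B w j e = ≡.sym (≡.trans (^-distrib-* Π ((B * w) ^ w) j) (cong (Π ^ j *_) (≡.trans (pw (B * w) w j _ e) (^-distrib-* B w (t * E)))))

-- The entropy step on a grid of dense groups.

module EntropyStep where

  open Arithmetic
  open Pickers
  open MatchingCounts
  open Deletions
  open import Data.Nat
  open import Data.Nat.Properties
  open import Data.Nat.Tactic.RingSolver using (solve-∀)
  open import Data.Nat.ListAction using (sum; product)
  open import Data.Nat.ListAction.Properties using (sum-++)
  open import Data.List using (List; []; _∷_; _++_; length; concat; map)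
  open import Data.List.Properties using (length-++; map-++)
  open import Data.List.Relation.Unary.All as All using (All; []; _∷_)
  open import Data.List.Relation.Unary.All.Properties using (concat⁺)
  open import Data.List.Relation.Binary.Permutation.Propositional using (_↭_; refl; trans)
  open import Data.List.Relation.Binary.Permutation.Propositional.Properties using (++-comm; All-resp-↭)
  open import Data.Product using (_×_; _,_; proj₁; proj₂; ∃₂)
  open import Relation.Binary.PropositionalEquality as ≡ using (_≡_; cong; cong₂; subst)

  length-concat : {X : Set} → ∀ s (Xs : List (List X)) → All (λ g → length g ≡ s) Xs → length (concat Xs) ≡ length Xs * s
  length-concat s [] [] = ≡.refl
  length-concat s (g ∷ Xs) (e ∷ es) = ≡.trans (length-++ g) (cong₂ _+_ e (length-concat s Xs es))

  module Degrees {R C : Set} (a : R → C → ℕ) where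

    row-degree : List C → R → ℕ
    row-degree ws u = sum (map (a u) ws)

    column-degree : List R → C → ℕ
    column-degree us w = sum (map (λ u → a u w) us)

    row-degree-++ : ∀ ws ws' u → row-degree (ws ++ ws') u ≡ row-degree ws u + row-degree ws' u
    row-degree-++ ws ws' u = ≡.trans (cong sum (map-++ (a u) ws ws')) (sum-++ (map (a u) ws) _)

    column-degree-++ : ∀ us us' w → column-degree (us ++ us') w ≡ column-degree us w + column-degree us' w
    column-degree-++ us us' w = ≡.trans (cong sum (map-++ (λ u → a u w) us us')) (sum-++ (map (λ u → a u w) us) _)

    Dense : ℕ → List R → List C → Set
    Dense t X Y = All (λ u → t ≤ row-degree Y u) X × All (λ w → t ≤ column-degree X w) Y

    -- Density is required between every pair of groups. It therefore survives the deletion of any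
    -- groups at all, which matters because the entropy step gives no control over which groups are
    -- deleted.
    record Grid (s t : ℕ) (Xs : List (List R)) (Ys : List (List C)) : Set where
      constructor grid
      field
        row-sizes : All (λ X → length X ≡ s) Xs
        column-sizes : All (λ Y → length Y ≡ s) Ys
        dense : All (λ X → All (Dense t X) Ys) Xs

    open Grid public

    grid-↭ : ∀ {s t Xs Xs' Ys Ys'} → Xs ↭ Xs' → Ys ↭ Ys' → Grid s t Xs Ys → Grid s t Xs' Ys'
    grid-↭ p q (grid x y d) = grid (All-resp-↭ p x) (All-resp-↭ q y) (All-resp-↭ p (All.map (All-resp-↭ q) d))

    grid-tail-rows : ∀ {s t X Xs Ys} → Grid s t (X ∷ Xs) Ys → Grid s t Xs Ys
    grid-tail-rows (grid (_ ∷ x) y (_ ∷ d)) = grid x y d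

    grid-tail-columns : ∀ {s t Xs Y Ys} → Grid s t Xs (Y ∷ Ys) → Grid s t Xs Ys
    grid-tail-columns (grid x (_ ∷ y) d) = grid x y (All.map All.tail d)

    rows-dense : ∀ {t} X Ys → All (Dense t X) Ys → All (λ u → length Ys * t ≤ row-degree (concat Ys) u) X
    rows-dense X [] [] = All.universal (λ _ → z≤n) X
    rows-dense {t} X (Y ∷ Ys) (d ∷ ds) = All.zipWith (λ { {u} (p , q) → ≤-trans (+-mono-≤ p q) (≤-reflexive (≡.sym (row-degree-++ Y (concat Ys) u))) }) (proj₁ d , rows-dense X Ys ds)

    columns-dense : ∀ {t} Xs Y → All (λ X → Dense t X Y) Xs → All (λ w → length Xs * t ≤ column-degree (concat Xs) w) Y
    columns-dense [] Y [] = All.universal (λ _ → z≤n) Y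
    columns-dense (X ∷ Xs) Y (d ∷ ds) = All.zipWith (λ { {w} (p , q) → ≤-trans (+-mono-≤ p q) (≤-reflexive (≡.sym (column-degree-++ X (concat Xs) w))) }) (proj₂ d , columns-dense Xs Y ds)

    transpose-all : ∀ {t} Xs Ys → All (λ X → All (Dense t X) Ys) Xs → All (λ Y → All (λ X → Dense t X Y) Xs) Ys
    transpose-all Xs [] d = []
    transpose-all Xs (Y ∷ Ys) d = All.map All.head d ∷ transpose-all Xs Ys (All.map All.tail d)

    grid-row-degrees : ∀ {s t Xs Ys} → Grid s t Xs Ys → All (λ u → length Ys * t ≤ row-degree (concat Ys) u) (concat Xs)
    grid-row-degrees {Xs = Xs} {Ys} G = concat⁺ (All.map (λ {X} → rows-dense X Ys) (dense G))

    grid-column-degrees : ∀ {s t Xs Ys} → Grid s t Xs Ys → All (λ w → length Xs * t ≤ column-degree (concat Xs) w) (concat Ys)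
    grid-column-degrees {Xs = Xs} {Ys} G = concat⁺ (All.map (λ {Y} → columns-dense Xs Y) (transpose-all Xs Ys (dense G)))

  module Entropy {R C : Set} (a : R → C → ℕ) (a≤1 : ∀ u w → a u w ≤ 1) where
    open Matchings a
    open Degrees a

    -- For a neighbour `w` of `u`, `row-column-modular` moves the deletion of `w` to the count
    -- without `u`; the resulting terms add up to the expansion of `N (u ∷ us) ws` along `u`.
    row-mass : ∀ u us ws → N us ws * pick (λ w r → a u w * N (u ∷ us) r) ws ≤ N (u ∷ us) ws * N (u ∷ us) ws
    row-mass u us ws = begin
      N us ws * pick (λ w r → a u w * N (u ∷ us) r) ws ≡⟨ pick-scale (N us ws) _ ws ⟨
      pick (λ w r → N us ws * (a u w * N (u ∷ us) r)) ws ≤⟨ pick-mono ws term ⟩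
      pick (λ w r → N (u ∷ us) ws * (a u w * N us r)) ws ≡⟨ pick-scale (N (u ∷ us) ws) _ ws ⟩
      N (u ∷ us) ws * N (u ∷ us) ws ∎
      where
        open ≤-Reasoning
        lem : ∀ x y z → x * (y * z) ≡ y * (x * z)
        lem = solve-∀
        term : ∀ w r → ws ↭ w ∷ r → N us ws * (a u w * N (u ∷ us) r) ≤ N (u ∷ us) ws * (a u w * N us r)
        term w r p = begin
          N us ws * (a u w * N (u ∷ us) r) ≡⟨ lem (N us ws) (a u w) _ ⟩
          a u w * (N us ws * N (u ∷ us) r) ≡⟨ cong (λ z → a u w * (z * N (u ∷ us) r)) (N-cols us p) ⟩
          a u w * (N us (w ∷ r) * N (u ∷ us) r) ≤⟨ *-monoʳ-≤ (a u w) (row-column-modular u us w r) ⟩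
          a u w * (N (u ∷ us) (w ∷ r) * N us r) ≡⟨ cong (λ z → a u w * (z * N us r)) (N-cols (u ∷ us) p) ⟨
          a u w * (N (u ∷ us) ws * N us r) ≡⟨ lem (a u w) (N (u ∷ us) ws) _ ⟩
          N (u ∷ us) ws * (a u w * N us r) ∎

    -- A column may stay uncovered, so the expansion along `w` has the further term `N us ws`, which
    -- is dropped.
    column-mass : ∀ us w ws → N us ws * pick (λ u r → a u w * N r (w ∷ ws)) us ≤ N us (w ∷ ws) * N us (w ∷ ws)
    column-mass us w ws = begin
      N us ws * pick (λ u r → a u w * N r (w ∷ ws)) us ≡⟨ pick-scale (N us ws) _ us ⟨
      pick (λ u r → N us ws * (a u w * N r (w ∷ ws))) us ≤⟨ pick-mono us term ⟩
      pick (λ u r → N us (w ∷ ws) * (a u w * N r ws)) us ≡⟨ pick-scale (N us (w ∷ ws)) _ us ⟩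
      N us (w ∷ ws) * pick (λ u r → a u w * N r ws) us ≤⟨ *-monoʳ-≤ (N us (w ∷ ws)) (≤-trans (m≤n+m _ (N us ws)) (≤-reflexive (≡.sym (column-expansion us w ws)))) ⟩
      N us (w ∷ ws) * N us (w ∷ ws) ∎
      where
        open ≤-Reasoning
        lem : ∀ x y z → x * (y * z) ≡ y * (z * x)
        lem = solve-∀
        lem2 : ∀ x y z → x * (y * z) ≡ y * (x * z)
        lem2 = solve-∀
        term : ∀ u r → us ↭ u ∷ r → N us ws * (a u w * N r (w ∷ ws)) ≤ N us (w ∷ ws) * (a u w * N r ws)
        term u r p = begin
          N us ws * (a u w * N r (w ∷ ws)) ≡⟨ lem (N us ws) (a u w) _ ⟩
          a u w * (N r (w ∷ ws) * N us ws) ≡⟨ cong (λ z → a u w * (N r (w ∷ ws) * z)) (N-rows p ws) ⟩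
          a u w * (N r (w ∷ ws) * N (u ∷ r) ws) ≤⟨ *-monoʳ-≤ (a u w) (row-column-modular u r w ws) ⟩
          a u w * (N (u ∷ r) (w ∷ ws) * N r ws) ≡⟨ cong (λ z → a u w * (z * N r ws)) (N-rows p (w ∷ ws)) ⟨
          a u w * (N us (w ∷ ws) * N r ws) ≡⟨ lem2 (a u w) (N us (w ∷ ws)) _ ⟩
          N us (w ∷ ws) * (a u w * N r ws) ∎

    -- The extremal vertices `u*` and `w*` are those whose deletion leaves the most matchings. The
    -- product over the rows is estimated through the neighbours of `w*` and that over the columns
    -- through the neighbours of `u*`. The exponents `j` and `i` compensate for the different
    -- numbers of rows and columns.
    deletion-entropy : ∀ us ws i j r z → let t = r + z ; s = r + t in
      length us ≡ i * s → length ws ≡ j * s → 0 < i * s → i ≤ j → 0 < N us ws →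
      All (λ u → j * t ≤ row-degree ws u) us → All (λ w → i * t ≤ column-degree us w) ws →
      product (dels (λ l → N l ws) us) ^ j * product (dels (N us) ws) ^ i * ((i * t) ^ s) ^ (i * j) ≤ ((N us ws * N us ws) ^ s) ^ (i * j)
    deletion-entropy us ws i j r z lu lw is>0 i≤j N>0 du dw
      with dels-max (λ l → N l ws) us (subst (0 <_) (≡.sym lu) is>0)
         | dels-max (N us) ws (subst (0 <_) (≡.sym lw) (≤-trans is>0 (*-monoˡ-≤ (r + (r + z)) i≤j)))
    ... | u* , us' , pu , maxA | w* , ws' , pw , maxB =
      combine (product (dels (λ l → N l ws) us)) (product (dels (N us) ws)) A* B* Q i j r z i≤j (*-pos N>0 N>0)
        (subst (λ l → product (dels (λ l → N l ws) us) ≤ A* ^ l) (≡.trans (length-dels _ us) lu) (product-bound _ maxA))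
        (subst (λ l → product (dels (N us) ws) ≤ B* ^ l) (≡.trans (length-dels _ ws) lw) (product-bound _ maxB))
        (subst (λ x → x * (B* * (i * t)) ^ (i * t) ≤ Q ^ (i * t) * A* ^ (i * r)) (wd-product (λ u → a u w*) (λ l → N l ws) us)
          (half B* Q A* (i * t) (i * r) (weighted-dels (λ u → a u w*) (λ l → N l ws) us)
            (≡.trans (wd-length _ _ us) (≡.trans lu (split i)))
            (wd-bound _ _ A* us (λ u → a≤1 u w*) maxA)
            (≤-trans (All.head (All-resp-↭ pw dw)) (≤-reflexive (≡.sym (wd-weight (λ u → a u w*) (λ l → N l ws) us))))
            massB))
        (subst (λ x → x * (A* * (j * t)) ^ (j * t) ≤ Q ^ (j * t) * B* ^ (j * r)) (wd-product (a u*) (N us) ws)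
          (half A* Q B* (j * t) (j * r) (weighted-dels (a u*) (N us) ws)
            (≡.trans (wd-length _ _ ws) (≡.trans lw (split j)))
            (wd-bound _ _ B* ws (a≤1 u*) maxB)
            (≤-trans (All.head (All-resp-↭ pu du)) (≤-reflexive (≡.sym (wd-weight (a u*) (N us) ws))))
            massA))
      where
        t = r + z
        s = r + t
        A* = N us' ws
        B* = N us ws'
        Q = N us ws * N us ws
        split : ∀ i → i * s ≡ i * t + i * r
        split i = lem i r z
          where
            lem : ∀ i r z → i * (r + (r + z)) ≡ i * (r + z) + i * r
            lem = solve-∀
        massB : B* * sum (map (λ p → proj₁ p * proj₂ p) (weighted-dels (λ u → a u w*) (λ l → N l ws) us)) ≤ Q
        massB = begin
          B* * sum (map (λ p → proj₁ p * proj₂ p) (weighted-dels (λ u → a u w*) (λ l → N l ws) us)) ≡⟨ cong (B* *_) (wd-sum _ _ us) ⟩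
          B* * pick (λ u l → a u w* * N l ws) us ≡⟨ cong (B* *_) (pick-ext us (λ u l _ → cong (a u w* *_) (N-cols l pw))) ⟩
          B* * pick (λ u l → a u w* * N l (w* ∷ ws')) us ≤⟨ column-mass us w* ws' ⟩
          N us (w* ∷ ws') * N us (w* ∷ ws') ≡⟨ cong₂ _*_ (N-cols us pw) (N-cols us pw) ⟨
          Q ∎
          where open ≤-Reasoning
        massA : A* * sum (map (λ p → proj₁ p * proj₂ p) (weighted-dels (a u*) (N us) ws)) ≤ Q
        massA = begin
          A* * sum (map (λ p → proj₁ p * proj₂ p) (weighted-dels (a u*) (N us) ws)) ≡⟨ cong (A* *_) (wd-sum _ _ ws) ⟩
          A* * pick (λ w l → a u* w * N us l) ws ≡⟨ cong (A* *_) (pick-ext ws (λ w l _ → cong (a u* w *_) (N-rows pu l))) ⟩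
          A* * pick (λ w l → a u* w * N (u* ∷ us') l) ws ≤⟨ row-mass u* us' ws ⟩
          N (u* ∷ us') ws * N (u* ∷ us') ws ≡⟨ cong₂ _*_ (N-rows pu ws) (N-rows pu ws) ⟨
          Q ∎
          where open ≤-Reasoning

    module Rows (ws : List C) = GroupDeletion (λ l → N l ws) (λ p → N-rows p ws) (λ x y zs → rows-submodular x y zs ws)
      (λ x ys zs _ p → N-pos-tail x (ys ++ zs) ws p)
    module Columns (us : List R) = GroupDeletion (N us) (N-cols us) (cols-submodular us)
      (λ x ys zs p _ → ≤-trans p (≤-trans (N-mono-cols us zs ys) (≤-reflexive (N-cols us (++-comm zs ys)))))

    -- On each side the group is taken whose deletion leaves the fewest matchings, because its value
    -- lies below the geometric mean over the groups of that side. The exponent `i * j` is common to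
    -- the means over `i` row groups and `j` column groups.
    grid-step : ∀ {s t Xs Ys} → Grid s t Xs Ys → 0 < s → s ≤ 2 * t → t ≤ s → 0 < length Xs → length Xs ≤ length Ys → 0 < N (concat Xs) (concat Ys) →
      ∃₂ λ X Xs' → ∃₂ λ Y Ys' → Xs ↭ X ∷ Xs' × Ys ↭ Y ∷ Ys' ×
        N (concat Xs') (concat Ys) * N (concat Xs) (concat Ys') * (length Xs * t) ^ s ≤ N (concat Xs) (concat Ys) * N (concat Xs) (concat Ys)
    grid-step {s} {t} {Xs} {Ys} G s>0 s≤2t t≤s i>0 i≤j N>0
      with dels-min (λ Zs → N (concat Zs) (concat Ys)) Xs i>0 | dels-min (λ Zs → N (concat Xs) (concat Zs)) Ys (≤-trans i>0 i≤j)
    ... | X , Xs' , px , minX | Y , Ys' , py , minY = X , Xs' , Y , Ys' , px , py ,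
      ^-cancel-≤ (i * j) _ _ (*-pos i>0 (≤-trans i>0 i≤j)) (*-cancelʳ-pos (W ^ (s * (i * j))) (^-pos W (s * (i * j)) N>0) (*-cancelʳ-pos (W ^ (s * (i * j))) (^-pos W (s * (i * j)) N>0) main))
      where
        i = length Xs
        j = length Ys
        us = concat Xs
        ws = concat Ys
        W = N us ws
        L₁ = N (concat Xs') ws
        L₂ = N us (concat Ys')
        δ = i * t
        E = i * j
        PA = product (dels (λ l → N l ws) us)
        PB = product (dels (N us) ws)
        -- `r` bounds the non-neighbours of a vertex in a group, and `z` is the surplus 2t - s that
        -- `combine` uses.
        r = s ∸ t
        z = t ∸ r
        r≤t : r ≤ t
        r≤t = m≤n+o⇒m∸n≤o s t (≤-trans s≤2t (≤-reflexive (cong (t +_) (+-identityʳ t))))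
        et : r + z ≡ t
        et = m+[n∸m]≡n r≤t
        es : r + (r + z) ≡ s
        es = ≡.trans (cong (r +_) et) (m∸n+n≡m t≤s)
        entropy : PA ^ j * PB ^ i * (δ ^ s) ^ E ≤ ((W * W) ^ s) ^ E
        entropy = subst₂' (deletion-entropy us ws i j r z
          (≡.trans (length-concat s Xs (row-sizes G)) (cong (i *_) (≡.sym es)))
          (≡.trans (length-concat s Ys (column-sizes G)) (cong (j *_) (≡.sym es)))
          (*-pos i>0 (subst (0 <_) (≡.sym es) s>0)) i≤j N>0
          (subst (λ t → All (λ u → j * t ≤ row-degree ws u) us) (≡.sym et) (grid-row-degrees G))
          (subst (λ t → All (λ w → i * t ≤ column-degree us w) ws) (≡.sym et) (grid-column-degrees G)))
          where
            subst₂' : PA ^ j * PB ^ i * ((i * (r + z)) ^ (r + (r + z))) ^ E ≤ ((W * W) ^ (r + (r + z))) ^ E → PA ^ j * PB ^ i * (δ ^ s) ^ E ≤ ((W * W) ^ s) ^ E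
            subst₂' h rewrite es | et = h
        rowsD : L₁ ^ i * (W ^ s) ^ i ≤ W ^ i * PA
        rowsD = Rows.groups-deletion₀ ws s L₁ Xs (row-sizes G) N>0 minX
        colsD : L₂ ^ j * (W ^ s) ^ j ≤ W ^ j * PB
        colsD = Columns.groups-deletion₀ us s L₂ Ys (column-sizes G) N>0 minY
        open ≤-Reasoning
        up : ∀ L P i j → L ^ i * (W ^ s) ^ i ≤ W ^ i * P → L ^ (i * j) * W ^ (s * (i * j)) ≤ W ^ (i * j) * P ^ j
        up L P i j h = begin
          L ^ (i * j) * W ^ (s * (i * j)) ≡⟨ cong₂ _*_ (^-*-assoc L i j) (≡.trans (^-*-assoc (W ^ s) i j) (^-*-assoc W s (i * j))) ⟨
          (L ^ i) ^ j * ((W ^ s) ^ i) ^ j ≡⟨ ^-distrib-* (L ^ i) _ j ⟨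
          (L ^ i * (W ^ s) ^ i) ^ j ≤⟨ ^-monoˡ-≤ j h ⟩
          (W ^ i * P) ^ j ≡⟨ ^-distrib-* (W ^ i) P j ⟩
          (W ^ i) ^ j * P ^ j ≡⟨ cong (_* P ^ j) (^-*-assoc W i j) ⟩
          W ^ (i * j) * P ^ j ∎
        colsE : L₂ ^ E * W ^ (s * E) ≤ W ^ E * PB ^ i
        colsE = subst (λ e → L₂ ^ e * W ^ (s * e) ≤ W ^ e * PB ^ i) (*-comm j i) (up L₂ PB j i colsD)
        lem1 : ∀ a b c d e → a * b * c * d * e ≡ (a * d) * (b * e) * c
        lem1 = solve-∀
        lem2 : ∀ a b c d e → a * c * (b * d) * e ≡ a * b * (c * d * e)
        lem2 = solve-∀
        main : (L₁ * L₂ * δ ^ s) ^ E * W ^ (s * E) * W ^ (s * E) ≤ (W * W) ^ E * W ^ (s * E) * W ^ (s * E)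
        main = begin
          (L₁ * L₂ * δ ^ s) ^ E * W ^ (s * E) * W ^ (s * E) ≡⟨ cong (λ v → v * W ^ (s * E) * W ^ (s * E)) (≡.trans (^-distrib-* (L₁ * L₂) (δ ^ s) E) (cong (_* (δ ^ s) ^ E) (^-distrib-* L₁ L₂ E))) ⟩
          L₁ ^ E * L₂ ^ E * (δ ^ s) ^ E * W ^ (s * E) * W ^ (s * E) ≡⟨ lem1 (L₁ ^ E) (L₂ ^ E) ((δ ^ s) ^ E) (W ^ (s * E)) _ ⟩
          L₁ ^ E * W ^ (s * E) * (L₂ ^ E * W ^ (s * E)) * (δ ^ s) ^ E ≤⟨ *-monoˡ-≤ ((δ ^ s) ^ E) (*-mono-≤ (up L₁ PA i j rowsD) colsE) ⟩
          W ^ E * PA ^ j * (W ^ E * PB ^ i) * (δ ^ s) ^ E ≡⟨ lem2 (W ^ E) (W ^ E) (PA ^ j) (PB ^ i) _ ⟩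
          W ^ E * W ^ E * (PA ^ j * PB ^ i * (δ ^ s) ^ E) ≤⟨ *-monoʳ-≤ (W ^ E * W ^ E) entropy ⟩
          W ^ E * W ^ E * ((W * W) ^ s) ^ E ≡⟨ cong₂ _*_ (≡.sym (^-distrib-* W W E)) (≡.trans (^-*-assoc (W * W) s E) (^-distrib-* W W (s * E))) ⟩
          (W * W) ^ E * (W ^ (s * E) * W ^ (s * E)) ≡⟨ *-assoc ((W * W) ^ E) _ _ ⟨
          (W * W) ^ E * W ^ (s * E) * W ^ (s * E) ∎

-- A crude lower bound by switchings.

module SwitchingBound where

  open Arithmetic
  open Pickers
  open MatchingCounts
  open EntropyStep
  open import Data.Nat
  open import Data.Nat.Properties
  open import Data.Nat.Tactic.RingSolver using (solve-∀)
  open import Data.Nat.ListAction using (sum)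
  open import Data.List using ([]; _∷_; _++_; length; concat; map)
  open import Data.List.Properties using (length-++)
  open import Data.List.Relation.Unary.All as All using (All; []; _∷_)
  open import Data.List.Relation.Binary.Permutation.Propositional using (_↭_; refl; trans)
  open import Data.List.Relation.Binary.Permutation.Propositional.Properties using (All-resp-↭; map⁺)
  open import Data.Nat.ListAction.Properties using (sum-↭)
  open import Relation.Nullary using (yes; no)
  open import Relation.Binary.PropositionalEquality as ≡ using (_≡_; cong; cong₂)

  fall-suc : ∀ n j → fall n (suc j) ≡ fall n j * (n ∸ j)
  fall-suc n j = ≡.trans (cong (fall n) (+-comm 1 j)) (≡.trans (fall-+ n j 1) (cong (fall n j *_) (*-identityʳ (n ∸ j))))

  fall-mono : ∀ {n n'} j → n ≤ n' → fall n j ≤ fall n' j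
  fall-mono zero p = ≤-refl
  fall-mono (suc j) p = *-mono-≤ p (fall-mono j (∸-monoˡ-≤ 1 p))

  fall-full : ∀ n → fall n n ≡ n !
  fall-full zero = ≡.refl
  fall-full (suc n) = cong (suc n *_) (fall-full n)

  module Switching {R C : Set} (a : R → C → ℕ) (a≤1 : ∀ u w → a u w ≤ 1) where
    open Matchings a
    open Degrees a

    pick-weight : ∀ {X : Set} (c : X → ℕ) K xs → pick (λ x _ → c x * K) xs ≡ sum (map c xs) * K
    pick-weight c K [] = ≡.refl
    pick-weight c K (x ∷ xs) = ≡.trans (cong (c x * K +_) (pick-weight c K xs)) (≡.sym (*-distribʳ-+ K (c x) _))

    -- Double counting of matchings together with a column: each matching covers exactly `length us`
    -- columns.
    uncovered-columns : ∀ us ws → pick (λ w r → N us r) ws + length us * N us ws ≡ length ws * N us ws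
    uncovered-columns us ws = begin
      pick (λ w r → N us r) ws + length us * N us ws ≡⟨ cong (pick (λ w r → N us r) ws +_) covered ⟩
      pick (λ w r → N us r) ws + pick (λ w r → pick (λ u us' → a u w * N us' r) us) ws ≡⟨ pick-add _ _ ws ⟨
      pick (λ w r → N us r + pick (λ u us' → a u w * N us' r) us) ws ≡⟨ pick-ext ws (λ w r p → ≡.trans (≡.sym (column-expansion us w r)) (≡.sym (N-cols us p))) ⟩
      pick (λ _ _ → N us ws) ws ≡⟨ pick-const (N us ws) ws ⟩
      length ws * N us ws ∎
      where
        open ≡.≡-Reasoning
        covered : length us * N us ws ≡ pick (λ w r → pick (λ u us' → a u w * N us' r) us) ws
        covered = begin
          length us * N us ws ≡⟨ pick-const (N us ws) us ⟨
          pick (λ _ _ → N us ws) us ≡⟨ pick-ext us (λ u us' p → N-rows p ws) ⟩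
          pick (λ u us' → pick (λ w r → a u w * N us' r) ws) us ≡⟨ pick-swap _ us ws ⟩
          pick (λ w r → pick (λ u us' → a u w * N us' r) us) ws ∎

    -- A matching avoiding w is switched to one covering u by u v, u' w in place of u' v.
    switch : ∀ u us w r → (column-degree us w + row-degree r u + a u w) * N us r ≤ length us * N us r + N (u ∷ us) (w ∷ r)
    switch u us w r = begin
      (column-degree us w + row-degree r u + a u w) * g ≡⟨ lem (column-degree us w) (row-degree r u) (a u w) g ⟩
      column-degree us w * g + row-degree r u * g + a u w * g ≡⟨ cong₂ (λ x y → x + y + a u w * g) colsum rowsum ⟩
      Σce + (Σde + N (u ∷ us) r) + a u w * g ≡⟨ lem2 Σce Σde (N (u ∷ us) r) (a u w * g) ⟩
      (Σce + Σde) + (N (u ∷ us) r + a u w * g) ≤⟨ +-monoˡ-≤ (N (u ∷ us) r + a u w * g) incl ⟩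
      (length us * g + S) + (N (u ∷ us) r + a u w * g) ≡⟨ lem3 (length us * g) S (N (u ∷ us) r) (a u w * g) ⟩
      length us * g + (N (u ∷ us) r + (a u w * g + S)) ≡⟨ cong (length us * g +_) (column-expansion (u ∷ us) w r) ⟨
      length us * g + N (u ∷ us) (w ∷ r) ∎
      where
        open ≤-Reasoning
        g = N us r
        S = pick (λ u' us' → a u' w * N (u ∷ us') r) us
        Σce = pick (λ u' us' → pick (λ v r' → a u' w * (a u' v * N us' r')) r) us
        Σde = pick (λ u' us' → pick (λ v r' → a u v * (a u' v * N us' r')) r) us
        lem : ∀ x y z g → (x + y + z) * g ≡ x * g + y * g + z * g
        lem = solve-∀
        lem2 : ∀ x y z w → x + (y + z) + w ≡ x + y + (z + w)
        lem2 = solve-∀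
        lem3 : ∀ x y z w → x + y + (z + w) ≡ x + (z + (w + y))
        lem3 = solve-∀
        colsum : column-degree us w * g ≡ Σce
        colsum = ≡.trans (≡.sym (pick-weight (λ u' → a u' w) g us)) (pick-ext us (λ u' us' p →
          ≡.trans (cong (a u' w *_) (N-rows p r)) (≡.sym (pick-scale (a u' w) _ r))))
        rowsum : row-degree r u * g ≡ Σde + N (u ∷ us) r
        rowsum = ≡.sym (≡.trans (cong (_+ N (u ∷ us) r) (pick-swap _ us r)) (≡.trans (≡.sym (pick-add _ _ r)) (≡.trans (pick-ext r term) (pick-weight (a u) g r))))
          where
            term : ∀ v r' → r ↭ v ∷ r' → pick (λ u' us' → a u v * (a u' v * N us' r')) us + a u v * N us r' ≡ a u v * g
            term v r' p = ≡.trans (cong (_+ a u v * N us r') (pick-scale (a u v) _ us)) (≡.trans (≡.sym (*-distribˡ-+ (a u v) _ _))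
              (cong (a u v *_) (≡.trans (+-comm _ (N us r')) (≡.trans (≡.sym (column-expansion us v r')) (≡.sym (N-cols us p))))))
        incl : Σce + Σde ≤ length us * g + S
        incl = begin
          Σce + Σde ≡⟨ pick-add _ _ us ⟨
          pick (λ u' us' → pick (λ v r' → a u' w * (a u' v * N us' r')) r + pick (λ v r' → a u v * (a u' v * N us' r')) r) us ≤⟨ pick-mono us row ⟩
          pick (λ u' us' → g + a u' w * N (u ∷ us') r) us ≡⟨ pick-add _ _ us ⟩
          pick (λ _ _ → g) us + S ≡⟨ cong (_+ S) (pick-const g us) ⟩
          length us * g + S ∎
          where
            -- For indicators c + d ≤ 1 + c d. Multiplied by `e`, the product term may lose its
            -- factor e ≤ 1.
            bool : ∀ c d e k → c ≤ 1 → d ≤ 1 → e ≤ 1 → c * (e * k) + d * (e * k) ≤ e * k + c * (d * k)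
            bool zero zero e k _ _ _ = z≤n
            bool zero (suc zero) e k _ _ _ = ≤-reflexive (lemb (e * k))
              where
                lemb : ∀ x → 1 * x ≡ x + 0
                lemb = solve-∀
            bool (suc zero) zero e k _ _ _ = ≤-reflexive (lemb (e * k))
              where
                lemb : ∀ x → 1 * x + 0 ≡ x + 1 * 0
                lemb = solve-∀
            bool (suc zero) (suc zero) e k _ _ e≤1 = ≤-trans (≤-reflexive (lemb (e * k))) (+-monoʳ-≤ (e * k) (≤-trans (*-monoˡ-≤ k e≤1) (≤-reflexive (lemc k))))
              where
                lemb : ∀ x → 1 * x + 1 * x ≡ x + x
                lemb = solve-∀
                lemc : ∀ x → 1 * x ≡ 1 * (1 * x)
                lemc = solve-∀
            bool (suc (suc _)) _ _ _ (s≤s ()) _ _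
            bool zero (suc (suc _)) _ _ _ (s≤s ()) _
            bool (suc zero) (suc (suc _)) _ _ _ (s≤s ()) _
            row : ∀ u' us' → us ↭ u' ∷ us' → pick (λ v r' → a u' w * (a u' v * N us' r')) r + pick (λ v r' → a u v * (a u' v * N us' r')) r ≤ g + a u' w * N (u ∷ us') r
            row u' us' p = begin
              pick (λ v r' → a u' w * (a u' v * N us' r')) r + pick (λ v r' → a u v * (a u' v * N us' r')) r ≡⟨ pick-add _ _ r ⟨
              pick (λ v r' → a u' w * (a u' v * N us' r') + a u v * (a u' v * N us' r')) r ≤⟨ pick-mono r (λ v r' _ → bool (a u' w) (a u v) (a u' v) (N us' r') (a≤1 u' w) (a≤1 u v) (a≤1 u' v)) ⟩
              pick (λ v r' → a u' v * N us' r' + a u' w * (a u v * N us' r')) r ≡⟨ pick-add _ _ r ⟩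
              N (u' ∷ us') r + pick (λ v r' → a u' w * (a u v * N us' r')) r ≡⟨ cong₂ _+_ (≡.sym (N-rows p r)) (pick-scale (a u' w) _ r) ⟩
              g + a u' w * N (u ∷ us') r ∎

    row-degree-↭ : ∀ {ws ws'} u → ws ↭ ws' → row-degree ws u ≡ row-degree ws' u
    row-degree-↭ u p = sum-↭ (map⁺ (a u) p)

    -- Two degrees that exceed the number of rows by `D` leave `D` switchings for a matching and a
    -- column `w` it avoids. Summing over `w` uses that every matching avoids
    -- `length ws ∸ length us` columns.
    add-row : ∀ u us ws δa δb D → δb ≤ row-degree ws u → All (λ w → δa ≤ column-degree us w) ws → D + length us ≤ δa + δb →
      N us ws * ((length ws ∸ length us) * D) ≤ length ws * N (u ∷ us) ws
    add-row u us ws δa δb D row col d = begin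
      N us ws * ((n ∸ m) * D) ≤⟨ count ⟩
      D * pick (λ _ r → N us r) ws ≡⟨ pick-scale D _ ws ⟨
      pick (λ _ r → D * N us r) ws ≤⟨ pick-mono ws term ⟩
      pick (λ _ _ → N (u ∷ us) ws) ws ≡⟨ pick-const (N (u ∷ us) ws) ws ⟩
      n * N (u ∷ us) ws ∎
      where
        open ≤-Reasoning
        n = length ws
        m = length us
        lem : ∀ x y z → x * (y * z) ≡ z * (y * x)
        lem = solve-∀
        count : N us ws * ((n ∸ m) * D) ≤ D * pick (λ _ r → N us r) ws
        count = begin
          N us ws * ((n ∸ m) * D) ≡⟨ lem (N us ws) (n ∸ m) D ⟩
          D * ((n ∸ m) * N us ws) ≡⟨ cong (D *_) (*-distribʳ-∸ (N us ws) n m) ⟩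
          D * (n * N us ws ∸ m * N us ws) ≡⟨ cong (λ z → D * (z ∸ m * N us ws)) (uncovered-columns us ws) ⟨
          D * (pick (λ _ r → N us r) ws + m * N us ws ∸ m * N us ws) ≡⟨ cong (D *_) (m+n∸n≡m _ (m * N us ws)) ⟩
          D * pick (λ _ r → N us r) ws ∎
        term : ∀ w r → ws ↭ w ∷ r → D * N us r ≤ N (u ∷ us) ws
        term w r p = +-cancelˡ-≤ (m * N us r) _ _ (begin
          m * N us r + D * N us r ≡⟨ lem2 m D (N us r) ⟩
          (D + m) * N us r ≤⟨ *-monoˡ-≤ (N us r) (≤-trans d (+-mono-≤ (All.head (All-resp-↭ p col)) row)) ⟩
          (column-degree us w + row-degree ws u) * N us r ≡⟨ cong (_* N us r) (≡.trans (cong (column-degree us w +_) (≡.trans (row-degree-↭ u p) (+-comm (a u w) _))) (≡.sym (+-assoc (column-degree us w) _ _))) ⟩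
          (column-degree us w + row-degree r u + a u w) * N us r ≤⟨ switch u us w r ⟩
          m * N us r + N (u ∷ us) (w ∷ r) ≡⟨ cong (m * N us r +_) (N-cols (u ∷ us) p) ⟨
          m * N us r + N (u ∷ us) ws ∎)
          where
            lem2 : ∀ m D g → m * g + D * g ≡ (D + m) * g
            lem2 = solve-∀

    -- The falling factorial is what a complete bipartite graph would gain. Each new row loses at
    -- most a factor `K` against it, the ratio of all columns to the guaranteed switchings.
    add-rows : ∀ extra base ws δa δb D K → All (λ w → δa ≤ column-degree base w) ws → All (λ u → δb ≤ row-degree ws u) extra →
      D + (length extra + length base) ≤ δa + δb → 0 < D → length ws ≤ K * D →
      N base ws * fall (length ws ∸ length base) (length extra) ≤ K ^ length extra * N (extra ++ base) ws
    add-rows [] base ws δa δb D K _ _ _ _ _ = ≤-reflexive (≡.trans (*-identityʳ _) (≡.sym (*-identityˡ _)))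
    add-rows (u ∷ extra) base ws δa δb D K col (du ∷ dus) d D>0 nKD = *-cancelʳ-pos D D>0 (begin
      N base ws * fall (n ∸ b) (suc e) * D ≡⟨ cong (λ z → N base ws * z * D) (fall-suc (n ∸ b) e) ⟩
      N base ws * (fall (n ∸ b) e * (n ∸ b ∸ e)) * D ≡⟨ lem (N base ws) (fall (n ∸ b) e) (n ∸ b ∸ e) D ⟩
      N base ws * fall (n ∸ b) e * ((n ∸ b ∸ e) * D) ≤⟨ *-monoˡ-≤ ((n ∸ b ∸ e) * D) (add-rows extra base ws δa δb D K col dus (≤-trans (+-monoʳ-≤ D (n≤1+n _)) d) D>0 nKD) ⟩
      K ^ e * N (extra ++ base) ws * ((n ∸ b ∸ e) * D) ≡⟨ *-assoc (K ^ e) _ _ ⟩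
      K ^ e * (N (extra ++ base) ws * ((n ∸ b ∸ e) * D)) ≡⟨ cong (λ z → K ^ e * (N (extra ++ base) ws * (z * D))) (≡.trans (∸-+-assoc n b e) (cong (n ∸_) (≡.trans (+-comm b e) (≡.sym (length-++ extra))))) ⟩
      K ^ e * (N (extra ++ base) ws * ((n ∸ length (extra ++ base)) * D)) ≤⟨ *-monoʳ-≤ (K ^ e) (add-row u (extra ++ base) ws δa δb D du (All.map (λ {w} p → ≤-trans p (≤-trans (m≤n+m _ (column-degree extra w)) (≤-reflexive (≡.sym (column-degree-++ extra base w))))) col) (≤-trans (+-monoʳ-≤ D (≤-trans (≤-reflexive (length-++ extra)) (n≤1+n _))) d)) ⟩
      K ^ e * (n * N (u ∷ extra ++ base) ws) ≤⟨ *-monoʳ-≤ (K ^ e) (*-monoˡ-≤ (N (u ∷ extra ++ base) ws) nKD) ⟩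
      K ^ e * (K * D * N (u ∷ extra ++ base) ws) ≡⟨ lem2 (K ^ e) K D (N (u ∷ extra ++ base) ws) ⟩
      K * K ^ e * N (u ∷ extra ++ base) ws * D ∎)
      where
        open ≤-Reasoning
        n = length ws
        b = length base
        e = length extra
        lem : ∀ x y z w → x * (y * z) * w ≡ x * y * (z * w)
        lem = solve-∀
        lem2 : ∀ x y z w → x * (y * z * w) ≡ y * x * w * z
        lem2 = solve-∀

    -- All rows are added by switching, one group at a time. The constant is `M` because `j * g`
    -- switchings are available for j s = M (j g) columns.
    grid-crude : ∀ {s t} M g Xs Ys → Grid s t Xs Ys → s ≡ M * g → s + 2 * g ≤ 2 * t → 2 ≤ M → 0 < g → M ≤ length Ys → length Xs ≤ length Ys →
      fall (length Ys * s) (length Xs * s) ≤ M ^ (length Xs * s) * N (concat Xs) (concat Ys)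
    grid-crude M g [] Ys _ _ _ _ _ _ _ = ≤-refl
    grid-crude {s} {t} M g (X ∷ Xs) Ys G@(grid (ex ∷ exs) ey _) es 2t M≥2 g>0 Mj i<j = begin
      fall (j * s) (s + i * s) ≡⟨ cong (fall (j * s)) (+-comm s (i * s)) ⟩
      fall (j * s) (i * s + s) ≡⟨ fall-+ (j * s) (i * s) s ⟩
      fall (j * s) (i * s) * fall (j * s ∸ i * s) s ≤⟨ *-monoˡ-≤ (fall (j * s ∸ i * s) s) (grid-crude M g Xs Ys (grid-tail-rows G) es 2t M≥2 g>0 Mj (≤-trans (n≤1+n i) i<j)) ⟩
      M ^ (i * s) * N (concat Xs) ws * fall (j * s ∸ i * s) s ≡⟨ *-assoc (M ^ (i * s)) _ _ ⟩
      M ^ (i * s) * (N (concat Xs) ws * fall (j * s ∸ i * s) s) ≡⟨ cong₂ (λ x y → M ^ (i * s) * (N (concat Xs) ws * fall x y)) (cong₂ _∸_ (≡.sym lw) (≡.sym lb)) (≡.sym ex) ⟩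
      M ^ (i * s) * (N (concat Xs) ws * fall (length ws ∸ length (concat Xs)) (length X)) ≤⟨ *-monoʳ-≤ (M ^ (i * s)) (add-rows X (concat Xs) ws (i * t) (j * t) (j * g) M (grid-column-degrees (grid-tail-rows G)) (rows-dense X Ys (All.head (dense G))) D≤ (*-pos (≤-trans z<s i<j) g>0) n≤) ⟩
      M ^ (i * s) * (M ^ length X * N (X ++ concat Xs) ws) ≡⟨ cong (λ z → M ^ (i * s) * (M ^ z * N (X ++ concat Xs) ws)) ex ⟩
      M ^ (i * s) * (M ^ s * N (X ++ concat Xs) ws) ≡⟨ lem (M ^ (i * s)) (M ^ s) _ ⟩
      M ^ s * M ^ (i * s) * N (X ++ concat Xs) ws ≡⟨ cong (_* N (X ++ concat Xs) ws) (^-distribˡ-+-* M s (i * s)) ⟨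
      M ^ (s + i * s) * N (X ++ concat Xs) ws ∎
      where
        open ≤-Reasoning
        i = length Xs
        j = length Ys
        ws = concat Ys
        lem : ∀ a b c → a * (b * c) ≡ b * a * c
        lem = solve-∀
        lw : length ws ≡ j * s
        lw = length-concat s Ys ey
        lb : length (concat Xs) ≡ i * s
        lb = length-concat s Xs exs
        n≤ : length ws ≤ M * (j * g)
        n≤ = ≤-reflexive (≡.trans lw (≡.trans (cong (j *_) es) (l j M g)))
          where
            l : ∀ j M g → j * (M * g) ≡ M * (j * g)
            l = solve-∀
        -- The room needed for one more row group. It is free if `j` exceeds `i` by two or more. For
        -- j = i + 1 the surplus of `g` per group must supply it, and does because M ≤ j gives s = M
        -- g ≤ (i + 1) g ≤ 2 i g.
        arith : i * s + 2 * s ≤ j * s + 2 * (i * g)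
        arith with suc (suc i) ≤? j
        ... | yes p = ≤-trans (≤-trans (≤-reflexive (l i s)) (*-monoˡ-≤ s p)) (m≤m+n _ _)
          where
            l : ∀ i s → i * s + 2 * s ≡ suc (suc i) * s
            l = solve-∀
        ... | no ¬p = begin
          i * s + 2 * s ≡⟨ l i s ⟩
          suc i * s + s ≤⟨ +-mono-≤ (*-monoˡ-≤ s i<j) s≤ ⟩
          j * s + 2 * (i * g) ∎
          where
            l : ∀ i s → i * s + 2 * s ≡ suc i * s + s
            l = solve-∀
            j≤si : M ≤ suc i
            j≤si = ≤-trans Mj (s≤s⁻¹ (≰⇒> ¬p))
            l2 : ∀ i g → suc i * g + i * g ≡ 2 * (i * g) + g
            l2 = solve-∀
            s≤ : s ≤ 2 * (i * g)
            s≤ = begin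
              s ≡⟨ es ⟩
              M * g ≤⟨ *-monoˡ-≤ g j≤si ⟩
              g + i * g ≤⟨ +-monoˡ-≤ (i * g) (≤-trans (≤-reflexive (≡.sym (*-identityˡ g))) (*-monoˡ-≤ g (s≤s⁻¹ (≤-trans M≥2 j≤si)))) ⟩
              i * g + i * g ≡⟨ cong (i * g +_) (+-identityʳ (i * g)) ⟨
              2 * (i * g) ∎
        D≤ : j * g + (length X + length (concat Xs)) ≤ i * t + j * t
        D≤ = *-cancelˡ-≤ 2 (begin
          2 * (j * g + (length X + length (concat Xs))) ≡⟨ cong₂ (λ x y → 2 * (j * g + (x + y))) ex lb ⟩
          2 * (j * g + (s + i * s)) ≡⟨ l1 i j g s ⟩
          (i * s + 2 * s) + (i * s + 2 * (j * g)) ≤⟨ +-monoˡ-≤ (i * s + 2 * (j * g)) arith ⟩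
          (j * s + 2 * (i * g)) + (i * s + 2 * (j * g)) ≡⟨ l2 i j g s ⟩
          (i + j) * (s + 2 * g) ≤⟨ *-monoʳ-≤ (i + j) 2t ⟩
          (i + j) * (2 * t) ≡⟨ l3 i j t ⟩
          2 * (i * t + j * t) ∎)
          where
            l1 : ∀ i j g s → 2 * (j * g + (s + i * s)) ≡ (i * s + 2 * s) + (i * s + 2 * (j * g))
            l1 = solve-∀
            l2 : ∀ i j g s → (j * s + 2 * (i * g)) + (i * s + 2 * (j * g)) ≡ (i + j) * (s + 2 * g)
            l2 = solve-∀
            l3 : ∀ i j t → (i + j) * (2 * t) ≡ 2 * (i * t + j * t)
            l3 = solve-∀

-- The walk on the numbers of remaining groups.

module GridWalk where

  open Arithmetic
  open Pickers
  open MatchingCounts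
  open EntropyStep
  open SwitchingBound
  open import Data.Nat
  open import Data.Nat.Properties
  open import Data.Nat.Tactic.RingSolver using (solve-∀)
  open import Data.List using (_∷_; length; concat)
  open import Data.List.Relation.Binary.Permutation.Propositional.Properties using (↭-length)
  open import Data.Product using (_×_; _,_; ∃₂)
  open import Data.List.Relation.Binary.Permutation.Propositional using (_↭_; refl)
  open import Relation.Nullary using (yes; no)
  open import Relation.Binary.PropositionalEquality as ≡ using (_≡_; cong; cong₂; subst)

  -- (1 + 1/n)^(n+1) decreases from its value 4 at n = 1
  suc-power-bound : ∀ n → suc (suc n) ^ suc (suc n) ≤ 4 * suc n ^ suc (suc n)
  suc-power-bound zero = ≤-refl
  suc-power-bound (suc n) = *-cancelʳ-pos (m ^ suc m) (^-pos m (suc m) z<s) (begin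
    suc (suc m) ^ suc (suc m) * m ^ suc m ≡⟨ cong (suc (suc m) ^ suc (suc m) *_) (*-identityʳ (m ^ suc m)) ⟨
    suc (suc m) ^ suc (suc m) * (m ^ suc m * 1) ≤⟨ am-gm-step (suc m) m 1 ⟩
    suc m ^ suc m * (m + 1) ^ suc (suc m) ≡⟨ cong (λ z → suc m ^ suc m * z ^ suc (suc m)) (+-comm m 1) ⟩
    suc m ^ suc m * suc m ^ suc (suc m) ≤⟨ *-monoˡ-≤ (suc m ^ suc (suc m)) (suc-power-bound n) ⟩
    4 * m ^ suc m * suc m ^ suc (suc m) ≡⟨ lem (m ^ suc m) (suc m ^ suc (suc m)) ⟩
    4 * suc m ^ suc (suc m) * m ^ suc m ∎)
    where
      open ≤-Reasoning
      m = suc n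
      lem : ∀ a b → 4 * a * b ≡ 4 * b * a
      lem = solve-∀

  n^n≤4^n*n! : ∀ n → n ^ n ≤ 4 ^ n * n !
  n^n≤4^n*n! zero = ≤-refl
  n^n≤4^n*n! (suc zero) = m≤m+n 1 3
  n^n≤4^n*n! (suc n@(suc n')) = begin
    suc n ^ suc n ≤⟨ suc-power-bound n' ⟩
    4 * (n * n ^ n) ≤⟨ *-monoʳ-≤ 4 (*-mono-≤ (n≤1+n n) (n^n≤4^n*n! n)) ⟩
    4 * (suc n * (4 ^ n * n !)) ≡⟨ lem (suc n) (4 ^ n) (n !) ⟩
    4 * 4 ^ n * (suc n * n !) ∎
    where
      open ≤-Reasoning
      lem : ∀ a b c → 4 * (a * (b * c)) ≡ 4 * b * (a * c)
      lem = solve-∀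

  n!≤n^n : ∀ n → n ! ≤ n ^ n
  n!≤n^n zero = ≤-refl
  n!≤n^n (suc n) = *-monoʳ-≤ (suc n) (≤-trans (n!≤n^n n) (^-monoˡ-≤ n (n≤1+n n)))

  -- Turns the target of the walk, with `s` for `t`, into a genuine factorial. The exponential
  -- factor is of the same kind as the loss of the crude bound.
  block-factorial : ∀ i s → (s ^ i * i !) ^ s ≤ 4 ^ (i * s) * (i * s) !
  block-factorial i s = begin
    (s ^ i * i !) ^ s ≤⟨ ^-monoˡ-≤ s (*-monoʳ-≤ (s ^ i) (n!≤n^n i)) ⟩
    (s ^ i * i ^ i) ^ s ≡⟨ cong (_^ s) (^-distrib-* s i i) ⟨
    ((s * i) ^ i) ^ s ≡⟨ ≡.trans (^-*-assoc (s * i) i s) (cong (_^ (i * s)) (*-comm s i)) ⟩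
    (i * s) ^ (i * s) ≤⟨ n^n≤4^n*n! (i * s) ⟩
    4 ^ (i * s) * (i * s) ! ∎
    where open ≤-Reasoning

  !-pos : ∀ n → 0 < n !
  !-pos zero = z<s
  !-pos (suc n) = *-pos {suc n} z<s (!-pos n)

  2hx≤h²+x² : ∀ h x → 2 * h * x ≤ h * h + x * x
  2hx≤h²+x² zero x = z≤n
  2hx≤h²+x² (suc h) zero = ≤-trans (≤-reflexive (*-zeroʳ (2 * suc h))) z≤n
  2hx≤h²+x² (suc h) (suc x) = ≤-trans (≤-reflexive (l1 h x)) (≤-trans (+-monoˡ-≤ (2 + 2 * h + 2 * x) (2hx≤h²+x² h x)) (≤-reflexive (l2 h x)))
    where
      l1 : ∀ a b → 2 * suc a * suc b ≡ 2 * a * b + (2 + 2 * a + 2 * b)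
      l1 = solve-∀
      l2 : ∀ a b → a * a + b * b + (2 + 2 * a + 2 * b) ≡ suc a * suc a + suc b * suc b
      l2 = solve-∀

  -- Superharmonicity in multiplicative form: squaring allows the bounds at the two neighbours to be
  -- multiplied. The exponents of 2 on the two sides are harmonic separately; only their difference
  -- is a potential, and keeping them apart avoids a subtraction.
  walk-step : ∀ T' T D W W₁ W₂ Λ e e₁ e₂ l l₁ l₂ → T ≡ T' * D → e + e ≡ e₁ + e₂ → l₁ + l₂ ≡ l + l →
    T' ^ Λ * 2 ^ e₁ ≤ W₁ ^ Λ * 2 ^ l₁ → T ^ Λ * 2 ^ e₂ ≤ W₂ ^ Λ * 2 ^ l₂ → W₁ * W₂ * D ≤ W * W →
    T ^ Λ * 2 ^ e ≤ W ^ Λ * 2 ^ l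
  walk-step T' T D W W₁ W₂ Λ e e₁ e₂ l l₁ l₂ T≡ e≡ l≡ ih₁ ih₂ step = ^-cancel-≤ 2 _ _ z<s (begin
    (T ^ Λ * 2 ^ e) ^ 2 ≡⟨ square (T ^ Λ * 2 ^ e) ⟩
    T ^ Λ * 2 ^ e * (T ^ Λ * 2 ^ e) ≡⟨ cong (λ u → u * 2 ^ e * (T ^ Λ * 2 ^ e)) (≡.trans (cong (_^ Λ) T≡) (^-distrib-* T' D Λ)) ⟩
    T' ^ Λ * D ^ Λ * 2 ^ e * (T ^ Λ * 2 ^ e) ≡⟨ lem1 (T' ^ Λ) (D ^ Λ) (2 ^ e) (T ^ Λ) ⟩
    T' ^ Λ * T ^ Λ * D ^ Λ * (2 ^ e * 2 ^ e) ≡⟨ cong (T' ^ Λ * T ^ Λ * D ^ Λ *_) (pow2 e e e₁ e₂ e≡) ⟩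
    T' ^ Λ * T ^ Λ * D ^ Λ * (2 ^ e₁ * 2 ^ e₂) ≡⟨ lem2 (T' ^ Λ) (T ^ Λ) (D ^ Λ) (2 ^ e₁) (2 ^ e₂) ⟩
    T' ^ Λ * 2 ^ e₁ * (T ^ Λ * 2 ^ e₂) * D ^ Λ ≤⟨ *-monoˡ-≤ (D ^ Λ) (*-mono-≤ ih₁ ih₂) ⟩
    W₁ ^ Λ * 2 ^ l₁ * (W₂ ^ Λ * 2 ^ l₂) * D ^ Λ ≡⟨ lem2 (W₁ ^ Λ) (W₂ ^ Λ) (D ^ Λ) (2 ^ l₁) (2 ^ l₂) ⟨
    W₁ ^ Λ * W₂ ^ Λ * D ^ Λ * (2 ^ l₁ * 2 ^ l₂) ≡⟨ cong₂ _*_ (≡.trans (cong (_* D ^ Λ) (≡.sym (^-distrib-* W₁ W₂ Λ))) (≡.sym (^-distrib-* (W₁ * W₂) D Λ))) (pow2 l₁ l₂ l l l≡) ⟩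
    (W₁ * W₂ * D) ^ Λ * (2 ^ l * 2 ^ l) ≤⟨ *-monoˡ-≤ (2 ^ l * 2 ^ l) (^-monoˡ-≤ Λ step) ⟩
    (W * W) ^ Λ * (2 ^ l * 2 ^ l) ≡⟨ cong (_* (2 ^ l * 2 ^ l)) (^-distrib-* W W Λ) ⟩
    W ^ Λ * W ^ Λ * (2 ^ l * 2 ^ l) ≡⟨ lem3 (W ^ Λ) (2 ^ l) ⟩
    W ^ Λ * 2 ^ l * (W ^ Λ * 2 ^ l) ≡⟨ square (W ^ Λ * 2 ^ l) ⟨
    (W ^ Λ * 2 ^ l) ^ 2 ∎)
    where
      open ≤-Reasoning
      square : ∀ y → y ^ 2 ≡ y * y
      square y = cong (y *_) (*-identityʳ y)
      pow2 : ∀ p q p' q' → p + q ≡ p' + q' → 2 ^ p * 2 ^ q ≡ 2 ^ p' * 2 ^ q'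
      pow2 p q p' q' e = ≡.trans (≡.sym (^-distribˡ-+-* 2 p q)) (≡.trans (cong (2 ^_) e) (^-distribˡ-+-* 2 p' q'))
      lem1 : ∀ a b c d → a * b * c * (d * c) ≡ a * d * b * (c * c)
      lem1 = solve-∀
      lem2 : ∀ a b d p q → a * b * d * (p * q) ≡ a * p * (b * q) * d
      lem2 = solve-∀
      lem3 : ∀ a b → a * a * (b * b) ≡ a * b * (a * b)
      lem3 = solve-∀

  module Walk {R C : Set} (a : R → C → ℕ) (a≤1 : ∀ u w → a u w ≤ 1)
    (s t M g : ℕ) (s≡Mg : s ≡ M * g) (2t≥ : s + 2 * g ≤ 2 * t) (t≤s : t ≤ s) (2≤M : 2 ≤ M) (g>0 : 0 < g)
    (K h Λ c : ℕ) (4M≤ : 4 * M ≤ 2 ^ c) (h²≥ : c * Λ * K ≤ h * h) where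
    open Matchings a
    open Degrees a
    open Entropy a a≤1
    open Switching a a≤1

    target : ℕ → ℕ
    target i = (t ^ i * i !) ^ s

    -- With j = i + x, `loss i x` minus `2 * h * x` is (x - h)² + i + j plus the constant
    -- `c * M * Λ`, which pays for stopping the walk when few row groups remain.
    loss : ℕ → ℕ → ℕ
    loss i x = x * x + i + (i + x) + (h * h + c * M * Λ)

    crude : ∀ {Xs Ys} → Grid s t Xs Ys → M ≤ length Ys → length Xs ≤ length Ys →
      target (length Xs) ≤ (2 ^ c) ^ (length Xs * s) * N (concat Xs) (concat Ys)
    crude {Xs} {Ys} G Mj ij = begin
      (t ^ i * i !) ^ s ≤⟨ ^-monoˡ-≤ s (*-monoˡ-≤ (i !) (^-monoˡ-≤ i t≤s)) ⟩
      (s ^ i * i !) ^ s ≤⟨ block-factorial i s ⟩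
      4 ^ (i * s) * (i * s) ! ≡⟨ cong (4 ^ (i * s) *_) (fall-full (i * s)) ⟨
      4 ^ (i * s) * fall (i * s) (i * s) ≤⟨ *-monoʳ-≤ (4 ^ (i * s)) (fall-mono (i * s) (*-monoˡ-≤ s ij)) ⟩
      4 ^ (i * s) * fall (length Ys * s) (i * s) ≤⟨ *-monoʳ-≤ (4 ^ (i * s)) (grid-crude M g Xs Ys G s≡Mg 2t≥ 2≤M g>0 Mj ij) ⟩
      4 ^ (i * s) * (M ^ (i * s) * W) ≡⟨ *-assoc (4 ^ (i * s)) _ W ⟨
      4 ^ (i * s) * M ^ (i * s) * W ≡⟨ cong (_* W) (^-distrib-* 4 M (i * s)) ⟨
      (4 * M) ^ (i * s) * W ≤⟨ *-monoˡ-≤ W (^-monoˡ-≤ (i * s) 4M≤) ⟩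
      (2 ^ c) ^ (i * s) * W ∎
      where
        open ≤-Reasoning
        i = length Xs
        W = N (concat Xs) (concat Ys)

    positive : ∀ {Xs Ys} → Grid s t Xs Ys → M ≤ length Ys → length Xs ≤ length Ys → 0 < N (concat Xs) (concat Ys)
    positive {Xs} {Ys} G Mj ij = pos {M ^ (length Xs * s)} (≤-trans (≤-trans (!-pos (length Xs * s)) (≤-reflexive (≡.sym (fall-full (length Xs * s)))))
      (≤-trans (fall-mono (length Xs * s) (*-monoˡ-≤ s ij)) (grid-crude M g Xs Ys G s≡Mg 2t≥ 2≤M g>0 Mj ij)))
      where
        pos : ∀ {x y} → 0 < x * y → 0 < y
        pos {x} {zero} p = ≤-trans p (≤-reflexive (*-zeroʳ x))
        pos {x} {suc y} p = z<s

    -- Where the walk stops, the crude bound loses `c` bits for each of the `i * s` rows, and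
    -- raising to the power `Λ` multiplies this by `Λ`. The potential at the stopping point has to
    -- cover it.
    crude-suffices : ∀ {Xs Ys} i x → Grid s t Xs Ys → length Xs ≡ i → length Ys ≡ i + x → M ≤ i + x →
      2 * h * x + c * i * Λ ≤ loss i x →
      target i ^ Λ * 2 ^ (s * (2 * h * x)) ≤ N (concat Xs) (concat Ys) ^ Λ * 2 ^ (s * loss i x)
    crude-suffices {Xs} {Ys} i x G ≡.refl ly Mj e = begin
      target i ^ Λ * 2 ^ (s * (2 * h * x)) ≤⟨ *-monoˡ-≤ (2 ^ (s * (2 * h * x))) (^-monoˡ-≤ Λ (crude G (≤-trans Mj (≤-reflexive (≡.sym ly))) (≤-trans (m≤m+n i x) (≤-reflexive (≡.sym ly))))) ⟩
      ((2 ^ c) ^ (i * s) * W) ^ Λ * 2 ^ (s * (2 * h * x)) ≡⟨ cong (_* 2 ^ (s * (2 * h * x))) (^-distrib-* ((2 ^ c) ^ (i * s)) W Λ) ⟩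
      ((2 ^ c) ^ (i * s)) ^ Λ * W ^ Λ * 2 ^ (s * (2 * h * x)) ≡⟨ cong (λ z → z * W ^ Λ * 2 ^ (s * (2 * h * x))) (≡.trans (cong (_^ Λ) (^-*-assoc 2 c (i * s))) (^-*-assoc 2 (c * (i * s)) Λ)) ⟩
      2 ^ (c * (i * s) * Λ) * W ^ Λ * 2 ^ (s * (2 * h * x)) ≡⟨ lem (2 ^ (c * (i * s) * Λ)) (W ^ Λ) _ ⟩
      W ^ Λ * (2 ^ (s * (2 * h * x)) * 2 ^ (c * (i * s) * Λ)) ≡⟨ cong (W ^ Λ *_) (^-distribˡ-+-* 2 (s * (2 * h * x)) (c * (i * s) * Λ)) ⟨
      W ^ Λ * 2 ^ (s * (2 * h * x) + c * (i * s) * Λ) ≤⟨ *-monoʳ-≤ (W ^ Λ) (^-monoʳ-≤ 2 (≤-trans (≤-reflexive (lem2 s (2 * h * x) c i Λ)) (*-monoʳ-≤ s e))) ⟩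
      W ^ Λ * 2 ^ (s * loss i x) ∎
      where
        open ≤-Reasoning
        W = N (concat Xs) (concat Ys)
        lem : ∀ a b c → a * b * c ≡ b * (c * a)
        lem = solve-∀
        lem2 : ∀ s y c i L → s * y + c * (i * s) * L ≡ s * (y + c * i * L)
        lem2 = solve-∀

    -- x² + i + j and x = j - i are harmonic for the walk that lowers i or j by one.
    walk : ∀ n i x Xs Ys → i + (i + x) ≤ n → Grid s t Xs Ys → length Xs ≡ i → length Ys ≡ i + x → M ≤ i + x → i + x ≤ K →
      target i ^ Λ * 2 ^ (s * (2 * h * x)) ≤ N (concat Xs) (concat Ys) ^ Λ * 2 ^ (s * loss i x)
    -- On the diagonal the term h² of the potential is left over, and it pays for the crude bound on
    -- as many as `K` groups.
    walk n i zero Xs Ys _ G lx ly Mj jK = crude-suffices i 0 G lx ly Mj (begin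
      2 * h * 0 + c * i * Λ ≡⟨ cong (_+ c * i * Λ) (*-zeroʳ (2 * h)) ⟩
      c * i * Λ ≡⟨ lem c i Λ ⟩
      c * Λ * i ≤⟨ *-monoʳ-≤ (c * Λ) (≤-trans (m≤m+n i 0) jK) ⟩
      c * Λ * K ≤⟨ h²≥ ⟩
      h * h ≤⟨ m≤m+n (h * h) _ ⟩
      h * h + c * M * Λ ≤⟨ m≤n+m _ (0 + i + (i + 0)) ⟩
      loss i 0 ∎)
      where
        open ≤-Reasoning
        lem : ∀ c i L → c * i * L ≡ c * L * i
        lem = solve-∀
    -- For i ≤ M the constant `c * M * Λ` pays for the crude bound. Stopping here also keeps M ≤ j,
    -- which the crude bound requires: a column group is deleted only when M < i.
    walk n i (suc x') Xs Ys b G lx ly Mj jK with i ≤? M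
    ... | yes i≤M = crude-suffices i x G lx ly Mj (begin
      2 * h * x + c * i * Λ ≤⟨ +-mono-≤ (2hx≤h²+x² h x) (*-monoˡ-≤ Λ (*-monoʳ-≤ c i≤M)) ⟩
      h * h + x * x + c * M * Λ ≡⟨ lem (h * h) (x * x) (c * M * Λ) ⟩
      x * x + (h * h + c * M * Λ) ≤⟨ +-monoˡ-≤ (h * h + c * M * Λ) (≤-trans (m≤m+n (x * x) i) (m≤m+n (x * x + i) (i + x))) ⟩
      loss i x ∎)
      where
        open ≤-Reasoning
        x = suc x'
        lem : ∀ a b c → a + b + c ≡ b + (a + c)
        lem = solve-∀
    walk zero zero (suc x') Xs Ys () G lx ly Mj jK | no i≰M
    walk n zero (suc x') Xs Ys b G lx ly Mj jK | no i≰M with i≰M z≤n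
    ... | ()
    walk (suc n) i@(suc i') x@(suc x') Xs Ys b G lx ly Mj jK | no i≰M = finish (grid-step G (subst (0 <_) (≡.sym s≡Mg) (*-pos (≤-trans z<s 2≤M) g>0))
        (≤-trans (m≤m+n s (2 * g)) 2t≥) t≤s (subst (0 <_) (≡.sym lx) z<s) i≤j (positive G (≤-trans Mj (≤-reflexive (≡.sym ly))) i≤j))
      where
        W = N (concat Xs) (concat Ys)
        i≤j : length Xs ≤ length Ys
        i≤j = ≤-trans (≤-reflexive lx) (≤-trans (m≤m+n i x) (≤-reflexive (≡.sym ly)))
        target-suc : target i ≡ target i' * (i * t) ^ s
        target-suc = ≡.trans (cong (_^ s) (l t (t ^ i') i (i' !))) (^-distrib-* (t ^ i' * i' !) (i * t) s)
          where
            l : ∀ t p i f → t * p * (i * f) ≡ p * f * (i * t)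
            l = solve-∀
        exps : ∀ s h x' → s * (2 * h * suc x') + s * (2 * h * suc x') ≡ s * (2 * h * suc (suc x')) + s * (2 * h * x')
        exps = solve-∀
        expl : ∀ s i' x' k → s * (suc (suc x') * suc (suc x') + i' + (i' + suc (suc x')) + k) + s * (x' * x' + suc i' + (suc i' + x') + k)
          ≡ s * (suc x' * suc x' + suc i' + (suc i' + suc x') + k) + s * (suc x' * suc x' + suc i' + (suc i' + suc x') + k)
        expl s i' x' k = ≡.trans (≡.sym (*-distribˡ-+ s _ _)) (≡.trans (cong (s *_) (l i' x' k)) (*-distribˡ-+ s _ _))
          where
            l : ∀ i x k → (suc (suc x) * suc (suc x) + i + (i + suc (suc x)) + k) + (x * x + suc i + (suc i + x) + k)
              ≡ (suc x * suc x + suc i + (suc i + suc x) + k) + (suc x * suc x + suc i + (suc i + suc x) + k)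
            l = solve-∀
        finish : (∃₂ λ X Xs' → ∃₂ λ Y Ys' → Xs ↭ X ∷ Xs' × Ys ↭ Y ∷ Ys' ×
            N (concat Xs') (concat Ys) * N (concat Xs) (concat Ys') * (length Xs * t) ^ s ≤ W * W) →
          target i ^ Λ * 2 ^ (s * (2 * h * x)) ≤ W ^ Λ * 2 ^ (s * loss i x)
        finish (X , Xs' , Y , Ys' , px , py , step) = walk-step (target i') (target i) ((i * t) ^ s) W W₁ W₂ Λ
            (s * (2 * h * x)) (s * (2 * h * suc x)) (s * (2 * h * x')) (s * loss i x) (s * loss i' (suc x)) (s * loss i x')
            target-suc (exps s h x') (expl s i' x' (h * h + c * M * Λ)) ih₁ ih₂ (subst (λ l → W₁ * W₂ * (l * t) ^ s ≤ W * W) lx step)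
          where
            W₁ = N (concat Xs') (concat Ys)
            W₂ = N (concat Xs) (concat Ys')
            lx' : length Xs' ≡ i'
            lx' = suc-injective (≡.trans (≡.sym (↭-length px)) lx)
            ly' : length Ys' ≡ i + x'
            ly' = suc-injective (≡.trans (≡.sym (↭-length py)) (≡.trans ly (+-suc i x')))
            ih₁ : target i' ^ Λ * 2 ^ (s * (2 * h * suc x)) ≤ W₁ ^ Λ * 2 ^ (s * loss i' (suc x))
            ih₁ = walk n i' (suc x) Xs' Ys (≤-trans (≤-reflexive (l i' x')) (s≤s⁻¹ b)) (grid-tail-rows (grid-↭ px refl G)) lx' (≡.trans ly (≡.sym (+-suc i' x)))
              (subst (M ≤_) (≡.sym (+-suc i' x)) Mj) (subst (_≤ K) (≡.sym (+-suc i' x)) jK)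
              where
                l : ∀ i x → i + (i + suc (suc x)) ≡ i + (suc i + suc x)
                l = solve-∀
            ih₂ : target i ^ Λ * 2 ^ (s * (2 * h * x')) ≤ W₂ ^ Λ * 2 ^ (s * loss i x')
            ih₂ = walk n i x' Xs Ys' (s≤s⁻¹ (≤-trans (≤-reflexive (l i' x')) b)) (grid-tail-columns (grid-↭ refl py G)) lx ly'
              (≤-trans (<⇒≤ (≰⇒> i≰M)) (m≤m+n i x')) (≤-trans (+-monoʳ-≤ i (n≤1+n x')) jK)
              where
                l : ∀ i x → suc (suc i + (suc i + x)) ≡ suc i + (suc i + suc x)
                l = solve-∀

-- Balanced bipartite graphs: the omitted rows and the total loss.

module BalancedGraphs where

  open Arithmetic
  open Pickers
  open MatchingCounts
  open EntropyStep
  open SwitchingBound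
  open GridWalk
  open import Data.Nat
  open import Data.Nat.Properties
  open import Data.Nat.Tactic.RingSolver using (solve-∀)
  open import Data.List using (_++_; length; concat)
  open import Data.List.Properties using (length-++)
  open import Data.List.Relation.Unary.All as All using (All)
  open import Relation.Binary.PropositionalEquality as ≡ using (_≡_; cong; cong₂; subst)

  fall≤^ : ∀ n j → fall n j ≤ n ^ j
  fall≤^ n zero = ≤-refl
  fall≤^ n (suc j) = *-monoʳ-≤ n (≤-trans (fall≤^ (n ∸ 1) j) (^-monoˡ-≤ j (m∸n≤m n 1)))

  fall-! : ∀ a b → (a + b) ! ≡ fall (a + b) a * b !
  fall-! a b = begin
    (a + b) ! ≡⟨ fall-full (a + b) ⟨
    fall (a + b) (a + b) ≡⟨ fall-+ (a + b) a b ⟩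
    fall (a + b) a * fall (a + b ∸ a) b ≡⟨ cong (λ z → fall (a + b) a * fall z b) (m+n∸m≡n a b) ⟩
    fall (a + b) a * fall b b ≡⟨ cong (fall (a + b) a *_) (fall-full b) ⟩
    fall (a + b) a * b ! ∎
    where open ≡.≡-Reasoning

  factorial-blocks : ∀ i s → (i * s) ! ≤ (s ^ i * i !) ^ s
  factorial-blocks zero s = ≤-reflexive (≡.sym (^-zeroˡ s))
  factorial-blocks (suc i) s = begin
    (s + i * s) ! ≡⟨ fall-! s (i * s) ⟩
    fall (s + i * s) s * (i * s) ! ≤⟨ *-mono-≤ (fall≤^ (s + i * s) s) (factorial-blocks i s) ⟩
    (suc i * s) ^ s * (s ^ i * i !) ^ s ≡⟨ ^-distrib-* (suc i * s) (s ^ i * i !) s ⟨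
    (suc i * s * (s ^ i * i !)) ^ s ≡⟨ cong (_^ s) (lem (suc i) s (s ^ i) (i !)) ⟩
    (s * s ^ i * (suc i * i !)) ^ s ∎
    where
      open ≤-Reasoning
      lem : ∀ i s p f → i * s * (p * f) ≡ s * p * (i * f)
      lem = solve-∀

  bernoulli : ∀ n M → M ^ n * (M + n) ≤ suc M ^ n * M
  bernoulli zero M = ≤-reflexive (cong (1 *_) (+-identityʳ M))
  bernoulli (suc n) M = begin
    M * M ^ n * (M + suc n) ≡⟨ lem1 M (M ^ n) n ⟩
    M ^ n * (M * (M + suc n)) ≤⟨ *-monoʳ-≤ (M ^ n) (≤-trans (m≤m+n _ n) (≤-reflexive (lem2 M n))) ⟩
    M ^ n * (suc M * (M + n)) ≡⟨ lem3 (M ^ n) (suc M) (M + n) ⟩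
    suc M * (M ^ n * (M + n)) ≤⟨ *-monoʳ-≤ (suc M) (bernoulli n M) ⟩
    suc M * (suc M ^ n * M) ≡⟨ *-assoc (suc M) (suc M ^ n) M ⟨
    suc M * suc M ^ n * M ∎
    where
      open ≤-Reasoning
      lem1 : ∀ M p n → M * p * (M + suc n) ≡ p * (M * (M + suc n))
      lem1 = solve-∀
      lem2 : ∀ M n → M * (M + suc n) + n ≡ suc M * (M + n)
      lem2 = solve-∀
      lem3 : ∀ a b c → a * (b * c) ≡ b * (a * c)
      lem3 = solve-∀

  -- Converts bits into density: 2^(1/M) ≤ 1 + 1/M.
  doubling : ∀ M → 0 < M → 2 * M ^ M ≤ suc M ^ M
  doubling M M>0 = *-cancelʳ-pos M M>0 (≤-trans (≤-reflexive (lem M (M ^ M))) (bernoulli M M))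
    where
      lem : ∀ M p → 2 * p * M ≡ p * (M + M)
      lem = solve-∀

  -- The density is τ / M, and groups have size s = M g so that t = τ g is an integer. The walk
  -- starts with `i = K - h` row groups and `K = h * H` column groups; the `mx = h * s + ρ`
  -- remaining rows, added at the end, are at most a fraction 2 / H of all rows.
  module Balanced {R C : Set} (a : R → C → ℕ) (a≤1 : ∀ u w → a u w ≤ 1)
    (M τ g H h i c e ρ : ℕ)
    (2≤M : 2 ≤ M) (τ≤M : τ ≤ M) (M+2≤2τ : M + 2 ≤ 2 * τ) (g>0 : 0 < g) (h>0 : 0 < h)
    (i+h : i + h ≡ h * H) (ρ≤ : ρ ≤ h * (M * g)) (3M+2≤2H : 3 * M + 2 ≤ 2 * H)
    (8Me≤H : 8 * M * e ≤ H) (e-bound : 16 * H * M ≤ 2 ^ e) (c-bound : 4 * M ≤ 2 ^ c)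
    (h²≥ : c * (M * 8) * (h * H) ≤ h * h) (K-large : c * M * (M * 8) ≤ 2 * (h * H)) (4M≤K : 4 * M ≤ h * H) where

    open Matchings a
    open Degrees a
    open Switching a a≤1

    s t K Λ q mx : ℕ
    s = M * g
    t = τ * g
    K = h * H
    Λ = M * 8
    q = K * s + ρ
    mx = h * s + ρ

    open ≤-Reasoning

    2t≥ : s + 2 * g ≤ 2 * t
    2t≥ = ≤-trans (≤-reflexive (≡.sym (*-distribʳ-+ g M 2))) (≤-trans (*-monoˡ-≤ g M+2≤2τ) (≤-reflexive (*-assoc 2 τ g)))

    t≤s : t ≤ s
    t≤s = *-monoˡ-≤ g τ≤M

    M≤K : M ≤ K
    M≤K = ≤-trans (≤-trans (m≤m+n M (3 * M)) (≤-reflexive (lem M))) 4M≤K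
      where
        lem : ∀ M → M + 3 * M ≡ 4 * M
        lem = solve-∀

    s>0 : 0 < s
    s>0 = *-pos (≤-trans z<s 2≤M) g>0

    h≤K : h ≤ K
    h≤K = ≤-trans (m≤n+m h i) (≤-reflexive i+h)

    q≡ : q ≡ mx + i * s
    q≡ = ≡.trans (cong (λ z → z * s + ρ) (≡.sym i+h)) (lem i h s ρ)
      where
        lem : ∀ i h s ρ → (i + h) * s + ρ ≡ h * s + ρ + i * s
        lem = solve-∀

    mx≤ : mx ≤ 2 * (h * s)
    mx≤ = +-monoʳ-≤ (h * s) (≤-trans ρ≤ (≤-reflexive (≡.sym (+-identityʳ (h * s)))))

    q≤2Ks : q ≤ 2 * (K * s)
    q≤2Ks = +-monoʳ-≤ (K * s) (≤-trans ρ≤ (≤-trans (*-monoˡ-≤ s h≤K) (≤-reflexive (≡.sym (+-identityʳ (K * s))))))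

    q≤2Hmx : q ≤ 2 * H * mx
    q≤2Hmx = ≤-trans q≤2Ks (≤-trans (≤-reflexive (lem h H s)) (*-monoʳ-≤ (2 * H) (m≤m+n (h * s) ρ)))
      where
        lem : ∀ h H s → 2 * (h * H * s) ≡ 2 * H * (h * s)
        lem = solve-∀

    -- The constant arises from q ≤ 2 H mx and mx^mx ≤ 4^mx mx!. It is large but raised only to the
    -- power `mx`.
    factorial-split : q ! ≤ (8 * H) ^ mx * mx ! * (i * s) !
    factorial-split = begin
      q ! ≡⟨ cong _! q≡ ⟩
      (mx + i * s) ! ≡⟨ fall-! mx (i * s) ⟩
      fall (mx + i * s) mx * (i * s) ! ≤⟨ *-monoˡ-≤ ((i * s) !) (fall≤^ (mx + i * s) mx) ⟩
      (mx + i * s) ^ mx * (i * s) ! ≤⟨ *-monoˡ-≤ ((i * s) !) (^-monoˡ-≤ mx (≤-trans (≤-reflexive (≡.sym q≡)) q≤2Hmx)) ⟩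
      (2 * H * mx) ^ mx * (i * s) ! ≡⟨ cong (_* (i * s) !) (^-distrib-* (2 * H) mx mx) ⟩
      (2 * H) ^ mx * mx ^ mx * (i * s) ! ≤⟨ *-monoˡ-≤ ((i * s) !) (*-monoʳ-≤ ((2 * H) ^ mx) (n^n≤4^n*n! mx)) ⟩
      (2 * H) ^ mx * (4 ^ mx * mx !) * (i * s) ! ≡⟨ cong (_* (i * s) !) (≡.trans (≡.sym (*-assoc ((2 * H) ^ mx) (4 ^ mx) (mx !))) (cong (_* mx !) (≡.trans (≡.sym (^-distrib-* (2 * H) 4 mx)) (cong (_^ mx) (lem H))))) ⟩
      (8 * H) ^ mx * mx ! * (i * s) ! ∎
      where
        lem : ∀ H → 2 * H * 4 ≡ 8 * H
        lem = solve-∀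

    target-bound : τ ^ (i * s) * (i * s) ! ≤ M ^ (i * s) * (t ^ i * i !) ^ s
    target-bound = begin
      τ ^ (i * s) * (i * s) ! ≤⟨ *-monoʳ-≤ (τ ^ (i * s)) (factorial-blocks i s) ⟩
      τ ^ (i * s) * (s ^ i * i !) ^ s ≡⟨ cong (_* (s ^ i * i !) ^ s) (^-*-assoc τ i s) ⟨
      (τ ^ i) ^ s * (s ^ i * i !) ^ s ≡⟨ ^-distrib-* (τ ^ i) _ s ⟨
      (τ ^ i * (s ^ i * i !)) ^ s ≡⟨ cong (_^ s) core ⟩
      (M ^ i * (t ^ i * i !)) ^ s ≡⟨ ^-distrib-* (M ^ i) _ s ⟩
      (M ^ i) ^ s * (t ^ i * i !) ^ s ≡⟨ cong (_* (t ^ i * i !) ^ s) (^-*-assoc M i s) ⟩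
      M ^ (i * s) * (t ^ i * i !) ^ s ∎
      where
        core : τ ^ i * (s ^ i * i !) ≡ M ^ i * (t ^ i * i !)
        core = ≡.trans (≡.sym (*-assoc (τ ^ i) _ _)) (≡.trans (cong (_* i !) (≡.trans (≡.sym (^-distrib-* τ s i)) (≡.trans (cong (_^ i) (lem τ M g)) (^-distrib-* M t i)))) (*-assoc (M ^ i) _ _))
          where
            lem : ∀ τ M g → τ * (M * g) ≡ M * (τ * g)
            lem = solve-∀

    -- The reserved factor 2, the omitted rows and the walk lose at most 8 q bits together after
    -- raising to the power Λ = 8 M. That is 1 / M bit per row, hence a factor of at most 1 + 1 / M
    -- per row by `doubling`.
    losses : 2 ^ Λ * ((16 * H * M) ^ mx) ^ Λ * 2 ^ (s * (2 * K + c * M * Λ)) * M ^ (q * Λ) ≤ suc M ^ (q * Λ)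
    losses = begin
      2 ^ Λ * ((16 * H * M) ^ mx) ^ Λ * 2 ^ (s * (2 * K + c * M * Λ)) * M ^ (q * Λ) ≤⟨ *-monoˡ-≤ (M ^ (q * Λ)) (*-monoˡ-≤ (2 ^ (s * (2 * K + c * M * Λ))) (*-monoʳ-≤ (2 ^ Λ) (^-monoˡ-≤ Λ (^-monoˡ-≤ mx e-bound)))) ⟩
      2 ^ Λ * ((2 ^ e) ^ mx) ^ Λ * 2 ^ (s * (2 * K + c * M * Λ)) * M ^ (q * Λ) ≡⟨ cong (λ z → 2 ^ Λ * z * 2 ^ (s * (2 * K + c * M * Λ)) * M ^ (q * Λ)) (≡.trans (cong (_^ Λ) (^-*-assoc 2 e mx)) (^-*-assoc 2 (e * mx) Λ)) ⟩
      2 ^ Λ * 2 ^ (e * mx * Λ) * 2 ^ (s * (2 * K + c * M * Λ)) * M ^ (q * Λ) ≡⟨ cong (_* M ^ (q * Λ)) (≡.trans (cong (_* 2 ^ (s * (2 * K + c * M * Λ))) (≡.sym (^-distribˡ-+-* 2 Λ (e * mx * Λ)))) (≡.sym (^-distribˡ-+-* 2 (Λ + e * mx * Λ) (s * (2 * K + c * M * Λ))))) ⟩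
      2 ^ (Λ + e * mx * Λ + s * (2 * K + c * M * Λ)) * M ^ (q * Λ) ≤⟨ *-monoˡ-≤ (M ^ (q * Λ)) (^-monoʳ-≤ 2 exponent) ⟩
      2 ^ (8 * q) * M ^ (q * Λ) ≡⟨ cong (λ z → 2 ^ (8 * q) * M ^ z) (lemΛ q M) ⟩
      2 ^ (8 * q) * M ^ (M * (8 * q)) ≡⟨ cong (2 ^ (8 * q) *_) (^-*-assoc M M (8 * q)) ⟨
      2 ^ (8 * q) * (M ^ M) ^ (8 * q) ≡⟨ ^-distrib-* 2 (M ^ M) (8 * q) ⟨
      (2 * M ^ M) ^ (8 * q) ≤⟨ ^-monoˡ-≤ (8 * q) (doubling M (≤-trans z<s 2≤M)) ⟩
      (suc M ^ M) ^ (8 * q) ≡⟨ ^-*-assoc (suc M) M (8 * q) ⟩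
      suc M ^ (M * (8 * q)) ≡⟨ cong (suc M ^_) (lemΛ q M) ⟨
      suc M ^ (q * Λ) ∎
      where
        lemΛ : ∀ q M → q * (M * 8) ≡ M * (8 * q)
        lemΛ = solve-∀
        exponent : Λ + e * mx * Λ + s * (2 * K + c * M * Λ) ≤ 8 * q
        exponent = begin
          M * 8 + e * mx * Λ + s * (2 * K + c * M * Λ) ≤⟨ +-mono-≤ (+-mono-≤ p1 p2) (*-monoʳ-≤ s (+-monoʳ-≤ (2 * K) K-large)) ⟩
          2 * (K * s) + 2 * (K * s) + s * (2 * K + 2 * K) ≡⟨ lem K s ⟩
          8 * (K * s) ≤⟨ *-monoʳ-≤ 8 (m≤m+n (K * s) ρ) ⟩
          8 * q ∎
          where
            lem : ∀ K s → 2 * (K * s) + 2 * (K * s) + s * (2 * K + 2 * K) ≡ 8 * (K * s)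
            lem = solve-∀
            p1 : M * 8 ≤ 2 * (K * s)
            p1 = begin
              M * 8 ≡⟨ lem1 M ⟩
              2 * (4 * M) ≤⟨ *-monoʳ-≤ 2 4M≤K ⟩
              2 * K ≤⟨ *-monoʳ-≤ 2 (≤-trans (≤-reflexive (≡.sym (*-identityʳ K))) (*-monoʳ-≤ K s>0)) ⟩
              2 * (K * s) ∎
              where
                lem1 : ∀ M → M * 8 ≡ 2 * (4 * M)
                lem1 = solve-∀
            p2 : e * mx * Λ ≤ 2 * (K * s)
            p2 = begin
              e * mx * (M * 8) ≤⟨ *-monoˡ-≤ (M * 8) (*-monoʳ-≤ e mx≤) ⟩
              e * (2 * (h * s)) * (M * 8) ≡⟨ lem2 e h s M ⟩
              2 * (h * (8 * M * e) * s) ≤⟨ *-monoʳ-≤ 2 (*-monoˡ-≤ s (*-monoʳ-≤ h 8Me≤H)) ⟩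
              2 * (h * H * s) ∎
              where
                lem2 : ∀ e h s M → e * (2 * (h * s)) * (M * 8) ≡ 2 * (h * (8 * M * e) * s)
                lem2 = solve-∀

    -- Two units of density absorb the factor (M + 1) / M per row, since τ ≤ M. For the omitted rows
    -- τ is simply replaced by `M`.
    density-loss : (τ ∸ 2) ^ q * suc M ^ q ≤ τ ^ (i * s) * M ^ mx * M ^ q
    density-loss = begin
      (τ ∸ 2) ^ q * suc M ^ q ≡⟨ ^-distrib-* (τ ∸ 2) (suc M) q ⟨
      ((τ ∸ 2) * suc M) ^ q ≤⟨ ^-monoˡ-≤ q one ⟩
      (τ * M) ^ q ≡⟨ ^-distrib-* τ M q ⟩
      τ ^ q * M ^ q ≡⟨ cong (λ z → τ ^ z * M ^ q) q≡ ⟩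
      τ ^ (mx + i * s) * M ^ q ≡⟨ cong (_* M ^ q) (≡.trans (^-distribˡ-+-* τ mx (i * s)) (*-comm (τ ^ mx) _)) ⟩
      τ ^ (i * s) * τ ^ mx * M ^ q ≤⟨ *-monoˡ-≤ (M ^ q) (*-monoʳ-≤ (τ ^ (i * s)) (^-monoˡ-≤ mx τ≤M)) ⟩
      τ ^ (i * s) * M ^ mx * M ^ q ∎
      where
        one' : ∀ τ → τ ≤ M → (τ ∸ 2) * suc M ≤ τ * M
        one' zero _ = z≤n
        one' (suc zero) _ = z≤n
        one' (suc (suc τ)) p = begin
          τ * suc M ≡⟨ *-suc τ M ⟩
          τ + τ * M ≤⟨ +-monoˡ-≤ (τ * M) (≤-trans (n≤1+n τ) (≤-trans (n≤1+n (suc τ)) p)) ⟩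
          M + τ * M ≤⟨ m≤n+m _ M ⟩
          M + (M + τ * M) ∎
        one : (τ ∸ 2) * suc M ≤ τ * M
        one = one' τ τ≤M

    -- The factor 2 is a reserve for the averaging over orderings, of which up to half may fail to
    -- have the required degrees.
    many-matchings : ∀ Xs extra Ys lc → Grid s t Xs Ys → length Xs ≡ i → length Ys ≡ K → length extra ≡ mx → length lc ≡ ρ →
      All (λ u → K * t ≤ row-degree (concat Ys) u) extra →
      All (λ w → i * t ≤ column-degree (concat Xs) w) (concat Ys ++ lc) →
      2 * (q ! * (τ ∸ 2) ^ q) ≤ M ^ q * N (extra ++ concat Xs) (concat Ys ++ lc)
    many-matchings Xs extra Ys lc G lx ly le llc rows cols =
      ^-cancel-≤ Λ _ _ (*-pos (≤-trans z<s 2≤M) z<s) (*-cancelʳ-pos (suc M ^ (q * Λ)) (^-pos (suc M) (q * Λ) z<s) (begin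
        (2 * (q ! * (τ ∸ 2) ^ q)) ^ Λ * suc M ^ (q * Λ) ≡⟨ cong₂ _*_ (≡.trans (^-distrib-* 2 _ Λ) (cong (2 ^ Λ *_) (^-distrib-* (q !) _ Λ))) (≡.sym (^-*-assoc (suc M) q Λ)) ⟩
        2 ^ Λ * ((q !) ^ Λ * ((τ ∸ 2) ^ q) ^ Λ) * (suc M ^ q) ^ Λ ≡⟨ ≡.trans (l1 (2 ^ Λ) ((q !) ^ Λ) _ _) (cong (2 ^ Λ * (q !) ^ Λ *_) (≡.sym (^-distrib-* ((τ ∸ 2) ^ q) (suc M ^ q) Λ))) ⟩
        2 ^ Λ * (q !) ^ Λ * ((τ ∸ 2) ^ q * suc M ^ q) ^ Λ ≤⟨ *-monoʳ-≤ (2 ^ Λ * (q !) ^ Λ) (^-monoˡ-≤ Λ density-loss) ⟩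
        2 ^ Λ * (q !) ^ Λ * (T * M ^ mx * M ^ q) ^ Λ ≡⟨ cong (2 ^ Λ * (q !) ^ Λ *_) (≡.trans (^-distrib-* (T * M ^ mx) (M ^ q) Λ) (cong (_* (M ^ q) ^ Λ) (^-distrib-* T (M ^ mx) Λ))) ⟩
        2 ^ Λ * (q !) ^ Λ * (T ^ Λ * (M ^ mx) ^ Λ * (M ^ q) ^ Λ) ≡⟨ l2 (2 ^ Λ) ((q !) ^ Λ) (T ^ Λ) ((M ^ mx) ^ Λ) ((M ^ q) ^ Λ) ⟩
        (q !) ^ Λ * T ^ Λ * (2 ^ Λ * (M ^ mx) ^ Λ * (M ^ q) ^ Λ) ≡⟨ cong (_* (2 ^ Λ * (M ^ mx) ^ Λ * (M ^ q) ^ Λ)) (≡.sym (^-distrib-* (q !) T Λ)) ⟩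
        (q ! * T) ^ Λ * (2 ^ Λ * (M ^ mx) ^ Λ * (M ^ q) ^ Λ) ≤⟨ *-monoˡ-≤ _ main ⟩
        ((16 * H * M) ^ mx) ^ Λ * (M ^ (i * s)) ^ Λ * W ^ Λ * 2 ^ (s * (2 * K + c * M * Λ)) * (2 ^ Λ * (M ^ mx) ^ Λ * (M ^ q) ^ Λ) ≡⟨ l3 (((16 * H * M) ^ mx) ^ Λ) ((M ^ (i * s)) ^ Λ) (W ^ Λ) (2 ^ (s * (2 * K + c * M * Λ))) (2 ^ Λ) ((M ^ mx) ^ Λ) ((M ^ q) ^ Λ) ⟩
        (M ^ mx) ^ Λ * (M ^ (i * s)) ^ Λ * W ^ Λ * (2 ^ Λ * ((16 * H * M) ^ mx) ^ Λ * 2 ^ (s * (2 * K + c * M * Λ)) * (M ^ q) ^ Λ) ≡⟨ cong₂ (λ x y → x * W ^ Λ * (2 ^ Λ * ((16 * H * M) ^ mx) ^ Λ * 2 ^ (s * (2 * K + c * M * Λ)) * y)) Mq (^-*-assoc M q Λ) ⟩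
        (M ^ q) ^ Λ * W ^ Λ * (2 ^ Λ * ((16 * H * M) ^ mx) ^ Λ * 2 ^ (s * (2 * K + c * M * Λ)) * M ^ (q * Λ)) ≤⟨ *-monoʳ-≤ ((M ^ q) ^ Λ * W ^ Λ) losses ⟩
        (M ^ q) ^ Λ * W ^ Λ * suc M ^ (q * Λ) ≡⟨ cong (_* suc M ^ (q * Λ)) (^-distrib-* (M ^ q) W Λ) ⟨
        (M ^ q * W) ^ Λ * suc M ^ (q * Λ) ∎))
      where
        ws = concat Ys ++ lc
        W = N (extra ++ concat Xs) ws
        W₀ = N (concat Xs) (concat Ys)
        T = τ ^ (i * s)
        tgt = (t ^ i * i !) ^ s
        l1 : ∀ a b c d → a * (b * c) * d ≡ a * b * (c * d)
        l1 = solve-∀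
        l2 : ∀ a b c d e → a * b * (c * d * e) ≡ b * c * (a * d * e)
        l2 = solve-∀
        l3 : ∀ a b c d e f g → a * b * c * d * (e * f * g) ≡ f * b * c * (e * a * d * g)
        l3 = solve-∀
        Mq : (M ^ mx) ^ Λ * (M ^ (i * s)) ^ Λ ≡ (M ^ q) ^ Λ
        Mq = ≡.trans (≡.sym (^-distrib-* (M ^ mx) _ Λ)) (cong (_^ Λ) (≡.trans (≡.sym (^-distribˡ-+-* M mx (i * s))) (cong (M ^_) (≡.sym q≡))))
        lw : length ws ≡ q
        lw = ≡.trans (length-++ (concat Ys)) (cong₂ _+_ (≡.trans (length-concat s Ys (column-sizes G)) (cong (_* s) ly)) llc)
        lb : length (concat Xs) ≡ i * s
        lb = ≡.trans (length-concat s Xs (row-sizes G)) (cong (_* s) lx)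
        open Walk a a≤1 s t M g ≡.refl 2t≥ t≤s 2≤M g>0 K h Λ c c-bound h²≥ using (walk; loss)
        -- At the starting point x = h the two terms h² on the right cancel against 2 h x on the
        -- left. What remains is i + j ≤ 2 K and the constant.
        walked : tgt ^ Λ ≤ W₀ ^ Λ * 2 ^ (s * (2 * K + c * M * Λ))
        walked = *-cancelʳ-pos (2 ^ (s * (2 * h * h))) (^-pos 2 (s * (2 * h * h)) z<s) (begin
          tgt ^ Λ * 2 ^ (s * (2 * h * h)) ≤⟨ walk (i + (i + h)) i h Xs Ys ≤-refl G lx (≡.trans ly (≡.sym i+h)) (subst (M ≤_) (≡.sym i+h) M≤K) (≤-reflexive i+h) ⟩
          W₀ ^ Λ * 2 ^ (s * loss i h) ≤⟨ *-monoʳ-≤ (W₀ ^ Λ) (^-monoʳ-≤ 2 (*-monoʳ-≤ s (≤-trans (+-monoˡ-≤ (h * h + c * M * Λ) (+-mono-≤ (+-monoʳ-≤ (h * h) (≤-trans (m≤m+n i h) (≤-reflexive i+h))) (≤-reflexive i+h))) (≤-reflexive (l4 h K (c * M * Λ)))))) ⟩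
          W₀ ^ Λ * 2 ^ (s * (2 * K + c * M * Λ + 2 * h * h)) ≡⟨ cong (λ z → W₀ ^ Λ * 2 ^ z) (*-distribˡ-+ s (2 * K + c * M * Λ) (2 * h * h)) ⟩
          W₀ ^ Λ * 2 ^ (s * (2 * K + c * M * Λ) + s * (2 * h * h)) ≡⟨ cong (W₀ ^ Λ *_) (^-distribˡ-+-* 2 (s * (2 * K + c * M * Λ)) (s * (2 * h * h))) ⟩
          W₀ ^ Λ * (2 ^ (s * (2 * K + c * M * Λ)) * 2 ^ (s * (2 * h * h))) ≡⟨ *-assoc (W₀ ^ Λ) _ _ ⟨
          W₀ ^ Λ * 2 ^ (s * (2 * K + c * M * Λ)) * 2 ^ (s * (2 * h * h)) ∎)
          where
            l4 : ∀ h K k → h * h + K + K + (h * h + k) ≡ 2 * K + k + 2 * h * h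
            l4 = solve-∀
        -- After ρ is replaced by its bound h s, the condition becomes 2 K g ≥ 3 h s + 2 h g; for K
        -- = h H and s = M g this is 2 H ≥ 3 M + 2.
        D≤ : K * g + (length extra + length (concat Xs)) ≤ i * t + K * t
        D≤ = *-cancelˡ-≤ 2 (begin
          2 * (K * g + (length extra + length (concat Xs))) ≡⟨ cong₂ (λ x y → 2 * (K * g + (x + y))) le lb ⟩
          2 * (K * g + (mx + i * s)) ≡⟨ cong (λ z → 2 * (K * g + z)) (≡.sym q≡) ⟩
          2 * (K * g + (K * s + ρ)) ≤⟨ *-monoʳ-≤ 2 (+-monoʳ-≤ (K * g) (+-monoʳ-≤ (K * s) ρ≤)) ⟩
          2 * (K * g + (K * s + h * s)) ≤⟨ +-cancelʳ-≤ (h * (M * g) + 2 * (h * g)) _ _ (begin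
            2 * (K * g + (K * s + h * s)) + (h * (M * g) + 2 * (h * g)) ≡⟨ l5 h H M g ⟩
            2 * (h * H * g) + 2 * (h * H * (M * g)) + h * g * (3 * M + 2) ≤⟨ +-monoʳ-≤ (2 * (h * H * g) + 2 * (h * H * (M * g))) (*-monoʳ-≤ (h * g) 3M+2≤2H) ⟩
            2 * (h * H * g) + 2 * (h * H * (M * g)) + h * g * (2 * H) ≡⟨ l6 h H M g ⟩
            (h * H + h * H) * (M * g + 2 * g) ≡⟨ cong (λ z → (z + K) * (M * g + 2 * g)) (≡.sym i+h) ⟩
            (i + h + K) * (M * g + 2 * g) ≡⟨ l7 i h K (M * g) g ⟩
            (i + K) * (s + 2 * g) + (h * (M * g) + 2 * (h * g)) ∎) ⟩
          (i + K) * (s + 2 * g) ≤⟨ *-monoʳ-≤ (i + K) 2t≥ ⟩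
          (i + K) * (2 * t) ≡⟨ l8 i K t ⟩
          2 * (i * t + K * t) ∎)
          where
            l5 : ∀ h H M g → 2 * (h * H * g + (h * H * (M * g) + h * (M * g))) + (h * (M * g) + 2 * (h * g)) ≡ 2 * (h * H * g) + 2 * (h * H * (M * g)) + h * g * (3 * M + 2)
            l5 = solve-∀
            l6 : ∀ h H M g → 2 * (h * H * g) + 2 * (h * H * (M * g)) + h * g * (2 * H) ≡ (h * H + h * H) * (M * g + 2 * g)
            l6 = solve-∀
            l7 : ∀ i h K w g → (i + h + K) * (w + 2 * g) ≡ (i + K) * (w + 2 * g) + (h * w + 2 * (h * g))
            l7 = solve-∀
            l8 : ∀ i K t → (i + K) * (2 * t) ≡ 2 * (i * t + K * t)
            l8 = solve-∀
        added : W₀ * mx ! ≤ (2 * M) ^ mx * W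
        added = begin
          W₀ * mx ! ≤⟨ *-monoˡ-≤ (mx !) (N-mono-cols (concat Xs) (concat Ys) lc) ⟩
          N (concat Xs) ws * mx ! ≡⟨ cong (N (concat Xs) ws *_) (≡.sym (≡.trans (cong₂ fall (≡.trans (cong₂ _∸_ lw lb) (≡.trans (cong (_∸ i * s) q≡) (m+n∸n≡m mx (i * s)))) le) (fall-full mx))) ⟩
          N (concat Xs) ws * fall (length ws ∸ length (concat Xs)) (length extra) ≤⟨ add-rows extra (concat Xs) ws (i * t) (K * t) (K * g) (2 * M) cols
            (All.map (λ {u} p → ≤-trans p (≤-trans (m≤m+n _ (row-degree lc u)) (≤-reflexive (≡.sym (row-degree-++ (concat Ys) lc u))))) rows)
            D≤ (*-pos (≤-trans h>0 h≤K) g>0) (≤-trans (≤-reflexive lw) (≤-trans q≤2Ks (≤-reflexive (l9 K M g)))) ⟩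
          (2 * M) ^ length extra * W ≡⟨ cong (λ z → (2 * M) ^ z * W) le ⟩
          (2 * M) ^ mx * W ∎
          where
            l9 : ∀ K M g → 2 * (K * (M * g)) ≡ 2 * M * (K * g)
            l9 = solve-∀
        main : (q ! * T) ^ Λ ≤ ((16 * H * M) ^ mx) ^ Λ * (M ^ (i * s)) ^ Λ * W ^ Λ * 2 ^ (s * (2 * K + c * M * Λ))
        main = begin
          (q ! * T) ^ Λ ≤⟨ ^-monoˡ-≤ Λ (begin
            q ! * T ≤⟨ *-monoˡ-≤ T factorial-split ⟩
            (8 * H) ^ mx * mx ! * (i * s) ! * T ≡⟨ l10 ((8 * H) ^ mx * mx !) ((i * s) !) T ⟩
            (8 * H) ^ mx * mx ! * (T * (i * s) !) ≤⟨ *-monoʳ-≤ ((8 * H) ^ mx * mx !) target-bound ⟩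
            (8 * H) ^ mx * mx ! * (M ^ (i * s) * tgt) ∎) ⟩
          ((8 * H) ^ mx * mx ! * (M ^ (i * s) * tgt)) ^ Λ ≡⟨ ≡.trans (cong (_^ Λ) (l11 ((8 * H) ^ mx) (mx !) (M ^ (i * s)) tgt)) (^-distrib-* ((8 * H) ^ mx * M ^ (i * s) * mx !) tgt Λ) ⟩
          ((8 * H) ^ mx * M ^ (i * s) * mx !) ^ Λ * tgt ^ Λ ≤⟨ *-monoʳ-≤ (((8 * H) ^ mx * M ^ (i * s) * mx !) ^ Λ) walked ⟩
          ((8 * H) ^ mx * M ^ (i * s) * mx !) ^ Λ * (W₀ ^ Λ * 2 ^ (s * (2 * K + c * M * Λ))) ≡⟨ ≡.trans (≡.sym (*-assoc (((8 * H) ^ mx * M ^ (i * s) * mx !) ^ Λ) (W₀ ^ Λ) (2 ^ (s * (2 * K + c * M * Λ))))) (cong (_* 2 ^ (s * (2 * K + c * M * Λ))) (≡.sym (^-distrib-* ((8 * H) ^ mx * M ^ (i * s) * mx !) W₀ Λ))) ⟩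
          ((8 * H) ^ mx * M ^ (i * s) * mx ! * W₀) ^ Λ * 2 ^ (s * (2 * K + c * M * Λ)) ≤⟨ *-monoˡ-≤ (2 ^ (s * (2 * K + c * M * Λ))) (^-monoˡ-≤ Λ (begin
            (8 * H) ^ mx * M ^ (i * s) * mx ! * W₀ ≡⟨ l12 ((8 * H) ^ mx * M ^ (i * s)) (mx !) W₀ ⟩
            (8 * H) ^ mx * M ^ (i * s) * (W₀ * mx !) ≤⟨ *-monoʳ-≤ ((8 * H) ^ mx * M ^ (i * s)) added ⟩
            (8 * H) ^ mx * M ^ (i * s) * ((2 * M) ^ mx * W) ≡⟨ l13 ((8 * H) ^ mx) (M ^ (i * s)) ((2 * M) ^ mx) W ⟩
            (8 * H) ^ mx * (2 * M) ^ mx * M ^ (i * s) * W ≡⟨ cong (λ z → z * M ^ (i * s) * W) (≡.trans (≡.sym (^-distrib-* (8 * H) (2 * M) mx)) (cong (_^ mx) (l14 H M))) ⟩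
            (16 * H * M) ^ mx * M ^ (i * s) * W ∎)) ⟩
          ((16 * H * M) ^ mx * M ^ (i * s) * W) ^ Λ * 2 ^ (s * (2 * K + c * M * Λ)) ≡⟨ cong (_* 2 ^ (s * (2 * K + c * M * Λ))) (≡.trans (^-distrib-* ((16 * H * M) ^ mx * M ^ (i * s)) W Λ) (cong (_* W ^ Λ) (^-distrib-* ((16 * H * M) ^ mx) (M ^ (i * s)) Λ))) ⟩
          ((16 * H * M) ^ mx) ^ Λ * (M ^ (i * s)) ^ Λ * W ^ Λ * 2 ^ (s * (2 * K + c * M * Λ)) ∎
          where
            l10 : ∀ a b c → a * b * c ≡ a * (c * b)
            l10 = solve-∀
            l11 : ∀ a b c d → a * b * (c * d) ≡ a * c * b * d
            l11 = solve-∀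
            l12 : ∀ a b c → a * b * c ≡ a * (c * b)
            l12 = solve-∀
            l13 : ∀ a b c d → a * b * (c * d) ≡ a * c * b * d
            l13 = solve-∀
            l14 : ∀ H M → 8 * H * (2 * M) ≡ 16 * H * M
            l14 = solve-∀

-- Random draws: pairs, stability of densities, exponential moments.

module RandomDraws where

  open Pickers
  open SwitchingBound
  open import Data.Nat
  open import Data.Nat.Properties
  open import Data.Nat.Tactic.RingSolver using (solve-∀)
  open import Data.Nat.ListAction using (sum; product)
  open import Data.List using (List; []; _∷_; _++_; length; concatMap; map)
  open import Data.List.Properties using (length-++; ++-assoc; concatMap-pure)
  open import Data.List.Relation.Unary.All as All using ([]; _∷_)
  open import Data.List.Relation.Binary.Permutation.Propositional using (_↭_; refl; trans; ↭-reflexive)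
  open import Data.List.Relation.Binary.Permutation.Propositional.Properties using (↭-length; ++⁺ˡ)
  open import Data.Product using (proj₁)
  open import Relation.Nullary using (yes; no)
  open import Data.Empty using (⊥-elim)
  open import Relation.Binary.PropositionalEquality as ≡ using (_≡_; cong; cong₂; subst)

  private variable A X Y : Set

  run-zero : (P : Picker A X) → ∀ xs → P .run (λ _ _ → 0) xs ≡ 0
  run-zero P xs = P .scale 0 (λ _ _ → 0) xs

  run-pick : (P : Picker A X) → (h : Y → List Y → X → List A → ℕ) → ∀ us xs →
    P .run (λ x r → pick (λ u us' → h u us' x r) us) xs ≡ pick (λ u us' → P .run (h u us') xs) us
  run-pick P h [] xs = run-zero P xs
  run-pick P h (u ∷ us) xs = ≡.trans (P .add (h u us) _ xs) (cong (P .run (h u us) xs +_) (run-pick P (λ v vs → h v (u ∷ vs)) us xs))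

  module _ (D : Picker A X) (G : Picker A Y) (DD : Commute D D) (GG : Commute G G) (DG : Commute D G) where

    -- The factor `g (length r')` stands for the draws made afterwards; the number of their outcomes
    -- depends only on how many entries are left.
    pair-sum : (X → Y → ℕ) → ℕ → ℕ → (ℕ → ℕ) → List A → ℕ
    pair-sum b q k g V = repRun D (suc q) (λ us r → repRun G (suc k) (λ ys r' → pick (λ u _ → pick (λ y _ → b u y) ys) us * g (length r')) r) V

    -- By exchangeability the pair (u , y) may be assumed to be drawn first.
    pair-sum-first : ∀ b q k (g : ℕ → ℕ) V → let sz = G .size in
      pair-sum b q k g V ≡ suc q * (suc k * D .run (λ u r → G .run (λ y _ → b u y) r *
        (fall (length r ∸ sz) (q * D .size) * (fall (length r ∸ sz ∸ q * D .size) (k * sz) * g (length r ∸ sz ∸ q * D .size ∸ k * sz)))) V)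
    pair-sum-first b q k g V = begin
      repRun D (suc q) (λ us r → repRun G (suc k) (λ ys r' → pick (λ u _ → pick (λ y _ → b u y) ys) us * g (length r')) r) V
        ≡⟨ ext′ (rep D (suc q)) V (λ us r → ≡.trans (ext′ (rep G (suc k)) r (λ ys r' → scale-pick us ys (g (length r')))) (run-pick (rep G (suc k)) (λ u _ ys r' → pick (λ y _ → b u y) ys * g (length r')) us r)) ⟩
      repRun D (suc q) (λ us r → pick (λ u _ → repRun G (suc k) (λ ys r' → pick (λ y _ → b u y) ys * g (length r')) r) us) V
        ≡⟨ rep-pick D DD q (λ u _ r → repRun G (suc k) (λ ys r' → pick (λ y _ → b u y) ys * g (length r')) r) V ⟩
      suc q * D .run (λ u r → repRun D q (λ _ r' → repRun G (suc k) (λ ys r'' → pick (λ y _ → b u y) ys * g (length r'')) r') r) V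
        ≡⟨ cong (suc q *_) (ext′ D V (λ u r → ≡.trans (ext′ (rep D q) r (λ _ r' → inner u r')) (≡.trans (repScale D q (suc k) _ r) (cong (suc k *_) (outer u r))))) ⟩
      suc q * D .run (λ u r → suc k * (G .run (λ y _ → b u y) r * g₂ (length r ∸ sz))) V
        ≡⟨ cong (suc q *_) (D .scale (suc k) _ V) ⟩
      suc q * (suc k * D .run (λ u r → G .run (λ y _ → b u y) r * g₂ (length r ∸ sz)) V) ∎
      where
        open ≡.≡-Reasoning
        sz = G .size
        g₁ : ℕ → ℕ
        g₁ n = fall n (k * sz) * g (n ∸ k * sz)
        g₂ : ℕ → ℕ
        g₂ n = fall n (q * D .size) * g₁ (n ∸ q * D .size)
        scale-pick : ∀ us ys c → pick (λ u _ → pick (λ y _ → b u y) ys) us * c ≡ pick (λ u _ → pick (λ y _ → b u y) ys * c) us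
        scale-pick us ys c = ≡.trans (*-comm _ c) (≡.trans (≡.sym (pick-scale c _ us)) (pick-ext us (λ u _ _ → *-comm c _)))
        inner : ∀ u r → repRun G (suc k) (λ ys r' → pick (λ y _ → b u y) ys * g (length r')) r ≡ suc k * G .run (λ y r' → b u y * g₁ (length r')) r
        inner u r = ≡.trans (ext′ (rep G (suc k)) r (λ ys r' → ≡.trans (*-comm _ (g (length r'))) (≡.trans (≡.sym (pick-scale (g (length r')) _ ys)) (pick-ext ys (λ y _ _ → *-comm (g (length r')) (b u y))))))
          (≡.trans (rep-pick G GG k (λ y _ r' → b u y * g (length r')) r) (cong (suc k *_) (ext′ G r (λ y r' → ≡.trans (repScale G k (b u y) _ r') (cong (b u y *_) (repTotal G k g r'))))))
        outer : ∀ u r → repRun D q (λ _ r' → G .run (λ y r'' → b u y * g₁ (length r'')) r') r ≡ G .run (λ y _ → b u y) r * g₂ (length r ∸ sz)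
        outer u r = begin
          repRun D q (λ _ r' → G .run (λ y r'' → b u y * g₁ (length r'')) r') r ≡⟨ commute-rep D G DG q (λ _ y r'' → b u y * g₁ (length r'')) r ⟩
          G .run (λ y r' → repRun D q (λ _ r'' → b u y * g₁ (length r'')) r') r ≡⟨ ext′ G r (λ y r' → ≡.trans (repScale D q (b u y) _ r') (cong (b u y *_) (repTotal D q g₁ r'))) ⟩
          G .run (λ y r' → b u y * g₂ (length r')) r ≡⟨ ext G r (λ y r' o p → cong (λ n → b u y * g₂ n) (≡.sym (≡.trans (cong₂ _∸_ (≡.trans (↭-length p) (length-++ (G .flat y))) (≡.sym (G .ok-size o))) (m+n∸m≡n (length (G .flat y)) (length r'))))) ⟩
          G .run (λ y _ → b u y * g₂ (length r ∸ sz)) r ≡⟨ scaleʳ G (g₂ (length r ∸ sz)) (λ y _ → b u y) r ⟩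
          G .run (λ y _ → b u y) r * g₂ (length r ∸ sz) ∎

    -- Linearity of expectation: a bound for a single pair, uniform in its first component, passes
    -- to the sum over all pairs.
    pair-sum-bound : ∀ b c₁ c₂ q k (g : ℕ → ℕ) V →
      (∀ u r → D .Ok u → V ↭ D .flat u ++ r → c₁ * G .run (λ y _ → b u y) r ≤ c₂ * G .run (λ _ _ → 1) r) →
      c₁ * pair-sum b q k g V ≤ c₂ * pair-sum (λ _ _ → 1) q k g V
    pair-sum-bound b c₁ c₂ q k g V H = begin
      c₁ * pair-sum b q k g V ≡⟨ cong (c₁ *_) (pair-sum-first b q k g V) ⟩
      c₁ * (suc q * (suc k * D .run (λ u r → G .run (λ y _ → b u y) r * w r) V)) ≡⟨ lem c₁ (suc q) (suc k) _ ⟩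
      suc q * (suc k * (c₁ * D .run (λ u r → G .run (λ y _ → b u y) r * w r) V)) ≤⟨ *-monoʳ-≤ (suc q) (*-monoʳ-≤ (suc k) step) ⟩
      suc q * (suc k * (c₂ * D .run (λ u r → G .run (λ _ _ → 1) r * w r) V)) ≡⟨ lem c₂ (suc q) (suc k) _ ⟨
      c₂ * (suc q * (suc k * D .run (λ u r → G .run (λ _ _ → 1) r * w r) V)) ≡⟨ cong (c₂ *_) (pair-sum-first (λ _ _ → 1) q k g V) ⟨
      c₂ * pair-sum (λ _ _ → 1) q k g V ∎
      where
        open ≤-Reasoning
        sz = G .size
        w : List A → ℕ
        w r = fall (length r ∸ sz) (q * D .size) * (fall (length r ∸ sz ∸ q * D .size) (k * sz) * g (length r ∸ sz ∸ q * D .size ∸ k * sz))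
        lem : ∀ a b c d → a * (b * (c * d)) ≡ b * (c * (a * d))
        lem = solve-∀
        step : c₁ * D .run (λ u r → G .run (λ y _ → b u y) r * w r) V ≤ c₂ * D .run (λ u r → G .run (λ _ _ → 1) r * w r) V
        step = ≤-trans (≤-reflexive (≡.sym (D .scale c₁ _ V))) (≤-trans (D .mono V (λ u r o p →
          ≤-trans (≤-reflexive (≡.sym (*-assoc c₁ _ (w r)))) (≤-trans (*-monoˡ-≤ (w r) (H u r o p)) (≤-reflexive (*-assoc c₂ _ (w r)))))) (≤-reflexive (D .scale c₂ _ V)))

  seqs : ∀ {A : Set} → ℕ → Picker A (List A)
  seqs = rep picker

  seqs-commute : ∀ {A : Set} d e → Commute (seqs {A} d) (seqs e)
  seqs-commute d e = commute-reps picker picker pick-pick d e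

  flat-id : (xs : List A) → concatMap (λ x → x ∷ []) xs ≡ xs
  flat-id = concatMap-pure

  -- Each entry occurs in e * fall (n ∸ 1) (e ∸ 1) of the sequences of length e
  remove-one : ∀ e (φ : List A → ℕ) → (∀ l → φ l ≤ 1) → ∀ x r →
    seqs e .run (λ v _ → φ v) (x ∷ r) ≤ seqs e .run (λ v _ → φ v) r + e * fall (length r) (e ∸ 1)
  remove-one zero φ b x r = m≤m+n (φ []) 0
  remove-one (suc e) φ b x r = begin
    seqs e .run (λ v _ → φ (x ∷ v)) r + pick (λ y r' → seqs e .run (λ v _ → φ (y ∷ v)) (x ∷ r')) r ≤⟨ +-mono-≤ first (pick-mono r (λ y r' p → ≤-trans (remove-one e (λ v → φ (y ∷ v)) (λ l → b (y ∷ l)) x r') (+-monoʳ-≤ _ (≤-reflexive (cong (λ n → e * fall (n ∸ 1) (e ∸ 1)) (≡.sym (↭-length p))))))) ⟩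
    fall (length r) e + pick (λ y r' → seqs e .run (λ v _ → φ (y ∷ v)) r' + e * fall (length r ∸ 1) (e ∸ 1)) r ≡⟨ cong (fall (length r) e +_) (≡.trans (pick-add _ _ r) (cong (pick (λ y r' → seqs e .run (λ v _ → φ (y ∷ v)) r') r +_) (pick-const _ r))) ⟩
    fall (length r) e + (seqs (suc e) .run (λ v _ → φ v) r + length r * (e * fall (length r ∸ 1) (e ∸ 1))) ≡⟨ lem (fall (length r) e) (seqs (suc e) .run (λ v _ → φ v) r) (length r * (e * fall (length r ∸ 1) (e ∸ 1))) ⟩
    seqs (suc e) .run (λ v _ → φ v) r + (fall (length r) e + length r * (e * fall (length r ∸ 1) (e ∸ 1))) ≡⟨ cong (λ z → seqs (suc e) .run (λ v _ → φ v) r + (fall (length r) e + z)) (last e) ⟩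
    seqs (suc e) .run (λ v _ → φ v) r + suc e * fall (length r) e ∎
    where
      open ≤-Reasoning
      lem : ∀ a b c → a + (b + c) ≡ b + (a + c)
      lem = solve-∀
      lem2 : ∀ a b c → a * (b * c) ≡ b * (a * c)
      lem2 = solve-∀
      last : ∀ e → length r * (e * fall (length r ∸ 1) (e ∸ 1)) ≡ e * fall (length r) e
      last zero = *-zeroʳ (length r)
      last (suc e) = lem2 (length r) (suc e) _
      first : seqs e .run (λ v _ → φ (x ∷ v)) r ≤ fall (length r) e
      first = ≤-trans (seqs e .mono r (λ v _ _ _ → b (x ∷ v))) (≤-reflexive (≡.trans (const (seqs e) 1 r) (≡.trans (*-identityʳ _) (cong (fall (length r)) (*-identityʳ e)))))

  fall-mono₁ : ∀ n j → fall (n ∸ 1) j ≤ fall n j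
  fall-mono₁ n j = fall-mono j (m∸n≤m n 1)

  remove-many : ∀ e (φ : List A → ℕ) → (∀ l → φ l ≤ 1) → ∀ z r →
    seqs e .run (λ v _ → φ v) (z ++ r) ≤ seqs e .run (λ v _ → φ v) r + length z * (e * fall (length (z ++ r) ∸ 1) (e ∸ 1))
  remove-many e φ b [] r = m≤m+n _ 0
  remove-many e φ b (x ∷ z) r = begin
    seqs e .run (λ v _ → φ v) (x ∷ z ++ r) ≤⟨ remove-one e φ b x (z ++ r) ⟩
    seqs e .run (λ v _ → φ v) (z ++ r) + e * f ≤⟨ +-monoˡ-≤ (e * f) (remove-many e φ b z r) ⟩
    seqs e .run (λ v _ → φ v) r + length z * (e * fall (length (z ++ r) ∸ 1) (e ∸ 1)) + e * f ≤⟨ +-monoˡ-≤ (e * f) (+-monoʳ-≤ _ (*-monoʳ-≤ (length z) (*-monoʳ-≤ e (fall-mono₁ (length (z ++ r)) (e ∸ 1))))) ⟩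
    seqs e .run (λ v _ → φ v) r + length z * (e * f) + e * f ≡⟨ lem _ (length z) (e * f) ⟩
    seqs e .run (λ v _ → φ v) r + (e * f + length z * (e * f)) ∎
    where
      open ≤-Reasoning
      f = fall (length (z ++ r)) (e ∸ 1)
      lem : ∀ a b c → a + b * c + c ≡ a + (c + b * c)
      lem = solve-∀

  seqs-total : ∀ e (r : List A) → seqs e .run (λ _ _ → 1) r ≡ fall (length r) e
  seqs-total e r = ≡.trans (const (seqs e) 1 r) (≡.trans (*-identityʳ _) (cong (fall (length r)) (*-identityʳ e)))

  fall-pred : ∀ n e → 0 < e → fall n e ≡ n * fall (n ∸ 1) (e ∸ 1)
  fall-pred n (suc e) _ = ≡.refl

  -- At most `length z * e * fall (n ∸ 1) (e ∸ 1)` sequences of length `e` use an entry of `z`,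
  -- where `n` is the full length. By the smallness hypothesis this is at most `fall n e` divided by
  -- `M`, one unit of density.
  density-robust : ∀ e τ M (φ : List A → ℕ) → 0 < e → (∀ l → φ l ≤ 1) → ∀ z r →
    suc τ * fall (length (z ++ r)) e ≤ M * seqs e .run (λ v _ → φ v) (z ++ r) → M * (length z * e) ≤ length (z ++ r) →
    τ * fall (length r) e ≤ M * seqs e .run (λ v _ → φ v) r
  density-robust e τ M φ e>0 b z r H small = begin
    τ * fall (length r) e ≤⟨ *-monoʳ-≤ τ (fall-mono e (≤-trans (m≤n+m _ (length z)) (≤-reflexive (≡.sym (length-++ z))))) ⟩
    τ * fall n e ≤⟨ +-cancelˡ-≤ (fall n e) _ _ (begin
      fall n e + τ * fall n e ≤⟨ H ⟩
      M * seqs e .run (λ v _ → φ v) (z ++ r) ≤⟨ *-monoʳ-≤ M (remove-many e φ b z r) ⟩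
      M * (seqs e .run (λ v _ → φ v) r + length z * (e * fall (n ∸ 1) (e ∸ 1))) ≡⟨ lem M _ (length z) e (fall (n ∸ 1) (e ∸ 1)) ⟩
      M * (length z * e) * fall (n ∸ 1) (e ∸ 1) + M * seqs e .run (λ v _ → φ v) r ≤⟨ +-monoˡ-≤ _ (*-monoˡ-≤ (fall (n ∸ 1) (e ∸ 1)) small) ⟩
      n * fall (n ∸ 1) (e ∸ 1) + M * seqs e .run (λ v _ → φ v) r ≡⟨ cong (_+ M * seqs e .run (λ v _ → φ v) r) (fall-pred n e e>0) ⟨
      fall n e + M * seqs e .run (λ v _ → φ v) r ∎) ⟩
    M * seqs e .run (λ v _ → φ v) r ∎
    where
      open ≤-Reasoning
      n = length (z ++ r)
      lem : ∀ M x z e f → M * (x + z * (e * f)) ≡ M * (z * e) * f + M * x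
      lem = solve-∀

  shortfall : (X → ℕ) → ℕ → List X → ℕ
  shortfall φ t Y with t ≤? sum (map φ Y)
  ... | yes _ = 0
  ... | no _ = 1

  -- An exponential moment in which every hit contributes β / (β + 1), scaled by β + 1 per draw to
  -- stay among the natural numbers. The draws are dependent, but by `density-robust` a hit has
  -- conditional probability at least τ / M at each of them.
  module Chernoff {A : Set} (e τ M β : ℕ) (e>0 : 0 < e) (τ≤M : τ ≤ M) (φ : List A → ℕ) (φ≤1 : ∀ l → φ l ≤ 1) where
    weight : List A → ℕ
    weight v = suc β ∸ φ v

    moment : ℕ → List A → ℕ
    moment j r = repRun (seqs e) j (λ Y _ → product (map weight Y)) r

    base : ℕ
    base = M * suc β ∸ τ

    weight-sum : ∀ r → τ * fall (length r) e ≤ M * seqs e .run (λ v _ → φ v) r →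
      M * seqs e .run (λ v _ → weight v) r ≤ base * fall (length r) e
    weight-sum r H = +-cancelˡ-≤ (τ * fall (length r) e) _ _ (begin
      τ * fall (length r) e + M * W ≤⟨ +-monoˡ-≤ (M * W) H ⟩
      M * seqs e .run (λ v _ → φ v) r + M * W ≡⟨ *-distribˡ-+ M _ W ⟨
      M * (seqs e .run (λ v _ → φ v) r + W) ≡⟨ cong (M *_) (≡.sym (seqs e .add _ _ r)) ⟩
      M * seqs e .run (λ v _ → φ v + weight v) r ≡⟨ cong (M *_) (ext′ (seqs e) r (λ v _ → m+[n∸m]≡n (≤-trans (φ≤1 v) (s≤s z≤n)))) ⟩
      M * seqs e .run (λ _ _ → suc β) r ≡⟨ cong (M *_) (≡.trans (const (seqs e) (suc β) r) (cong (λ z → fall (length r) z * suc β) (*-identityʳ e))) ⟩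
      M * (fall (length r) e * suc β) ≡⟨ lem M (fall (length r) e) (suc β) ⟩
      M * suc β * fall (length r) e ≡⟨ cong (_* fall (length r) e) (≡.sym (m+[n∸m]≡n τ≤)) ⟩
      (τ + base) * fall (length r) e ≡⟨ *-distribʳ-+ (fall (length r) e) τ base ⟩
      τ * fall (length r) e + base * fall (length r) e ∎)
      where
        open ≤-Reasoning
        W = seqs e .run (λ v _ → weight v) r
        lem : ∀ a b c → a * (b * c) ≡ a * c * b
        lem = solve-∀
        τ≤ : τ ≤ M * suc β
        τ≤ = ≤-trans τ≤M (m≤m*n M (suc β))

    -- `r₀` is the list before the first draw and `z` is everything drawn since. Each step goes back
    -- to the density of `r₀` and removes all of `z` at once, so that the lost unit is not charged
    -- again at every draw.
    moment-bound : ∀ j r₀ z r → r₀ ↭ z ++ r → suc τ * fall (length r₀) e ≤ M * seqs e .run (λ v _ → φ v) r₀ →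
      M * ((length z + j * e) * e) ≤ length r₀ →
      M ^ j * moment j r ≤ base ^ j * repRun (seqs e) j (λ _ _ → 1) r
    moment-bound zero r₀ z r p H small = ≤-refl
    moment-bound (suc j) r₀ z r p H small = begin
      M * M ^ j * seqs e .run (λ v r' → repRun (seqs e) j (λ Y _ → weight v * product (map weight Y)) r') r
        ≡⟨ cong (M * M ^ j *_) (ext′ (seqs e) r (λ v r' → repScale (seqs e) j (weight v) _ r')) ⟩
      M * M ^ j * seqs e .run (λ v r' → weight v * moment j r') r ≡⟨ ≡.trans (*-assoc M (M ^ j) _) (cong (M *_) (≡.sym (seqs e .scale (M ^ j) _ r))) ⟩
      M * seqs e .run (λ v r' → M ^ j * (weight v * moment j r')) r ≤⟨ *-monoʳ-≤ M (seqs e .mono r inner) ⟩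
      M * seqs e .run (λ v r' → base ^ j * k * weight v) r ≡⟨ cong (M *_) (seqs e .scale (base ^ j * k) _ r) ⟩
      M * (base ^ j * k * seqs e .run (λ v _ → weight v) r) ≡⟨ lem M (base ^ j * k) _ ⟩
      base ^ j * k * (M * seqs e .run (λ v _ → weight v) r) ≤⟨ *-monoʳ-≤ (base ^ j * k) (weight-sum r (density-robust e τ M φ e>0 φ≤1 z r (subst₂' H) (≤-trans (*-monoʳ-≤ M (*-monoˡ-≤ e (m≤m+n (length z) _))) (≤-trans small (≤-reflexive (↭-length p)))))) ⟩
      base ^ j * k * (base * fall (length r) e) ≡⟨ lem2 (base ^ j) k base (fall (length r) e) ⟩
      base * base ^ j * (fall (length r) e * k) ≡⟨ cong (base * base ^ j *_) (≡.sym (≡.trans (repTotal (seqs e) (suc j) (λ _ → 1) r) (≡.trans (*-identityʳ _) (≡.trans (cong (λ x → fall (length r) (x + j * (e * 1))) (*-identityʳ e)) (fall-+ (length r) e (j * (e * 1))))))) ⟩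
      base * base ^ j * repRun (seqs e) (suc j) (λ _ _ → 1) r ∎
      where
        open ≤-Reasoning
        k = fall (length r ∸ e) (j * (e * 1))
        lem : ∀ a b c → a * (b * c) ≡ b * (a * c)
        lem = solve-∀
        lem2 : ∀ a b c d → a * b * (c * d) ≡ c * a * (d * b)
        lem2 = solve-∀
        subst₂' : suc τ * fall (length r₀) e ≤ M * seqs e .run (λ v _ → φ v) r₀ → suc τ * fall (length (z ++ r)) e ≤ M * seqs e .run (λ v _ → φ v) (z ++ r)
        subst₂' h = ≤-trans (≤-reflexive (cong (λ n → suc τ * fall n e) (≡.sym (↭-length p)))) (≤-trans h (≤-reflexive (cong (M *_) (seqs e .resp (λ _ _ → ≡.refl) p))))
        inner : ∀ v r' → seqs e .Ok v → r ↭ seqs e .flat v ++ r' → M ^ j * (weight v * moment j r') ≤ base ^ j * k * weight v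
        inner v r' o p' = begin
          M ^ j * (weight v * moment j r') ≡⟨ lem3 (M ^ j) (weight v) _ ⟩
          M ^ j * moment j r' * weight v ≤⟨ *-monoˡ-≤ (weight v) (moment-bound j r₀ (z ++ f) r' (trans p (trans (++⁺ˡ z p') (↭-reflexive (≡.sym (++-assoc z f r'))))) H
            (≤-trans (≤-reflexive (cong (λ x → M * (x * e)) (≡.trans (cong (_+ j * e) (≡.trans (length-++ z) (cong (length z +_) lf))) (+-assoc (length z) e (j * e))))) small)) ⟩
          base ^ j * repRun (seqs e) j (λ _ _ → 1) r' * weight v ≡⟨ cong (λ x → base ^ j * x * weight v) (≡.trans (repTotal (seqs e) j (λ _ → 1) r') (≡.trans (*-identityʳ _) (cong (λ x → fall x (j * (e * 1))) lr'))) ⟩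
          base ^ j * k * weight v ∎
          where
            f = seqs e .flat v
            lem3 : ∀ a b c → a * (b * c) ≡ a * c * b
            lem3 = solve-∀
            lf : length f ≡ e
            lf = ≡.trans (seqs e .ok-size o) (*-identityʳ e)
            lr' : length r' ≡ length r ∸ e
            lr' = ≡.sym (≡.trans (cong₂ _∸_ (≡.trans (↭-length p') (length-++ f)) (≡.sym lf)) (m+n∸m≡n (length f) (length r')))

    -- At most `c` factors of the product can be the smaller weight `β`.
    shortfall-weight : ∀ Y c → sum (map φ Y) ≤ c → c ≤ length Y → β ^ c * suc β ^ (length Y ∸ c) ≤ product (map weight Y)
    shortfall-weight [] zero _ _ = ≤-refl
    shortfall-weight (v ∷ Y) c h l with φ v | φ≤1 v
    shortfall-weight (v ∷ Y) c h l | zero | _ with c ≤? length Y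
    ... | yes p = begin
      β ^ c * suc β ^ (suc (length Y) ∸ c) ≡⟨ cong (λ z → β ^ c * suc β ^ z) (+-∸-assoc 1 p) ⟩
      β ^ c * (suc β * suc β ^ (length Y ∸ c)) ≡⟨ lem (β ^ c) (suc β) _ ⟩
      suc β * (β ^ c * suc β ^ (length Y ∸ c)) ≤⟨ *-monoʳ-≤ (suc β) (shortfall-weight Y c h p) ⟩
      suc β * product (map weight Y) ∎
      where
        open ≤-Reasoning
        lem : ∀ a b c → a * (b * c) ≡ b * (a * c)
        lem = solve-∀
    ... | no ¬p with c | l
    ... | suc c' | s≤s l' = begin
      β * β ^ c' * suc β ^ (length Y ∸ c') ≡⟨ *-assoc β (β ^ c') _ ⟩
      β * (β ^ c' * suc β ^ (length Y ∸ c')) ≤⟨ *-mono-≤ (n≤1+n β) (shortfall-weight Y c' (≤-trans (sum≤ Y) (s≤s⁻¹ (≰⇒> ¬p))) l') ⟩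
      suc β * product (map weight Y) ∎
      where
        open ≤-Reasoning
        sum≤ : ∀ Y → sum (map φ Y) ≤ length Y
        sum≤ [] = z≤n
        sum≤ (v ∷ Y) = +-mono-≤ (φ≤1 v) (sum≤ Y)
    ... | zero | _ = ⊥-elim (¬p z≤n)
    shortfall-weight (v ∷ Y) (suc c) (s≤s h) (s≤s l) | suc zero | _ = ≤-trans (≤-reflexive (*-assoc β (β ^ c) _)) (*-monoʳ-≤ β (shortfall-weight Y c h l))
    shortfall-weight (v ∷ Y) c h l | suc (suc _) | s≤s ()

    -- Markov's inequality for `moment`.
    shortfall-rare : ∀ s t r → t ≤ s → suc τ * fall (length r) e ≤ M * seqs e .run (λ v _ → φ v) r → M * (s * e * e) ≤ length r →
      M ^ s * (β ^ t * suc β ^ (s ∸ t)) * repRun (seqs e) s (λ Y _ → shortfall φ t Y) r ≤ base ^ s * repRun (seqs e) s (λ _ _ → 1) r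
    shortfall-rare s t r t≤s H small = begin
      M ^ s * w * repRun (seqs e) s (λ Y _ → shortfall φ t Y) r ≡⟨ ≡.trans (*-assoc (M ^ s) w _) (cong (M ^ s *_) (≡.sym (repScale (seqs e) s w _ r))) ⟩
      M ^ s * repRun (seqs e) s (λ Y _ → w * shortfall φ t Y) r ≤⟨ *-monoʳ-≤ (M ^ s) (repMono (seqs e) s r (λ Y _ o _ → term Y (proj₁ o))) ⟩
      M ^ s * moment s r ≤⟨ moment-bound s r [] r refl H small ⟩
      base ^ s * repRun (seqs e) s (λ _ _ → 1) r ∎
      where
        open ≤-Reasoning
        w = β ^ t * suc β ^ (s ∸ t)
        term : ∀ Y → length Y ≡ s → w * shortfall φ t Y ≤ product (map weight Y)
        term Y l with t ≤? sum (map φ Y)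
        ... | yes _ = ≤-trans (≤-reflexive (*-zeroʳ w)) z≤n
        ... | no ¬p = ≤-trans (≤-reflexive (*-identityʳ w)) (subst (λ n → β ^ t * suc β ^ (n ∸ t) ≤ product (map weight Y)) l (shortfall-weight Y t (<⇒≤ (≰⇒> ¬p)) (≤-trans t≤s (≤-reflexive (≡.sym l)))))

-- Random splittings of the vertices: regularity and averaging.

module Structures where

  open Pickers
  open MatchingCounts
  open SwitchingBound
  open RandomDraws
  open import Data.Nat
  open import Data.Nat.Properties
  open import Data.Nat.Tactic.RingSolver using (solve-∀)
  open import Data.Nat.ListAction using (sum; product)
  open import Data.List using (List; []; _∷_; _++_; length; concat; map; take; drop)
  open import Data.List.Properties using (length-++; ++-assoc; length-take; length-drop; take++drop≡id)
  open import Data.List.Relation.Unary.All as All using (All; []; _∷_)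
  open import Data.List.Relation.Binary.Permutation.Propositional using (_↭_; refl; trans; ↭-reflexive)
  open import Data.List.Relation.Binary.Permutation.Propositional.Properties using (↭-length; ++⁺ˡ; ++-comm)
  open import Data.Product using (_,_; proj₁)
  open import Relation.Nullary using (yes)
  open import Relation.Binary.PropositionalEquality as ≡ using (_≡_; cong; cong₂; subst)

  private variable A X Y : Set

  groups : ℕ → ℕ → List X → List (List X)
  groups s zero xs = []
  groups s (suc k) xs = take s xs ∷ groups s k (drop s xs)

  take-exact : ∀ (g xs : List X) → take (length g) (g ++ xs) ≡ g
  take-exact [] xs = ≡.refl
  take-exact (x ∷ g) xs = cong (x ∷_) (take-exact g xs)

  drop-exact : ∀ (g xs : List X) → drop (length g) (g ++ xs) ≡ xs
  drop-exact [] xs = ≡.refl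
  drop-exact (x ∷ g) xs = drop-exact g xs

  groups-concat : ∀ s (Ys : List (List X)) l → All (λ g → length g ≡ s) Ys → groups s (length Ys) (concat Ys ++ l) ≡ Ys
  groups-concat s [] l [] = ≡.refl
  groups-concat s (g ∷ Ys) l (≡.refl ∷ es) rewrite ++-assoc g (concat Ys) l | take-exact g (concat Ys ++ l) | drop-exact g (concat Ys ++ l) = cong (g ∷_) (groups-concat s Ys l es)

  concat-groups : ∀ s k (xs : List X) → concat (groups s k xs) ++ drop (k * s) xs ≡ xs
  concat-groups s zero xs = ≡.refl
  concat-groups s (suc k) xs = begin
    (take s xs ++ concat (groups s k (drop s xs))) ++ drop (s + k * s) xs ≡⟨ ++-assoc (take s xs) _ _ ⟩
    take s xs ++ (concat (groups s k (drop s xs)) ++ drop (s + k * s) xs) ≡⟨ cong (λ z → take s xs ++ (concat (groups s k (drop s xs)) ++ z)) (drop-+ s (k * s) xs) ⟩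
    take s xs ++ (concat (groups s k (drop s xs)) ++ drop (k * s) (drop s xs)) ≡⟨ cong (take s xs ++_) (concat-groups s k (drop s xs)) ⟩
    take s xs ++ drop s xs ≡⟨ take++drop≡id s xs ⟩
    xs ∎
    where
      open ≡.≡-Reasoning
      drop-+ : ∀ {X : Set} a b (xs : List X) → drop (a + b) xs ≡ drop b (drop a xs)
      drop-+ zero b xs = ≡.refl
      drop-+ (suc a) zero [] = ≡.refl
      drop-+ (suc a) (suc b) [] = ≡.refl
      drop-+ (suc a) b (x ∷ xs) = drop-+ a b xs

  length-groups : ∀ s k (xs : List X) → length (groups s k xs) ≡ k
  length-groups s zero xs = ≡.refl
  length-groups s (suc k) xs = cong suc (length-groups s k (drop s xs))

  groups-sizes : ∀ s k (xs : List X) → k * s ≤ length xs → All (λ g → length g ≡ s) (groups s k xs)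
  groups-sizes s zero xs p = []
  groups-sizes s (suc k) xs p = ≡.trans (length-take s xs) (m≤n⇒m⊓n≡m (≤-trans (m≤m+n s (k * s)) p)) ∷
    groups-sizes s k (drop s xs) (≤-trans (≤-reflexive (≡.sym (m+n∸m≡n s (k * s)))) (≤-trans (∸-monoˡ-≤ s p) (≤-reflexive (≡.sym (length-drop s xs)))))

  groups-prefix : ∀ {P : List X → Set} s a b (xs : List X) → All P (groups s (a + b) xs) → All P (groups s a xs)
  groups-prefix s zero b xs ps = []
  groups-prefix s (suc a) b xs (p ∷ ps) = p ∷ groups-prefix s a b (drop s xs) ps

  pick-zero⇒All : (F : X → ℕ) → ∀ xs → pick (λ x _ → F x) xs ≡ 0 → All (λ x → F x ≡ 0) xs
  pick-zero⇒All F [] _ = []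
  pick-zero⇒All F (x ∷ xs) e = m+n≡0⇒m≡0 (F x) e ∷ pick-zero⇒All F xs (m+n≡0⇒n≡0 (F x) e)

  shortfall-zero : (φ : X → ℕ) → ∀ t Y → shortfall φ t Y ≡ 0 → t ≤ sum (map φ Y)
  shortfall-zero φ t Y e with t ≤? sum (map φ Y)
  ... | yes p = p

  -- The number of bad pairs of a vertex and a group is used in place of an indicator of failure:
  -- its mean is found by linearity, and it is at least 1 whenever some pair is bad.
  deficient : (X → Y → ℕ) → ℕ → ℕ → ℕ → List X → List Y → ℕ
  deficient φ t s k us vs = pick (λ u _ → pick (λ Y _ → shortfall (φ u) t Y) (groups s k vs)) us

  -- For `V` of length `q * (d + e)` the two rounds of draws exhaust `V`, so this sums over all its
  -- orderings, each cut into consecutive pieces.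
  structure : ℕ → ℕ → ℕ → (List (List A) → List (List A) → ℕ) → List A → ℕ
  structure d e q H V = repRun (seqs d) q (λ us r → repRun (seqs e) q (λ vs _ → H us vs) r) V

  structure-swap : ∀ d e q (H : List (List A) → List (List A) → ℕ) V → structure d e q H V ≡ structure e d q (λ vs us → H us vs) V
  structure-swap d e q H V = commute-reps (seqs d) (seqs e) (seqs-commute d e) q q (λ us vs _ → H us vs) V

  structure-mono : ∀ d e q {H H' : List (List A) → List (List A) → ℕ} V → (∀ us vs → length us ≡ q → length vs ≡ q → H us vs ≤ H' us vs) → structure d e q H V ≤ structure d e q H' V
  structure-mono d e q V h = repMono (seqs d) q V (λ us r o _ → repMono (seqs e) q r (λ vs _ o' _ → h us vs (proj₁ o) (proj₁ o')))

  structure-add : ∀ d e q (H H' : List (List A) → List (List A) → ℕ) V → structure d e q (λ us vs → H us vs + H' us vs) V ≡ structure d e q H V + structure d e q H' V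
  structure-add d e q H H' V = ≡.trans (ext′ (rep (seqs d) q) V (λ us r → repAdd (seqs e) q (λ vs _ → H us vs) (λ vs _ → H' us vs) r)) (repAdd (seqs d) q _ _ V)

  structure-scale : ∀ d e q c (H : List (List A) → List (List A) → ℕ) V → structure d e q (λ us vs → c * H us vs) V ≡ c * structure d e q H V
  structure-scale d e q c H V = ≡.trans (ext′ (rep (seqs d) q) V (λ us r → repScale (seqs e) q c (λ vs _ → H us vs) r)) (repScale (seqs d) q c _ V)

  structure-total : ∀ d e q (V : List A) → length V ≡ q * (d + e) → structure d e q (λ _ _ → 1) V ≡ (q * (d + e)) !
  structure-total d e q V l = begin
    structure d e q (λ _ _ → 1) V ≡⟨ ext′ (rep (seqs d) q) V (λ us r → ≡.trans (repTotal (seqs e) q (λ _ → 1) r) (*-identityʳ _)) ⟩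
    repRun (seqs d) q (λ us r → fall (length r) (q * (e * 1))) V ≡⟨ repTotal (seqs d) q (λ n → fall n (q * (e * 1))) V ⟩
    fall (length V) (q * (d * 1)) * fall (length V ∸ q * (d * 1)) (q * (e * 1)) ≡⟨ fall-+ (length V) (q * (d * 1)) (q * (e * 1)) ⟨
    fall (length V) (q * (d * 1) + q * (e * 1)) ≡⟨ cong₂ fall l (lem q d e) ⟩
    fall (q * (d + e)) (q * (d + e)) ≡⟨ fall-full (q * (d + e)) ⟩
    (q * (d + e)) ! ∎
    where
      open ≡.≡-Reasoning
      lem : ∀ q d e → q * (d * 1) + q * (e * 1) ≡ q * (d + e)
      lem = solve-∀

  -- Exchangeability reduces the mean to one row and one group drawn first, to which
  -- `shortfall-rare` applies. The ρ columns outside the groups only enter through the number `g` of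
  -- ways to draw them.
  deficient-bound : ∀ {A : Set} (φ : List A → List A → ℕ) d e q' K' s ρ t τ M β V → suc q' ≡ suc K' * s + ρ → 0 < e → τ ≤ M → t ≤ s → (∀ u v → φ u v ≤ 1) →
    (∀ u r → length u ≡ d → V ↭ u ++ r → suc τ * fall (length r) e ≤ M * seqs e .run (λ v _ → φ u v) r) →
    M * (s * e * e) + d ≤ length V →
    M ^ s * (β ^ t * suc β ^ (s ∸ t)) * structure d e (suc q') (deficient φ t s (suc K')) V ≤
    (M * suc β ∸ τ) ^ s * (suc q' * suc K' * structure d e (suc q') (λ _ _ → 1) V)
  deficient-bound {A} φ d e q' K' s ρ t τ M β V q≡ e>0 τ≤M t≤s φ≤1 H small = begin
    c₁ * structure d e q (deficient φ t s K) V ≡⟨ cong (c₁ *_) (regroup (λ us Y → pick (λ u _ → pick (λ Y _ → shortfall (φ u) t Y) Y) us)) ⟩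
    c₁ * pair-sum D G DD GG DG (λ u Y → shortfall (φ u) t Y) q' K' g V ≤⟨ pair-sum-bound D G DD GG DG (λ u Y → shortfall (φ u) t Y) c₁ c₂ q' K' g V rare ⟩
    c₂ * pair-sum D G DD GG DG (λ _ _ → 1) q' K' g V ≡⟨ cong (c₂ *_) (regroup (λ us Y → pick (λ u _ → pick (λ Y _ → 1) Y) us)) ⟨
    c₂ * structure d e q (λ us vs → pick (λ u _ → pick (λ Y _ → 1) (groups s K vs)) us) V ≤⟨ *-monoʳ-≤ c₂ (structure-mono d e q V (λ us vs lu _ → ≤-reflexive (count us vs lu))) ⟩
    c₂ * structure d e q (λ us vs → q * K * 1) V ≡⟨ cong (c₂ *_) (structure-scale d e q (q * K) (λ _ _ → 1) V) ⟩
    c₂ * (q * K * structure d e q (λ _ _ → 1) V) ∎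
    where
      open ≤-Reasoning
      q = suc q'
      K = suc K'
      D = seqs d
      G = rep (seqs e) s
      DD = seqs-commute d d
      GG = commute-reps (seqs e) (seqs e) (seqs-commute e e) s s
      DG = commute-sym G D (commute-rep (seqs e) D (seqs-commute e d) s)
      g : ℕ → ℕ
      g n = fall n (ρ * (e * 1))
      c₁ = M ^ s * (β ^ t * suc β ^ (s ∸ t))
      c₂ = (M * suc β ∸ τ) ^ s
      count : ∀ us vs → length us ≡ q → pick (λ u _ → pick (λ Y _ → 1) (groups s K vs)) us ≡ q * K * 1
      count us vs lu = ≡.trans (pick-const _ us) (≡.trans (cong₂ _*_ lu (≡.trans (pick-const 1 (groups s K vs)) (cong (_* 1) (length-groups s K vs)))) (≡.sym (*-assoc q K 1)))
      regroup : ∀ (F : List (List A) → List (List (List A)) → ℕ) → structure d e q (λ us vs → F us (groups s K vs)) V ≡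
        repRun D q (λ us r → repRun G K (λ Ys r' → F us Ys * g (length r')) r) V
      regroup F = ext′ (rep D q) V (λ us r → ≡.trans (cong (λ n → repRun (seqs e) n (λ vs _ → F us (groups s K vs)) r) q≡) (≡.trans (rep-+ (seqs e) (K * s) ρ _ r) (≡.trans (rep-* (seqs e) K s _ r)
        (ext G' r (λ Ys r' o _ → inner us Ys r' o)))))
        where
          G' = rep G K
          inner : ∀ us Ys r' → G' .Ok Ys → repRun (seqs e) ρ (λ lc _ → F us (groups s K (concat Ys ++ lc))) r' ≡ F us Ys * g (length r')
          inner us Ys r' (lY , oks) = ≡.trans (ext′ (rep (seqs e) ρ) r' (λ lc _ → cong (F us) (≡.trans (cong (λ n → groups s n (concat Ys ++ lc)) (≡.sym lY)) (groups-concat s Ys lc (All.map proj₁ oks)))))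
            (≡.trans (const (rep (seqs e) ρ) (F us Ys) r') (*-comm _ (F us Ys)))
      rare : ∀ u r → D .Ok u → V ↭ D .flat u ++ r → c₁ * G .run (λ Y _ → shortfall (φ u) t Y) r ≤ c₂ * G .run (λ _ _ → 1) r
      rare u r o p = Chernoff.shortfall-rare e τ M β e>0 τ≤M (φ u) (φ≤1 u) s t r t≤s (H u r (proj₁ o) p')
        (+-cancelʳ-≤ d _ _ (≤-trans small (≤-reflexive (≡.trans (↭-length p') (≡.trans (length-++ u) (≡.trans (cong (_+ length r) (proj₁ o)) (+-comm d (length r))))))))
        where
          p' : V ↭ u ++ r
          p' = subst (λ l → V ↭ l ++ r) (flat-id u) p

  deficient-bound⁺ : ∀ {A : Set} (φ : List A → List A → ℕ) d e q K s ρ t τ M β V → 0 < q → 0 < K → q ≡ K * s + ρ → 0 < e → τ ≤ M → t ≤ s → (∀ u v → φ u v ≤ 1) →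
    (∀ u r → length u ≡ d → V ↭ u ++ r → suc τ * fall (length r) e ≤ M * seqs e .run (λ v _ → φ u v) r) →
    M * (s * e * e) + d ≤ length V →
    M ^ s * (β ^ t * suc β ^ (s ∸ t)) * structure d e q (deficient φ t s K) V ≤ (M * suc β ∸ τ) ^ s * (q * K * structure d e q (λ _ _ → 1) V)
  deficient-bound⁺ φ d e (suc q') (suc K') s ρ t τ M β V _ _ = deficient-bound φ d e q' K' s ρ t τ M β V

  module Averaging {A : Set} (edge : List A → ℕ) (edge-↭ : ∀ {xs ys} → xs ↭ ys → edge xs ≡ edge ys) where

    adj : List A → List A → ℕ
    adj u v = edge (u ++ v)

    open Matchings adj

    diagonal : List (List A) → List (List A) → ℕ
    diagonal (u ∷ us) (v ∷ vs) = adj u v * diagonal us vs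
    diagonal _ _ = 1

    all-edges : List (List A) → ℕ
    all-edges ws = product (map edge ws)

    -- The sequences in `vs` are exchangeable, so each of the `c !` bijections between `us` and `vs`
    -- contributes as much as the identity.
    N-average : ∀ e c us r → length us ≡ c → repRun (seqs e) c (λ vs _ → N us vs) r ≡ c ! * repRun (seqs e) c (λ vs _ → diagonal us vs) r
    N-average e zero [] r _ = ≡.refl
    N-average e (suc c) (u ∷ us) r l = begin
      repRun (seqs e) (suc c) (λ vs _ → pick (λ v vs' → adj u v * N us vs') vs) r ≡⟨ rep-pick (seqs e) (seqs-commute e e) c (λ v vs' _ → adj u v * N us vs') r ⟩
      suc c * seqs e .run (λ v r → repRun (seqs e) c (λ vs _ → adj u v * N us vs) r) r ≡⟨ cong (suc c *_) (ext′ (seqs e) r step) ⟩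
      suc c * seqs e .run (λ v r → c ! * repRun (seqs e) c (λ vs _ → adj u v * diagonal us vs) r) r ≡⟨ cong (suc c *_) (seqs e .scale (c !) _ r) ⟩
      suc c * (c ! * repRun (seqs e) (suc c) (λ vs _ → diagonal (u ∷ us) vs) r) ≡⟨ *-assoc (suc c) (c !) _ ⟨
      suc c ! * repRun (seqs e) (suc c) (λ vs _ → diagonal (u ∷ us) vs) r ∎
      where
        open ≡.≡-Reasoning
        lem : ∀ a b c → a * (b * c) ≡ b * (a * c)
        lem = solve-∀
        step : ∀ v r → repRun (seqs e) c (λ vs _ → adj u v * N us vs) r ≡ c ! * repRun (seqs e) c (λ vs _ → adj u v * diagonal us vs) r
        step v r = ≡.trans (repScale (seqs e) c (adj u v) _ r) (≡.trans (cong (adj u v *_) (N-average e c us r (suc-injective l)))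
          (≡.trans (lem (adj u v) (c !) _) (cong (c ! *_) (≡.sym (repScale (seqs e) c (adj u v) _ r)))))

    -- The two rounds of draws are interleaved, so that every piece of size `d` is directly followed
    -- by its partner and the two join to one piece of size `d + e`.
    structure-diagonal : ∀ d e q V → structure d e q diagonal V ≡ repRun (seqs (d + e)) q (λ ws _ → all-edges ws) V
    structure-diagonal d e zero V = ≡.refl
    structure-diagonal d e (suc q) V = begin
      seqs d .run (λ u r → repRun (seqs d) q (λ us r₁ → seqs e .run (λ v r₂ → repRun (seqs e) q (λ vs _ → adj u v * diagonal us vs) r₂) r₁) r) V
        ≡⟨ ext′ (seqs d) V (λ u r → commute-rep (seqs d) (seqs e) (seqs-commute d e) q (λ us v r₂ → repRun (seqs e) q (λ vs _ → adj u v * diagonal us vs) r₂) r) ⟩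
      seqs d .run (λ u r → seqs e .run (λ v r₁ → repRun (seqs d) q (λ us r₂ → repRun (seqs e) q (λ vs _ → adj u v * diagonal us vs) r₂) r₁) r) V
        ≡⟨ ext′ (seqs d) V (λ u r → ext′ (seqs e) r (λ v r₁ → ≡.trans (structure-scale d e q (adj u v) diagonal r₁) (≡.trans (cong (adj u v *_) (structure-diagonal d e q r₁)) (≡.sym (repScale (seqs (d + e)) q (adj u v) _ r₁))))) ⟩
      seqs d .run (λ u r → seqs e .run (λ v r₁ → repRun (seqs (d + e)) q (λ ws _ → edge (u ++ v) * all-edges ws) r₁) r) V
        ≡⟨ rep-+ picker d e (λ w r₁ → repRun (seqs (d + e)) q (λ ws _ → edge w * all-edges ws) r₁) V ⟨
      seqs (d + e) .run (λ w r₁ → repRun (seqs (d + e)) q (λ ws _ → edge w * all-edges ws) r₁) V ∎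
      where open ≡.≡-Reasoning

    structure-N : ∀ d e q V → structure d e q N V ≡ q ! * repRun (seqs (d + e)) q (λ ws _ → all-edges ws) V
    structure-N d e q V = ≡.trans (ext (rep (seqs d) q) V (λ us r o _ → N-average e q us r (proj₁ o))) (≡.trans (repScale (seqs d) q (q !) _ V) (cong (q ! *_) (structure-diagonal d e q V)))

    -- Because e ≤ d, a column `v` can be enlarged by d - e random vertices to a set of size `d`.
    -- The degree hypothesis applies to that set, and the last `e` vertices complete the edge.
    column-density : ∀ d e τ M V → e ≤ d →
      (∀ u r → length u ≡ d → V ↭ u ++ r → τ * fall (length r) e ≤ M * seqs e .run (λ v _ → edge (u ++ v)) r) →
      ∀ v r → length v ≡ e → V ↭ v ++ r → τ * fall (length r) d ≤ M * seqs d .run (λ u _ → edge (u ++ v)) r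
    column-density d e τ M V e≤d H v r lv p = begin
      τ * fall (length r) d ≡⟨ cong (τ *_) (≡.trans (cong (fall (length r)) (≡.sym d≡)) (fall-+ (length r) c e)) ⟩
      τ * (fall (length r) c * fall (length r ∸ c) e) ≡⟨ lem τ (fall (length r) c) _ ⟩
      fall (length r) c * (τ * fall (length r ∸ c) e) ≡⟨ ≡.sym (≡.trans (seqs c .total (λ n → τ * fall n e) r) (cong (λ z → fall (length r) z * (τ * fall (length r ∸ z) e)) (*-identityʳ c))) ⟩
      seqs c .run (λ w r' → τ * fall (length r') e) r ≤⟨ seqs c .mono r inner ⟩
      seqs c .run (λ w r' → M * seqs e .run (λ x _ → edge ((w ++ x) ++ v)) r') r ≡⟨ seqs c .scale M _ r ⟩
      M * seqs c .run (λ w r' → seqs e .run (λ x _ → edge ((w ++ x) ++ v)) r') r ≡⟨ cong (M *_) (≡.sym (rep-+ picker c e (λ u _ → edge (u ++ v)) r)) ⟩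
      M * seqs (c + e) .run (λ u _ → edge (u ++ v)) r ≡⟨ cong (λ z → M * seqs z .run (λ u _ → edge (u ++ v)) r) d≡ ⟩
      M * seqs d .run (λ u _ → edge (u ++ v)) r ∎
      where
        open ≤-Reasoning
        c = d ∸ e
        d≡ : c + e ≡ d
        d≡ = m∸n+n≡m e≤d
        lem : ∀ a b c → a * (b * c) ≡ b * (a * c)
        lem = solve-∀
        inner : ∀ w r' → seqs c .Ok w → r ↭ seqs c .flat w ++ r' → τ * fall (length r') e ≤ M * seqs e .run (λ x _ → edge ((w ++ x) ++ v)) r'
        inner w r' o p' = ≤-trans (H (v ++ w) r' (≡.trans (length-++ v) (≡.trans (cong₂ _+_ lv (proj₁ o)) (≡.trans (+-comm e c) d≡)))
            (trans p (trans (++⁺ˡ v (subst (λ l → r ↭ l ++ r') (flat-id w) p')) (↭-reflexive (≡.sym (++-assoc v w r'))))))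
          (≤-reflexive (cong (M *_) (ext′ (seqs e) r' (λ x _ → edge-↭ (trans (↭-reflexive (++-assoc v w x)) (++-comm v (w ++ x)))))))

-- Tail estimates, and the count of ordered matchings.

module OrderedMatchings where

  open Arithmetic
  open Pickers
  open MatchingCounts
  open EntropyStep
  open GridWalk
  open BalancedGraphs
  open RandomDraws
  open Structures
  open import Data.Nat
  open import Data.Nat.Properties
  open import Data.Nat.Tactic.RingSolver using (solve-∀)
  open import Data.List using (List; []; _∷_; _++_; length; concat; map; drop)
  open import Data.List.Properties using (length-drop)
  open import Data.List.Relation.Unary.All as All using (All; []; _∷_)
  open import Data.List.Relation.Unary.All.Properties using (++⁻ˡ; ++⁻ʳ; concat⁻)
  open import Data.List.Relation.Binary.Permutation.Propositional using (_↭_; refl; trans; ↭-sym; ↭-reflexive)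
  open import Data.List.Relation.Binary.Permutation.Propositional.Properties using (++-comm)
  open import Data.Product using (_,_)
  open import Relation.Binary.PropositionalEquality as ≡ using (_≡_; cong; cong₂; subst)

  bernoulli-general : ∀ n x y → x ^ n * (x + n * y) ≤ (x + y) ^ n * x
  bernoulli-general zero x y = ≤-reflexive (cong (1 *_) (+-identityʳ x))
  bernoulli-general (suc n) x y = begin
    x * x ^ n * (x + suc n * y) ≡⟨ lem1 x (x ^ n) n y ⟩
    x ^ n * (x * (x + suc n * y)) ≤⟨ *-monoʳ-≤ (x ^ n) (≤-trans (m≤m+n _ (n * (y * y))) (≤-reflexive (lem2 x y n))) ⟩
    x ^ n * ((x + y) * (x + n * y)) ≡⟨ lem3 (x ^ n) (x + y) (x + n * y) ⟩
    (x + y) * (x ^ n * (x + n * y)) ≤⟨ *-monoʳ-≤ (x + y) (bernoulli-general n x y) ⟩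
    (x + y) * ((x + y) ^ n * x) ≡⟨ *-assoc (x + y) ((x + y) ^ n) x ⟨
    (x + y) * (x + y) ^ n * x ∎
    where
      open ≤-Reasoning
      lem1 : ∀ x p n y → x * p * (x + suc n * y) ≡ p * (x * (x + suc n * y))
      lem1 = solve-∀
      lem2 : ∀ x y n → x * (x + suc n * y) + n * (y * y) ≡ (x + y) * (x + n * y)
      lem2 = solve-∀
      lem3 : ∀ a b c → a * (b * c) ≡ b * (a * c)
      lem3 = solve-∀

  -- Bernoulli's inequality for the base 1 - 1 / (β + 1), with `w` in place of the difference
  -- `suc β` minus `n`.
  bernoulli-below : ∀ n β w → w + n ≡ suc β → suc β ^ n * w ≤ β ^ n * suc β
  bernoulli-below zero β w e = ≤-reflexive (cong (1 *_) (≡.trans (≡.sym (+-identityʳ w)) e))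
  bernoulli-below (suc n) β w e = begin
    suc β * suc β ^ n * w ≡⟨ lem1 (suc β) (suc β ^ n) w ⟩
    suc β ^ n * (suc β * w) ≤⟨ *-monoʳ-≤ (suc β ^ n) (≤-trans (+-monoˡ-≤ (β * w) w≤β) (≤-reflexive (≡.sym (*-suc β w)))) ⟩
    suc β ^ n * (β * suc w) ≡⟨ lem1' (suc β ^ n) β (suc w) ⟩
    β * (suc β ^ n * suc w) ≤⟨ *-monoʳ-≤ β (bernoulli-below n β (suc w) (≡.trans (≡.sym (+-suc w n)) e)) ⟩
    β * (β ^ n * suc β) ≡⟨ *-assoc β (β ^ n) (suc β) ⟨
    β * β ^ n * suc β ∎
    where
      open ≤-Reasoning
      lem1 : ∀ a b c → a * b * c ≡ b * (a * c)
      lem1 = solve-∀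
      lem1' : ∀ a b c → a * (b * c) ≡ b * (a * c)
      lem1' = solve-∀
      w≤β : w ≤ β
      w≤β = ≤-trans (m≤m+n w n) (≤-reflexive (suc-injective (≡.trans (≡.sym (+-suc w n)) e)))

  -- Bernoulli's inequality on each half of the exponent gives growth quadratic in `g`, which beats
  -- the linear factor.
  exponential-beats-linear : ∀ D c g → 2 * (D * (c * c)) ≤ ⌊ g /2⌋ → 0 < c → D * g * c ^ g ≤ suc c ^ g
  exponential-beats-linear D c g small c>0 = *-cancelʳ-pos (c * c) (*-pos c>0 c>0) (begin
    D * g * c ^ g * (c * c) ≡⟨ lem1 D g (c ^ g) c ⟩
    c ^ g * (D * (c * c) * g) ≤⟨ *-monoʳ-≤ (c ^ g) quad ⟩
    c ^ g * (x * y) ≤⟨ *-monoʳ-≤ (c ^ g) (*-mono-≤ (m≤n+m x c) (m≤n+m y c)) ⟩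
    c ^ g * ((c + x) * (c + y)) ≡⟨ cong (λ z → c ^ z * ((c + x) * (c + y))) (≡.sym (⌊n/2⌋+⌈n/2⌉≡n g)) ⟩
    c ^ (x + y) * ((c + x) * (c + y)) ≡⟨ cong (_* ((c + x) * (c + y))) (^-distribˡ-+-* c x y) ⟩
    c ^ x * c ^ y * ((c + x) * (c + y)) ≡⟨ lem2 (c ^ x) (c ^ y) (c + x) (c + y) ⟩
    c ^ x * (c + x) * (c ^ y * (c + y)) ≤⟨ *-mono-≤ (bernoulli x c) (bernoulli y c) ⟩
    suc c ^ x * c * (suc c ^ y * c) ≡⟨ lem3 (suc c ^ x) c (suc c ^ y) ⟩
    suc c ^ x * suc c ^ y * (c * c) ≡⟨ cong (_* (c * c)) (^-distribˡ-+-* (suc c) x y) ⟨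
    suc c ^ (x + y) * (c * c) ≡⟨ cong (λ z → suc c ^ z * (c * c)) (⌊n/2⌋+⌈n/2⌉≡n g) ⟩
    suc c ^ g * (c * c) ∎)
    where
      open ≤-Reasoning
      x = ⌊ g /2⌋
      y = ⌈ g /2⌉
      lem1 : ∀ D g p c → D * g * p * (c * c) ≡ p * (D * (c * c) * g)
      lem1 = solve-∀
      lem2 : ∀ a b c d → a * b * (c * d) ≡ a * c * (b * d)
      lem2 = solve-∀
      lem3 : ∀ a c b → a * c * (b * c) ≡ a * b * (c * c)
      lem3 = solve-∀
      lem4 : ∀ a y → a * (y + y) ≡ 2 * a * y
      lem4 = solve-∀
      quad : D * (c * c) * g ≤ x * y
      quad = begin
        D * (c * c) * g ≡⟨ cong (D * (c * c) *_) (⌊n/2⌋+⌈n/2⌉≡n g) ⟨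
        D * (c * c) * (x + y) ≤⟨ *-monoʳ-≤ (D * (c * c)) (+-monoˡ-≤ y (⌊n/2⌋≤⌈n/2⌉ g)) ⟩
        D * (c * c) * (y + y) ≡⟨ lem4 (D * (c * c)) y ⟩
        2 * (D * (c * c)) * y ≤⟨ *-monoˡ-≤ y small ⟩
        x * y ∎

  -- A block of `M` draws, with B = β + 1: the moment is about 1 - (τ + 1) / B and the threshold
  -- weight about 1 - τ / B. The unit between them yields a gain of 1 + 1 / (2B); the condition on β
  -- keeps the second-order term τ (τ + 1) / B² at no more than half of 1 / B.
  tail-factor : ∀ M τ β → suc τ ≤ M → 2 * (suc τ * τ) ≤ suc β →
    (M * suc β ∸ suc τ) ^ M * (2 * suc β + 1) ≤ M ^ M * (β ^ τ * suc β ^ (M ∸ τ)) * (2 * suc β)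
  tail-factor M τ β τ<M big = *-cancelʳ-pos (B * B) z<s (begin
    X * (2 * B + 1) * (B * B) ≡⟨ l1 X B ⟩
    X * B * ((2 * B + 1) * B) ≤⟨ *-monoʳ-≤ (X * B) inner ⟩
    X * B * (2 * ((B + suc τ) * w)) ≡⟨ l2 X B (B + suc τ) w ⟩
    X * (B + suc τ) * (w * (2 * B)) ≤⟨ *-monoˡ-≤ (w * (2 * B)) first ⟩
    (M * B) ^ M * B * (w * (2 * B)) ≡⟨ cong (λ z → z * B * (w * (2 * B))) (≡.trans (^-distrib-* M B M) (cong (λ z → M ^ M * B ^ z) (≡.sym (m∸n+n≡m (<⇒≤ τ<M))))) ⟩
    M ^ M * B ^ (M ∸ τ + τ) * B * (w * (2 * B)) ≡⟨ cong (λ z → M ^ M * z * B * (w * (2 * B))) (^-distribˡ-+-* B (M ∸ τ) τ) ⟩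
    M ^ M * (B ^ (M ∸ τ) * B ^ τ) * B * (w * (2 * B)) ≡⟨ l3 (M ^ M) (B ^ (M ∸ τ)) (B ^ τ) B w ⟩
    M ^ M * B ^ (M ∸ τ) * (B ^ τ * w) * (2 * B * B) ≤⟨ *-monoˡ-≤ (2 * B * B) (*-monoʳ-≤ (M ^ M * B ^ (M ∸ τ)) (bernoulli-below τ β w wτ)) ⟩
    M ^ M * B ^ (M ∸ τ) * (β ^ τ * B) * (2 * B * B) ≡⟨ l4 (M ^ M) (B ^ (M ∸ τ)) (β ^ τ) B ⟩
    M ^ M * (β ^ τ * B ^ (M ∸ τ)) * (2 * B) * (B * B) ∎)
    where
      open ≤-Reasoning
      B = suc β
      w = B ∸ τ
      x = M * B ∸ suc τ
      X = x ^ M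
      τ≤B : τ ≤ B
      τ≤B = ≤-trans (m≤m*n' τ) big
        where
          m≤m*n' : ∀ τ → τ ≤ 2 * (suc τ * τ)
          m≤m*n' τ = ≤-trans (m≤m+n τ _) (≤-reflexive (l τ))
            where
              l : ∀ τ → τ + (τ + 2 * (τ * τ)) ≡ 2 * (suc τ * τ)
              l = solve-∀
      wτ : w + τ ≡ B
      wτ = m∸n+n≡m τ≤B
      1+τ<MB : suc τ ≤ M * B
      1+τ<MB = ≤-trans τ<M (m≤m*n M B)
      xτ : x + suc τ ≡ M * B
      xτ = m∸n+n≡m 1+τ<MB
      l1 : ∀ X B → X * (2 * B + 1) * (B * B) ≡ X * B * ((2 * B + 1) * B)
      l1 = solve-∀
      l2 : ∀ X B c w → X * B * (2 * (c * w)) ≡ X * c * (w * (2 * B))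
      l2 = solve-∀
      l3 : ∀ a b c B w → a * (b * c) * B * (w * (2 * B)) ≡ a * b * (c * w) * (2 * B * B)
      l3 = solve-∀
      l4 : ∀ a b c B → a * b * (c * B) * (2 * B * B) ≡ a * (c * b) * (2 * B) * (B * B)
      l4 = solve-∀
      inner : (2 * B + 1) * B ≤ 2 * ((B + suc τ) * w)
      inner = +-cancelʳ-≤ (2 * ((B + suc τ) * τ)) _ _ (begin
        (2 * B + 1) * B + 2 * ((B + suc τ) * τ) ≡⟨ l5 B τ ⟩
        2 * (B * B) + B + 2 * (B * τ) + 2 * (suc τ * τ) ≤⟨ +-monoʳ-≤ (2 * (B * B) + B + 2 * (B * τ)) big ⟩
        2 * (B * B) + B + 2 * (B * τ) + B ≡⟨ l6 B τ ⟩
        2 * ((B + suc τ) * B) ≡⟨ cong (λ z → 2 * ((B + suc τ) * z)) (≡.sym wτ) ⟩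
        2 * ((B + suc τ) * (w + τ)) ≡⟨ l7 (B + suc τ) w τ ⟩
        2 * ((B + suc τ) * w) + 2 * ((B + suc τ) * τ) ∎)
        where
          l5 : ∀ B τ → (2 * B + 1) * B + 2 * ((B + suc τ) * τ) ≡ 2 * (B * B) + B + 2 * (B * τ) + 2 * (suc τ * τ)
          l5 = solve-∀
          l6 : ∀ B τ → 2 * (B * B) + B + 2 * (B * τ) + B ≡ 2 * ((B + suc τ) * B)
          l6 = solve-∀
          l7 : ∀ a w τ → 2 * (a * (w + τ)) ≡ 2 * (a * w) + 2 * (a * τ)
          l7 = solve-∀
      first : X * (B + suc τ) ≤ (M * B) ^ M * B
      first with x in eq
      ... | zero = ≤-trans (≤-reflexive (cong (_* (B + suc τ)) (zero^ M (≤-trans z<s τ<M)))) z≤n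
        where
          zero^ : ∀ M → 0 < M → 0 ^ M ≡ 0
          zero^ (suc M) _ = ≡.refl
      ... | x₁@(suc _) = *-cancelʳ-pos x₁ z<s (begin
        x₁ ^ M * (B + suc τ) * x₁ ≡⟨ *-assoc (x₁ ^ M) (B + suc τ) x₁ ⟩
        x₁ ^ M * ((B + suc τ) * x₁) ≤⟨ *-monoʳ-≤ (x₁ ^ M) (begin
          (B + suc τ) * x₁ ≡⟨ *-distribʳ-+ x₁ B (suc τ) ⟩
          B * x₁ + suc τ * x₁ ≤⟨ +-monoʳ-≤ (B * x₁) (*-monoʳ-≤ (suc τ) (≤-trans (m≤m+n x₁ (suc τ)) (≤-reflexive (≡.trans (cong (_+ suc τ) (≡.sym eq)) xτ)))) ⟩
          B * x₁ + suc τ * (M * B) ≡⟨ l8 B x₁ (suc τ) M ⟩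
          B * (x₁ + M * suc τ) ∎) ⟩
        x₁ ^ M * (B * (x₁ + M * suc τ)) ≡⟨ l9 (x₁ ^ M) B (x₁ + M * suc τ) ⟩
        B * (x₁ ^ M * (x₁ + M * suc τ)) ≤⟨ *-monoʳ-≤ B (bernoulli-general M x₁ (suc τ)) ⟩
        B * ((x₁ + suc τ) ^ M * x₁) ≡⟨ cong (λ z → B * (z ^ M * x₁)) (≡.trans (cong (_+ suc τ) (≡.sym eq)) xτ) ⟩
        B * ((M * B) ^ M * x₁) ≡⟨ l10 B ((M * B) ^ M) x₁ ⟩
        (M * B) ^ M * B * x₁ ∎)
        where
          l8 : ∀ B x t M → B * x + t * (M * B) ≡ B * (x + M * t)
          l8 = solve-∀
          l9 : ∀ a b c → a * (b * c) ≡ b * (a * c)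
          l9 = solve-∀
          l10 : ∀ a b c → a * (b * c) ≡ b * a * c
          l10 = solve-∀

  -- The gains of `g` blocks multiply. `D` will be four times the number of pairs in the union
  -- bound, and `exponential-beats-linear` supplies the hypothesis on it.
  tail-small : ∀ M τ β g D → suc τ ≤ M → 2 * (suc τ * τ) ≤ suc β → D * (2 * suc β) ^ g ≤ (2 * suc β + 1) ^ g →
    D * (M * suc β ∸ suc τ) ^ (M * g) ≤ M ^ (M * g) * (β ^ (τ * g) * suc β ^ (M * g ∸ τ * g))
  tail-small M τ β g D τ<M big exp = *-cancelʳ-pos ((2 * suc β + 1) ^ g) (^-pos (2 * suc β + 1) g (m≤n+m 1 (2 * suc β))) (begin
    D * (M * suc β ∸ suc τ) ^ (M * g) * (2 * suc β + 1) ^ g ≡⟨ cong (λ z → D * z * (2 * suc β + 1) ^ g) (^-*-assoc (M * suc β ∸ suc τ) M g) ⟨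
    D * X ^ g * (2 * suc β + 1) ^ g ≡⟨ ≡.trans (*-assoc D (X ^ g) _) (cong (D *_) (≡.sym (^-distrib-* X (2 * suc β + 1) g))) ⟩
    D * (X * (2 * suc β + 1)) ^ g ≤⟨ *-monoʳ-≤ D (^-monoˡ-≤ g (tail-factor M τ β τ<M big)) ⟩
    D * (Y * (2 * suc β)) ^ g ≡⟨ cong (D *_) (^-distrib-* Y (2 * suc β) g) ⟩
    D * (Y ^ g * (2 * suc β) ^ g) ≡⟨ lem D (Y ^ g) ((2 * suc β) ^ g) ⟩
    Y ^ g * (D * (2 * suc β) ^ g) ≤⟨ *-monoʳ-≤ (Y ^ g) exp ⟩
    Y ^ g * (2 * suc β + 1) ^ g ≡⟨ cong (_* (2 * suc β + 1) ^ g) Yg ⟩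
    M ^ (M * g) * (β ^ (τ * g) * suc β ^ (M * g ∸ τ * g)) * (2 * suc β + 1) ^ g ∎)
    where
      open ≤-Reasoning
      X = (M * suc β ∸ suc τ) ^ M
      Y = M ^ M * (β ^ τ * suc β ^ (M ∸ τ))
      lem : ∀ a b c → a * (b * c) ≡ b * (a * c)
      lem = solve-∀
      Yg : Y ^ g ≡ M ^ (M * g) * (β ^ (τ * g) * suc β ^ (M * g ∸ τ * g))
      Yg = ≡.trans (^-distrib-* (M ^ M) _ g) (cong₂ _*_ (^-*-assoc M M g) (≡.trans (^-distrib-* (β ^ τ) _ g)
        (cong₂ _*_ (^-*-assoc β τ g) (≡.trans (^-*-assoc (suc β) (M ∸ τ) g) (cong (suc β ^_) (*-distribʳ-∸ g M τ))))))

  -- Two of the 2 + τ units in `density` are spent before the matchings are counted: one because the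
  -- draws are made without replacement, the other as the gap between the mean and the threshold t =
  -- τ g of the tail estimate.
  module Counting {A : Set} (edge : List A → ℕ) (edge≤1 : ∀ l → edge l ≤ 1) (edge-↭ : ∀ {xs ys} → xs ↭ ys → edge xs ≡ edge ys)
    (d e : ℕ) (e>0 : 0 < e) (e≤d : e ≤ d)
    (M τ g H h i c b ρ β q K : ℕ) (q>0 : 0 < q) (K>0 : 0 < K)
    (2≤M : 2 ≤ M) (τ<M : suc τ ≤ M) (M+2≤2τ : M + 2 ≤ 2 * τ) (g>0 : 0 < g) (h>0 : 0 < h)
    (i+h : i + h ≡ h * H) (ρ≤ : ρ ≤ h * (M * g)) (3M+2≤2H : 3 * M + 2 ≤ 2 * H)
    (8Mb≤H : 8 * M * b ≤ H) (b-bound : 16 * H * M ≤ 2 ^ b) (c-bound : 4 * M ≤ 2 ^ c)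
    (h²≥ : c * (M * 8) * (h * H) ≤ h * h) (K-large : c * M * (M * 8) ≤ 2 * (h * H)) (4M≤K : 4 * M ≤ h * H)
    (K≡ : K ≡ h * H) (q≡ : q ≡ K * (M * g) + ρ) (β-large : 2 * (suc τ * τ) ≤ suc β)
    (g-large : 4 * (q * K) * (2 * suc β) ^ g ≤ (2 * suc β + 1) ^ g)
    (V : List A) (V-length : length V ≡ q * (d + e))
    (small-e : M * (M * g * e * e) + d ≤ length V) (small-d : M * (M * g * d * d) + e ≤ length V)
    (density : ∀ u r → length u ≡ d → V ↭ u ++ r → (2 + τ) * fall (length r) e ≤ M * seqs e .run (λ v _ → edge (u ++ v)) r)
    where

    open Averaging edge edge-↭
    open Matchings adj
    open Degrees adj

    private
      s t Q : ℕ
      s = M * g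
      t = τ * g
      Q = q ! * (τ ∸ 2) ^ q
      S : (List (List A) → List (List A) → ℕ) → List A → ℕ
      S = structure d e q
      rowsBad colsBad : List (List A) → List (List A) → ℕ
      rowsBad us vs = deficient adj t s K us vs
      colsBad us vs = deficient (λ v u → adj u v) t s K vs us

    open ≤-Reasoning

    -- The bad pairs are counted for all vertices against all groups of the other side. Their
    -- absence thus gives the grid and also the degrees of the omitted rows and of the ρ leftover
    -- columns.
    many-if-regular : ∀ us vs → length us ≡ q → length vs ≡ q → rowsBad us vs ≡ 0 → colsBad us vs ≡ 0 → 2 * Q ≤ M ^ q * N us vs
    many-if-regular us vs lu lv rb cb = begin
      2 * (q ! * (τ ∸ 2) ^ q) ≡⟨ cong (λ z → 2 * (z ! * (τ ∸ 2) ^ z)) q≡' ⟩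
      2 * ((h * H * s + ρ) ! * (τ ∸ 2) ^ (h * H * s + ρ)) ≤⟨ Balanced.many-matchings adj (λ u v → edge≤1 (u ++ v)) M τ g H h i c b ρ 2≤M (<⇒≤ τ<M) M+2≤2τ g>0 h>0 i+h ρ≤ 3M+2≤2H 8Mb≤H b-bound c-bound h²≥ K-large 4M≤K
          Xs extra Ys lc G (length-groups s i us) (≡.trans (length-groups s K vs) K≡) le llc rowsOk colsOk ⟩
      M ^ (h * H * s + ρ) * N (extra ++ concat Xs) (concat Ys ++ lc) ≡⟨ cong₂ _*_ (cong (M ^_) (≡.sym q≡')) (≡.trans (N-rows (↭-sym us≡) (concat Ys ++ lc)) (cong (N us) vs≡)) ⟩
      M ^ q * N us vs ∎
      where
        q≡' : q ≡ h * H * s + ρ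
        q≡' = ≡.trans q≡ (cong (λ z → z * s + ρ) K≡)
        K≡i+h : K ≡ i + h
        K≡i+h = ≡.trans K≡ (≡.sym i+h)
        Xs = groups s i us
        extra = drop (i * s) us
        Ys = groups s K vs
        lc = drop (K * s) vs
        us≡ : us ↭ extra ++ concat Xs
        us≡ = trans (↭-reflexive (≡.sym (concat-groups s i us))) (++-comm (concat Xs) extra)
        vs≡ : concat Ys ++ lc ≡ vs
        vs≡ = concat-groups s K vs
        Ks≤q : K * s ≤ q
        Ks≤q = ≤-trans (m≤m+n (K * s) ρ) (≤-reflexive (≡.sym q≡))
        is≤q : i * s ≤ q
        is≤q = ≤-trans (*-monoˡ-≤ s (≤-trans (m≤m+n i h) (≤-reflexive (≡.sym K≡i+h)))) Ks≤q
        le : length extra ≡ h * s + ρ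
        le = ≡.trans (length-drop (i * s) us) (≡.trans (cong (_∸ i * s) (≡.trans lu (≡.trans q≡ (≡.trans (cong (λ z → z * s + ρ) K≡i+h) (lem i h s ρ))))) (m+n∸m≡n (i * s) (h * s + ρ)))
          where
            lem : ∀ i h s ρ → (i + h) * s + ρ ≡ i * s + (h * s + ρ)
            lem = solve-∀
        llc : length lc ≡ ρ
        llc = ≡.trans (length-drop (K * s) vs) (≡.trans (cong (_∸ K * s) (≡.trans lv q≡)) (m+n∸m≡n (K * s) ρ))
        rowAll : All (λ u → All (λ Y → t ≤ row-degree Y u) Ys) us
        rowAll = All.map (λ {u} z → All.map (λ {Y} → shortfall-zero (adj u) t Y) (pick-zero⇒All (λ Y → shortfall (adj u) t Y) Ys z)) (pick-zero⇒All _ us rb)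
        colAll : All (λ v → All (λ X → t ≤ column-degree X v) (groups s K us)) vs
        colAll = All.map (λ {v} z → All.map (λ {X} → shortfall-zero (λ u → adj u v) t X) (pick-zero⇒All (λ X → shortfall (λ u → adj u v) t X) (groups s K us) z)) (pick-zero⇒All _ vs cb)
        colAll' : All (λ v → All (λ X → t ≤ column-degree X v) Xs) vs
        colAll' = All.map (λ {v} z → groups-prefix s i h us (subst (λ k → All (λ X → t ≤ column-degree X v) (groups s k us)) K≡i+h z)) colAll
        rowAllXs : All (All (λ u → All (λ Y → t ≤ row-degree Y u) Ys)) Xs
        rowAllXs = concat⁻ (++⁻ˡ (concat Xs) (subst (All _) (≡.sym (concat-groups s i us)) rowAll))
        colAllYs : All (All (λ v → All (λ X → t ≤ column-degree X v) Xs)) Ys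
        colAllYs = concat⁻ (++⁻ˡ (concat Ys) (subst (All _) (≡.sym vs≡) colAll'))
        flip-rows : ∀ X Ys → All (λ u → All (λ Y → t ≤ row-degree Y u) Ys) X → All (λ Y → All (λ u → t ≤ row-degree Y u) X) Ys
        flip-rows X [] p = []
        flip-rows X (Y ∷ Ys) p = All.map All.head p ∷ flip-rows X Ys (All.map All.tail p)
        flip-columns : ∀ Xs Ys → All (All (λ v → All (λ X → t ≤ column-degree X v) Xs)) Ys → All (λ X → All (All (λ v → t ≤ column-degree X v)) Ys) Xs
        flip-columns [] Ys p = []
        flip-columns (X ∷ Xs) Ys p = All.map (All.map All.head) p ∷ flip-columns Xs Ys (All.map (All.map All.tail) p)
        G : Grid s t Xs Ys
        G = grid (groups-sizes s i us (≤-trans is≤q (≤-reflexive (≡.sym lu)))) (groups-sizes s K vs (≤-trans Ks≤q (≤-reflexive (≡.sym lv))))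
          (All.zipWith (λ { {X} (p , p') → All.zipWith (λ { (x , y) → x , y }) (flip-rows X Ys p , p') }) (rowAllXs , flip-columns Xs Ys colAllYs))
        sum-rows : ∀ u Ys → All (λ Y → t ≤ row-degree Y u) Ys → length Ys * t ≤ row-degree (concat Ys) u
        sum-rows u [] [] = z≤n
        sum-rows u (Y ∷ Ys) (p ∷ ps) = ≤-trans (+-mono-≤ p (sum-rows u Ys ps)) (≤-reflexive (≡.sym (row-degree-++ Y (concat Ys) u)))
        sum-columns : ∀ v Xs → All (λ X → t ≤ column-degree X v) Xs → length Xs * t ≤ column-degree (concat Xs) v
        sum-columns v [] [] = z≤n
        sum-columns v (X ∷ Xs) (p ∷ ps) = ≤-trans (+-mono-≤ p (sum-columns v Xs ps)) (≤-reflexive (≡.sym (column-degree-++ X (concat Xs) v)))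
        rowsOk : All (λ u → h * H * t ≤ row-degree (concat Ys) u) extra
        rowsOk = All.map (λ {u} p → ≤-trans (≤-reflexive (cong (_* t) (≡.sym (≡.trans (length-groups s K vs) K≡)))) (sum-rows u Ys p)) (++⁻ʳ (concat Xs) (subst (All _) (≡.sym (concat-groups s i us)) rowAll))
        colsOk : All (λ w → i * t ≤ column-degree (concat Xs) w) (concat Ys ++ lc)
        colsOk = subst (All _) (≡.sym vs≡) (All.map (λ {v} p → ≤-trans (≤-reflexive (cong (_* t) (≡.sym (length-groups s i us)))) (sum-columns v Xs p)) colAll')

    -- The numbers of bad pairs are integers, so a single bad pair already makes the last summand at
    -- least `2 * Q`.
    many-or-bad : ∀ us vs → length us ≡ q → length vs ≡ q → 2 * Q * 1 ≤ M ^ q * N us vs + 2 * Q * (rowsBad us vs + colsBad us vs)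
    many-or-bad us vs lu lv = either (rowsBad us vs) (colsBad us vs) (2 * Q) (M ^ q * N us vs) (many-if-regular us vs lu lv)
      where
        either : ∀ x y a m → (x ≡ 0 → y ≡ 0 → a ≤ m) → a * 1 ≤ m + a * (x + y)
        either zero zero a m f = ≤-trans (≤-reflexive (*-identityʳ a)) (≤-trans (f ≡.refl ≡.refl) (m≤m+n m _))
        either zero (suc y) a m f = ≤-trans (*-monoʳ-≤ a (s≤s z≤n)) (m≤n+m _ m)
        either (suc x) y a m f = ≤-trans (*-monoʳ-≤ a (s≤s z≤n)) (m≤n+m _ m)

    private
      quarter : ∀ c₁ c₂ B T → 0 < c₁ → c₁ * B ≤ c₂ * (q * K * T) → 4 * (q * K) * c₂ ≤ c₁ → 4 * B ≤ T
      quarter c₁ c₂ B T p h₁ h₂ = *-cancelˡ-pos c₁ p (begin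
        c₁ * (4 * B) ≡⟨ l1 c₁ B ⟩
        4 * (c₁ * B) ≤⟨ *-monoʳ-≤ 4 h₁ ⟩
        4 * (c₂ * (q * K * T)) ≡⟨ l2 c₂ (q * K) T ⟩
        4 * (q * K) * c₂ * T ≤⟨ *-monoˡ-≤ T h₂ ⟩
        c₁ * T ∎)
        where
          l1 : ∀ a b → a * (4 * b) ≡ 4 * (a * b)
          l1 = solve-∀
          l2 : ∀ a b c → 4 * (a * (b * c)) ≡ 4 * b * a * c
          l2 = solve-∀
      c₁ c₂ : ℕ
      c₁ = M ^ s * (β ^ t * suc β ^ (s ∸ t))
      c₂ = (M * suc β ∸ suc τ) ^ s
      rare : 4 * (q * K) * c₂ ≤ c₁
      rare = tail-small M τ β g (4 * (q * K)) τ<M β-large g-large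
      β>0 : 0 < β
      β>0 = s≤s⁻¹ (≤-trans (*-monoʳ-≤ 2 (*-mono-≤ (s≤s (z≤n {τ})) τ>0)) β-large)
        where
          τ>0 : 1 ≤ τ
          τ>0 = pos τ (≤-trans (m≤n+m 2 M) M+2≤2τ)
            where
              pos : ∀ τ → 2 ≤ 2 * τ → 1 ≤ τ
              pos (suc τ) _ = s≤s z≤n
      c₁>0 : 0 < c₁
      c₁>0 = *-pos (^-pos M s (≤-trans z<s 2≤M)) (*-pos (^-pos β t β>0) (^-pos (suc β) (s ∸ t) z<s))
      t≤s : t ≤ s
      t≤s = *-monoˡ-≤ g (<⇒≤ τ<M)
      rows-rare : 4 * S rowsBad V ≤ S (λ _ _ → 1) V
      rows-rare = quarter c₁ c₂ (S rowsBad V) (S (λ _ _ → 1) V) c₁>0 (deficient-bound⁺ adj d e q K s ρ t (suc τ) M β V q>0 K>0 q≡ e>0 τ<M t≤s (λ u v → edge≤1 (u ++ v)) density small-e) rare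
      -- By `structure-swap` the columns may be drawn first, which turns this into the row estimate
      -- with `d` and `e` interchanged; `column-density` provides its hypothesis.
      columns-rare : 4 * S colsBad V ≤ S (λ _ _ → 1) V
      columns-rare = ≤-trans (≤-reflexive (cong (4 *_) (structure-swap d e q colsBad V))) (≤-trans
        (quarter c₁ c₂ (structure e d q (λ vs us → colsBad us vs) V) (structure e d q (λ _ _ → 1) V) c₁>0 (deficient-bound⁺ (λ v u → adj u v) e d q K s ρ t (suc τ) M β V q>0 K>0 q≡ (≤-trans e>0 e≤d) τ<M t≤s (λ v u → edge≤1 (u ++ v)) (column-density d e (2 + τ) M V e≤d density) small-d) rare)
        (≤-reflexive (≡.sym (structure-swap d e q (λ _ _ → 1) V))))

    -- Both numbers of bad pairs have mean at most 1/4. Hence they consume at most half of the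
    -- `2 * Q` granted by `many-matchings`.
    many-orderings : (τ ∸ 2) ^ q * (q * (d + e)) ! ≤ M ^ q * repRun (seqs (d + e)) q (λ ws _ → all-edges ws) V
    many-orderings = *-cancelˡ-pos (q !) (!-pos q) (begin
      q ! * ((τ ∸ 2) ^ q * (q * (d + e)) !) ≡⟨ *-assoc (q !) _ _ ⟨
      Q * (q * (d + e)) ! ≡⟨ cong (Q *_) (≡.sym (structure-total d e q V V-length)) ⟩
      Q * T ≤⟨ +-cancelʳ-≤ (Q * T) _ _ (begin
        Q * T + Q * T ≡⟨ l1 Q T ⟩
        2 * Q * T ≡⟨ structure-scale d e q (2 * Q) (λ _ _ → 1) V ⟨
        S (λ _ _ → 2 * Q * 1) V ≤⟨ structure-mono d e q V many-or-bad ⟩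
        S (λ us vs → M ^ q * N us vs + 2 * Q * (rowsBad us vs + colsBad us vs)) V ≡⟨ ≡.trans (structure-add d e q _ _ V) (cong₂ _+_ (structure-scale d e q (M ^ q) N V) (≡.trans (structure-scale d e q (2 * Q) _ V) (cong (2 * Q *_) (structure-add d e q rowsBad colsBad V)))) ⟩
        M ^ q * S N V + 2 * Q * (S rowsBad V + S colsBad V) ≤⟨ +-monoʳ-≤ (M ^ q * S N V) few ⟩
        M ^ q * S N V + Q * T ∎) ⟩
      M ^ q * S N V ≡⟨ cong (M ^ q *_) (structure-N d e q V) ⟩
      M ^ q * (q ! * repRun (seqs (d + e)) q (λ ws _ → all-edges ws) V) ≡⟨ l2 (M ^ q) (q !) _ ⟩
      q ! * (M ^ q * repRun (seqs (d + e)) q (λ ws _ → all-edges ws) V) ∎)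
      where
        T = S (λ _ _ → 1) V
        l1 : ∀ a b → a * b + a * b ≡ 2 * a * b
        l1 = solve-∀
        l2 : ∀ a b c → a * (b * c) ≡ b * (a * c)
        l2 = solve-∀
        l3 : ∀ Q x y → 2 * (2 * Q * (x + y)) ≡ Q * (4 * x + 4 * y)
        l3 = solve-∀
        l4 : ∀ Q T → Q * (T + T) ≡ 2 * (Q * T)
        l4 = solve-∀
        few : 2 * Q * (S rowsBad V + S colsBad V) ≤ Q * T
        few = *-cancelˡ-≤ 2 (begin
          2 * (2 * Q * (S rowsBad V + S colsBad V)) ≡⟨ l3 Q (S rowsBad V) (S colsBad V) ⟩
          Q * (4 * S rowsBad V + 4 * S colsBad V) ≤⟨ *-monoʳ-≤ Q (+-mono-≤ rows-rare columns-rare) ⟩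
          Q * (T + T) ≡⟨ l4 Q T ⟩
          2 * (Q * T) ∎)

-- Choice of the parameters.

module Parameters where

  open Arithmetic
  open Pickers
  open RandomDraws
  open Structures
  open OrderedMatchings
  open import Data.Nat
  open import Data.Nat.Properties
  open import Data.Nat.DivMod using (_/_; _%_; m≡m%n+[m/n]*n; m%n<n; m*n/n≡m; /-mono-≤)
  open import Data.Nat.Tactic.RingSolver using (solve-∀)
  open import Data.List using (List; _++_; length)
  open import Data.List.Relation.Binary.Permutation.Propositional using (_↭_)
  open import Relation.Binary.PropositionalEquality as ≡ using (_≡_; cong)

  n≤2^n : ∀ n → n ≤ 2 ^ n
  n≤2^n zero = z≤n
  n≤2^n (suc n) = ≤-trans (+-mono-≤ (^-pos 2 n z<s) (n≤2^n n)) (≤-reflexive (cong (2 ^ n +_) (≡.sym (+-identityʳ (2 ^ n)))))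

  -- Equality holds at 8, which explains the offset.
  square≤2^ : ∀ n → 4 * ((8 + n) * (8 + n)) ≤ 2 ^ (8 + n)
  square≤2^ zero = ≤-refl
  square≤2^ (suc n) = begin
    4 * ((8 + suc n) * (8 + suc n)) ≤⟨ ≤-trans (m≤m+n _ (4 * (47 + 14 * n + n * n))) (≤-reflexive (lem n)) ⟩
    2 * (4 * ((8 + n) * (8 + n))) ≤⟨ *-monoʳ-≤ 2 (square≤2^ n) ⟩
    2 * 2 ^ (8 + n) ≡⟨ cong (2 ^_) (≡.sym (+-suc 8 n)) ⟩
    2 ^ (8 + suc n) ∎
    where
      open ≤-Reasoning
      lem : ∀ n → 4 * ((8 + suc n) * (8 + suc n)) + 4 * (47 + 14 * n + n * n) ≡ 2 * (4 * ((8 + n) * (8 + n)))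
      lem = solve-∀

  -- `H` must exceed a multiple of `b`, and `2 ^ b` must exceed a multiple of `H`. The demands are
  -- compatible because `b` need only be logarithmic in `H`.
  record Scale (M : ℕ) : Set where
    field
      H b : ℕ
      M≤H : M ≤ H
      3M+2≤2H : 3 * M + 2 ≤ 2 * H
      8Mb≤H : 8 * M * b ≤ H
      b-bound : 16 * H * M ≤ 2 ^ b

  scale-for : ∀ M → 2 ≤ M → Scale M
  scale-for M 2≤M = record { H = H ; b = b ; M≤H = M≤H ; 3M+2≤2H = 3M ; 8Mb≤H = 8Mb ; b-bound = bb }
    where
      open ≤-Reasoning
      a = 8 + 4 * M
      H = 2 ^ a
      -- An upper bound for the binary logarithm of 16 H M, as H = 2 ^ a and M ≤ 2 ^ M.
      b = a + (4 + M)
      8Mb : 8 * M * b ≤ H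
      8Mb = begin
        8 * M * (a + (4 + M)) ≤⟨ *-monoʳ-≤ (8 * M) (+-monoʳ-≤ a 4+M≤a) ⟩
        8 * M * (a + a) ≡⟨ l1 M a ⟩
        4 * (4 * M * a) ≤⟨ *-monoʳ-≤ 4 (*-monoˡ-≤ a (m≤n+m (4 * M) 8)) ⟩
        4 * (a * a) ≤⟨ square≤2^ (4 * M) ⟩
        H ∎
        where
          l1 : ∀ M a → 8 * M * (a + a) ≡ 4 * (4 * M * a)
          l1 = solve-∀
          4+M≤a : 4 + M ≤ a
          4+M≤a = +-mono-≤ (m≤m+n 4 4) (m≤m+n M (3 * M))
      32M≤H : 32 * M ≤ H
      32M≤H = ≤-trans (≤-reflexive (l M)) (≤-trans (*-monoʳ-≤ (8 * M) (≤-trans (m≤m+n 4 M) (m≤n+m (4 + M) a))) 8Mb)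
        where
          l : ∀ M → 32 * M ≡ 8 * M * 4
          l = solve-∀
      M≤H : M ≤ H
      M≤H = ≤-trans (m≤m+n M (31 * M)) 32M≤H
      3M : 3 * M + 2 ≤ 2 * H
      3M = ≤-trans (+-monoʳ-≤ (3 * M) 2≤M) (≤-trans (≤-trans (m≤m+n (3 * M + M) (28 * M)) (≤-reflexive (l M))) (≤-trans 32M≤H (m≤m+n H (H + 0))))
        where
          l : ∀ M → 3 * M + M + 28 * M ≡ 32 * M
          l = solve-∀
      bb : 16 * H * M ≤ 2 ^ b
      bb = begin
        16 * H * M ≡⟨ l H M ⟩
        H * (16 * M) ≤⟨ *-monoʳ-≤ H (*-monoʳ-≤ 16 (n≤2^n M)) ⟩
        H * (16 * 2 ^ M) ≡⟨ cong (H *_) (^-distribˡ-+-* 2 4 M) ⟨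
        H * 2 ^ (4 + M) ≡⟨ ^-distribˡ-+-* 2 a (4 + M) ⟨
        2 ^ (a + (4 + M)) ∎
        where
          l : ∀ H M → 16 * H * M ≡ H * (16 * M)
          l = solve-∀

  module Thresholds (M : ℕ) (2≤M : 2 ≤ M) (k : ℕ) (sc : Scale M) where
    open Scale sc
    open ≤-Reasoning

    h K c β L G threshold : ℕ
    -- 32 M² H is what c Λ K ≤ h² asks for when c = 4 M, Λ = 8 M and K = h H. The factor `suc k`
    -- makes the vertices drawn for one group few compared with all vertices.
    h = 32 * (M * M) * H * suc k
    K = h * H
    c = 4 * M
    β = 2 * (M * M)
    -- The bound that `exponential-beats-linear` imposes on half of `g`, for D = 8 K² M and c = 2 (β
    -- + 1).
    L = 2 * (8 * (K * K) * M * (2 * suc β * (2 * suc β)))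
    -- For g ≥ G the part `H` gives ρ ≤ K M ≤ h (M g), and the part `L + L` makes half of `g` at
    -- least `L`.
    G = H + (L + L)
    threshold = G * (K * M)

    M>0 : 0 < M
    M>0 = ≤-trans z<s 2≤M

    H>0 : 0 < H
    H>0 = ≤-trans M>0 M≤H

    h>0 : 0 < h
    h>0 = *-pos {32 * (M * M) * H} {suc k} (*-pos {32 * (M * M)} {H} (*-pos {32} {M * M} z<s (*-pos M>0 M>0)) H>0) z<s

    K>0 : 0 < K
    K>0 = *-pos h>0 H>0

    KM>0 : 0 < K * M
    KM>0 = *-pos K>0 M>0

    h≤K : h ≤ K
    h≤K = ≤-trans (≤-reflexive (≡.sym (*-identityʳ h))) (*-monoʳ-≤ h H>0)

    32MMH≤h : 32 * (M * M) * H ≤ h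
    32MMH≤h = ≤-trans (≤-reflexive (≡.sym (*-identityʳ _))) (*-monoʳ-≤ (32 * (M * M) * H) (s≤s z≤n))

    h²≥ : c * (M * 8) * (h * H) ≤ h * h
    h²≥ = ≤-trans (≤-reflexive (l M h H)) (*-monoʳ-≤ h 32MMH≤h)
      where
        l : ∀ M h H → 4 * M * (M * 8) * (h * H) ≡ h * (32 * (M * M) * H)
        l = solve-∀

    32MMM≤K : 32 * (M * M) * M ≤ K
    32MMM≤K = ≤-trans (*-monoʳ-≤ (32 * (M * M)) M≤H) (≤-trans 32MMH≤h h≤K)

    K-large : c * M * (M * 8) ≤ 2 * (h * H)
    K-large = ≤-trans (≤-reflexive (l M)) (≤-trans 32MMM≤K (m≤m+n K (K + 0)))
      where
        l : ∀ M → 4 * M * M * (M * 8) ≡ 32 * (M * M) * M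
        l = solve-∀

    4M≤K : 4 * M ≤ h * H
    4M≤K = ≤-trans (*-monoˡ-≤ M (≤-trans (m≤m+n 4 28) (≤-trans (≤-reflexive (≡.sym (*-identityʳ 32))) (*-monoʳ-≤ 32 (*-pos M>0 M>0))))) 32MMM≤K

    Mk≤K : M * suc k ≤ K
    Mk≤K = ≤-trans (*-monoˡ-≤ (suc k) (≤-trans (≤-trans (≤-reflexive (≡.sym (*-identityˡ M))) (*-monoˡ-≤ M (*-pos {32} {M * M} z<s (*-pos M>0 M>0)))) (*-monoʳ-≤ (32 * (M * M)) M≤H))) h≤K

    small : ∀ g q x y → 0 < g → K * (M * g) ≤ q → x ≤ k → y ≤ k → M * (M * g * x * x) + y ≤ q * k
    small g q x y g>0 Kq x≤k y≤k = begin
      M * (M * g * x * x) + y ≤⟨ +-mono-≤ (*-monoʳ-≤ M (*-mono-≤ (*-monoʳ-≤ (M * g) x≤k) x≤k)) (≤-trans y≤k (≤-trans (≤-reflexive (≡.sym (*-identityˡ k))) (*-monoˡ-≤ k (*-pos M>0 (*-pos M>0 g>0))))) ⟩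
      M * (M * g * k * k) + M * (M * g) * k ≡⟨ l M g k ⟩
      M * suc k * (M * g) * k ≤⟨ *-monoˡ-≤ k (*-monoˡ-≤ (M * g) Mk≤K) ⟩
      K * (M * g) * k ≤⟨ *-monoˡ-≤ k Kq ⟩
      q * k ∎
      where
        l : ∀ M g k → M * (M * g * k * k) + M * (M * g) * k ≡ M * suc k * (M * g) * k
        l = solve-∀

    half-large : ∀ g → G ≤ g → L ≤ ⌊ g /2⌋
    half-large g p = ≤-trans (≤-reflexive (n≡⌊n+n/2⌋ L)) (⌊n/2⌋-mono (≤-trans (m≤n+m (L + L) H) p))

    g-large : ∀ g q → G ≤ g → 0 < g → q ≤ K * M * suc g → 4 * (q * K) * (2 * suc β) ^ g ≤ (2 * suc β + 1) ^ g
    g-large g q Gg g>0 qg = begin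
      4 * (q * K) * (2 * suc β) ^ g ≤⟨ *-monoˡ-≤ ((2 * suc β) ^ g) (begin
        4 * (q * K) ≤⟨ *-monoʳ-≤ 4 (*-monoˡ-≤ K (≤-trans qg (*-monoʳ-≤ (K * M) (+-monoˡ-≤ g g>0)))) ⟩
        4 * (K * M * (g + g) * K) ≡⟨ l K M g ⟩
        8 * (K * K) * M * g ∎) ⟩
      8 * (K * K) * M * g * (2 * suc β) ^ g ≤⟨ exponential-beats-linear (8 * (K * K) * M) (2 * suc β) g (half-large g Gg) z<s ⟩
      suc (2 * suc β) ^ g ≡⟨ cong (_^ g) (+-comm 1 (2 * suc β)) ⟩
      (2 * suc β + 1) ^ g ∎
      where
        l : ∀ K M g → 4 * (K * M * (g + g) * K) ≡ 8 * (K * K) * M * g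
        l = solve-∀

    ordered-matchings : {A : Set} (edge : List A → ℕ) → (∀ l → edge l ≤ 1) → (edge-↭ : ∀ {xs ys} → xs ↭ ys → edge xs ≡ edge ys) →
      ∀ d e → 0 < e → e ≤ d → d + e ≡ k → ∀ q → threshold ≤ q → ∀ τ → suc τ ≤ M → M + 2 ≤ 2 * τ →
      ∀ V → length V ≡ q * (d + e) →
      (∀ u r → length u ≡ d → V ↭ u ++ r → (2 + τ) * fall (length r) e ≤ M * seqs e .run (λ v _ → edge (u ++ v)) r) →
      (τ ∸ 2) ^ q * (q * (d + e)) ! ≤ M ^ q * repRun (seqs (d + e)) q (λ ws _ → Averaging.all-edges edge edge-↭ ws) V
    ordered-matchings edge edge≤1 edge-↭ d e e>0 e≤d de q q≥ τ τ<M M+2≤2τ V lV density =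
      Counting.many-orderings edge edge≤1 edge-↭ d e e>0 e≤d M τ g H h (K ∸ h) c b ρ β q K
        (≤-trans (*-pos K>0 (*-pos M>0 g>0)) Kq) K>0 2≤M τ<M M+2≤2τ g>0 h>0 (m∸n+n≡m h≤K) ρ≤ 3M+2≤2H 8Mb≤H b-bound (n≤2^n (4 * M)) h²≥ K-large 4M≤K
        ≡.refl q≡ β-large (g-large g q Gg g>0 q≤) V lV (sm e d (m≤n+m e d) (m≤m+n d e)) (sm d e (m≤m+n d e) (m≤n+m e d)) density
      where
        instance
          KM≢0 : NonZero (K * M)
          KM≢0 = >-nonZero KM>0
        g = q / (K * M)
        ρ = q % (K * M)
        Gg : G ≤ g
        Gg = ≤-trans (≤-reflexive (≡.sym (m*n/n≡m G (K * M)))) (/-mono-≤ q≥ ≤-refl)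
        g>0 : 0 < g
        g>0 = ≤-trans H>0 (≤-trans (m≤m+n H (L + L)) Gg)
        lem : ∀ ρ g K M → ρ + g * (K * M) ≡ K * (M * g) + ρ
        lem = solve-∀
        q≡ : q ≡ K * (M * g) + ρ
        q≡ = ≡.trans (m≡m%n+[m/n]*n q (K * M)) (lem ρ g K M)
        Kq : K * (M * g) ≤ q
        Kq = ≤-trans (m≤m+n _ ρ) (≤-reflexive (≡.sym q≡))
        ρ< : ρ ≤ K * M
        ρ< = <⇒≤ (m%n<n q (K * M))
        ρ≤ : ρ ≤ h * (M * g)
        ρ≤ = ≤-trans ρ< (≤-trans (≤-reflexive (l h H M)) (*-monoʳ-≤ h (*-monoʳ-≤ M (≤-trans (m≤m+n H (L + L)) Gg))))
          where
            l : ∀ h H M → h * H * M ≡ h * (M * H)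
            l = solve-∀
        q≤ : q ≤ K * M * suc g
        q≤ = ≤-trans (≤-reflexive (m≡m%n+[m/n]*n q (K * M))) (≤-trans (+-monoˡ-≤ (g * (K * M)) ρ<) (≤-reflexive (l (K * M) g)))
          where
            l : ∀ x g → x + g * x ≡ x * suc g
            l = solve-∀
        β-large : 2 * (suc τ * τ) ≤ suc β
        β-large = ≤-trans (*-monoʳ-≤ 2 (*-mono-≤ τ<M (<⇒≤ τ<M))) (n≤1+n β)
        sm : ∀ x y → x ≤ d + e → y ≤ d + e → M * (M * g * x * x) + y ≤ length V
        sm x y p p' = ≤-trans (small g q x y g>0 Kq (≤-trans p (≤-reflexive de)) (≤-trans p' (≤-reflexive de))) (≤-reflexive (≡.trans (cong (q *_) (≡.sym de)) (≡.sym lV)))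

-- Degrees of sets as sums over sequences of vertices.

module SubsetSequences where

  open import Defs
  open Pickers
  open SwitchingBound
  open RandomDraws
  open import Data.Bool using (Bool; true; false; _∧_; T)
  open import Data.Nat
  open import Data.Nat.Properties
  open import Data.Nat.Combinatorics using (_C_; k>n⇒nCk≡0; nCk+nC[k+1]≡[n+1]C[k+1])
  open import Data.Nat.Tactic.RingSolver using (solve-∀)
  open import Data.Nat.ListAction using (sum)
  open import Data.List using (List; []; _∷_; _++_; length; map; filterᵇ; allFin)
  open import Data.List.Properties using (length-map; map-tabulate; map-++)
  open import Data.List.Relation.Unary.All as All using (All; []; _∷_)
  import Data.List.Relation.Unary.All.Properties as AllP
  open import Data.List.Relation.Unary.AllPairs using ([]; _∷_)
  open import Data.List.Relation.Unary.Unique.Propositional using (Unique)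
  open import Data.List.Relation.Unary.Unique.Propositional.Properties using (allFin⁺)
  open import Data.List.Relation.Binary.Permutation.Propositional using (_↭_; refl; prep; swap; trans; ↭-sym; ↭-reflexive; ↭⇒↭ₛ)
  open import Data.List.Relation.Binary.Permutation.Propositional.Properties using (↭-length; ++⁺ʳ; shift; drop-∷; map⁺)
  import Data.List.Relation.Binary.Permutation.Setoid.Properties as PermS
  open import Data.Fin using (Fin; zero; suc)
  open import Data.Fin.Subset using (Subset; ∣_∣; _∪_; ⊥; ∁; ⁅_⁆)
  open import Data.Fin.Subset.Properties using (∪-assoc; ∪-comm; ∪-identityˡ)
  open import Data.Vec using ([]; _∷_; lookup)
  open import Data.Product using (_,_)
  open import Data.Empty using (⊥-elim)
  open import Function using (id)
  open import Relation.Nullary using (yes; no)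
  open import Relation.Binary.PropositionalEquality as ≡ using (_≡_; _≢_; cong; cong₂; subst)
  open import Data.List.Membership.Propositional using (_∈_)
  open import Data.List.Membership.Propositional.Properties using (∈-map⁺; ∈-++⁺ˡ; ∈-++⁺ʳ; ∈-∃++)
  open import Data.List.Relation.Unary.Any using (here)

  private variable
    A B : Set
    n : ℕ

  ⟦_⟧ : Bool → ℕ
  ⟦ true ⟧ = 1
  ⟦ false ⟧ = 0

  ⟦⟧≤1 : ∀ b → ⟦ b ⟧ ≤ 1
  ⟦⟧≤1 true = ≤-refl
  ⟦⟧≤1 false = z≤n

  fall≡!*C : ∀ n k → fall n k ≡ k ! * (n C k)
  fall≡!*C n zero = ≡.sym (≡.trans (+-identityʳ (n C 0)) ≡.refl)
  fall≡!*C zero (suc k) = ≡.sym (≡.trans (cong (suc k ! *_) (k>n⇒nCk≡0 {0} {suc k} z<s)) (*-zeroʳ (suc k !)))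
  fall≡!*C (suc n) (suc k) = begin
    suc n * fall n k ≡⟨ pascal ⟩
    suc k * fall n k + fall n (suc k) ≡⟨ cong₂ (λ x y → suc k * x + y) (fall≡!*C n k) (fall≡!*C n (suc k)) ⟩
    suc k * (k ! * (n C k)) + suc k ! * (n C suc k) ≡⟨ cong (_+ suc k ! * (n C suc k)) (*-assoc (suc k) (k !) (n C k)) ⟨
    suc k ! * (n C k) + suc k ! * (n C suc k) ≡⟨ *-distribˡ-+ (suc k !) (n C k) (n C suc k) ⟨
    suc k ! * ((n C k) + (n C suc k)) ≡⟨ cong (suc k ! *_) (nCk+nC[k+1]≡[n+1]C[k+1] n k) ⟩
    suc k ! * (suc n C suc k) ∎
    where
      open ≡.≡-Reasoning
      fall-zero : ∀ n k → n < k → fall n k ≡ 0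
      fall-zero zero (suc k) _ = ≡.refl
      fall-zero (suc n) (suc k) (s≤s p) = ≡.trans (cong (suc n *_) (fall-zero n k p)) (*-zeroʳ (suc n))
      pascal : suc n * fall n k ≡ suc k * fall n k + fall n (suc k)
      pascal with k ≤? n
      ... | yes p = ≡.trans (cong (λ z → suc z * fall n k) (≡.sym (m+[n∸m]≡n p))) (≡.trans (lem k (n ∸ k) (fall n k)) (cong (suc k * fall n k +_) (≡.sym (fall-suc n k))))
        where
          lem : ∀ k m f → suc (k + m) * f ≡ suc k * f + f * m
          lem = solve-∀
      ... | no p = ≡.trans (cong (suc n *_) z) (≡.trans (*-zeroʳ (suc n)) (≡.sym (cong₂ _+_ (≡.trans (cong (suc k *_) z) (*-zeroʳ (suc k))) (≡.trans (fall-suc n k) (cong (_* (n ∸ k)) z)))))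
        where
          z : fall n k ≡ 0
          z = fall-zero n k (≰⇒> p)

  combSum : ℕ → (List A → ℕ) → List A → ℕ
  combSum zero h xs = h []
  combSum (suc j) h [] = 0
  combSum (suc j) h (x ∷ xs) = combSum j (λ ys → h (x ∷ ys)) xs + combSum (suc j) h xs

  combSum-ext : ∀ j {h h' : List A → ℕ} → (∀ ys → h ys ≡ h' ys) → ∀ xs → combSum j h xs ≡ combSum j h' xs
  combSum-ext zero e xs = e []
  combSum-ext (suc j) e [] = ≡.refl
  combSum-ext (suc j) e (x ∷ xs) = cong₂ _+_ (combSum-ext j (λ ys → e (x ∷ ys)) xs) (combSum-ext (suc j) e xs)

  combSum-map : ∀ j (f : A → B) (h : List B → ℕ) xs → combSum j h (map f xs) ≡ combSum j (λ ys → h (map f ys)) xs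
  combSum-map zero f h xs = ≡.refl
  combSum-map (suc j) f h [] = ≡.refl
  combSum-map (suc j) f h (x ∷ xs) = cong₂ _+_ (combSum-map j f (λ ys → h (f x ∷ ys)) xs) (combSum-map (suc j) f h xs)

  Symmetric : (List A → ℕ) → Set
  Symmetric h = ∀ {xs ys} → xs ↭ ys → h xs ≡ h ys

  -- A sublist of length `suc j` arises once for each of its entries as the one drawn first, and a
  -- symmetric `h` does not see which.
  combSum-pick : ∀ j (h : List A → ℕ) → Symmetric h → ∀ xs → pick (λ x r → combSum j (λ ys → h (x ∷ ys)) r) xs ≡ suc j * combSum (suc j) h xs
  combSum-pick j h H [] = ≡.sym (*-zeroʳ (suc j))
  combSum-pick zero h H (z ∷ zs) = ≡.trans (cong (h (z ∷ []) +_) (combSum-pick zero h H zs)) (lem (h (z ∷ [])) (combSum 1 h zs))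
    where
      lem : ∀ a b → a + 1 * b ≡ 1 * (a + b)
      lem = solve-∀
  combSum-pick (suc j) h H (z ∷ zs) = begin
    C₁ + pick (λ x r → combSum j (λ ys → h (x ∷ z ∷ ys)) r + combSum (suc j) (λ ys → h (x ∷ ys)) r) zs
      ≡⟨ cong (C₁ +_) (pick-add _ _ zs) ⟩
    C₁ + (pick (λ x r → combSum j (λ ys → h (x ∷ z ∷ ys)) r) zs + pick (λ x r → combSum (suc j) (λ ys → h (x ∷ ys)) r) zs)
      ≡⟨ cong₂ (λ u v → C₁ + (u + v)) (≡.trans (pick-ext zs (λ x r _ → combSum-ext j (λ ys → H (swap x z refl)) r)) (combSum-pick j (λ ys → h (z ∷ ys)) (λ p → H (prep z p)) zs)) (combSum-pick (suc j) h H zs) ⟩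
    C₁ + (suc j * C₁ + suc (suc j) * combSum (suc (suc j)) h zs) ≡⟨ lem j C₁ (combSum (suc (suc j)) h zs) ⟩
    suc (suc j) * (C₁ + combSum (suc (suc j)) h zs) ∎
    where
      open ≡.≡-Reasoning
      C₁ = combSum (suc j) (λ ys → h (z ∷ ys)) zs
      lem : ∀ j a b → a + (suc j * a + suc (suc j) * b) ≡ suc (suc j) * (a + b)
      lem = solve-∀

  seqs-symmetric : ∀ j (h : List A → ℕ) → Symmetric h → ∀ xs → seqs j .run (λ ys _ → h ys) xs ≡ j ! * combSum j h xs
  seqs-symmetric zero h H xs = ≡.sym (+-identityʳ _)
  seqs-symmetric (suc j) h H xs = begin
    pick (λ x r → seqs j .run (λ ys _ → h (x ∷ ys)) r) xs ≡⟨ pick-ext xs (λ x r _ → seqs-symmetric j (λ ys → h (x ∷ ys)) (λ p → H (prep x p)) r) ⟩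
    pick (λ x r → j ! * combSum j (λ ys → h (x ∷ ys)) r) xs ≡⟨ pick-scale (j !) _ xs ⟩
    j ! * pick (λ x r → combSum j (λ ys → h (x ∷ ys)) r) xs ≡⟨ cong (j ! *_) (combSum-pick j h H xs) ⟩
    j ! * (suc j * combSum (suc j) h xs) ≡⟨ lem (j !) (suc j) _ ⟩
    suc j ! * combSum (suc j) h xs ∎
    where
      open ≡.≡-Reasoning
      lem : ∀ a b c → a * (b * c) ≡ b * a * c
      lem = solve-∀

  subSum : (Subset n → ℕ) → ℕ
  subSum {zero} g = g []
  subSum {suc n} g = subSum (λ T → g (true ∷ T)) + subSum (λ T → g (false ∷ T))

  subSum-mono : {g h : Subset n → ℕ} → (∀ T → g T ≤ h T) → subSum g ≤ subSum h
  subSum-mono {zero} p = p []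
  subSum-mono {suc n} p = +-mono-≤ (subSum-mono (λ T → p (true ∷ T))) (subSum-mono (λ T → p (false ∷ T)))

  subSum-ext : {g h : Subset n → ℕ} → (∀ T → g T ≡ h T) → subSum g ≡ subSum h
  subSum-ext {zero} p = p []
  subSum-ext {suc n} p = cong₂ _+_ (subSum-ext (λ T → p (true ∷ T))) (subSum-ext (λ T → p (false ∷ T)))

  subSum-zero : ∀ n → subSum {n} (λ _ → 0) ≡ 0
  subSum-zero zero = ≡.refl
  subSum-zero (suc n) = cong₂ _+_ (subSum-zero n) (subSum-zero n)

  listSum : (A → ℕ) → List A → ℕ
  listSum f xs = sum (map f xs)

  listSum-++ : (f : A → ℕ) → ∀ xs ys → listSum f (xs ++ ys) ≡ listSum f xs + listSum f ys
  listSum-++ f [] ys = ≡.refl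
  listSum-++ f (x ∷ xs) ys = ≡.trans (cong (f x +_) (listSum-++ f xs ys)) (≡.sym (+-assoc (f x) _ _))

  listSum-map : (f : B → ℕ) (g : A → B) → ∀ xs → listSum f (map g xs) ≡ listSum (λ x → f (g x)) xs
  listSum-map f g [] = ≡.refl
  listSum-map f g (x ∷ xs) = cong (f (g x) +_) (listSum-map f g xs)

  listSum-filter : (p : A → Bool) (f : A → ℕ) → ∀ xs → listSum f (filterᵇ p xs) ≡ listSum (λ x → ⟦ p x ⟧ * f x) xs
  listSum-filter p f [] = ≡.refl
  listSum-filter p f (x ∷ xs) with p x
  ... | true = cong₂ _+_ (≡.sym (+-identityʳ (f x))) (listSum-filter p f xs)
  ... | false = listSum-filter p f xs

  length-filter : (p : A → Bool) → ∀ xs → length (filterᵇ p xs) ≡ listSum (λ x → ⟦ p x ⟧) xs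
  length-filter p [] = ≡.refl
  length-filter p (x ∷ xs) with p x
  ... | true = cong suc (length-filter p xs)
  ... | false = length-filter p xs

  listSum-allSubsets : ∀ n (f : Subset n → ℕ) → listSum f (allSubsets n) ≡ subSum f
  listSum-allSubsets zero f = +-identityʳ (f [])
  listSum-allSubsets (suc n) f = ≡.trans (listSum-++ f (map (true ∷_) (allSubsets n)) _)
    (cong₂ _+_ (≡.trans (listSum-map f (true ∷_) (allSubsets n)) (listSum-allSubsets n _)) (≡.trans (listSum-map f (false ∷_) (allSubsets n)) (listSum-allSubsets n _)))

  elements : Subset n → List (Fin n)
  elements [] = []
  elements (true ∷ S) = zero ∷ map suc (elements S)
  elements (false ∷ S) = map suc (elements S)

  set : List (Fin n) → Subset n
  set [] = ⊥
  set (x ∷ xs) = ⁅ x ⁆ ∪ set xs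

  set-map-suc : (xs : List (Fin n)) → set (map suc xs) ≡ false ∷ set xs
  set-map-suc [] = ≡.refl
  set-map-suc (x ∷ xs) = cong (λ S → ⁅ suc x ⁆ ∪ S) (set-map-suc xs)

  set-++ : (xs ys : List (Fin n)) → set (xs ++ ys) ≡ set xs ∪ set ys
  set-++ [] ys = ≡.sym (∪-identityˡ (set ys))
  set-++ (x ∷ xs) ys = ≡.trans (cong (⁅ x ⁆ ∪_) (set-++ xs ys)) (≡.sym (∪-assoc ⁅ x ⁆ (set xs) (set ys)))

  set-↭ : {xs ys : List (Fin n)} → xs ↭ ys → set xs ≡ set ys
  set-↭ refl = ≡.refl
  set-↭ (prep x p) = cong (⁅ x ⁆ ∪_) (set-↭ p)
  set-↭ (swap {xs} {ys} x y p) = ≡.trans (cong (λ S → ⁅ x ⁆ ∪ (⁅ y ⁆ ∪ S)) (set-↭ p)) (≡.trans (≡.sym (∪-assoc ⁅ x ⁆ ⁅ y ⁆ (set ys))) (≡.trans (cong (_∪ set ys) (∪-comm ⁅ x ⁆ ⁅ y ⁆)) (∪-assoc ⁅ y ⁆ ⁅ x ⁆ (set ys))))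
  set-↭ (trans p q) = ≡.trans (set-↭ p) (set-↭ q)

  subset-size : (S T : Subset n) → subsetᵇ S T ≡ true → ∣ S ∣ ≤ ∣ T ∣
  subset-size [] [] _ = z≤n
  subset-size (true ∷ S) (true ∷ T) p = s≤s (subset-size S T p)
  subset-size (false ∷ S) (true ∷ T) p = ≤-trans (subset-size S T p) (n≤1+n _)
  subset-size (false ∷ S) (false ∷ T) p = subset-size S T p

  ≢⇒≡ᵇ-false : ∀ m n → m ≢ n → (m ≡ᵇ n) ≡ false
  ≢⇒≡ᵇ-false m n h with m ≡ᵇ n in eq
  ... | false = ≡.refl
  ... | true = ⊥-elim (h (≡ᵇ⇒≡ m n (subst T (≡.sym eq) _)))

  ≡ᵇ-refl : ∀ m → (m ≡ᵇ m) ≡ true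
  ≡ᵇ-refl zero = ≡.refl
  ≡ᵇ-refl (suc m) = ≡ᵇ-refl m

  -- The link between `deg`, which filters the list of all subsets, and draws from the complement of
  -- `S`. The induction runs along the characteristic vector of `S`.
  supersets : (S : Subset n) → ∀ j (g : Subset n → ℕ) → combSum j (λ ys → g (S ∪ set ys)) (elements (∁ S)) ≡ subSum (λ T → ⟦ subsetᵇ S T ∧ (∣ T ∣ ≡ᵇ ∣ S ∣ + j) ⟧ * g T)
  supersets [] zero g = ≡.sym (+-identityʳ _)
  supersets [] (suc j) g = ≡.refl
  supersets {suc n} (true ∷ S) j g = begin
    combSum j (λ ys → g ((true ∷ S) ∪ set ys)) (map suc (elements (∁ S))) ≡⟨ combSum-map j suc _ (elements (∁ S)) ⟩
    combSum j (λ ys → g ((true ∷ S) ∪ set (map suc ys))) (elements (∁ S)) ≡⟨ combSum-ext j (λ ys → cong (λ U → g ((true ∷ S) ∪ U)) (set-map-suc ys)) (elements (∁ S)) ⟩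
    combSum j (λ ys → g (true ∷ (S ∪ set ys))) (elements (∁ S)) ≡⟨ supersets S j (λ T → g (true ∷ T)) ⟩
    subSum (λ T → ⟦ subsetᵇ S T ∧ (∣ T ∣ ≡ᵇ ∣ S ∣ + j) ⟧ * g (true ∷ T)) ≡⟨ ≡.trans (≡.sym (+-identityʳ _)) (cong (subSum (λ T → ⟦ subsetᵇ S T ∧ (∣ T ∣ ≡ᵇ ∣ S ∣ + j) ⟧ * g (true ∷ T)) +_) (≡.sym (subSum-zero n))) ⟩
    subSum (λ T → ⟦ subsetᵇ S T ∧ (∣ T ∣ ≡ᵇ ∣ S ∣ + j) ⟧ * g (true ∷ T)) + subSum {n} (λ T → 0) ∎
    where open ≡.≡-Reasoning
  supersets {suc n} (false ∷ S) zero g = begin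
    g ((false ∷ S) ∪ ⊥) ≡⟨ supersets S zero (λ T → g (false ∷ T)) ⟩
    subSum (λ T → ⟦ subsetᵇ S T ∧ (∣ T ∣ ≡ᵇ ∣ S ∣ + 0) ⟧ * g (false ∷ T)) ≡⟨ cong (_+ subSum (λ T → ⟦ subsetᵇ S T ∧ (∣ T ∣ ≡ᵇ ∣ S ∣ + 0) ⟧ * g (false ∷ T))) (≡.trans (≡.sym (subSum-zero n)) (subSum-ext too-big)) ⟩
    subSum (λ T → ⟦ subsetᵇ S T ∧ (suc ∣ T ∣ ≡ᵇ ∣ S ∣ + 0) ⟧ * g (true ∷ T)) + subSum (λ T → ⟦ subsetᵇ S T ∧ (∣ T ∣ ≡ᵇ ∣ S ∣ + 0) ⟧ * g (false ∷ T)) ∎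
    where
      open ≡.≡-Reasoning
      too-big : ∀ T → 0 ≡ ⟦ subsetᵇ S T ∧ (suc ∣ T ∣ ≡ᵇ ∣ S ∣ + 0) ⟧ * g (true ∷ T)
      too-big T with subsetᵇ S T in eq
      ... | false = ≡.refl
      ... | true = cong (λ b → ⟦ b ⟧ * g (true ∷ T)) (≡.sym (≢⇒≡ᵇ-false (suc ∣ T ∣) (∣ S ∣ + 0) (λ e → <⇒≢ (≤-trans (s≤s (≤-trans (≤-reflexive (+-identityʳ ∣ S ∣)) (subset-size S T eq))) ≤-refl) (≡.sym e))))
  supersets {suc n} (false ∷ S) (suc j) g = begin
    combSum j (λ ys → g ((false ∷ S) ∪ (⁅ zero ⁆ ∪ set ys))) (map suc (elements (∁ S))) + combSum (suc j) (λ ys → g ((false ∷ S) ∪ set ys)) (map suc (elements (∁ S)))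
      ≡⟨ cong₂ _+_ (≡.trans (combSum-map j suc _ (elements (∁ S))) (combSum-ext j (λ ys → cong (λ U → g ((false ∷ S) ∪ (⁅ zero ⁆ ∪ U))) (set-map-suc ys)) (elements (∁ S))))
                   (≡.trans (combSum-map (suc j) suc _ (elements (∁ S))) (combSum-ext (suc j) (λ ys → cong (λ U → g ((false ∷ S) ∪ U)) (set-map-suc ys)) (elements (∁ S)))) ⟩
    combSum j (λ ys → g (true ∷ (S ∪ (⊥ ∪ set ys)))) (elements (∁ S)) + combSum (suc j) (λ ys → g (false ∷ (S ∪ set ys))) (elements (∁ S))
      ≡⟨ cong₂ _+_ (≡.trans (combSum-ext j (λ ys → cong (λ U → g (true ∷ (S ∪ U))) (∪-identityˡ (set ys))) (elements (∁ S))) (supersets S j (λ T → g (true ∷ T)))) (supersets S (suc j) (λ T → g (false ∷ T))) ⟩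
    subSum (λ T → ⟦ subsetᵇ S T ∧ (∣ T ∣ ≡ᵇ ∣ S ∣ + j) ⟧ * g (true ∷ T)) + subSum (λ T → ⟦ subsetᵇ S T ∧ (∣ T ∣ ≡ᵇ ∣ S ∣ + suc j) ⟧ * g (false ∷ T))
      ≡⟨ cong (_+ subSum (λ T → ⟦ subsetᵇ S T ∧ (∣ T ∣ ≡ᵇ ∣ S ∣ + suc j) ⟧ * g (false ∷ T))) (subSum-ext (λ T → cong (λ m → ⟦ subsetᵇ S T ∧ (suc ∣ T ∣ ≡ᵇ m) ⟧ * g (true ∷ T)) (≡.sym (+-suc ∣ S ∣ j)))) ⟩
    subSum (λ T → ⟦ subsetᵇ S T ∧ (suc ∣ T ∣ ≡ᵇ ∣ S ∣ + suc j) ⟧ * g (true ∷ T)) + subSum (λ T → ⟦ subsetᵇ S T ∧ (∣ T ∣ ≡ᵇ ∣ S ∣ + suc j) ⟧ * g (false ∷ T)) ∎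
    where open ≡.≡-Reasoning

  ∪set-symmetric : (S : Subset n) (g : Subset n → ℕ) → Symmetric (λ ys → g (S ∪ set ys))
  ∪set-symmetric S g p = cong (λ U → g (S ∪ U)) (set-↭ p)

  -- An edge through `S` arises from `j !` orders of its other vertices.
  degree-as-sequences : (E : Subset n → Bool) → ∀ k → (∀ T → E T ≡ true → ∣ T ∣ ≡ k) → ∀ S j → ∣ S ∣ + j ≡ k →
    seqs j .run (λ ys _ → ⟦ E (S ∪ set ys) ⟧) (elements (∁ S)) ≡ j ! * deg E S
  degree-as-sequences {n} E k uniform S j e = ≡.trans (seqs-symmetric j _ (∪set-symmetric S (λ T → ⟦ E T ⟧)) (elements (∁ S))) (cong (j ! *_) (≡.trans (supersets S j (λ T → ⟦ E T ⟧))
    (≡.sym (≡.trans (length-filter _ (allSubsets n)) (≡.trans (listSum-allSubsets n _) (subSum-ext pointwise))))))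
    where
      pointwise : ∀ T → ⟦ E T ∧ subsetᵇ S T ⟧ ≡ ⟦ subsetᵇ S T ∧ (∣ T ∣ ≡ᵇ ∣ S ∣ + j) ⟧ * ⟦ E T ⟧
      pointwise T with E T in eq
      ... | false = ≡.sym (*-zeroʳ ⟦ subsetᵇ S T ∧ (∣ T ∣ ≡ᵇ ∣ S ∣ + j) ⟧)
      ... | true rewrite e | uniform T eq | ≡ᵇ-refl k with subsetᵇ S T
      ...   | true = ≡.refl
      ...   | false = ≡.refl

  allFin-suc : ∀ n → allFin (suc n) ≡ zero ∷ map suc (allFin n)
  allFin-suc n = cong (zero ∷_) (≡.sym (map-tabulate id suc))

  elements-∁ : (S : Subset n) → allFin n ↭ elements S ++ elements (∁ S)
  elements-∁ [] = refl
  elements-∁ {suc n} (true ∷ S) = trans (↭-reflexive (allFin-suc n)) (prep zero (trans (map⁺ suc (elements-∁ S)) (↭-reflexive (map-++ suc (elements S) (elements (∁ S))))))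
  elements-∁ {suc n} (false ∷ S) = trans (↭-reflexive (allFin-suc n)) (trans (prep zero (trans (map⁺ suc (elements-∁ S)) (↭-reflexive (map-++ suc (elements S) (elements (∁ S)))))) (↭-sym (shift zero (map suc (elements S)) _)))

  length-elements : (S : Subset n) → length (elements S) ≡ ∣ S ∣
  length-elements [] = ≡.refl
  length-elements (true ∷ S) = cong suc (≡.trans (length-map suc (elements S)) (length-elements S))
  length-elements (false ∷ S) = ≡.trans (length-map suc (elements S)) (length-elements S)

  elements-insert : (x : Fin n) (S : Subset n) → lookup S x ≡ false → elements (⁅ x ⁆ ∪ S) ↭ x ∷ elements S
  elements-insert zero (false ∷ S) _ = prep zero (↭-reflexive (cong (λ U → map suc (elements U)) (∪-identityˡ S)))
  elements-insert (suc x) (true ∷ S) p = trans (prep zero (map⁺ suc (elements-insert x S p))) (swap zero (suc x) refl)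
  elements-insert (suc x) (false ∷ S) p = map⁺ suc (elements-insert x S p)

  lookup-⊥ : (x : Fin n) → lookup ⊥ x ≡ false
  lookup-⊥ zero = ≡.refl
  lookup-⊥ (suc x) = lookup-⊥ x

  lookup-insert : (x y : Fin n) (S : Subset n) → x ≢ y → lookup S x ≡ false → lookup (⁅ y ⁆ ∪ S) x ≡ false
  lookup-insert zero zero S h _ = ⊥-elim (h ≡.refl)
  lookup-insert zero (suc y) (false ∷ S) h p = ≡.refl
  lookup-insert (suc x) zero (_ ∷ S) h p = ≡.trans (cong (λ U → lookup U x) (∪-identityˡ S)) p
  lookup-insert (suc x) (suc y) (_ ∷ S) h p = lookup-insert x y S (λ e → h (cong suc e)) p

  lookup-set : (x : Fin n) → ∀ xs → All (x ≢_) xs → lookup (set xs) x ≡ false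
  lookup-set x [] _ = lookup-⊥ x
  lookup-set x (y ∷ ys) (p ∷ ps) = lookup-insert x y (set ys) p (lookup-set x ys ps)

  elements-set : (u r : List (Fin n)) → Unique (u ++ r) → elements (set u) ↭ u
  elements-set [] r _ = ↭-reflexive (empty _)
    where
      empty : ∀ n → elements (⊥ {n}) ≡ []
      empty zero = ≡.refl
      empty (suc n) = cong (map suc) (empty n)
  elements-set (x ∷ u) r (p ∷ ps) = trans (elements-insert x (set u) (lookup-set x u (AllP.++⁻ˡ u p))) (prep x (elements-set u r ps))

  allFin-unique : ∀ {xs : List (Fin n)} → allFin n ↭ xs → Unique xs
  allFin-unique {n} p = PermS.Unique-resp-↭ (≡.setoid (Fin n)) (↭⇒↭ₛ p) (allFin⁺ n)

  drop-prefix : (u : List A) → ∀ {r r'} → u ++ r ↭ u ++ r' → r ↭ r'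
  drop-prefix [] p = p
  drop-prefix (x ∷ u) p = drop-prefix u (drop-∷ p)

  module _ {u r : List (Fin n)} (p : allFin n ↭ u ++ r) where
    size-set : ∣ set u ∣ ≡ length u
    size-set = ≡.trans (≡.sym (length-elements (set u))) (↭-length (elements-set u r (allFin-unique p)))

    rest-elements : elements (∁ (set u)) ↭ r
    rest-elements = drop-prefix u (trans (++⁺ʳ (elements (∁ (set u))) (↭-sym (elements-set u r (allFin-unique p)))) (trans (↭-sym (elements-∁ (set u))) p))

    degree-sequences : (E : Subset n → Bool) → ∀ k → (∀ T → E T ≡ true → ∣ T ∣ ≡ k) → ∀ j → length u + j ≡ k →
      seqs j .run (λ ys _ → ⟦ E (set (u ++ ys)) ⟧) r ≡ j ! * deg E (set u)
    degree-sequences E k uniform j e = begin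
      seqs j .run (λ ys _ → ⟦ E (set (u ++ ys)) ⟧) r ≡⟨ ext′ (seqs j) r (λ ys _ → cong (λ U → ⟦ E U ⟧) (set-++ u ys)) ⟩
      seqs j .run (λ ys _ → ⟦ E (set u ∪ set ys) ⟧) r ≡⟨ seqs j .resp (λ _ _ → ≡.refl) rest-elements ⟨
      seqs j .run (λ ys _ → ⟦ E (set u ∪ set ys) ⟧) (elements (∁ (set u))) ≡⟨ degree-as-sequences E k uniform (set u) j (≡.trans (cong (_+ j) size-set) e) ⟩
      j ! * deg E (set u) ∎
      where open ≡.≡-Reasoning

  minList≤ : (f : A → ℕ) → (p : A → Bool) → ∀ xs ys x → p x ≡ true → minList (map f (filterᵇ p (xs ++ x ∷ ys))) ≤ f x
  minList≤ f p [] ys x e with p x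
  minList≤ f p [] ys x e | true with map f (filterᵇ p ys)
  ... | [] = ≤-refl
  ... | z ∷ zs = m⊓n≤m (f x) _
  minList≤ f p (w ∷ xs) ys x e with p w
  ... | false = minList≤ f p xs ys x e
  ... | true with map f (filterᵇ p (xs ++ x ∷ ys)) | minList≤ f p xs ys x e | nonempty xs
    where
      nonempty : ∀ xs → map f (filterᵇ p (xs ++ x ∷ ys)) ≢ []
      nonempty [] q with p x
      nonempty [] () | true
      nonempty (w ∷ xs) q with p w
      nonempty (w ∷ xs) () | true
      ... | false = nonempty xs q
  ... | [] | _ | h = ⊥-elim (h ≡.refl)
  ... | z ∷ zs | ih | _ = ≤-trans (m⊓n≤n (f w) _) ih

  ∈-allSubsets : (S : Subset n) → S ∈ allSubsets n
  ∈-allSubsets [] = here ≡.refl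
  ∈-allSubsets (true ∷ S) = ∈-++⁺ˡ (∈-map⁺ (true ∷_) (∈-allSubsets S))
  ∈-allSubsets {suc n} (false ∷ S) = ∈-++⁺ʳ (map (true ∷_) (allSubsets n)) (∈-map⁺ (false ∷_) (∈-allSubsets S))

  minDeg≤deg : ∀ d (E : Subset n → Bool) S → ∣ S ∣ ≡ d → minDeg d E ≤ deg E S
  minDeg≤deg {n} d E S e with ∈-∃++ (∈-allSubsets S)
  ... | xs , ys , q = subst (λ l → minList (map (deg E) (filterᵇ (λ S → ∣ S ∣ ≡ᵇ d) l)) ≤ deg E S) (≡.sym q) (minList≤ (deg E) (λ S → ∣ S ∣ ≡ᵇ d) xs ys S (≡.trans (cong (_≡ᵇ d) e) (≡ᵇ-refl d)))

-- From orderings of the vertices to perfect matchings.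

module PerfectMatchings where

  open import Defs
  open Pickers
  open RandomDraws
  open SubsetSequences
  open import Data.Bool using (Bool; true; false; _∧_; T)
  open import Data.Bool.ListAction using (all)
  open import Data.Nat
  open import Data.Nat.Properties
  open import Data.Nat.Tactic.RingSolver using (solve-∀)
  open import Data.Nat.ListAction using (sum; product)
  open import Data.Nat.ListAction.Properties using (sum-↭)
  open import Data.List using (List; []; _∷_; _++_; length; map; filterᵇ; allFin; foldr; concat; concatMap)
  open import Data.List.Properties using (length-++; ++-identityʳ; ++-assoc; length-tabulate)
  open import Data.List.Relation.Unary.All as All using (All; []; _∷_)
  open import Data.List.Relation.Binary.Permutation.Propositional using (_↭_; refl; prep; swap; trans; ↭-reflexive)
  open import Data.List.Relation.Binary.Permutation.Propositional.Properties using (↭-length; ++⁺ˡ; shift; map⁺; All-resp-↭)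
  open import Data.Fin using (Fin; zero; suc)
  open import Data.Fin.Subset using (Subset; ∣_∣; _∪_; ⊥; ∁)
  open import Data.Fin.Subset.Properties using (∪-assoc; ∪-comm; ∪-idem; ∪-identityˡ)
  open import Data.Vec using ([]; _∷_)
  open import Data.Product using (_×_; _,_; proj₁; proj₂)
  open import Data.Empty using (⊥-elim)
  open import Data.Sum using (_⊎_; inj₁; inj₂)
  open import Relation.Binary.PropositionalEquality as ≡ using (_≡_; cong; cong₂; subst)

  private variable
    A : Set
    n : ℕ

  ⋃ : List (Subset n) → Subset n
  ⋃ = foldr _∪_ ⊥

  ⋃-↭ : {Ss Ts : List (Subset n)} → Ss ↭ Ts → ⋃ Ss ≡ ⋃ Ts
  ⋃-↭ refl = ≡.refl
  ⋃-↭ (prep x p) = cong (x ∪_) (⋃-↭ p)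
  ⋃-↭ (swap {Ss} {Ts} x y p) = ≡.trans (cong (λ S → x ∪ (y ∪ S)) (⋃-↭ p)) (≡.trans (≡.sym (∪-assoc x y (⋃ Ts))) (≡.trans (cong (_∪ ⋃ Ts) (∪-comm x y)) (∪-assoc y x (⋃ Ts))))
  ⋃-↭ (trans p q) = ≡.trans (⋃-↭ p) (⋃-↭ q)

  ⋃-map-set : (ws : List (List (Fin n))) → ⋃ (map set ws) ≡ set (concat ws)
  ⋃-map-set [] = ≡.refl
  ⋃-map-set (w ∷ ws) = ≡.trans (cong (set w ∪_) (⋃-map-set ws)) (≡.sym (set-++ w (concat ws)))

  total-size : List (Subset n) → ℕ
  total-size Ts = sum (map ∣_∣ Ts)

  ∪-size : (S U : Subset n) → ∣ S ∪ U ∣ ≤ ∣ S ∣ + ∣ U ∣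
  ∪-size [] [] = z≤n
  ∪-size (true ∷ S) (true ∷ U) = s≤s (≤-trans (∪-size S U) (+-monoʳ-≤ ∣ S ∣ (n≤1+n ∣ U ∣)))
  ∪-size (true ∷ S) (false ∷ U) = s≤s (∪-size S U)
  ∪-size (false ∷ S) (true ∷ U) = ≤-trans (s≤s (∪-size S U)) (≤-reflexive (≡.sym (+-suc ∣ S ∣ ∣ U ∣)))
  ∪-size (false ∷ S) (false ∷ U) = ∪-size S U

  ∪-size-disjoint : (S U : Subset n) → ∣ S ∣ + ∣ U ∣ ≤ ∣ S ∪ U ∣ → disjointᵇ S U ≡ true
  ∪-size-disjoint [] [] _ = ≡.refl
  ∪-size-disjoint (true ∷ S) (true ∷ U) p = ⊥-elim (<⇒≱ (≤-trans (s≤s (∪-size S U)) (≤-reflexive (≡.sym (+-suc ∣ S ∣ ∣ U ∣)))) (s≤s⁻¹ p))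
  ∪-size-disjoint (true ∷ S) (false ∷ U) p = ∪-size-disjoint S U (s≤s⁻¹ p)
  ∪-size-disjoint (false ∷ S) (true ∷ U) p = ∪-size-disjoint S U (s≤s⁻¹ (≤-trans (≤-reflexive (≡.sym (+-suc ∣ S ∣ ∣ U ∣))) p))
  ∪-size-disjoint (false ∷ S) (false ∷ U) p = ∪-size-disjoint S U p

  ⋃-size : (Ts : List (Subset n)) → ∣ ⋃ Ts ∣ ≤ total-size Ts
  ⋃-size {n} [] = ≤-reflexive (empty n)
    where
      empty : ∀ n → ∣ ⊥ {n} ∣ ≡ 0
      empty zero = ≡.refl
      empty (suc n) = empty n
  ⋃-size (S ∷ Ts) = ≤-trans (∪-size S (⋃ Ts)) (+-monoʳ-≤ ∣ S ∣ (⋃-size Ts))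

  disjoint-∪ : (S U W : Subset n) → disjointᵇ S (U ∪ W) ≡ true → disjointᵇ S U ≡ true × disjointᵇ S W ≡ true
  disjoint-∪ [] [] [] _ = ≡.refl , ≡.refl
  disjoint-∪ (true ∷ S) (false ∷ U) (false ∷ W) p = disjoint-∪ S U W p
  disjoint-∪ (false ∷ S) (_ ∷ U) (_ ∷ W) p = disjoint-∪ S U W p

  disjoint-⋃ : (S : Subset n) → ∀ Ts → disjointᵇ S (⋃ Ts) ≡ true → all (disjointᵇ S) Ts ≡ true
  disjoint-⋃ S [] _ = ≡.refl
  disjoint-⋃ S (U ∷ Ts) p = cong₂ _∧_ (proj₁ (disjoint-∪ S U (⋃ Ts) p)) (disjoint-⋃ S Ts (proj₂ (disjoint-∪ S U (⋃ Ts) p)))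

  -- Sizes add up only when nothing overlaps, so disjointness of all pairs can be read off from the
  -- size of the union.
  size-pairwiseDisjoint : (Ts : List (Subset n)) → total-size Ts ≤ ∣ ⋃ Ts ∣ → pairwiseDisjointᵇ Ts ≡ true
  size-pairwiseDisjoint [] _ = ≡.refl
  size-pairwiseDisjoint (S ∷ Ts) p = cong₂ _∧_
    (disjoint-⋃ S Ts (∪-size-disjoint S (⋃ Ts) (≤-trans (+-monoʳ-≤ ∣ S ∣ (⋃-size Ts)) p)))
    (size-pairwiseDisjoint Ts (+-cancelˡ-≤ ∣ S ∣ _ _ (≤-trans p (∪-size S (⋃ Ts)))))

  full-size : (S : Subset n) → fullᵇ S ≡ true → ∣ S ∣ ≡ n
  full-size [] _ = ≡.refl
  full-size (true ∷ S) p = cong suc (full-size S p)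

  full-allFin : ∀ n → fullᵇ (set (allFin n)) ≡ true
  full-allFin zero = ≡.refl
  full-allFin (suc n) = ≡.trans (cong fullᵇ (≡.trans (cong set (allFin-suc n)) (≡.trans (cong ((true ∷ ⊥) ∪_) (set-map-suc (allFin n))) (cong (true ∷_) (∪-identityˡ (set (allFin n))))))) (full-allFin n)

  -- equivalent to isPerfectMatchingᵇ, but visibly independent of the order of Ts
  perfect : List (Subset n) → ℕ
  perfect {n} Ts = ⟦ fullᵇ (⋃ Ts) ∧ (total-size Ts ≡ᵇ n) ⟧

  perfect-symmetric : Symmetric (perfect {n})
  perfect-symmetric {n} p = cong₂ (λ S m → ⟦ fullᵇ S ∧ (m ≡ᵇ n) ⟧) (⋃-↭ p) (sum-↭ (map⁺ ∣_∣ p))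

  perfect≤isPerfectMatching : (Ts : List (Subset n)) → perfect Ts ≤ ⟦ isPerfectMatchingᵇ Ts ⟧
  perfect≤isPerfectMatching {n} Ts with fullᵇ (⋃ Ts) in f | total-size Ts ≡ᵇ n in s
  ... | false | _ = z≤n
  ... | true | false = z≤n
  ... | true | true = ≤-reflexive (≡.sym (cong (λ b → ⟦ b ∧ true ⟧) (size-pairwiseDisjoint Ts (≤-reflexive (≡.trans (≡ᵇ⇒≡ (total-size Ts) n (subst T (≡.sym s) _)) (≡.sym (full-size (⋃ Ts) f)))))))

  perfect-no-repeat : (S : Subset n) → 0 < ∣ S ∣ → ∀ Ts → perfect (S ∷ S ∷ Ts) ≡ 0
  perfect-no-repeat {n} S p Ts with fullᵇ (S ∪ (S ∪ ⋃ Ts)) in f | total-size (S ∷ S ∷ Ts) ≡ᵇ n in s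
  ... | false | _ = ≡.refl
  ... | true | false = ≡.refl
  ... | true | true = ⊥-elim (<⇒≱ (+-monoˡ-< (total-size (S ∷ Ts)) p) (begin
    total-size (S ∷ S ∷ Ts) ≡⟨ ≡ᵇ⇒≡ (total-size (S ∷ S ∷ Ts)) n (subst T (≡.sym s) _) ⟩
    n ≡⟨ full-size (S ∪ (S ∪ ⋃ Ts)) f ⟨
    ∣ S ∪ (S ∪ ⋃ Ts) ∣ ≡⟨ cong ∣_∣ (≡.trans (≡.sym (∪-assoc S S (⋃ Ts))) (cong (_∪ ⋃ Ts) (∪-idem S))) ⟩
    ∣ S ∪ ⋃ Ts ∣ ≤⟨ ⋃-size (S ∷ Ts) ⟩
    total-size (S ∷ Ts) ∎))
    where open ≤-Reasoning

  -- `Q` will exclude the empty set, whose repetition changes neither the union nor the total size.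
  Vanishing : (A → Set) → (List A → ℕ) → Set
  Vanishing Q P = ∀ pre x mid post → Q x → P (pre ++ x ∷ mid ++ x ∷ post) ≡ 0

  perfect-vanishing : Vanishing (λ S → 0 < ∣ S ∣) (perfect {n})
  perfect-vanishing pre x mid post p = ≡.trans (perfect-symmetric (trans (shift x pre (mid ++ x ∷ post)) (prep x (trans (++⁺ˡ pre (shift x mid post)) (shift x pre (mid ++ post)))))) (perfect-no-repeat x p (pre ++ mid ++ post))

  tuples : ℕ → (List A → ℕ) → List A → ℕ
  tuples zero P L = P []
  tuples (suc q) P L = listSum (λ x → tuples q (λ Ts → P (x ∷ Ts)) L) L

  listSum-mono : {f g : A → ℕ} → (∀ x → f x ≤ g x) → ∀ xs → listSum f xs ≤ listSum g xs
  listSum-mono p [] = z≤n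
  listSum-mono p (x ∷ xs) = +-mono-≤ (p x) (listSum-mono p xs)

  listSum-ext : {f g : A → ℕ} → (∀ x → f x ≡ g x) → ∀ xs → listSum f xs ≡ listSum g xs
  listSum-ext p [] = ≡.refl
  listSum-ext p (x ∷ xs) = cong₂ _+_ (p x) (listSum-ext p xs)

  listSum-pick : (f : A → ℕ) → ∀ xs → listSum f xs ≡ pick (λ x _ → f x) xs
  listSum-pick f [] = ≡.refl
  listSum-pick f (x ∷ xs) = cong (f x +_) (listSum-pick f xs)

  tuples-↭ : ∀ q (P : List A → ℕ) {L L'} → L ↭ L' → tuples q P L ≡ tuples q P L'
  tuples-↭ zero P p = ≡.refl
  tuples-↭ (suc q) P {L} {L'} p = ≡.trans (listSum-ext (λ x → tuples-↭ q (λ Ts → P (x ∷ Ts)) p) L) (sum-↭ (map⁺ _ p))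

  tuples-zero : ∀ q (P : List A → ℕ) → (∀ Ts → P Ts ≡ 0) → ∀ L → tuples q P L ≡ 0
  tuples-zero zero P z L = z []
  tuples-zero (suc q) P z L = go L
    where
      go : ∀ xs → listSum (λ x → tuples q (λ Ts → P (x ∷ Ts)) L) xs ≡ 0
      go [] = ≡.refl
      go (x ∷ xs) = cong₂ _+_ (tuples-zero q (λ Ts → P (x ∷ Ts)) (λ Ts → z (x ∷ Ts)) L) (go xs)

  tuples-drop : ∀ q (P : List A → ℕ) x r → (∀ mid post → P (mid ++ x ∷ post) ≡ 0) → tuples q P (x ∷ r) ≤ tuples q P r
  tuples-drop zero P x r z = ≤-refl
  tuples-drop (suc q) P x r z = ≤-trans (≤-reflexive (cong (_+ listSum (λ y → tuples q (λ Ts → P (y ∷ Ts)) (x ∷ r)) r) (tuples-zero q (λ Ts → P (x ∷ Ts)) (z []) (x ∷ r))))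
    (listSum-mono (λ y → tuples-drop q (λ Ts → P (y ∷ Ts)) x r (λ mid → z (y ∷ mid))) r)

  -- `P` vanishes as soon as an entry is repeated, so an entry may be removed from the pool once it
  -- is chosen.
  tuples≤seqs : ∀ (Q : A → Set) q (P : List A → ℕ) → Vanishing Q P → ∀ L → All Q L → tuples q P L ≤ seqs q .run (λ Ts _ → P Ts) L
  tuples≤seqs Q zero P V L h = ≤-refl
  tuples≤seqs Q (suc q) P V L h = begin
    listSum (λ x → tuples q (λ Ts → P (x ∷ Ts)) L) L ≡⟨ listSum-pick _ L ⟩
    pick (λ x _ → tuples q (λ Ts → P (x ∷ Ts)) L) L ≤⟨ pick-mono L term ⟩
    pick (λ x r → seqs q .run (λ Ts _ → P (x ∷ Ts)) r) L ∎
    where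
      open ≤-Reasoning
      term : ∀ x r → L ↭ x ∷ r → tuples q (λ Ts → P (x ∷ Ts)) L ≤ seqs q .run (λ Ts _ → P (x ∷ Ts)) r
      term x r p with All-resp-↭ p h
      ... | qx ∷ qr = begin
        tuples q (λ Ts → P (x ∷ Ts)) L ≡⟨ tuples-↭ q _ p ⟩
        tuples q (λ Ts → P (x ∷ Ts)) (x ∷ r) ≤⟨ tuples-drop q _ x r (λ mid post → V [] x mid post qx) ⟩
        tuples q (λ Ts → P (x ∷ Ts)) r ≤⟨ tuples≤seqs Q q (λ Ts → P (x ∷ Ts)) (λ pre → V (x ∷ pre)) r qr ⟩
        seqs q .run (λ Ts _ → P (x ∷ Ts)) r ∎

  combSum-mono : ∀ j {h h' : List A → ℕ} → (∀ ys → h ys ≤ h' ys) → ∀ xs → combSum j h xs ≤ combSum j h' xs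
  combSum-mono zero e xs = e []
  combSum-mono (suc j) e [] = z≤n
  combSum-mono (suc j) e (x ∷ xs) = +-mono-≤ (combSum-mono j (λ ys → e (x ∷ ys)) xs) (combSum-mono (suc j) e xs)

  combSum≤sublists : ∀ j (p : List A → Bool) xs → combSum j (λ ys → ⟦ p ys ⟧) xs ≤ length (filterᵇ p (sublists xs))
  combSum≤sublists j p xs = ≤-trans (go j (λ ys → ⟦ p ys ⟧) xs) (≤-reflexive (≡.sym (length-filter p (sublists xs))))
    where
      go : ∀ {A : Set} j (h : List A → ℕ) xs → combSum j h xs ≤ listSum h (sublists xs)
      go zero h [] = m≤m+n (h []) 0
      go zero h (x ∷ xs) = ≤-trans (go zero h xs) (≤-trans (m≤n+m _ _) (≤-reflexive (≡.sym (listSum-++ h (map (x ∷_) (sublists xs)) (sublists xs)))))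
      go (suc j) h [] = z≤n
      go (suc j) h (x ∷ xs) = ≤-trans (+-mono-≤ (≤-trans (go j (λ ys → h (x ∷ ys)) xs) (≤-reflexive (≡.sym (listSum-map h (x ∷_) (sublists xs))))) (go (suc j) h xs)) (≤-reflexive (≡.sym (listSum-++ h (map (x ∷_) (sublists xs)) (sublists xs))))

  seqs-mono-pool : ∀ j (φ : List A → ℕ) z r → seqs j .run (λ w _ → φ w) r ≤ seqs j .run (λ w _ → φ w) (z ++ r)
  seqs-mono-pool zero φ z r = ≤-refl
  seqs-mono-pool (suc j) φ z r = ≤-trans (pick-mono r (λ x r' _ → seqs-mono-pool j (λ w → φ (x ∷ w)) z r')) (≤-trans (m≤n+m _ _) (≤-reflexive (≡.sym (pick-++ _ z r))))

  subSum-scale : ∀ c (g : Subset n → ℕ) → subSum (λ T → c * g T) ≡ c * subSum g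
  subSum-scale {zero} c g = ≡.refl
  subSum-scale {suc n} c g = ≡.trans (cong₂ _+_ (subSum-scale {n} c (λ T → g (true ∷ T))) (subSum-scale {n} c (λ T → g (false ∷ T)))) (≡.sym (*-distribˡ-+ c _ _))

  module Orderings (E : Subset n → Bool) (k : ℕ) (uniform : ∀ T → E T ≡ true → ∣ T ∣ ≡ k) (k>0 : 0 < k) where

    edge : List (Fin n) → ℕ
    edge w = ⟦ E (set w) ⟧

    all-edges : List (List (Fin n)) → ℕ
    all-edges ws = product (map edge ws)

    sets-sum : (g : Subset n → ℕ) → seqs k .run (λ w _ → g (set w)) (allFin n) ≤ k ! * subSum g
    sets-sum g = begin
      seqs k .run (λ w _ → g (set w)) (allFin n) ≡⟨ seqs k .resp (λ _ _ → ≡.refl) (rest-elements {u = []} refl) ⟨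
      seqs k .run (λ w _ → g (set w)) (elements (∁ ⊥)) ≡⟨ ext′ (seqs k) (elements (∁ ⊥)) (λ w _ → cong g (≡.sym (∪-identityˡ (set w)))) ⟩
      seqs k .run (λ w _ → g (⊥ ∪ set w)) (elements (∁ ⊥)) ≡⟨ seqs-symmetric k _ (∪set-symmetric ⊥ g) (elements (∁ ⊥)) ⟩
      k ! * combSum k (λ w → g (⊥ ∪ set w)) (elements (∁ ⊥)) ≡⟨ cong (k ! *_) (supersets ⊥ k g) ⟩
      k ! * subSum (λ T → ⟦ subsetᵇ ⊥ T ∧ (∣ T ∣ ≡ᵇ ∣ ⊥ {n} ∣ + k) ⟧ * g T) ≤⟨ *-monoʳ-≤ (k !) (subSum-mono (λ T → ≤-trans (*-monoˡ-≤ (g T) (⟦⟧≤1 (subsetᵇ ⊥ T ∧ (∣ T ∣ ≡ᵇ ∣ ⊥ {n} ∣ + k)))) (≤-reflexive (+-identityʳ (g T))))) ⟩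
      k ! * subSum g ∎
      where open ≤-Reasoning

    -- Forgetting that later sequences avoid the vertices `z` used before only enlarges the sum. The
    -- edges can then be chosen independently, and disjointness is left to `P`.
    choose-independently : ∀ q (P : List (Subset n) → ℕ) z r → allFin n ↭ z ++ r →
      repRun (seqs k) q (λ ws _ → all-edges ws * P (map set ws)) r ≤ (k !) ^ q * tuples q P (edgeList E)
    choose-independently zero P z r p = ≤-refl
    choose-independently (suc q) P z r p = begin
      seqs k .run (λ w r' → repRun (seqs k) q (λ ws _ → edge w * all-edges ws * P (set w ∷ map set ws)) r') r ≤⟨ seqs k .mono r inner ⟩
      seqs k .run (λ w _ → G (set w)) r ≤⟨ seqs-mono-pool k (λ w → G (set w)) z r ⟩
      seqs k .run (λ w _ → G (set w)) (z ++ r) ≡⟨ seqs k .resp (λ _ _ → ≡.refl) p ⟨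
      seqs k .run (λ w _ → G (set w)) (allFin n) ≤⟨ sets-sum G ⟩
      k ! * subSum G ≡⟨ cong (k ! *_) (≡.trans (subSum-ext (λ T → lem ⟦ E T ⟧ ((k !) ^ q) (tuples q (λ Ts → P (T ∷ Ts)) (edgeList E)))) (subSum-scale {n} ((k !) ^ q) (λ T → ⟦ E T ⟧ * tuples q (λ Ts → P (T ∷ Ts)) (edgeList E)))) ⟩
      k ! * ((k !) ^ q * subSum (λ T → ⟦ E T ⟧ * tuples q (λ Ts → P (T ∷ Ts)) (edgeList E))) ≡⟨ *-assoc (k !) ((k !) ^ q) _ ⟨
      k ! * (k !) ^ q * subSum (λ T → ⟦ E T ⟧ * tuples q (λ Ts → P (T ∷ Ts)) (edgeList E)) ≡⟨ cong (k ! * (k !) ^ q *_) (≡.trans (listSum-filter E _ (allSubsets n)) (listSum-allSubsets n _)) ⟨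
      k ! * (k !) ^ q * tuples (suc q) P (edgeList E) ∎
      where
        open ≤-Reasoning
        G : Subset n → ℕ
        G T = ⟦ E T ⟧ * ((k !) ^ q * tuples q (λ Ts → P (T ∷ Ts)) (edgeList E))
        lem : ∀ a b c → a * (b * c) ≡ b * (a * c)
        lem = solve-∀
        inner : ∀ w r' → seqs k .Ok w → r ↭ seqs k .flat w ++ r' → repRun (seqs k) q (λ ws _ → edge w * all-edges ws * P (set w ∷ map set ws)) r' ≤ G (set w)
        inner w r' o p' = ≤-trans (≤-reflexive (≡.trans (ext′ (rep (seqs k) q) r' (λ ws _ → *-assoc (edge w) (all-edges ws) _)) (repScale (seqs k) q (edge w) _ r')))
          (*-monoʳ-≤ (edge w) (choose-independently q (λ Ts → P (set w ∷ Ts)) (z ++ seqs k .flat w) r' (trans p (trans (++⁺ˡ z p') (↭-reflexive (≡.sym (++-assoc z (seqs k .flat w) r')))))))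

    edges-nonempty : All (λ T → 0 < ∣ T ∣) (edgeList E)
    edges-nonempty = go (allSubsets n)
      where
        go : ∀ L → All (λ T → 0 < ∣ T ∣) (filterᵇ E L)
        go [] = []
        go (T ∷ L) with E T in eq
        ... | true = subst (0 <_) (≡.sym (uniform T eq)) k>0 ∷ go L
        ... | false = go L

    -- The factor `perfect` has to be inserted while the pieces are still known to partition the
    -- vertices; `choose-independently` forgets this.
    partition-perfect : ∀ q ws → n ≡ q * k → length ws ≡ q → allFin n ↭ concat ws → all-edges ws ≤ all-edges ws * perfect (map set ws)
    partition-perfect q ws nq l p with sizes ws
      where
        sizes : ∀ ws → all-edges ws ≡ 0 ⊎ total-size (map set ws) ≡ length ws * k
        sizes [] = inj₂ ≡.refl
        sizes (w ∷ ws) with E (set w) in eq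
        ... | false = inj₁ ≡.refl
        ... | true with sizes ws
        ...   | inj₁ z = inj₁ (≡.trans (+-identityʳ _) z)
        ...   | inj₂ z = inj₂ (cong₂ _+_ (uniform (set w) eq) z)
    ... | inj₁ z = ≤-trans (≤-reflexive z) z≤n
    ... | inj₂ z = ≤-reflexive (≡.sym (≡.trans (cong (all-edges ws *_) one) (*-identityʳ _)))
      where
        one : perfect (map set ws) ≡ 1
        one = ≡.trans (cong₂ (λ b m → ⟦ b ∧ (m ≡ᵇ n) ⟧) (≡.trans (cong fullᵇ (≡.trans (⋃-map-set ws) (≡.sym (set-↭ p)))) (full-allFin n)) (≡.trans z (≡.trans (cong (_* k) l) (≡.sym nq)))) (cong ⟦_⟧ (≡ᵇ-refl n))

    -- A perfect matching arises from `q !` orders of its edges and `k !` orders of the vertices of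
    -- each edge; for this direction an upper bound on these multiplicities is enough.
    orderings≤numPM : ∀ q → n ≡ q * k → repRun (seqs k) q (λ ws _ → all-edges ws) (allFin n) ≤ (k !) ^ q * (q ! * numPM E)
    orderings≤numPM q nq = begin
      repRun (seqs k) q (λ ws _ → all-edges ws) (allFin n) ≤⟨ repMono (seqs k) q (allFin n) covers ⟩
      repRun (seqs k) q (λ ws _ → all-edges ws * perfect (map set ws)) (allFin n) ≤⟨ choose-independently q perfect [] (allFin n) refl ⟩
      (k !) ^ q * tuples q perfect (edgeList E) ≤⟨ *-monoʳ-≤ ((k !) ^ q) (tuples≤seqs (λ T → 0 < ∣ T ∣) q perfect perfect-vanishing (edgeList E) edges-nonempty) ⟩
      (k !) ^ q * seqs q .run (λ Ts _ → perfect Ts) (edgeList E) ≡⟨ cong ((k !) ^ q *_) (seqs-symmetric q perfect perfect-symmetric (edgeList E)) ⟩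
      (k !) ^ q * (q ! * combSum q perfect (edgeList E)) ≤⟨ *-monoʳ-≤ ((k !) ^ q) (*-monoʳ-≤ (q !) (≤-trans (combSum-mono q perfect≤isPerfectMatching (edgeList E)) (combSum≤sublists q isPerfectMatchingᵇ (edgeList E)))) ⟩
      (k !) ^ q * (q ! * numPM E) ∎
      where
        open ≤-Reasoning
        flat-concat : ∀ (ws : List (List (Fin n))) → concatMap (seqs k .flat) ws ≡ concat ws
        flat-concat [] = ≡.refl
        flat-concat (w ∷ ws) = cong₂ _++_ (flat-id w) (flat-concat ws)
        covers : ∀ ws r → length ws ≡ q × All (seqs k .Ok) ws → allFin n ↭ concatMap (seqs k .flat) ws ++ r → all-edges ws ≤ all-edges ws * perfect (map set ws)
        covers ws r o p = partition-perfect q ws nq (proj₁ o) (trans p (↭-reflexive (≡.trans (cong (concatMap (seqs k .flat) ws ++_) (empty r lr)) (≡.trans (++-identityʳ _) (flat-concat ws)))))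
          where
            lr : length r ≡ 0
            lr = +-cancelˡ-≡ (q * (k * 1)) (length r) 0 (≡.trans (≡.sym (≡.trans (↭-length p) (≡.trans (length-++ (concatMap (seqs k .flat) ws)) (cong (_+ length r) (repOkSize (seqs k) q o)))))
              (≡.trans (length-tabulate {n = n} (λ i → i)) (≡.trans nq (≡.trans (cong (q *_) (≡.sym (*-identityʳ k))) (≡.sym (+-identityʳ _))))))
            empty : ∀ (r : List (Fin n)) → length r ≡ 0 → r ≡ []
            empty [] _ = ≡.refl

-- The count for hypergraphs, and graphs with a parity obstruction.

module ParityGraphs where

  open import Defs
  open Arithmetic
  open Pickers
  open SwitchingBound
  open GridWalk
  open RandomDraws
  open Parameters
  open SubsetSequences
  open PerfectMatchings
  open import Data.Bool using (Bool; true; false; _∧_; _∨_; not; T)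
  open import Data.Bool.Properties using (not-involutive; ∨-zeroʳ)
  open import Data.Bool.ListAction using (all; any)
  open import Data.Nat
  open import Data.Nat.Properties
  open import Data.Nat.Combinatorics using (_C_)
  open import Data.Nat.Tactic.RingSolver using (solve-∀)
  open import Data.Nat.ListAction.Properties using (sum-↭)
  open import Data.List using (List; []; _∷_; _++_; length; map; filterᵇ; allFin)
  open import Data.List.Properties using (length-++; ++-assoc; length-tabulate)
  open import Data.List.Relation.Unary.All as All using (All; []; _∷_)
  open import Data.List.Relation.Unary.Any using (here; there)
  open import Data.List.Membership.Propositional using (_∈_)
  open import Data.List.Membership.Propositional.Properties using (∈-map⁺; ∈-map⁻; ∈-++⁺ˡ; ∈-++⁺ʳ; ∈-++⁻)
  open import Data.List.Relation.Binary.Permutation.Propositional using (_↭_; refl; trans; ↭-reflexive)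
  open import Data.List.Relation.Binary.Permutation.Propositional.Properties using (↭-length; ++⁺ˡ; map⁺)
  open import Data.Fin using (Fin; zero; suc)
  open import Data.Fin.Subset using (Subset; ∣_∣; _∪_; ⊥; ∁)
  open import Data.Fin.Subset.Properties using (∪-identityˡ)
  open import Data.Vec using ([]; _∷_)
  open import Data.Product using (_,_; proj₁; Σ)
  open import Data.Sum using (inj₁; inj₂)
  open import Data.Empty using (⊥-elim)
  open import Relation.Binary.PropositionalEquality as ≡ using (_≡_; _≢_; cong; cong₂; subst)

  private variable
    n : ℕ

  length-allFin : ∀ n → length (allFin n) ≡ n
  length-allFin n = length-tabulate {n = n} (λ i → i)

  rest-length : ∀ {u r : List (Fin n)} → allFin n ↭ u ++ r → length r ≡ n ∸ length u
  rest-length {n} {u} {r} p = ≡.sym (≡.trans (cong (_∸ length u) (≡.trans (≡.sym (length-allFin n)) (≡.trans (↭-length p) (length-++ u)))) (m+n∸m≡n (length u) (length r)))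

  -- The bound on `q` is fixed before the graph and τ are given, which is the uniformity over all
  -- graphs.
  counting-theorem : ∀ M → 2 ≤ M → ∀ k d → 0 < d → d < k → k ≤ 2 * d → Σ ℕ λ q₀ → ∀ q → q₀ ≤ q → (G : KGraph k (q * k)) → ∀ τ → suc τ ≤ M → M + 2 ≤ 2 * τ →
    (2 + τ) * ((q * k ∸ d) C (k ∸ d)) ≤ M * minDeg d (proj₁ G) →
    (τ ∸ 2) ^ q * (q * k) ! ≤ M ^ q * ((k !) ^ q * (q ! * numPM (proj₁ G)))
  counting-theorem M 2≤M k d d>0 d<k k≤2d = threshold , bound
    where
      open Thresholds M 2≤M k (scale-for M 2≤M) using (threshold; ordered-matchings)
      open ≤-Reasoning
      e = k ∸ d
      d+e : d + e ≡ k
      d+e = m+[n∸m]≡n (<⇒≤ d<k)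
      e≤d : e ≤ d
      e≤d = m≤n+o⇒m∸n≤o k d (≤-trans k≤2d (≤-reflexive (cong (d +_) (+-identityʳ d))))
      bound : ∀ q → threshold ≤ q → (G : KGraph k (q * k)) → ∀ τ → suc τ ≤ M → M + 2 ≤ 2 * τ →
        (2 + τ) * ((q * k ∸ d) C e) ≤ M * minDeg d (proj₁ G) → (τ ∸ 2) ^ q * (q * k) ! ≤ M ^ q * ((k !) ^ q * (q ! * numPM (proj₁ G)))
      bound q q≥ (E , uniform) τ τ<M M+2≤2τ deg≥ = begin
        (τ ∸ 2) ^ q * (q * k) ! ≤⟨ subst (λ k' → (τ ∸ 2) ^ q * (q * k') ! ≤ M ^ q * repRun (seqs k') q (λ ws _ → O.all-edges ws) (allFin (q * k))) d+e
          (ordered-matchings O.edge (λ l → ⟦⟧≤1 (E (set l))) (λ p → cong (λ S → ⟦ E S ⟧) (set-↭ p)) d e (m<n⇒0<n∸m d<k) e≤d d+e q q≥ τ τ<M M+2≤2τ (allFin (q * k))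
            (≡.trans (length-allFin (q * k)) (cong (q *_) (≡.sym d+e))) density) ⟩
        M ^ q * repRun (seqs k) q (λ ws _ → O.all-edges ws) (allFin (q * k)) ≤⟨ *-monoʳ-≤ (M ^ q) (O.orderings≤numPM q ≡.refl) ⟩
        M ^ q * ((k !) ^ q * (q ! * numPM E)) ∎
        where
          module O = Orderings E k uniform (≤-trans d>0 (<⇒≤ d<k))
          density : ∀ u r → length u ≡ d → allFin (q * k) ↭ u ++ r → (2 + τ) * fall (length r) e ≤ M * seqs e .run (λ v _ → O.edge (u ++ v)) r
          density u r lu p = begin
            (2 + τ) * fall (length r) e ≡⟨ cong ((2 + τ) *_) (≡.trans (cong (λ x → fall x e) (≡.trans (rest-length {u = u} {r} p) (cong (q * k ∸_) lu))) (fall≡!*C (q * k ∸ d) e)) ⟩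
            (2 + τ) * (e ! * ((q * k ∸ d) C e)) ≡⟨ lem (2 + τ) (e !) _ ⟩
            e ! * ((2 + τ) * ((q * k ∸ d) C e)) ≤⟨ *-monoʳ-≤ (e !) (≤-trans deg≥ (*-monoʳ-≤ M (minDeg≤deg d E (set u) (≡.trans (size-set {u = u} {r} p) lu)))) ⟩
            e ! * (M * deg E (set u)) ≡⟨ lem (e !) M _ ⟩
            M * (e ! * deg E (set u)) ≡⟨ cong (M *_) (degree-sequences {u = u} {r} p E k uniform e (≡.trans (cong (_+ e) lu) d+e)) ⟨
            M * seqs e .run (λ v _ → O.edge (u ++ v)) r ∎
            where
              lem : ∀ a b c → a * (b * c) ≡ b * (a * c)
              lem = solve-∀

  isEven : ℕ → Bool
  isEven zero = true
  isEven (suc m) = not (isEven m)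

  isEven-+ : ∀ m n → isEven m ≡ true → isEven (m + n) ≡ isEven n
  isEven-+ zero n _ = ≡.refl
  isEven-+ (suc (suc m)) n p = ≡.trans (not-involutive (isEven (m + n))) (isEven-+ m n (≡.trans (≡.sym (not-involutive (isEven m))) p))

  isEven-double : ∀ x → isEven (2 * x) ≡ true
  isEven-double x = ≡.trans (cong (λ y → isEven (x + y)) (+-identityʳ x)) (go x)
    where
      go : ∀ x → isEven (x + x) ≡ true
      go zero = ≡.refl
      go (suc x) = ≡.trans (cong (λ y → not (isEven y)) (+-suc x x)) (≡.trans (not-involutive (isEven (x + x))) (go x))

  initial : ℕ → Fin n → Bool
  initial zero _ = false
  initial (suc a) zero = true
  initial (suc a) (suc i) = initial a i

  initial-count : ∀ a n → a ≤ n → listSum (λ i → ⟦ initial a i ⟧) (allFin n) ≡ a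
  initial-count zero n _ = go (allFin n)
    where
      go : (xs : List (Fin n)) → listSum (λ i → 0) xs ≡ 0
      go [] = ≡.refl
      go (x ∷ xs) = go xs
  initial-count (suc a) (suc n) (s≤s p) = ≡.trans (cong (listSum (λ i → ⟦ initial (suc a) i ⟧)) (allFin-suc n)) (cong suc (≡.trans (listSum-map _ suc (allFin n)) (initial-count a n p)))

  weight : (Fin n → ℕ) → Subset n → ℕ
  weight f S = listSum f (elements S)

  weight-∪ : (f : Fin n → ℕ) → ∀ S U → disjointᵇ S U ≡ true → weight f (S ∪ U) ≡ weight f S + weight f U
  weight-∪ f [] [] _ = ≡.refl
  weight-∪ {suc n} f (b ∷ S) (b' ∷ U) p = go b b' p
    where
      tails : disjointᵇ S U ≡ true → listSum f (map suc (elements (S ∪ U))) ≡ listSum f (map suc (elements S)) + listSum f (map suc (elements U))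
      tails p = ≡.trans (listSum-map f suc (elements (S ∪ U))) (≡.trans (weight-∪ (λ i → f (suc i)) S U p)
        (≡.sym (cong₂ _+_ (listSum-map f suc (elements S)) (listSum-map f suc (elements U)))))
      lem : ∀ a b c → a + (b + c) ≡ b + (a + c)
      lem = solve-∀
      go : ∀ b b' → disjointᵇ (b ∷ S) (b' ∷ U) ≡ true → weight f ((b ∷ S) ∪ (b' ∷ U)) ≡ weight f (b ∷ S) + weight f (b' ∷ U)
      go true false p = ≡.trans (cong (f zero +_) (tails p)) (≡.sym (+-assoc (f zero) _ _))
      go false true p = ≡.trans (cong (f zero +_) (tails p)) (lem (f zero) (listSum f (map suc (elements S))) (listSum f (map suc (elements U))))
      go false false p = tails p

  disjoint-⋃⁺ : (S : Subset n) → ∀ Ts → all (disjointᵇ S) Ts ≡ true → disjointᵇ S (⋃ Ts) ≡ true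
  disjoint-⋃⁺ S [] _ = go S
    where
      go : ∀ {n} (S : Subset n) → disjointᵇ S ⊥ ≡ true
      go [] = ≡.refl
      go (true ∷ S) = go S
      go (false ∷ S) = go S
  disjoint-⋃⁺ S (U ∷ Ts) p with disjointᵇ S U in eq
  ... | true = join S U (⋃ Ts) eq (disjoint-⋃⁺ S Ts p)
    where
      join : ∀ {n} (S U W : Subset n) → disjointᵇ S U ≡ true → disjointᵇ S W ≡ true → disjointᵇ S (U ∪ W) ≡ true
      join [] [] [] _ _ = ≡.refl
      join (true ∷ S) (false ∷ U) (false ∷ W) p q = join S U W p q
      join (false ∷ S) (_ ∷ U) (_ ∷ W) p q = join S U W p q

  full-elements : (S : Subset n) → fullᵇ S ≡ true → elements S ≡ allFin n
  full-elements [] _ = ≡.refl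
  full-elements {suc n} (true ∷ S) p = ≡.trans (cong (λ l → zero ∷ map suc l) (full-elements S p)) (≡.sym (allFin-suc n))

  even-⋃ : (f : Fin n → ℕ) → ∀ Ts → All (λ T → isEven (weight f T) ≡ true) Ts → pairwiseDisjointᵇ Ts ≡ true → isEven (weight f (⋃ Ts)) ≡ true
  even-⋃ {n} f [] _ _ = cong isEven (go n f)
    where
      go : ∀ n (f : Fin n → ℕ) → weight f ⊥ ≡ 0
      go zero f = ≡.refl
      go (suc n) f = ≡.trans (listSum-map f suc (elements (⊥ {n}))) (go n (λ i → f (suc i)))
  even-⋃ f (S ∷ Ts) (h ∷ hs) p with all (disjointᵇ S) Ts in eq
  ... | true = ≡.trans (cong isEven (weight-∪ f S (⋃ Ts) (disjoint-⋃⁺ S Ts eq))) (≡.trans (isEven-+ (weight f S) _ h) (even-⋃ f Ts hs p))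

  set-elements : (S : Subset n) → set (elements S) ≡ S
  set-elements [] = ≡.refl
  set-elements (true ∷ S) = ≡.trans (cong ((true ∷ ⊥) ∪_) (set-map-suc (elements S))) (cong (true ∷_) (≡.trans (∪-identityˡ _) (set-elements S)))
  set-elements (false ∷ S) = ≡.trans (set-map-suc (elements S)) (cong (false ∷_) (set-elements S))

  weight-set : (f : Fin n → ℕ) → ∀ {u r} → allFin n ↭ u ++ r → weight f (set u) ≡ listSum f u
  weight-set f {u} {r} p = sum-↭ (map⁺ f (elements-set u r (allFin-unique p)))

  ∈-sublists-filter : {A : Set} (p : A → Bool) → ∀ L → filterᵇ p L ∈ sublists L
  ∈-sublists-filter p [] = here ≡.refl
  ∈-sublists-filter p (x ∷ L) with p x
  ... | true = ∈-++⁺ˡ (∈-map⁺ (x ∷_) (∈-sublists-filter p L))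
  ... | false = ∈-++⁺ʳ (map (x ∷_) (sublists L)) (∈-sublists-filter p L)

  sublists-All : {A : Set} {P : A → Set} → ∀ L {M} → All P L → M ∈ sublists L → All P M
  sublists-All [] _ (here ≡.refl) = []
  sublists-All (x ∷ L) (p ∷ ps) m with ∈-++⁻ (map (x ∷_) (sublists L)) m
  ... | inj₂ q = sublists-All L ps q
  ... | inj₁ q with ∈-map⁻ (x ∷_) q
  ...   | _ , q' , ≡.refl = p ∷ sublists-All L ps q'

  filter-All : {A : Set} (p : A → Bool) → ∀ L → All (λ x → p x ≡ true) (filterᵇ p L)
  filter-All p [] = []
  filter-All p (x ∷ L) with p x in eq
  ... | true = eq ∷ filter-All p L
  ... | false = filter-All p L

  eqᵇ-refl : (S : Subset n) → eqᵇ S S ≡ true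
  eqᵇ-refl S = cong₂ _∧_ (go S) (go S)
    where
      go : ∀ {n} (S : Subset n) → subsetᵇ S S ≡ true
      go [] = ≡.refl
      go (true ∷ S) = go S
      go (false ∷ S) = go S

  eqᵇ⇒≡ : (S U : Subset n) → eqᵇ S U ≡ true → S ≡ U
  eqᵇ⇒≡ [] [] _ = ≡.refl
  eqᵇ⇒≡ (true ∷ S) (true ∷ U) p = cong (true ∷_) (eqᵇ⇒≡ S U p)
  eqᵇ⇒≡ (true ∷ S) (false ∷ U) ()
  eqᵇ⇒≡ (false ∷ S) (true ∷ U) p with subsetᵇ S U
  eqᵇ⇒≡ (false ∷ S) (true ∷ U) () | true
  eqᵇ⇒≡ (false ∷ S) (true ∷ U) () | false
  eqᵇ⇒≡ (false ∷ S) (false ∷ U) p = cong (false ∷_) (eqᵇ⇒≡ S U p)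

  any-eq⁺ : ∀ (S : Subset n) L → S ∈ L → any (eqᵇ S) L ≡ true
  any-eq⁺ S (U ∷ L) (here ≡.refl) = cong (_∨ any (eqᵇ S) L) (eqᵇ-refl S)
  any-eq⁺ S (U ∷ L) (there m) = ≡.trans (cong (eqᵇ S U ∨_) (any-eq⁺ S L m)) (∨-zeroʳ (eqᵇ S U))

  any-eq⁻ : ∀ {P : Subset n → Set} (S : Subset n) L → All P L → any (eqᵇ S) L ≡ true → P S
  any-eq⁻ S (U ∷ L) (p ∷ ps) h with eqᵇ S U in eq
  ... | true = subst _ (≡.sym (eqᵇ⇒≡ S U eq)) p
  ... | false = any-eq⁻ S L ps h

  ∈-filter : {A : Set} (p : A → Bool) → ∀ L x → x ∈ L → p x ≡ true → x ∈ filterᵇ p L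
  ∈-filter p (y ∷ L) .y (here ≡.refl) e with p y
  ... | true = here ≡.refl
  ∈-filter p (y ∷ L) x (there m) e with p y
  ... | true = there (∈-filter p L x m e)
  ... | false = ∈-filter p L x m e

  allKGraphs-uniform : ∀ k n {E} → E ∈ allKGraphs k n → ∀ T → E T ≡ true → ∣ T ∣ ≡ k
  allKGraphs-uniform k n m T e with ∈-map⁻ (λ L T → any (eqᵇ T) L) m
  ... | L , q , ≡.refl = any-eq⁻ T L (sublists-All (subsetsOfSize k n) (All.map (λ {S} h → ≡ᵇ⇒≡ ∣ S ∣ k (subst Data.Bool.T (≡.sym h) _)) (filter-All (λ S → ∣ S ∣ ≡ᵇ k) (allSubsets n))) q) e

  -- The edges are the k-sets that meet the first `a` vertices in an even number, while `a` itself
  -- is odd.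
  module Parity (k' n a : ℕ) (a-odd : isEven a ≡ false) (a≤n : a ≤ n) where
    k : ℕ
    k = suc k'

    side : Fin n → ℕ
    side i = ⟦ initial a i ⟧

    parityGraph : Subset n → Bool
    parityGraph S = (∣ S ∣ ≡ᵇ k) ∧ isEven (weight side S)

    edges : List (Subset n)
    edges = filterᵇ parityGraph (subsetsOfSize k n)

    -- Defined through the list of its edges, so that it is literally a member of `allKGraphs k n`,
    -- over which `m` quantifies.
    graph : Subset n → Bool
    graph S = any (eqᵇ S) edges

    graph∈ : graph ∈ allKGraphs k n
    graph∈ = ∈-map⁺ (λ L T → any (eqᵇ T) L) (∈-sublists-filter parityGraph (subsetsOfSize k n))

    graph-uniform : ∀ T → graph T ≡ true → ∣ T ∣ ≡ k
    graph-uniform = allKGraphs-uniform k n graph∈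

    ∧-left : ∀ {x y} → x ∧ y ≡ true → x ≡ true
    ∧-left {true} _ = ≡.refl

    ∧-right : ∀ {x y} → x ∧ y ≡ true → y ≡ true
    ∧-right {true} h = h

    graph-even : ∀ T → graph T ≡ true → isEven (weight side T) ≡ true
    graph-even T h = ∧-right {∣ T ∣ ≡ᵇ k} (any-eq⁻ {P = λ T → parityGraph T ≡ true} T edges (filter-All parityGraph (subsetsOfSize k n)) h)

    graph-complete : ∀ T → parityGraph T ≡ true → graph T ≡ true
    graph-complete T h = any-eq⁺ T edges (∈-filter parityGraph (subsetsOfSize k n) T (∈-filter (λ S → ∣ S ∣ ≡ᵇ k) (allSubsets n) T (∈-allSubsets T) (∧-left h)) h)

    -- A perfect matching would divide the first `a` vertices into parts of even size.
    no-perfect-matching : numPM graph ≡ 0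
    no-perfect-matching = go (sublists (edgeList graph)) (λ m → sublists-All (edgeList graph) (filter-All graph (allSubsets n)) m)
      where
        never : ∀ Ts → All (λ T → graph T ≡ true) Ts → isPerfectMatchingᵇ Ts ≢ true
        never Ts h e with ≡.trans (≡.sym a-odd) (≡.trans (cong isEven (≡.sym whole)) (even-⋃ side Ts (All.map (λ {T} → graph-even T) h) (∧-left e)))
          where
            whole : weight side (⋃ Ts) ≡ a
            whole = ≡.trans (cong (listSum side) (full-elements (⋃ Ts) (∧-right {pairwiseDisjointᵇ Ts} e))) (initial-count a n a≤n)
        ... | ()
        go : ∀ Ls → (∀ {M} → M ∈ Ls → All (λ T → graph T ≡ true) M) → length (filterᵇ isPerfectMatchingᵇ Ls) ≡ 0
        go [] h = ≡.refl
        go (M ∷ Ls) h with isPerfectMatchingᵇ M in eq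
        ... | true = ⊥-elim (never M (h (here ≡.refl)) eq)
        ... | false = go Ls (λ m → h (there m))

    -- The last vertex of an edge may be chosen freely on one of the two sides.
    last-vertex : ∀ b u r → b + k' ≤ a → b + k' ≤ n ∸ a → allFin n ↭ u ++ r → length u ≡ k' → b ≤ pick (λ y _ → ⟦ graph (set (u ++ y ∷ [])) ⟧) r
    last-vertex b u r b≤a b≤ p lu = go (isEven (listSum side u)) ≡.refl
      where
        open ≤-Reasoning
        others : (φ : Fin n → ℕ) → (∀ i → φ i ≤ 1) → b + k' ≤ listSum φ (allFin n) → b ≤ listSum φ r
        others φ φ≤1 h = +-cancelʳ-≤ k' _ _ (begin
          b + k' ≤⟨ h ⟩
          listSum φ (allFin n) ≡⟨ ≡.trans (sum-↭ (map⁺ φ p)) (listSum-++ φ u r) ⟩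
          listSum φ u + listSum φ r ≤⟨ +-monoˡ-≤ (listSum φ r) (≤-trans (bounded u) (≤-reflexive lu)) ⟩
          k' + listSum φ r ≡⟨ +-comm k' _ ⟩
          listSum φ r + k' ∎)
          where
            bounded : ∀ u → listSum φ u ≤ length u
            bounded [] = z≤n
            bounded (x ∷ u) = +-mono-≤ (φ≤1 x) (bounded u)
        term : ∀ y r' → r ↭ y ∷ r' → isEven (listSum side u + side y) ≡ true → 1 ≤ ⟦ graph (set (u ++ y ∷ [])) ⟧
        term y r' q e = ≤-reflexive (≡.sym (cong ⟦_⟧ (graph-complete (set (u ++ y ∷ [])) (cong₂ _∧_
          (≡.trans (cong (_≡ᵇ k) (≡.trans (size-set {u = u ++ y ∷ []} {r'} p') (≡.trans (length-++ u) (≡.trans (+-comm (length u) 1) (cong suc lu))))) (≡ᵇ-refl k))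
          (≡.trans (cong isEven (≡.trans (weight-set side {u ++ y ∷ []} {r'} p') (≡.trans (listSum-++ side u (y ∷ [])) (cong (listSum side u +_) (+-identityʳ (side y)))))) e)))))
          where
            p' : allFin n ↭ (u ++ y ∷ []) ++ r'
            p' = trans p (trans (++⁺ˡ u q) (↭-reflexive (≡.sym (++-assoc u (y ∷ []) r'))))
        go : ∀ parity → isEven (listSum side u) ≡ parity → b ≤ pick (λ y _ → ⟦ graph (set (u ++ y ∷ [])) ⟧) r
        go true e = ≤-trans (others (λ i → 1 ∸ side i) (λ i → m∸n≤m 1 (side i)) (≤-trans b≤ (≤-reflexive off-side)))
          (≤-trans (≤-reflexive (listSum-pick _ r)) (pick-mono r avoid))
          where
            off-side : n ∸ a ≡ listSum (λ i → 1 ∸ side i) (allFin n)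
            off-side = ≡.sym (≡.trans (≡.sym (m+n∸n≡m _ a)) (cong (_∸ a) (≡.trans (cong (listSum (λ i → 1 ∸ side i) (allFin n) +_) (≡.sym (initial-count a n a≤n))) (≡.trans (complement (allFin n)) (length-allFin n)))))
              where
                complement : ∀ xs → listSum (λ i → 1 ∸ side i) xs + listSum side xs ≡ length xs
                complement [] = ≡.refl
                complement (x ∷ xs) = ≡.trans (interchange (1 ∸ side x) _ (side x) _) (cong₂ _+_ (m∸n+n≡m (⟦⟧≤1 (initial a x))) (complement xs))
            avoid : ∀ y r' → r ↭ y ∷ r' → 1 ∸ side y ≤ ⟦ graph (set (u ++ y ∷ [])) ⟧
            avoid y r' q with side y in eq
            ... | zero = term y r' q (≡.trans (cong (λ s → isEven (listSum side u + s)) eq) (≡.trans (cong isEven (+-identityʳ (listSum side u))) e))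
            ... | suc x = ≤-trans (≤-reflexive (0∸n≡0 x)) z≤n
        go false e = ≤-trans (others side (λ i → ⟦⟧≤1 (initial a i)) (≤-trans b≤a (≤-reflexive (≡.sym (initial-count a n a≤n)))))
          (≤-trans (≤-reflexive (listSum-pick side r)) (pick-mono r use))
          where
            use : ∀ y r' → r ↭ y ∷ r' → side y ≤ ⟦ graph (set (u ++ y ∷ [])) ⟧
            use y r' q with initial a y in eq
            ... | false = z≤n
            ... | true = term y r' q (≡.trans (cong (λ b → isEven (listSum side u + ⟦ b ⟧)) eq) (≡.trans (cong isEven (+-comm (listSum side u) 1)) (cong not e)))

    -- An edge through `S` is found by adding arbitrary vertices until `k'` are chosen; at least `b`
    -- of the remaining `n ∸ k'` vertices then complete it.
    graph-degree : ∀ b d S → b + k' ≤ a → b + k' ≤ n ∸ a → ∣ S ∣ ≡ d → d ≤ k' → b * ((n ∸ d) C (k ∸ d)) ≤ (n ∸ k') * deg graph S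
    graph-degree b d S b≤a b≤ sz d≤k' = *-cancelˡ-pos (e !) (!-pos e) (begin
      e ! * (b * ((n ∸ d) C e)) ≡⟨ lem1 (e !) b _ ⟩
      b * (e ! * ((n ∸ d) C e)) ≡⟨ cong (b *_) (≡.trans (≡.sym (fall≡!*C (n ∸ d) e)) (cong (fall (n ∸ d)) e≡)) ⟩
      b * fall (n ∸ d) (suc e') ≡⟨ cong (b *_) (≡.trans (fall-suc (n ∸ d) e') (cong (fall (n ∸ d) e' *_) (≡.trans (∸-+-assoc n d e') (cong (n ∸_) d+e')))) ⟩
      b * (fall (n ∸ d) e' * (n ∸ k')) ≡⟨ lem2 b (fall (n ∸ d) e') (n ∸ k') ⟩
      (n ∸ k') * (fall (n ∸ d) e' * b) ≤⟨ *-monoʳ-≤ (n ∸ k') lower ⟩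
      (n ∸ k') * (e ! * deg graph S) ≡⟨ lem1 (n ∸ k') (e !) _ ⟩
      e ! * ((n ∸ k') * deg graph S) ∎)
      where
        open ≤-Reasoning
        e = k ∸ d
        e' = k' ∸ d
        e≡ : e ≡ suc e'
        e≡ = +-∸-assoc 1 d≤k'
        d+e' : d + e' ≡ k'
        d+e' = m+[n∸m]≡n d≤k'
        lem1 : ∀ a b c → a * (b * c) ≡ b * (a * c)
        lem1 = solve-∀
        lem2 : ∀ a b c → a * (b * c) ≡ c * (b * a)
        lem2 = solve-∀
        u = elements S
        r = elements (∁ S)
        lu : length u ≡ d
        lu = ≡.trans (length-elements S) sz
        p : allFin n ↭ u ++ r
        p = elements-∁ S
        lower : fall (n ∸ d) e' * b ≤ e ! * deg graph S
        lower = begin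
          fall (n ∸ d) e' * b ≡⟨ cong₂ (λ x y → fall x y * b) (≡.trans (cong (n ∸_) (≡.sym lu)) (≡.sym (rest-length {u = u} {r} p))) (≡.sym (*-identityʳ e')) ⟩
          fall (length r) (e' * 1) * b ≡⟨ const (seqs e') b r ⟨
          seqs e' .run (λ _ _ → b) r ≤⟨ seqs e' .mono r inner ⟩
          seqs e' .run (λ ys r' → pick (λ y _ → ⟦ graph (set (u ++ ys ++ y ∷ [])) ⟧) r') r ≡⟨ rep-+ picker e' 1 (λ ys _ → ⟦ graph (set (u ++ ys)) ⟧) r ⟨
          seqs (e' + 1) .run (λ ys _ → ⟦ graph (set (u ++ ys)) ⟧) r ≡⟨ cong (λ j → seqs j .run (λ ys _ → ⟦ graph (set (u ++ ys)) ⟧) r) (≡.trans (+-comm e' 1) (≡.sym e≡)) ⟩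
          seqs e .run (λ ys _ → ⟦ graph (set (u ++ ys)) ⟧) r ≡⟨ degree-sequences {u = u} {r} p graph k graph-uniform e (≡.trans (cong (_+ e) lu) (m+[n∸m]≡n (≤-trans d≤k' (n≤1+n k')))) ⟩
          e ! * deg graph (set u) ≡⟨ cong (λ U → e ! * deg graph U) (set-elements S) ⟩
          e ! * deg graph S ∎
          where
            inner : ∀ ys r' → seqs e' .Ok ys → r ↭ seqs e' .flat ys ++ r' → b ≤ pick (λ y _ → ⟦ graph (set (u ++ ys ++ y ∷ [])) ⟧) r'
            inner ys r' o q = ≤-trans (last-vertex b (u ++ ys) r' b≤a b≤ (trans p (trans (++⁺ˡ u (subst (λ l → r ↭ l ++ r') (flat-id ys) q)) (↭-reflexive (≡.sym (++-assoc u ys r')))))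
              (≡.trans (length-++ u) (≡.trans (cong₂ _+_ lu (proj₁ o)) d+e')))
              (≤-reflexive (pick-ext r' (λ y _ _ → cong (λ l → ⟦ graph (set l) ⟧) (++-assoc u ys (y ∷ [])))))

-- The lower bound 1/2 for the degree threshold.

module DegreeThreshold where

  open import Defs
  open Arithmetic
  open Pickers
  open GridWalk
  open RandomDraws
  open SubsetSequences
  open ParityGraphs
  open import Data.Bool using (Bool; true; false; _∧_; _∨_; not; T)
  open import Data.Bool.ListAction using (all)
  open import Data.Nat
  open import Data.Nat.Properties
  open import Data.Nat.Combinatorics using (_C_)
  open import Data.Nat.DivMod using (_/_; m/n*n≤m; m≡m%n+[m/n]*n; m%n<n)
  open import Data.Nat.Tactic.RingSolver using (solve-∀)
  open import Data.List using ([]; _∷_; length; map; filterᵇ; upTo)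
  open import Data.List.Relation.Unary.All as All using (All; []; _∷_)
  import Data.List.Relation.Unary.All.Properties as AllP
  open import Data.List.Relation.Unary.Any using (here; there)
  open import Data.List.Membership.Propositional using (_∈_)
  open import Data.List.Membership.Propositional.Properties using (∈-map⁺; ∈-upTo⁺)
  open import Data.Fin.Subset using (Subset; ∣_∣; ∁; _∪_)
  open import Data.Vec using ([]; _∷_)
  open import Data.Product using (_,_; proj₁; proj₂; ∃)
  open import Data.Sum using (inj₁; inj₂)
  open import Data.Empty using (⊥-elim)
  open import Relation.Nullary using (yes; no)
  open import Relation.Binary.PropositionalEquality as ≡ using (_≡_; cong; cong₂; subst)

  private variable
    n : ℕ

  minList-All : (P : ℕ → Set) → ∀ xs → All P xs → ∀ {x} → x ∈ xs → P (minList xs)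
  minList-All P (x ∷ []) (p ∷ _) _ = p
  minList-All P (x ∷ xs@(y ∷ ys)) (p ∷ ps) _ with ⊓-sel x (minList xs)
  ... | inj₁ e = subst P (≡.sym e) p
  ... | inj₂ e = subst P (≡.sym e) (minList-All P xs ps (here ≡.refl))

  subset-of-size : ∀ d n → d ≤ n → ∃ λ (S : Subset n) → ∣ S ∣ ≡ d
  subset-of-size zero zero _ = [] , ≡.refl
  subset-of-size zero (suc n) _ with subset-of-size zero n z≤n
  ... | S , e = false ∷ S , e
  subset-of-size (suc d) (suc n) (s≤s p) with subset-of-size d n p
  ... | S , e = true ∷ S , cong suc e

  ∈-subsetsOfSize : ∀ d (S : Subset n) → ∣ S ∣ ≡ d → S ∈ subsetsOfSize d n
  ∈-subsetsOfSize {n} d S e = ∈-filter (λ S → ∣ S ∣ ≡ᵇ d) (allSubsets n) S (∈-allSubsets S) (≡.trans (cong (_≡ᵇ d) e) (≡ᵇ-refl d))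

  all-false : {A : Set} (f : A → Bool) → ∀ xs {x} → x ∈ xs → f x ≡ false → all f xs ≡ false
  all-false f (x ∷ xs) (here ≡.refl) e = cong (_∧ all f xs) e
  all-false f (x ∷ xs) (there m) e with f x
  ... | true = all-false f xs m e
  ... | false = ≡.refl

  all-true : {A : Set} (f : A → Bool) → ∀ xs → (∀ {x} → x ∈ xs → f x ≡ true) → all f xs ≡ true
  all-true f [] h = ≡.refl
  all-true f (x ∷ xs) h = cong₂ _∧_ (h (here ≡.refl)) (all-true f xs (λ m → h (there m)))

  ≤⇒≤ᵇ-true : ∀ {m n} → m ≤ n → (m ≤ᵇ n) ≡ true
  ≤⇒≤ᵇ-true {m} {n} p with m ≤ᵇ n | ≤⇒≤ᵇ p
  ... | true | _ = ≡.refl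

  >⇒≤ᵇ-false : ∀ {m n} → n < m → (m ≤ᵇ n) ≡ false
  >⇒≤ᵇ-false {m} {n} p with m ≤ᵇ n in eq
  ... | false = ≡.refl
  ... | true = ⊥-elim (<⇒≱ p (≤ᵇ⇒≤ m n (subst T (≡.sym eq) _)))

  minDeg-All : (P : ℕ → Set) → ∀ d (E : Subset n → Bool) → d ≤ n → (∀ S → ∣ S ∣ ≡ d → P (deg E S)) → P (minDeg d E)
  minDeg-All {n} P d E d≤n h = minList-All P (map (deg E) (subsetsOfSize d n))
    (AllP.map⁺ (All.map (λ {S} e → h S (≡ᵇ⇒≡ ∣ S ∣ d (subst T (≡.sym e) _))) (filter-All (λ S → ∣ S ∣ ≡ᵇ d) (allSubsets n))))
    (∈-map⁺ (deg E) (∈-subsetsOfSize d (proj₁ (subset-of-size d n d≤n)) (proj₂ (subset-of-size d n d≤n))))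

  minDeg≤C : ∀ d k (E : Subset n → Bool) → (∀ S → E S ≡ true → ∣ S ∣ ≡ k) → d ≤ k → d ≤ n → minDeg d E ≤ (n ∸ d) C (k ∸ d)
  minDeg≤C {n} d k E uniform d≤k d≤n = minDeg-All (_≤ (n ∸ d) C e) d E d≤n bound
    where
      open ≤-Reasoning
      e = k ∸ d
      bound : ∀ S → ∣ S ∣ ≡ d → deg E S ≤ (n ∸ d) C e
      bound S sz = *-cancelˡ-pos (e !) (!-pos e) (begin
        e ! * deg E S ≡⟨ degree-as-sequences E k uniform S e (≡.trans (cong (_+ e) sz) (m+[n∸m]≡n d≤k)) ⟨
        seqs e .run (λ ys _ → ⟦ E (S ∪ set ys) ⟧) (elements (∁ S)) ≤⟨ seqs e .mono (elements (∁ S)) (λ ys _ _ _ → ⟦⟧≤1 (E (S ∪ set ys))) ⟩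
        seqs e .run (λ _ _ → 1) (elements (∁ S)) ≡⟨ seqs-total e (elements (∁ S)) ⟩
        fall (length (elements (∁ S))) e ≡⟨ cong (λ m → fall m e) (≡.trans (rest-length {u = elements S} {elements (∁ S)} (elements-∁ S)) (cong (n ∸_) (≡.trans (length-elements S) sz))) ⟩
        fall (n ∸ d) e ≡⟨ fall≡!*C (n ∸ d) e ⟩
        e ! * ((n ∸ d) C e) ∎)

  -- Every `t` up to the minimum degree of `E` fails the test. The value `suc top` passes it
  -- vacuously, as no minimum degree is that large; so the filtered list is nonempty and `minList`
  -- does not return its default 0.
  m-above : ∀ d k n {E} → d ≤ k → d ≤ n → E ∈ allKGraphs k n → numPM E ≡ 0 → minDeg d E < m d k n
  m-above d k n {E} d≤k d≤n E∈ noPM = minList-All (minDeg d E <_) (filterᵇ (forcesPMᵇ d k n) (upTo (suc (suc top))))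
    (All.map above (filter-All (forcesPMᵇ d k n) (upTo (suc (suc top)))))
    (∈-filter (forcesPMᵇ d k n) (upTo (suc (suc top))) (suc top) (∈-upTo⁺ ≤-refl) (all-true _ (allKGraphs k n) vacuous))
    where
      top = (n ∸ d) C (k ∸ d)
      above : ∀ {t} → forcesPMᵇ d k n t ≡ true → minDeg d E < t
      above {t} h with t ≤? minDeg d E
      ... | no p = ≰⇒> p
      ... | yes p with ≡.trans (≡.sym h) (all-false _ (allKGraphs k n) E∈ (cong₂ (λ b c → not b ∨ not (c ≡ᵇ 0)) (≤⇒≤ᵇ-true p) noPM))
      ...   | ()
      vacuous : ∀ {E} → E ∈ allKGraphs k n → not (suc top ≤ᵇ minDeg d E) ∨ hasPMᵇ E ≡ true
      vacuous {E} i = cong (λ b → not b ∨ hasPMᵇ E) (>⇒≤ᵇ-false (s≤s (minDeg≤C d k E (allKGraphs-uniform k n i) d≤k d≤n)))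

  parity-bound : ∀ d k' n a b → isEven a ≡ false → a ≤ n → d ≤ k' → d ≤ n → b + k' ≤ a → b + k' ≤ n ∸ a →
    b * ((n ∸ d) C (suc k' ∸ d)) ≤ n * m d (suc k') n
  parity-bound d k' n a b odd a≤n d≤k' d≤n b≤a b≤ = begin
    b * ((n ∸ d) C (suc k' ∸ d)) ≤⟨ minDeg-All (λ D → b * ((n ∸ d) C (suc k' ∸ d)) ≤ (n ∸ k') * D) d graph d≤n (λ S e → graph-degree b d S b≤a b≤ e d≤k') ⟩
    (n ∸ k') * minDeg d graph ≤⟨ *-mono-≤ (m∸n≤m n k') (<⇒≤ (m-above d (suc k') n (≤-trans d≤k' (n≤1+n k')) d≤n graph∈ no-perfect-matching)) ⟩
    n * m d (suc k') n ∎
    where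
      open ≤-Reasoning
      open Parity k' n a odd a≤n using (graph; graph∈; graph-degree; no-perfect-matching)

  -- a = 2 ⌊n/4⌋ + 1 is odd and splits the vertices almost evenly
  m-lower : ∀ d k' n → d ≤ k' → 4 * suc k' ≤ n → (n ∸ 5 * suc k') * ((n ∸ d) C (suc k' ∸ d)) ≤ 2 * n * m d (suc k') n
  m-lower d k' n d≤k' n≥ = begin
    (n ∸ 5 * suc k') * c ≤⟨ *-monoˡ-≤ c n≤2b ⟩
    2 * b * c ≡⟨ *-assoc 2 b c ⟩
    2 * (b * c) ≤⟨ *-monoʳ-≤ 2 (parity-bound d k' n a b odd a≤n d≤k' d≤n b≤a b≤) ⟩
    2 * (n * m d (suc k') n) ≡⟨ *-assoc 2 n _ ⟨
    2 * n * m d (suc k') n ∎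
    where
      open ≤-Reasoning
      c = (n ∸ d) C (suc k' ∸ d)
      x = n / 4
      a = suc (2 * x)
      -- Both sides have at least 2 x - 1 vertices, and `k'` of these may already lie in the edge.
      b = 2 * x ∸ 1 ∸ k'
      odd : isEven a ≡ false
      odd = cong not (isEven-double x)
      4x≤n : 4 * x ≤ n
      4x≤n = ≤-trans (≤-reflexive (*-comm 4 x)) (m/n*n≤m n 4)
      n≤4x+3 : n ≤ 3 + 4 * x
      n≤4x+3 = ≤-trans (≤-reflexive (m≡m%n+[m/n]*n n 4)) (+-mono-≤ (s≤s⁻¹ (m%n<n n 4)) (≤-reflexive (*-comm x 4)))
      k≤x : suc k' ≤ x
      k≤x = s≤s⁻¹ (*-cancelˡ-< 4 (suc k') (suc x) (begin-strict
        4 * suc k' ≤⟨ n≥ ⟩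
        n ≤⟨ n≤4x+3 ⟩
        3 + 4 * x <⟨ ≤-refl ⟩
        4 + 4 * x ≡⟨ *-suc 4 x ⟨
        4 * suc x ∎))
      k'≤2x : k' ≤ 2 * x
      k'≤2x = ≤-trans (≤-trans (n≤1+n k') k≤x) (m≤m+n x (x + 0))
      k'≤2x-1 : k' ≤ 2 * x ∸ 1
      k'≤2x-1 = ∸-monoˡ-≤ 1 (≤-trans k≤x (m≤m+n x (x + 0)))
      b+k' : b + k' ≡ 2 * x ∸ 1
      b+k' = m∸n+n≡m k'≤2x-1
      double : a + (2 * x ∸ 1) ≤ n
      double = ≤-trans (≤-reflexive (go x (≤-trans (s≤s z≤n) k≤x))) 4x≤n
        where
          go : ∀ x → 1 ≤ x → suc (2 * x) + (2 * x ∸ 1) ≡ 4 * x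
          go (suc x) _ = lem x
            where
              lem : ∀ x → suc (2 * suc x) + (x + (suc x + 0)) ≡ 4 * suc x
              lem = solve-∀
      a≤n : a ≤ n
      a≤n = ≤-trans (m≤m+n a _) double
      d≤n : d ≤ n
      d≤n = ≤-trans d≤k' (≤-trans k'≤2x (≤-trans (n≤1+n _) a≤n))
      b≤a : b + k' ≤ a
      b≤a = ≤-trans (≤-reflexive b+k') (≤-trans (m∸n≤m (2 * x) 1) (n≤1+n _))
      b≤ : b + k' ≤ n ∸ a
      b≤ = ≤-trans (≤-reflexive b+k') (≤-trans (≤-reflexive (≡.sym (m+n∸m≡n a (2 * x ∸ 1)))) (∸-monoˡ-≤ a double))
      n≤2b : n ∸ 5 * suc k' ≤ 2 * b
      n≤2b = m≤n+o⇒m∸n≤o n (5 * suc k') (begin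
        n ≤⟨ n≤4x+3 ⟩
        3 + 4 * x ≡⟨ lem₁ x ⟩
        3 + 2 * (2 * x) ≤⟨ +-monoʳ-≤ 3 (*-monoʳ-≤ 2 (m≤n+m∸n (2 * x) 1)) ⟩
        3 + 2 * (1 + (2 * x ∸ 1)) ≡⟨ cong (λ z → 3 + 2 * (1 + z)) b+k' ⟨
        3 + 2 * (1 + (b + k')) ≤⟨ m≤m+n _ (3 * k') ⟩
        3 + 2 * (1 + (b + k')) + 3 * k' ≡⟨ lem₂ b k' ⟩
        5 * suc k' + 2 * b ∎)
        where
          lem₁ : ∀ x → 3 + 4 * x ≡ 3 + 2 * (2 * x)
          lem₁ = solve-∀
          lem₂ : ∀ b k → 3 + 2 * (1 + (b + k)) + 3 * k ≡ 5 * suc k + 2 * b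
          lem₂ = solve-∀

-- Passage to rational densities.

open import Defs
open Arithmetic
open SwitchingBound
open GridWalk
open SubsetSequences
open ParityGraphs
open DegreeThreshold
open import Data.Nat using (ℕ; zero; suc; _≤_; _<_; _*_; _∸_; _^_; _!; z≤n; s≤s; z<s; NonZero)
import Data.Nat as ℕ
import Data.Nat.Properties as ℕP
open import Data.Nat.Combinatorics using (_C_)
import Data.Nat.DivMod as DM
open import Data.Nat.Tactic.RingSolver using (solve-∀)
open import Data.Integer using (+_; +≤+; +<+)
import Data.Integer as ℤ
import Data.Integer.Properties as ℤP
open import Data.Rational using (ℚ; 0ℚ; mkℚ; ↧ₙ_; toℚᵘ; _+_; _-_; -_) renaming (_<_ to _<ℚ_; _≤_ to _≤ℚ_; _*_ to _*ℚ_)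
import Data.Rational as ℚ
import Data.Rational.Properties as ℚP
open import Data.Rational.Unnormalised as ℚᵘ using (mkℚᵘ; _≃_; *≡*; *≤*; *<*)
import Data.Rational.Unnormalised.Properties as ℚᵘP
open import Data.Product using (Σ; _,_; proj₁; proj₂)
open import Data.Empty using (⊥-elim)
open import Relation.Binary.PropositionalEquality as ≡ using (_≡_; cong; cong₂)

toℚᵘ-ratio : ∀ a b → toℚᵘ (ratio a (suc b)) ≃ mkℚᵘ (+ a) b
toℚᵘ-ratio a b = ℚP.toℚᵘ-fromℚᵘ (mkℚᵘ (+ a) b)

ratio-≤ : ∀ {a b c d} → 0 < b → 0 < d → a * d ≤ c * b → ratio a b ≤ℚ ratio c d
ratio-≤ {a} {suc b} {c} {suc d} _ _ h = ℚP.toℚᵘ-cancel-≤ (ℚᵘP.≤-respˡ-≃ (ℚᵘP.≃-sym (toℚᵘ-ratio a b)) (ℚᵘP.≤-respʳ-≃ (ℚᵘP.≃-sym (toℚᵘ-ratio c d))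
  (*≤* (≡.subst₂ ℤ._≤_ (ℤP.pos-* a (suc d)) (ℤP.pos-* c (suc b)) (+≤+ h)))))

ratio-< : ∀ {a b c d} → 0 < b → 0 < d → a * d < c * b → ratio a b <ℚ ratio c d
ratio-< {a} {suc b} {c} {suc d} _ _ h = ℚP.toℚᵘ-cancel-< (ℚᵘP.<-respˡ-≃ (ℚᵘP.≃-sym (toℚᵘ-ratio a b)) (ℚᵘP.<-respʳ-≃ (ℚᵘP.≃-sym (toℚᵘ-ratio c d))
  (*<* (≡.subst₂ ℤ._<_ (ℤP.pos-* a (suc d)) (ℤP.pos-* c (suc b)) (+<+ h)))))

ratio-<⁻¹ : ∀ {a b c d} → 0 < b → 0 < d → ratio a b <ℚ ratio c d → a * d < c * b
ratio-<⁻¹ {a} {suc b} {c} {suc d} _ _ h = ℤP.drop‿+<+ (≡.subst₂ ℤ._<_ (≡.sym (ℤP.pos-* a (suc d))) (≡.sym (ℤP.pos-* c (suc b)))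
  (ℚᵘP.drop-*<* (ℚᵘP.<-respˡ-≃ (toℚᵘ-ratio a b) (ℚᵘP.<-respʳ-≃ (toℚᵘ-ratio c d) (ℚP.toℚᵘ-mono-< h)))))

ratio-* : ∀ {a b c d} → 0 < b → 0 < d → ratio a b *ℚ ratio c d ≡ ratio (a * c) (b * d)
ratio-* {a} {suc b} {c} {suc d} _ _ = ℚP.toℚᵘ-injective (ℚᵘP.≃-trans (ℚP.toℚᵘ-homo-* (ratio a (suc b)) (ratio c (suc d)))
  (ℚᵘP.≃-trans (ℚᵘP.*-cong (toℚᵘ-ratio a b) (toℚᵘ-ratio c d)) (ℚᵘP.≃-trans (*≡* (cong (ℤ._* (+ (suc b * suc d))) (≡.sym (ℤP.pos-* a c)))) (ℚᵘP.≃-sym (toℚᵘ-ratio (a * c) (d ℕ.+ b * suc d))))))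

ratio-+ : ∀ {a c b} → 0 < b → ratio a b + ratio c b ≡ ratio (a ℕ.+ c) b
ratio-+ {a} {c} {suc b} _ = ℚP.toℚᵘ-injective (ℚᵘP.≃-trans (ℚP.toℚᵘ-homo-+ (ratio a (suc b)) (ratio c (suc b)))
  (ℚᵘP.≃-trans (ℚᵘP.+-cong (toℚᵘ-ratio a b) (toℚᵘ-ratio c b)) (ℚᵘP.≃-trans (*≡* same) (ℚᵘP.≃-sym (toℚᵘ-ratio (a ℕ.+ c) b)))))
  where
    open ≡.≡-Reasoning
    lem : ∀ a c b → (a * b ℕ.+ c * b) * b ≡ (a ℕ.+ c) * (b * b)
    lem = solve-∀
    same : (+ a ℤ.* + suc b ℤ.+ + c ℤ.* + suc b) ℤ.* + suc b ≡ + (a ℕ.+ c) ℤ.* + (suc b * suc b)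
    same = begin
      (+ a ℤ.* + suc b ℤ.+ + c ℤ.* + suc b) ℤ.* + suc b ≡⟨ cong (ℤ._* + suc b) (cong₂ ℤ._+_ (≡.sym (ℤP.pos-* a (suc b))) (≡.sym (ℤP.pos-* c (suc b)))) ⟩
      + (a * suc b ℕ.+ c * suc b) ℤ.* + suc b ≡⟨ ℤP.pos-* (a * suc b ℕ.+ c * suc b) (suc b) ⟨
      + ((a * suc b ℕ.+ c * suc b) * suc b) ≡⟨ cong +_ (lem a c (suc b)) ⟩
      + ((a ℕ.+ c) * (suc b * suc b)) ≡⟨ ℤP.pos-* (a ℕ.+ c) (suc b * suc b) ⟩
      + (a ℕ.+ c) ℤ.* + (suc b * suc b) ∎

ratio-^ : ∀ {a b} q → 0 < b → ratio a b ^ℚ q ≡ ratio (a ^ q) (b ^ q)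
ratio-^ zero _ = ≡.refl
ratio-^ {a} {b} (suc q) p = ≡.trans (cong (ratio a b *ℚ_) (ratio-^ q p)) (ratio-* p (^-pos b q p))

ratio-nonneg : ∀ a b → 0ℚ ≤ℚ ratio a b
ratio-nonneg a zero = ℚP.≤-refl
ratio-nonneg a (suc b) = ratio-≤ {0} {1} {a} {suc b} z<s z<s z≤n

*-monoˡ : ∀ {x y z} → 0ℚ ≤ℚ z → x ≤ℚ y → z *ℚ x ≤ℚ z *ℚ y
*-monoˡ {z = z} p = ℚP.*-monoˡ-≤-nonNeg z {{ℚ.nonNegative p}}

*-monoʳ : ∀ {x y z} → 0ℚ ≤ℚ z → x ≤ℚ y → x *ℚ z ≤ℚ y *ℚ z
*-monoʳ {z = z} p = ℚP.*-monoʳ-≤-nonNeg z {{ℚ.nonNegative p}}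

^ℚ-nonneg : ∀ {x} q → 0ℚ ≤ℚ x → 0ℚ ≤ℚ x ^ℚ q
^ℚ-nonneg zero p = ratio-nonneg 1 1
^ℚ-nonneg {x} (suc q) p = ℚP.≤-trans (ℚP.≤-reflexive (≡.sym (ℚP.*-zeroʳ x))) (*-monoˡ p (^ℚ-nonneg q p))

^ℚ-mono : ∀ {x y} q → 0ℚ ≤ℚ x → x ≤ℚ y → x ^ℚ q ≤ℚ y ^ℚ q
^ℚ-mono zero p h = ℚP.≤-refl
^ℚ-mono {x} {y} (suc q) p h = ℚP.≤-trans (*-monoˡ p (^ℚ-mono q p h)) (*-monoʳ (^ℚ-nonneg q (ℚP.≤-trans p h)) h)

-- The numerator of a positive rational is at least 1.
unit≤ : ∀ y → 0ℚ <ℚ y → ratio 1 (↧ₙ y) ≤ℚ y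
unit≤ y@(mkℚ (+ zero) d c) p = ⊥-elim (ℤP.<-irrefl ≡.refl (ℚᵘP.drop-*<* (ℚP.toℚᵘ-mono-< p)))
unit≤ y@(mkℚ ℤ.-[1+ _ ] d c) (ℚ.*<* ())
unit≤ y@(mkℚ (+ suc a) d c) p = ℚP.toℚᵘ-cancel-≤ (ℚᵘP.≤-respˡ-≃ (ℚᵘP.≃-sym (toℚᵘ-ratio 1 d))
  (*≤* (≡.subst₂ ℤ._≤_ (ℤP.pos-* 1 (suc d)) (ℤP.pos-* (suc a) (suc d)) (+≤+ (ℕP.*-monoˡ-≤ (suc d) (s≤s (z≤n {a})))))))

C-pos : ∀ n k → k ≤ n → 0 < n C k
C-pos n k p with n C k in eq
... | suc _ = z<s
... | zero = ⊥-elim (ℕP.<⇒≱ (ℕP.≤-trans (ℕP.≤-trans (!-pos k) (ℕP.≤-reflexive (≡.sym (fall-full k)))) (fall-mono k p))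
  (ℕP.≤-reflexive (≡.trans (fall≡!*C n k) (≡.trans (cong (k ! *_) eq) (ℕP.*-zeroʳ (k !))))))

-- The witness (M - 1) / (2M) lies strictly between the given rational and 1/2. It is reached once
-- the relative error 5 k / n in `m-lower` is at most 1 / M, that is, for n ≥ 5 k M.
below-half : ∀ d k' M → d ≤ k' → 2 ≤ M → BelowAlpha d (suc k') (ratio (M ∸ 2) (2 * M))
below-half d k' M d≤k' 2≤M = ratio (M ∸ 1) (2 * M) , ratio-< 2M>0 2M>0 (ℕP.*-monoˡ-< (2 * M) {{ℕ.>-nonZero 2M>0}} (ℕP.∸-monoʳ-< {M} ℕP.≤-refl 2≤M)) ,
  5 * k * M ℕ.+ 4 * k , λ j N≤ → large (j * k) (ℕP.≤-trans (ℕP.m≤m+n _ _) N≤) (ℕP.≤-trans (ℕP.m≤n+m _ (5 * k * M)) N≤)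
  where
    open ℕP.≤-Reasoning
    k = suc k'
    M>0 : 0 < M
    M>0 = ℕP.≤-trans z<s 2≤M
    2M>0 : 0 < 2 * M
    2M>0 = *-pos {2} z<s M>0
    large : ∀ n → 5 * k * M ≤ n → 4 * k ≤ n → ratio (M ∸ 1) (2 * M) ≤ℚ ratio (m d k n) ((n ∸ d) C (k ∸ d))
    large n n≥ n≥' = ratio-≤ 2M>0 (C-pos (n ∸ d) (k ∸ d) (ℕP.∸-monoˡ-≤ d k≤n)) (*-cancelˡ-pos n n>0 (begin
      n * ((M ∸ 1) * c) ≡⟨ l1 n (M ∸ 1) c ⟩
      (M ∸ 1) * n * c ≤⟨ ℕP.*-monoˡ-≤ c shrink ⟩
      M * (n ∸ 5 * k) * c ≡⟨ ℕP.*-assoc M (n ∸ 5 * k) c ⟩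
      M * ((n ∸ 5 * k) * c) ≤⟨ ℕP.*-monoʳ-≤ M (m-lower d k' n d≤k' n≥') ⟩
      M * (2 * n * m d k n) ≡⟨ l2 M n (m d k n) ⟩
      n * (m d k n * (2 * M)) ∎))
      where
        c = (n ∸ d) C (k ∸ d)
        k≤n : k ≤ n
        k≤n = ℕP.≤-trans (ℕP.m≤m+n k (3 * k)) n≥'
        n>0 : 0 < n
        n>0 = ℕP.≤-trans z<s k≤n
        l1 : ∀ n a c → n * (a * c) ≡ a * n * c
        l1 = solve-∀
        l2 : ∀ M n x → M * (2 * n * x) ≡ n * (x * (2 * M))
        l2 = solve-∀
        l3 : ∀ M k → M * (5 * k) ≡ 5 * k * M
        l3 = solve-∀
        shrink : (M ∸ 1) * n ≤ M * (n ∸ 5 * k)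
        shrink = begin
          (M ∸ 1) * n ≡⟨ ℕP.*-distribʳ-∸ n M 1 ⟩
          M * n ∸ 1 * n ≤⟨ ℕP.∸-monoʳ-≤ (M * n) (begin
            M * (5 * k) ≡⟨ l3 M k ⟩
            5 * k * M ≤⟨ n≥ ⟩
            n ≡⟨ ℕP.*-identityˡ n ⟨
            1 * n ∎) ⟩
          M * n ∸ M * (5 * k) ≡⟨ ℕP.*-distribˡ-∸ M n (5 * k) ⟨
          M * (n ∸ 5 * k) ∎

theorem1p8 : (k d : ℕ) → 1 ≤ d → d < k → k ≤ 2 * d →
    (γ : ℚ) → 0ℚ <ℚ γ →
    (ε : ℚ) → 0ℚ <ℚ ε → ε <ℚ γ →
    Σ ℕ (λ n₀ → (q : ℕ) → n₀ ≤ q * k →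
    (G : KGraph k (q * k)) →
    ((x : ℚ) → BelowAlpha d k x → x + γ <ℚ normDeg d k (proj₁ G)) →
    completePM k q *ℚ ((normDeg d k (proj₁ G) - ε) ^ℚ q)
    ≤ℚ ratio (numPM (proj₁ G)) 1)
theorem1p8 k@(suc k') d 1≤d d<k k≤2d γ γ>0 ε ε>0 ε<γ = suc (proj₁ counting) * k , bound
  where
    b₁ = ↧ₙ ε
    b₂ = ↧ₙ (γ - ε)
    -- Six units 1 / M are set aside for the distance between the density of the graph and the base
    -- of the final power. The denominators of ε and γ - ε make 6 / M ≤ ε and 1 / M ≤ γ - ε.
    M = 6 * (b₁ * b₂)
    b₁b₂>0 : 0 < b₁ * b₂
    b₁b₂>0 = *-pos {b₁} {b₂} z<s z<s
    6≤M : 6 ≤ M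
    6≤M = ℕP.*-monoʳ-≤ 6 b₁b₂>0
    2≤M : 2 ≤ M
    2≤M = ℕP.≤-trans (ℕP.m≤m+n 2 4) 6≤M
    M>0 : 0 < M
    M>0 = ℕP.≤-trans z<s 2≤M
    2M>0 : 0 < 2 * M
    2M>0 = *-pos {2} z<s M>0
    counting = counting-theorem M 2≤M k d 1≤d d<k k≤2d
    γ-ε>0 : 0ℚ <ℚ γ - ε
    γ-ε>0 = ℚP.<-respˡ-≡ (ℚP.+-inverseʳ ε) (ℚP.+-monoˡ-< (- ε) ε<γ)
    cancel : ∀ y → (y - ε) + ε ≡ y
    cancel y = ≡.trans (ℚP.+-assoc y (- ε) ε) (≡.trans (cong (λ z → y + z) (ℚP.+-inverseˡ ε)) (ℚP.+-identityʳ y))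
    small-ε : ratio 6 M ≤ℚ ε
    small-ε = ℚP.≤-trans (ratio-≤ {6} {M} {1} {b₁} M>0 z<s (ℕP.≤-trans (ℕP.*-monoʳ-≤ 6 (ℕP.m≤m*n b₁ b₂)) (ℕP.≤-reflexive (≡.sym (ℕP.*-identityˡ M))))) (unit≤ ε ε>0)
    small-ε₂ : ratio 12 (2 * M) ≤ℚ ε
    small-ε₂ = ℚP.≤-trans (ratio-≤ {12} {2 * M} {6} {M} 2M>0 M>0 (ℕP.≤-reflexive (lem M))) small-ε
      where
        lem : ∀ M → 12 * M ≡ 6 * (2 * M)
        lem = solve-∀
    small-γ : ratio 2 (2 * M) ≤ℚ γ - ε
    small-γ = ℚP.≤-trans (ratio-≤ {2} {2 * M} {1} {b₂} 2M>0 z<s (ℕP.≤-trans (ℕP.*-monoʳ-≤ 2 (ℕP.≤-trans (ℕP.m≤n*m b₂ b₁) (ℕP.m≤m+n _ (5 * (b₁ * b₂))))) (ℕP.≤-reflexive (≡.sym (ℕP.*-identityˡ (2 * M)))))) (unit≤ (γ - ε) γ-ε>0)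
    x : ℚ
    x = ratio (M ∸ 2) (2 * M)
    -- Here γ = (γ - ε) + ε is at least 1 + 6 units 1 / M. The first lifts `x` to 1/2; the other six
    -- are the margin above 1/2 that the conditions on τ use.
    gap : ratio (M ℕ.+ 12) (2 * M) ≤ℚ x + γ
    gap = begin
      ratio (M ℕ.+ 12) (2 * M) ≡⟨ cong (λ z → ratio (z ℕ.+ 12) (2 * M)) (ℕP.m∸n+n≡m 2≤M) ⟨
      ratio (M ∸ 2 ℕ.+ 2 ℕ.+ 12) (2 * M) ≡⟨ ratio-+ {M ∸ 2 ℕ.+ 2} {12} 2M>0 ⟨
      ratio (M ∸ 2 ℕ.+ 2) (2 * M) + ratio 12 (2 * M) ≡⟨ cong (λ z → z + ratio 12 (2 * M)) (ratio-+ {M ∸ 2} {2} 2M>0) ⟨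
      x + ratio 2 (2 * M) + ratio 12 (2 * M) ≤⟨ ℚP.+-mono-≤ (ℚP.+-monoʳ-≤ x small-γ) small-ε₂ ⟩
      x + (γ - ε) + ε ≡⟨ ≡.trans (ℚP.+-assoc x (γ - ε) ε) (cong (λ y → x + y) (cancel γ)) ⟩
      x + γ ∎
      where open ℚP.≤-Reasoning
    bound : (q : ℕ) → suc (proj₁ counting) * k ≤ q * k → (G : KGraph k (q * k)) →
      ((x : ℚ) → BelowAlpha d k x → x + γ <ℚ normDeg d k (proj₁ G)) →
      completePM k q *ℚ ((normDeg d k (proj₁ G) - ε) ^ℚ q) ≤ℚ ratio (numPM (proj₁ G)) 1
    bound q n≥ G@(E , uniform) dense = begin
      completePM k q *ℚ ((p - ε) ^ℚ q) ≤⟨ *-monoˡ (ratio-nonneg ((q * k) !) (q ! * (k !) ^ q)) (^ℚ-mono q p-ε≥0 p-ε≤) ⟩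
      completePM k q *ℚ (ratio (τ ∸ 2) M ^ℚ q) ≡⟨ cong (completePM k q *ℚ_) (ratio-^ {τ ∸ 2} {M} q M>0) ⟩
      completePM k q *ℚ ratio ((τ ∸ 2) ^ q) (M ^ q) ≡⟨ ratio-* {(q * k) !} {q ! * (k !) ^ q} {(τ ∸ 2) ^ q} {M ^ q} den>0 (^-pos M q M>0) ⟩
      ratio ((q * k) ! * (τ ∸ 2) ^ q) (q ! * (k !) ^ q * M ^ q) ≤⟨ ratio-≤ {(q * k) ! * (τ ∸ 2) ^ q} {q ! * (k !) ^ q * M ^ q} {numPM E} {1} (*-pos den>0 (^-pos M q M>0)) z<s count ⟩
      ratio (numPM E) 1 ∎
      where
        open ℚP.≤-Reasoning
        n = q * k
        D = minDeg d E
        c = (n ∸ d) C (k ∸ d)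
        p : ℚ
        p = normDeg d k E
        q> : suc (proj₁ counting) ≤ q
        q> = ℕP.*-cancelʳ-≤ _ q k n≥
        -- The successor in the choice of n₀ excludes q = 0, so the binomial coefficient below is
        -- positive and `ratio` does not fall back on its default 0.
        k≤n : k ≤ n
        k≤n = ℕP.≤-trans (ℕP.≤-reflexive (≡.sym (ℕP.*-identityˡ k))) (ℕP.*-monoˡ-≤ k (ℕP.≤-trans (s≤s z≤n) q>))
        c>0 : 0 < c
        c>0 = C-pos (n ∸ d) (k ∸ d) (ℕP.∸-monoˡ-≤ d k≤n)
        instance
          c≢0 : NonZero c
          c≢0 = ℕ.>-nonZero c>0
        den>0 : 0 < q ! * (k !) ^ q
        den>0 = *-pos (!-pos q) (^-pos (k !) q (!-pos k))
        D≤c : D ≤ c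
        D≤c = minDeg≤C d k E uniform (ℕP.<⇒≤ d<k) (ℕP.≤-trans (ℕP.<⇒≤ d<k) k≤n)
        x+γ<p : x + γ <ℚ p
        x+γ<p = dense x (below-half d k' M (ℕ.s≤s⁻¹ d<k) 2≤M)
        half< : (M ℕ.+ 12) * c < D * (2 * M)
        half< = ratio-<⁻¹ {M ℕ.+ 12} {2 * M} {D} {c} 2M>0 c>0 (ℚP.≤-<-trans gap x+γ<p)
        t₀ = (M * D) DM./ c
        t₀c≤ : t₀ * c ≤ M * D
        t₀c≤ = DM.m/n*n≤m (M * D) c
        MD< : M * D < suc t₀ * c
        MD< = ℕP.≤-<-trans (ℕP.≤-reflexive (DM.m≡m%n+[m/n]*n (M * D) c)) (ℕP.+-monoˡ-< (t₀ * c) (DM.m%n<n (M * D) c))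
        -- `t₀` is the density in units of 1 / M, rounded down. `counting-theorem` asks for the
        -- density (2 + τ) / M.
        τ = t₀ ∸ 2
        M+12< : M ℕ.+ 12 < 2 * suc t₀
        M+12< = ℕP.*-cancelʳ-< c (M ℕ.+ 12) (2 * suc t₀) (ℕP.<-trans half< (ℕP.≤-<-trans (ℕP.≤-reflexive (lem D M)) (ℕP.<-≤-trans (ℕP.*-monoʳ-< 2 MD<) (ℕP.≤-reflexive (≡.sym (ℕP.*-assoc 2 (suc t₀) c))))))
          where
            lem : ∀ D M → D * (2 * M) ≡ 2 * (M * D)
            lem = solve-∀
        7≤t₀ : 7 ≤ t₀
        7≤t₀ = ℕ.s≤s⁻¹ (ℕP.*-cancelˡ-≤ 2 (ℕP.≤-trans (ℕP.≤-trans (ℕP.+-monoˡ-≤ 12 (ℕP.≤-trans (ℕP.m≤m+n 4 2) 6≤M)) (ℕP.n≤1+n _)) M+12<))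
        2+τ : 2 ℕ.+ τ ≡ t₀
        2+τ = ℕP.m+[n∸m]≡n (ℕP.≤-trans (ℕP.m≤m+n 2 5) 7≤t₀)
        t₀≤M : t₀ ≤ M
        t₀≤M = ℕP.*-cancelʳ-≤ t₀ M c (ℕP.≤-trans t₀c≤ (ℕP.*-monoʳ-≤ M D≤c))
        τ<M : suc τ ≤ M
        τ<M = ℕP.≤-trans (ℕP.n≤1+n _) (ℕP.≤-trans (ℕP.≤-reflexive 2+τ) t₀≤M)
        M+2≤2τ : M ℕ.+ 2 ≤ 2 * τ
        M+2≤2τ = ℕP.+-cancelʳ-≤ 6 _ _ (ℕP.≤-trans (ℕP.≤-reflexive (ℕP.+-assoc M 2 6)) (ℕP.≤-trans (ℕP.+-monoʳ-≤ M (ℕP.m≤m+n 8 4))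
          (ℕP.≤-trans (ℕP.<⇒≤ M+12<) (ℕP.≤-reflexive (≡.trans (cong (λ z → 2 * suc z) (≡.sym 2+τ)) (lem τ))))))
          where
            lem : ∀ τ → 2 * suc (2 ℕ.+ τ) ≡ 2 * τ ℕ.+ 6
            lem = solve-∀
        main : (τ ∸ 2) ^ q * (q * k) ! ≤ M ^ q * ((k !) ^ q * (q ! * numPM E))
        main = proj₂ counting q (ℕP.≤-trans (ℕP.n≤1+n _) q>) G τ τ<M M+2≤2τ (ℕP.≤-trans (ℕP.≤-reflexive (cong (_* c) 2+τ)) t₀c≤)
        count : (q * k) ! * (τ ∸ 2) ^ q * 1 ≤ numPM E * (q ! * (k !) ^ q * M ^ q)
        count = ℕP.≤-trans (ℕP.≤-reflexive (l1 ((q * k) !) ((τ ∸ 2) ^ q))) (ℕP.≤-trans main (ℕP.≤-reflexive (l2 (M ^ q) ((k !) ^ q) (q !) (numPM E))))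
          where
            l1 : ∀ a b → a * b * 1 ≡ b * a
            l1 = solve-∀
            l2 : ∀ a b c x → a * (b * (c * x)) ≡ x * (c * b * a)
            l2 = solve-∀
        p≤ : p ≤ℚ ratio (τ ∸ 2) M + ε
        p≤ = ℚP.≤-trans (ratio-≤ {D} {c} {τ ∸ 2 ℕ.+ 6} {M} c>0 M>0 (ℕP.≤-trans (ℕP.≤-reflexive (ℕP.*-comm D M)) (ℕP.≤-trans (ℕP.<⇒≤ MD<) (ℕP.*-monoˡ-≤ c step))))
          (ℚP.≤-trans (ℚP.≤-reflexive (≡.sym (ratio-+ {τ ∸ 2} {6} M>0))) (ℚP.+-monoʳ-≤ (ratio (τ ∸ 2) M) small-ε))
          where
            -- Rounding down costs one unit and `τ ∸ 2` lies four below `t₀`: five of the six units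
            -- provided by `M`.
            step : suc t₀ ≤ τ ∸ 2 ℕ.+ 6
            step = ℕP.≤-trans (ℕP.≤-reflexive (cong suc (≡.sym 2+τ))) (ℕP.≤-trans (ℕP.+-monoʳ-≤ 3 (ℕP.m≤n+m∸n τ 2)) (ℕP.≤-trans (ℕP.n≤1+n _) (ℕP.≤-reflexive (ℕP.+-comm 6 (τ ∸ 2)))))
        p-ε≤ : p - ε ≤ℚ ratio (τ ∸ 2) M
        p-ε≤ = ℚP.≤-trans (ℚP.+-monoˡ-≤ (- ε) p≤) (ℚP.≤-reflexive (≡.trans (ℚP.+-assoc (ratio (τ ∸ 2) M) ε (- ε)) (≡.trans (cong (λ y → ratio (τ ∸ 2) M + y) (ℚP.+-inverseʳ ε)) (ℚP.+-identityʳ _))))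
        ε≤p : ε ≤ℚ p
        ε≤p = begin
          ε ≡⟨ ℚP.+-identityˡ ε ⟨
          0ℚ + ε ≤⟨ ℚP.+-mono-≤ (ratio-nonneg (M ∸ 2) (2 * M)) (ℚP.<⇒≤ ε<γ) ⟩
          x + γ ≤⟨ ℚP.<⇒≤ x+γ<p ⟩
          p ∎
        p-ε≥0 : 0ℚ ≤ℚ p - ε
        p-ε≥0 = ℚP.≤-trans (ℚP.≤-reflexive (≡.sym (ℚP.+-inverseʳ ε))) (ℚP.+-monoˡ-≤ (- ε) ε≤p)
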